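{- Let $G$ be a finite connected simple cubic graph of genus $g$ which is edge-transitive (its automorphism group acts transitively on its edges). Then $|\mathrm{Aut}\,G|\leq 384(g-1)$.
   Context: The genus of a graph with $e$ edges and $v$ vertices is $e-v+1$. -}

module Defs where

open import Data.Nat using (ℕ; zero; suc; _<_; _<ᵇ_)
open import Data.Bool using (Bool; true; false; if_then_else_; _∧_)
open import Data.Fin using (Fin; toℕ)
open import Data.List using (List; map; allFin)
open import Data.Nat.ListAction using (sum)
open import Data.Product using (Σ; _×_; ∃; proj₁)
open import Data.Sum using (_⊎_)
open import Data.Integer using (ℤ; +_; _-_; _+_; _*_; _≤_)
open import Data.Fin.Permutation using (Permutation′; _⟨$⟩ʳ_)
open import Relation.Binary.PropositionalEquality using (_≡_)

record SimpleGraph (n : ℕ) : Set where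
  field
    adj   : Fin n → Fin n → Bool
    sym   : ∀ u v → adj u v ≡ adj v u
    irref : ∀ v → adj v v ≡ false
open SimpleGraph public

module _ {n : ℕ} (G : SimpleGraph n) where

  degree : Fin n → ℕ
  degree v = sum (map (λ w → if adj G v w then 1 else 0) (allFin n))

  Cubic : Set
  Cubic = ∀ v → degree v ≡ 3

  edgeCount : ℕ
  edgeCount = sum (map (λ u → sum (map (λ v →
      if adj G u v ∧ (toℕ u <ᵇ toℕ v) then 1 else 0) (allFin n))) (allFin n))

  genus : ℤ
  genus = (+ edgeCount) - (+ n) + + 1

  data Walk : Fin n → Fin n → Set where
    here  : ∀ {u} → Walk u u
    step  : ∀ {u v w} → adj G u v ≡ true → Walk v w → Walk u w

  Connected : Set
  Connected = (0 < n) × (∀ u v → Walk u v)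

  Aut : Set
  Aut = Σ (Permutation′ n) λ π → ∀ u v → adj G (π ⟨$⟩ʳ u) (π ⟨$⟩ʳ v) ≡ adj G u v

  apply : Aut → Fin n → Fin n
  apply σ v = proj₁ σ ⟨$⟩ʳ v

  EdgeTransitive : Set
  EdgeTransitive = ∀ u v x y → adj G u v ≡ true → adj G x y ≡ true →
    ∃ λ (σ : Aut) → (apply σ u ≡ x × apply σ v ≡ y) ⊎ (apply σ u ≡ y × apply σ v ≡ x)

  AutCardLe : ℤ → Set
  AutCardLe b = ∀ (k : ℕ) (f : Fin k → Aut) →
    (∀ i j → (∀ v → apply (f i) v ≡ apply (f j) v) → i ≡ j) → (+ k) ≤ b

{-# OPTIONS --safe #-}
-- Counting edges gives 2 e = 3 v, hence 384 (g - 1) = 128 e, and it remains to bound the stabiliser of an edge by 128.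
-- A cubic edge-transitive graph is never half-arc-transitive (out-degrees would be 3/2), so the group acts transitively on
-- the edges directed from one class of vertices to the other, and the claim becomes Goldschmidt's theorem: the stabiliser S
-- of a flag has order at most 128, and at most 64 if some element reverses an edge.
--
-- The tool is that a subgroup fixing a flag, and normalised by elements which are transitive on the neighbours of both of its
-- ends, is trivial. Suppose that both vertex stabilisers act on the neighbours as S₃. An involution in the centre of S gives,
-- by conjugation and multiplication around vertices, either an equivariant labelling of the edges or an equivariant labelling
-- z of the vertices of one class by involutions, with product 1 around each vertex (of the other class). In the latter
-- case let k be the least length of a walk from y to a vertex whose neighbours are not all fixed by z y. Odd k ≥ 5 and even
-- k ≥ 6 are impossible, because of the behaviour of the commutators of z at the two ends of a path. For k = 2, 3 and 4
-- filtrations by the stabilisers of balls give the bounds 128, 64 and 128, and no element reverses an edge when the bound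
-- is 128.
--
-- If S acts trivially on the neighbours of one end, let γ be a translation along an infinite path and P a b the stabiliser of
-- a segment of it. If P 0 (N + 1) = 1 with N minimal, then the order doubles along P 0 N ⊂ P 0 (N - 1) ⊂ …, so that S has order
-- 2 ^ N and is generated by shifts H i of a single involution. The least c with H 0 and H (c + 1) not commuting satisfies N ≤ 2 c + 1, 2 c ≤ N + 1 and 2 N ≤ 3 c + 3; this leaves
-- N ≤ 7, so that S has order at most 128, and N = 9, c = 5, which is excluded by commutator relations.
--
-- The arguments are classical, so bounds are derived in doubly negated form; the final inequality is decidable.
module Submission where

open import Defs hiding (sym; Walk)
open import Data.Nat using (ℕ)
open import Data.Integer using (+_; _-_; _*_)
open import Data.Bool using (Bool; true; false; not; if_then_else_; _∧_)
open import Data.Bool.Properties using (not-involutive) renaming (_≟_ to _≟ᴮ_)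
open import Data.Empty using (⊥; ⊥-elim)
open import Data.Fin using (Fin; toℕ; funToFin; finToFun) renaming (zero to fzero; suc to fsuc)
open import Data.Fin.Permutation using (permutation; _⟨$⟩ʳ_; _⟨$⟩ˡ_; inverseʳ; inverseˡ)
open import Data.Fin.Properties using (toℕ-injective; pigeonhole; finToFun-funToFin) renaming (_≟_ to _≟ꟳ_)
import Data.Integer as ℤ
import Data.Integer.Properties as ℤ
open import Data.Integer.Solver using (module +-*-Solver)
open import Data.List using (List; []; _∷_; length; map; filter; allFin) renaming (tabulate to tabulateᴸ)
open import Data.List.Membership.Propositional using (_∈_)
open import Data.List.Membership.Propositional.Properties using (∈-allFin; ∈-filter⁺; ∈-filter⁻)
open import Data.List.Properties using (length-tabulate; length-map)
open import Data.List.Relation.Unary.All as All using (All; []; _∷_)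
open import Data.List.Relation.Unary.All.Properties using (all-filter) renaming (map⁺ to All-map⁺)
open import Data.List.Relation.Unary.AllPairs using ([]; _∷_)
open import Data.List.Relation.Unary.Any using (Any; here; there)
open import Data.List.Relation.Unary.Unique.Propositional using (Unique)
open import Data.List.Relation.Unary.Unique.Propositional.Properties using (allFin⁺; map⁺) renaming (filter⁺ to filter⁺ᵁ)
open import Data.Maybe using (Maybe; just; nothing)
import Data.Nat as ℕ
open import Data.Nat using (zero; suc; _+_; _∸_; _^_; _≤_; _<_; _<ᵇ_; z≤n; s≤s)
open import Data.Nat.ListAction using (sum)
open import Data.Nat.Properties
  using (≤-refl; ≤-trans; ≤-reflexive; ≤-antisym; ≤-pred; <⇒≤; ≰⇒>; ≤∧≢⇒<; <-irrefl; <-cmp; <⇒<ᵇ; _≤?_; n≤1+n; n<1+n; m≤n⇒m≤1+n;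
    m≤m+n; m≤n+m; +-suc; +-comm; +-assoc; +-identityʳ; +-mono-≤; *-zeroʳ; *-distribˡ-+; *-cancelˡ-≡; +-0-commutativeMonoid)
  renaming (_≟_ to _≟ℕ_)
open import Data.Product using (Σ; ∃; ∃₂; _×_; _,_; proj₁; proj₂)
open import Data.Sum using (_⊎_; inj₁; inj₂; [_,_]′)
open import Data.Unit using (⊤; tt)
open import Data.Vec using (Vec; lookup; tabulate)
open import Data.Vec.Properties using (lookup∘tabulate; tabulate∘lookup; tabulate-cong) renaming (≡-dec to ≡-decⱽ)
open import Function using (_∘_; id; case_of_)
open import Relation.Binary.Definitions using (tri<; tri≈; tri>)
open import Relation.Binary.PropositionalEquality using (_≡_; _≢_; refl; sym; trans; cong; cong₂; subst; ≢-sym)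
open import Relation.Nullary using (¬_; Dec; yes; no)
open import Relation.Nullary.Decidable using (decidable-stable; True; toWitness; _×-dec_; _⊎-dec_)
open import Algebra.Properties.CommutativeMonoid.Sum +-0-commutativeMonoid
  using (∑-distrib-+; ∑-comm; sum-permute; sum-cong-≗) renaming (sum to ∑)

-- Each bound on a stabiliser comes from passing in turn to the kernels `Q` of the action on the
-- neighbours of a vertex one of whose flags is already fixed. Every step has index at most 2, so 64
-- and 128 are numbers of steps; at the end normalising elements carry one fixed flag along all
-- walks and kill what is left. An edge stabiliser may be twice a flag stabiliser, which is why
-- reversed edges demand 64.
--
-- Long critical distances fall to one computation. If involutions A and B attached to the ends of a
-- path do not commute, then A B A B is A times its conjugate under B, which lives near the start,
-- and also the conjugate of B under A times B, which lives near the end. On a long path two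
-- descriptions so far apart force relations, such as equal involutions at different vertices, that
-- minimality forbids. The delicate distances are the short ones, where both descriptions overlap
-- and exact commutators have to be determined before the kernels can be counted.

Stable : Set → Set
Stable P = ¬ ¬ P → P

⊥-stable : Stable ⊥
⊥-stable h = h id

em : ∀ {R : Set} → Stable R → (P : Set) → (P → R) → (¬ P → R) → R
em st P f g = st (λ nr → nr (g (λ p → nr (f p))))

em⊥ : (P : Set) → (P → ⊥) → (¬ P → ⊥) → ⊥
em⊥ = em ⊥-stable

-- Strong induction: without a least element every `P n` fails, because everything below `n` fails
-- already. The two helpers are the induction step and its hypothesis.
least : (P : ℕ → Set) (N : ℕ) → P N → ¬ ¬ (∃ λ n → P n × (∀ m → m < n → ¬ P m))
least P N pN k = noP N pN
  where
  noP : ∀ n → ¬ P n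
  below : ∀ n → ∀ m → m < n → ¬ P m
  noP n p = k (n , p , below n)
  below (suc n) m (s≤s m≤n) with m ≟ℕ n
  ... | yes refl = noP n
  ... | no m≢n = below n m (≤∧≢⇒< m≤n m≢n)

-- Groups and a solver for group words

record IsGroup {G : Set} (_∙_ : G → G → G) (ε : G) (_⁻¹ : G → G) : Set where
  field
    assoc : ∀ x y z → (x ∙ y) ∙ z ≡ x ∙ (y ∙ z)
    idˡ   : ∀ x → ε ∙ x ≡ x
    idʳ   : ∀ x → x ∙ ε ≡ x
    invˡ  : ∀ x → (x ⁻¹) ∙ x ≡ ε
    invʳ  : ∀ x → x ∙ (x ⁻¹) ≡ ε

infixl 7 _⊕_
data Ex : Set where
  var : ℕ → Ex
  _⊕_ : Ex → Ex → Ex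
  e0  : Ex
  _⁻  : Ex → Ex

-- A decision procedure for equations in groups in which some letters are involutions and some pairs of letters commute.
module GroupSolver {G : Set} {_∙_ : G → G → G} {ε : G} {_⁻¹ : G → G} (isG : IsGroup _∙_ ε _⁻¹) where
  open IsGroup isG

  Comm : G → G → Set
  Comm x y = (x ∙ y) ≡ (y ∙ x)

  at : List G → ℕ → G
  at [] _ = ε
  at (x ∷ ρ) zero = x
  at (x ∷ ρ) (suc i) = at ρ i

  ⟦_⟧ : Ex → List G → G
  ⟦ var i ⟧ ρ = at ρ i
  ⟦ e ⊕ f ⟧ ρ = ⟦ e ⟧ ρ ∙ ⟦ f ⟧ ρ
  ⟦ e0 ⟧ ρ = ε
  ⟦ e ⁻ ⟧ ρ = (⟦ e ⟧ ρ) ⁻¹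

  cancelˡ : ∀ a {b c} → a ∙ b ≡ a ∙ c → b ≡ c
  cancelˡ a {b} {c} h = trans (sym (l b)) (trans (cong ((a ⁻¹) ∙_) h) (l c))
    where
    l : ∀ x → (a ⁻¹) ∙ (a ∙ x) ≡ x
    l x = trans (sym (assoc _ _ _)) (trans (cong (_∙ x) (invˡ a)) (idˡ x))

  cancelʳ : ∀ a {b c} → b ∙ a ≡ c ∙ a → b ≡ c
  cancelʳ a {b} {c} h = trans (sym (l b)) (trans (cong (_∙ (a ⁻¹)) h) (l c))
    where
    l : ∀ x → (x ∙ a) ∙ (a ⁻¹) ≡ x
    l x = trans (assoc _ _ _) (trans (cong (x ∙_) (invʳ a)) (idʳ x))

  comm-inv : ∀ {x y} → Comm x y → Comm x (y ⁻¹)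
  comm-inv {x} {y} h = cancelˡ y (trans (sym (assoc _ _ _)) (trans (cong (_∙ (y ⁻¹)) (sym h))
    (trans (assoc _ _ _) (trans (cong (x ∙_) (invʳ y)) (trans (idʳ x) (sym (trans (sym (assoc _ _ _)) (trans (cong (_∙ x) (invʳ y)) (idˡ x)))))))))

  module WithFacts (ρ : List G) where
    data Fact : Set where
      ι : (i : ℕ) → at ρ i ∙ at ρ i ≡ ε → Fact
      κ : (i j : ℕ) → Comm (at ρ i) (at ρ j) → Fact

    isInv : List Fact → (i : ℕ) → Maybe (at ρ i ∙ at ρ i ≡ ε)
    isInv [] i = nothing
    isInv (ι j p ∷ fs) i with j ≟ℕ i
    ... | yes refl = just p
    ... | no _ = isInv fs i
    isInv (κ _ _ _ ∷ fs) i = isInv fs i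

    isCom : List Fact → (i j : ℕ) → Maybe (Comm (at ρ i) (at ρ j))
    isCom [] i j = nothing
    isCom (ι _ _ ∷ fs) i j = isCom fs i j
    isCom (κ a b p ∷ fs) i j with a ≟ℕ i | b ≟ℕ j
    ... | yes refl | yes refl = just p
    ... | _ | _ with a ≟ℕ j | b ≟ℕ i
    ...   | yes refl | yes refl = just (sym p)
    ...   | _ | _ = isCom fs i j

    Letter : Set
    Letter = Bool × ℕ

    ℓ : Letter → G
    ℓ (true , i) = at ρ i
    ℓ (false , i) = (at ρ i) ⁻¹

    ev : List Letter → G
    ev [] = ε
    ev (x ∷ w) = ℓ x ∙ ev w

    opp : List Fact → (x y : Letter) → Maybe (ℓ x ∙ ℓ y ≡ ε)
    opp fs (s , i) (t , j) with i ≟ℕ j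
    opp fs (true , i) (false , .i) | yes refl = just (invʳ _)
    opp fs (false , i) (true , .i) | yes refl = just (invˡ _)
    opp fs (true , i) (true , .i) | yes refl = isInv fs i
    opp fs (false , i) (false , .i) | yes refl with isInv fs i
    ... | nothing = nothing
    ... | just p = just (cancelˡ (at ρ i) (trans (sym (assoc _ _ _)) (trans (cong (_∙ ((at ρ i) ⁻¹)) (invʳ _))
                     (trans (idˡ _) (trans (trans (sym (idʳ _)) (trans (cong (((at ρ i) ⁻¹) ∙_) (sym p)) (trans (sym (assoc _ _ _)) (trans (cong (_∙ at ρ i) (invˡ _)) (idˡ _))))) (sym (idʳ _)))))))
    opp fs (s , i) (t , j) | no _ = nothing

    comL : List Fact → (x y : Letter) → Maybe (Comm (ℓ x) (ℓ y))
    comL fs (s , i) (t , j) with isCom fs i j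
    ... | nothing = nothing
    ... | just p = just (go s t)
      where
      go : ∀ s t → Comm (ℓ (s , i)) (ℓ (t , j))
      go true true = p
      go true false = comm-inv p
      go false true = sym (comm-inv (sym p))
      go false false = sym (comm-inv (sym (comm-inv p)))

    -- The letter `x` travels right past letters that commute with it until it meets one that
    -- cancels it. This is the only rewriting rule of the solver.
    cancel : List Fact → (x : Letter) (w : List Letter) → Maybe (Σ (List Letter) λ w' → ℓ x ∙ ev w ≡ ev w')
    cancel fs x [] = nothing
    cancel fs x (y ∷ w) with opp fs x y
    ... | just p = just (w , trans (sym (assoc _ _ _)) (trans (cong (_∙ ev w) p) (idˡ _)))
    ... | nothing with comL fs x y
    ...   | nothing = nothing
    ...   | just c with cancel fs x w
    ...     | nothing = nothing
    ...     | just (w' , q) = just (y ∷ w' , trans (sym (assoc _ _ _)) (trans (cong (_∙ ev w) c) (trans (assoc _ _ _) (cong (ℓ y ∙_) q))))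

    push : List Fact → (x : Letter) (w : List Letter) → Σ (List Letter) λ w' → ℓ x ∙ ev w ≡ ev w'
    push fs x w with cancel fs x w
    ... | just r = r
    ... | nothing = x ∷ w , refl

    pow : Bool → G → G
    pow true x = x
    pow false x = x ⁻¹

    inv-∙ : ∀ x y → (x ∙ y) ⁻¹ ≡ (y ⁻¹) ∙ (x ⁻¹)
    inv-∙ x y = cancelˡ (x ∙ y) (trans (invʳ _) (sym (trans (assoc _ _ _) (trans (cong (x ∙_) (trans (sym (assoc _ _ _)) (trans (cong (_∙ (x ⁻¹)) (invʳ y)) (idˡ _)))) (invʳ x)))))

    inv-inv : ∀ x → (x ⁻¹) ⁻¹ ≡ x
    inv-inv x = cancelˡ (x ⁻¹) (trans (invʳ _) (sym (invˡ x)))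

    inv-ε : ε ⁻¹ ≡ ε
    inv-ε = cancelˡ ε (trans (invʳ _) (sym (idˡ _)))

    -- Works with an accumulator: the word of `e`, or of its inverse when `s` is `false`, is pushed
    -- letter by letter in front of `w`.
    nrm : List Fact → (e : Ex) (s : Bool) (w : List Letter) → Σ (List Letter) λ w' → pow s (⟦ e ⟧ ρ) ∙ ev w ≡ ev w'
    nrm fs (var i) true w = push fs (true , i) w
    nrm fs (var i) false w = push fs (false , i) w
    nrm fs e0 true w = w , idˡ _
    nrm fs e0 false w = w , trans (cong (_∙ ev w) inv-ε) (idˡ _)
    nrm fs (e ⊕ f) true w with nrm fs f true w
    ... | (w₁ , p) with nrm fs e true w₁
    ...   | (w₂ , q) = w₂ , trans (assoc _ _ _) (trans (cong (⟦ e ⟧ ρ ∙_) p) q)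
    nrm fs (e ⊕ f) false w with nrm fs e false w
    ... | (w₁ , p) with nrm fs f false w₁
    ...   | (w₂ , q) = w₂ , trans (cong (_∙ ev w) (inv-∙ _ _)) (trans (assoc _ _ _) (trans (cong (((⟦ f ⟧ ρ) ⁻¹) ∙_) p) q))
    nrm fs (e ⁻) true w = nrm fs e false w
    nrm fs (e ⁻) false w with nrm fs e true w
    ... | (w₁ , p) = w₁ , trans (cong (_∙ ev w) (inv-inv _)) p

    word : List Fact → Ex → Ex → List Letter
    word fs e f = proj₁ (nrm fs e true (proj₁ (nrm fs f false [])))

    -- The product of `e` with the inverse of `f` is reduced to the empty word, instead of comparing
    -- two normal forms. A use supplies `refl`, so the reduction runs during type checking.
    solve : (fs : List Fact) (e f : Ex) → word fs e f ≡ [] → ⟦ e ⟧ ρ ≡ ⟦ f ⟧ ρ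
    solve fs e f h = cancelʳ ((⟦ f ⟧ ρ) ⁻¹) (trans (cong (⟦ e ⟧ ρ ∙_) (trans (sym (idʳ _)) (proj₂ (nrm fs f false []))))
      (trans (proj₂ (nrm fs e true _)) (trans (cong ev h) (sym (invʳ _)))))

  open WithFacts public using (ι; κ)

  grp : (ρ : List G) (fs : List (WithFacts.Fact ρ)) (e f : Ex) → WithFacts.word ρ fs e f ≡ [] → ⟦ e ⟧ ρ ≡ ⟦ f ⟧ ρ
  grp ρ = WithFacts.solve ρ

  comm-∙ : ∀ {x y z} → Comm x y → Comm x z → Comm x (y ∙ z)
  comm-∙ {x} {y} {z} p q = grp (x ∷ y ∷ z ∷ []) (κ 0 1 p ∷ κ 0 2 q ∷ []) (var 0 ⊕ (var 1 ⊕ var 2)) ((var 1 ⊕ var 2) ⊕ var 0) refl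

-- The abstract setting: a group acting on a cubic graph, transitive on flags of each type

record Star {V : Set} (Adj : V → V → Set) (v a b c : V) : Set where
  constructor mkStar
  field
    ₁ : Adj v a
    ₂ : Adj v b
    ₃ : Adj v c
    a≢b : a ≢ b
    a≢c : a ≢ c
    b≢c : b ≢ c
    only : ∀ w → Adj v w → w ≡ a ⊎ w ≡ b ⊎ w ≡ c

data Walk′ {V : Set} (Adj : V → V → Set) : ℕ → V → V → Set where
  stay : ∀ {u} → Walk′ Adj 0 u u
  _▸_  : ∀ {n u v w} → Adj u v → Walk′ Adj n v w → Walk′ Adj (suc n) u w

infixr 5 _▸_

-- T t is a class of vertices permuted by the group; every edge joins the two classes, which are disjoint or both
-- equal to the whole vertex set.
record Setting : Set₁ where
  infixl 7 _∙_
  infixr 6 _▹_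
  infix 8 _⁻¹
  field
    V G : Set
    _≟ⱽ_ : (u v : V) → Dec (u ≡ v)
    _≟ᴳ_ : (g h : G) → Dec (g ≡ h)
    ε : G
    _∙_ : G → G → G
    _⁻¹ : G → G
    isGroup : IsGroup _∙_ ε _⁻¹
    _▹_ : G → V → V
    ε▹ : ∀ v → ε ▹ v ≡ v
    ∙▹ : ∀ g h v → (g ∙ h) ▹ v ≡ g ▹ (h ▹ v)
    faithful : ∀ g → (∀ v → g ▹ v ≡ v) → g ≡ ε
    Adj : V → V → Set
    symA : ∀ {u v} → Adj u v → Adj v u
    actA : ∀ g {u v} → Adj u v → Adj (g ▹ u) (g ▹ v)
    star : ∀ {v a} → Adj v a → ∃₂ λ b c → Star Adj v a b c
    T : Bool → V → Set
    T-adj : ∀ {t u v} → Adj u v → T t u → T (not t) v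
    T-act : ∀ {t} g {v} → T t v → T t (g ▹ v)
    o : Bool → V
    To : ∀ t → T t (o t)
    Ao : ∀ t → Adj (o t) (o (not t))
    -- Takes no proofs, so that elements built from it depend on the vertices alone; outside flags
    -- of the right type its value is arbitrary.
    move : Bool → V → V → G
    move₁ : ∀ {t u v} → T t u → Adj u v → move t u v ▹ o t ≡ u
    move₂ : ∀ {t u v} → T t u → Adj u v → move t u v ▹ o (not t) ≡ v
    diam : ℕ
    conn : ∀ u v → ∃ λ n → n ≤ diam × Walk′ Adj n u v
    vertices : List V
    complete : ∀ v → Any (v ≡_) vertices
    -- Expresses that `g` has finite order: the positive powers of `g` lie in `P`, and the inverse
    -- is one of them.
    torsion : ∀ (P : G → Set) g → P g → (∀ h → P h → P (g ∙ h)) → P (g ⁻¹)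

-- Fixing vertices and neighbourhoods; counting along subgroups of index 2

module Basics (S : Setting) where
  open Setting S public
  open IsGroup isGroup public
  open GroupSolver isGroup public

  Walk : ℕ → V → V → Set
  Walk = Walk′ Adj

  St : V → V → V → V → Set
  St = Star Adj

  open Star public

  ▹-inj : ∀ g {u v} → g ▹ u ≡ g ▹ v → u ≡ v
  ▹-inj g {u} {v} h = trans (sym (l u)) (trans (cong (g ⁻¹ ▹_) h) (l v))
    where
    l : ∀ x → g ⁻¹ ▹ (g ▹ x) ≡ x
    l x = trans (sym (∙▹ _ _ _)) (trans (cong (_▹ x) (invˡ g)) (ε▹ x))

  ⁻¹▹ : ∀ g {u v} → g ▹ u ≡ v → g ⁻¹ ▹ v ≡ u
  ⁻¹▹ g {u} refl = trans (sym (∙▹ _ _ _)) (trans (cong (_▹ u) (invˡ g)) (ε▹ u))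

  ∙▹≡ : ∀ g h {u v w} → h ▹ u ≡ v → g ▹ v ≡ w → (g ∙ h) ▹ u ≡ w
  ∙▹≡ g h refl refl = ∙▹ g h _

  actAf : ∀ g {u v} → g ▹ u ≡ u → Adj u v → Adj u (g ▹ v)
  actAf g {u} {v} e a = subst (λ x → Adj x (g ▹ v)) e (actA g a)

  not-not : ∀ t → not (not t) ≡ t
  not-not = not-involutive

  T-adj′ : ∀ {t u v} → Adj u v → T (not t) u → T t v
  T-adj′ {t} a x = subst (λ t → T t _) (not-not t) (T-adj a x)

  T² : ∀ {t u v w} → Adj u v → Adj v w → T t u → T t w
  T² a b x = T-adj′ b (T-adj a x)

  st-act : ∀ g {v a b c} → St v a b c → St (g ▹ v) (g ▹ a) (g ▹ b) (g ▹ c)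
  st-act g {v} s = record
    { ₁ = actA g (₁ s) ; ₂ = actA g (₂ s) ; ₃ = actA g (₃ s)
    ; a≢b = λ e → a≢b s (▹-inj g e) ; a≢c = λ e → a≢c s (▹-inj g e) ; b≢c = λ e → b≢c s (▹-inj g e)
    ; only = λ w a → f w (only s (g ⁻¹ ▹ w) (subst (λ x → Adj x (g ⁻¹ ▹ w)) (⁻¹▹ g refl) (actA (g ⁻¹) a))) }
    where
    l : ∀ w → g ▹ (g ⁻¹ ▹ w) ≡ w
    l x = trans (sym (∙▹ _ _ _)) (trans (cong (_▹ x) (invʳ g)) (ε▹ x))
    f : ∀ w {a b c} → g ⁻¹ ▹ w ≡ a ⊎ g ⁻¹ ▹ w ≡ b ⊎ g ⁻¹ ▹ w ≡ c → w ≡ g ▹ a ⊎ w ≡ g ▹ b ⊎ w ≡ g ▹ c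
    f w (inj₁ refl) = inj₁ (sym (l w))
    f w (inj₂ (inj₁ refl)) = inj₂ (inj₁ (sym (l w)))
    f w (inj₂ (inj₂ refl)) = inj₂ (inj₂ (sym (l w)))

  st-132 : ∀ {v a b c} → St v a b c → St v a c b
  st-132 s = mkStar (₁ s) (₃ s) (₂ s) (a≢c s) (a≢b s) (≢-sym (b≢c s)) λ w a → f (only s w a)
    where
    f : ∀ {P Q R : Set} → P ⊎ Q ⊎ R → P ⊎ R ⊎ Q
    f (inj₁ x) = inj₁ x
    f (inj₂ (inj₁ x)) = inj₂ (inj₂ x)
    f (inj₂ (inj₂ x)) = inj₂ (inj₁ x)

  st-213 : ∀ {v a b c} → St v a b c → St v b a c
  st-213 s = mkStar (₂ s) (₁ s) (₃ s) (≢-sym (a≢b s)) (b≢c s) (a≢c s) λ w a → f (only s w a)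
    where
    f : ∀ {P Q R : Set} → P ⊎ Q ⊎ R → Q ⊎ P ⊎ R
    f (inj₁ x) = inj₂ (inj₁ x)
    f (inj₂ (inj₁ x)) = inj₁ x
    f (inj₂ (inj₂ x)) = inj₂ (inj₂ x)

  st-231 : ∀ {v a b c} → St v a b c → St v b c a
  st-231 s = st-132 (st-213 s)

  st-312 : ∀ {v a b c} → St v a b c → St v c a b
  st-312 s = st-213 (st-132 s)

  st-321 : ∀ {v a b c} → St v a b c → St v c b a
  st-321 s = st-132 (st-312 s)

  third : ∀ {v a b} → Adj v a → Adj v b → a ≢ b → ∃ λ c → St v a b c
  third {v} {a} {b} va vb ab with star va
  ... | p , q , s with only s b vb
  ...   | inj₁ e = ⊥-elim (ab (sym e))
  ...   | inj₂ (inj₁ refl) = q , s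
  ...   | inj₂ (inj₂ refl) = p , st-132 s

  other : ∀ {v a} → Adj v a → ∃ λ b → Adj v b × b ≢ a
  other va with star va
  ... | p , q , s = p , ₂ s , ≢-sym (a≢b s)

  st-uniq : ∀ {v a b c x} → St v a b c → Adj v x → x ≢ a → x ≢ b → x ≡ c
  st-uniq s vx xa xb with only s _ vx
  ... | inj₁ e = ⊥-elim (xa e)
  ... | inj₂ (inj₁ e) = ⊥-elim (xb e)
  ... | inj₂ (inj₂ e) = e

  st-two : ∀ {v a b c x} → St v a b c → Adj v x → x ≢ a → x ≡ b ⊎ x ≡ c
  st-two s vx xa with only s _ vx
  ... | inj₁ e = ⊥-elim (xa e)
  ... | inj₂ r = r

  swap? : ∀ g {v a b c} → St v a b c → g ▹ v ≡ v → g ▹ a ≡ a → (g ▹ b ≡ b × g ▹ c ≡ c) ⊎ (g ▹ b ≡ c × g ▹ c ≡ b)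
  swap? g {v} {a} {b} {c} s gv ga with only s (g ▹ b) (actAf g gv (₂ s))
  ... | inj₁ e = ⊥-elim (a≢b s (▹-inj g (trans ga (sym e))))
  ... | inj₂ (inj₁ e) = inj₁ (e , st-uniq s (actAf g gv (₃ s)) (λ x → a≢c s (▹-inj g (trans ga (sym x)))) (λ x → b≢c s (▹-inj g (trans e (sym x)))))
  ... | inj₂ (inj₂ e) = inj₂ (e , st-uniq (st-132 s) (actAf g gv (₃ s)) (λ x → a≢c s (▹-inj g (trans ga (sym x)))) (λ x → b≢c s (▹-inj g (trans e (sym x)))))

  -- The kernel of the action of the stabiliser of `v` on its neighbours, usually written G_v^[1].
  record Q (v : V) (g : G) : Set where
    constructor mkQ
    field
      fix : g ▹ v ≡ v
      fixₙ : ∀ w → Adj v w → g ▹ w ≡ w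
  open Q public

  Q-stable : ∀ {v g} → Stable (Q v g)
  Q-stable {v} {g} nn = mkQ (decidable-stable (_ ≟ⱽ _) λ k → nn λ q → k (fix q)) λ w vw → decidable-stable (_ ≟ⱽ _) λ k → nn λ q → k (fixₙ q w vw)

  mkQ₃ : ∀ {g v a b c} → St v a b c → g ▹ v ≡ v → g ▹ a ≡ a → g ▹ b ≡ b → Q v g
  mkQ₃ {g} s gv ga gb = mkQ gv λ w vw → f (only s w vw)
    where
    f : ∀ {w} → _ → g ▹ w ≡ w
    f (inj₁ refl) = ga
    f (inj₂ (inj₁ refl)) = gb
    f (inj₂ (inj₂ refl)) with swap? g s gv ga
    ... | inj₁ (_ , e) = e
    ... | inj₂ (e , _) = ⊥-elim (b≢c s (trans (sym gb) e))

  notQ : ∀ {g v a b c} → St v a b c → g ▹ v ≡ v → g ▹ a ≡ a → ¬ Q v g → g ▹ b ≡ c × g ▹ c ≡ b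
  notQ {g} s gv ga nq with swap? g s gv ga
  ... | inj₁ (e , _) = ⊥-elim (nq (mkQ₃ s gv ga e))
  ... | inj₂ r = r

  Q? : ∀ {g v a b c} → St v a b c → g ▹ v ≡ v → g ▹ a ≡ a → Dec (Q v g)
  Q? {g} s gv ga with swap? g s gv ga
  ... | inj₁ (e , _) = yes (mkQ₃ s gv ga e)
  ... | inj₂ (e , _) = no λ q → b≢c s (trans (sym (fixₙ q _ (₂ s))) e)

  fix-∙ : ∀ {g h v} → g ▹ v ≡ v → h ▹ v ≡ v → (g ∙ h) ▹ v ≡ v
  fix-∙ {g} {h} a b = ∙▹≡ g h b a

  fix-inv : ∀ {g v} → g ▹ v ≡ v → g ⁻¹ ▹ v ≡ v
  fix-inv {g} e = ⁻¹▹ g e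

  fix-conj : ∀ h {g v} → g ▹ v ≡ v → (h ∙ g ∙ h ⁻¹) ▹ (h ▹ v) ≡ h ▹ v
  fix-conj h {g} {v} e = ∙▹≡ (h ∙ g) (h ⁻¹) (⁻¹▹ h refl) (∙▹≡ h g e refl)

  Q-∙ : ∀ {g h v} → Q v g → Q v h → Q v (g ∙ h)
  Q-∙ {g} {h} a b = mkQ (fix-∙ (fix a) (fix b)) λ w vw → fix-∙ {g} {h} (fixₙ a w vw) (fixₙ b w vw)

  Q-inv : ∀ {g v} → Q v g → Q v (g ⁻¹)
  Q-inv a = mkQ (fix-inv (fix a)) λ w vw → fix-inv (fixₙ a w vw)

  Q-conj : ∀ h {g v} → Q v g → Q (h ▹ v) (h ∙ g ∙ h ⁻¹)
  Q-conj h {g} {v} a = mkQ (fix-conj h (fix a)) λ w vw → subst (λ w → (h ∙ g ∙ h ⁻¹) ▹ w ≡ w) (l w)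
      (fix-conj h (fixₙ a (h ⁻¹ ▹ w) (subst (λ x → Adj x (h ⁻¹ ▹ w)) (⁻¹▹ h refl) (actA (h ⁻¹) vw))))
    where
    l : ∀ x → h ▹ (h ⁻¹ ▹ x) ≡ x
    l x = trans (sym (∙▹ _ _ _)) (trans (cong (_▹ x) (invʳ h)) (ε▹ x))

  conj-conj : ∀ h g → h ∙ (h ⁻¹ ∙ g ∙ (h ⁻¹) ⁻¹) ∙ h ⁻¹ ≡ g
  conj-conj h g = grp (h ∷ g ∷ []) [] (var 0 ⊕ (var 0 ⁻ ⊕ var 1 ⊕ (var 0 ⁻) ⁻) ⊕ var 0 ⁻) (var 1) refl

  Q-conj⁻ : ∀ h {g v} → Q (h ▹ v) (h ∙ g ∙ h ⁻¹) → Q v g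
  Q-conj⁻ h {g} {v} q = subst₂′ (⁻¹▹ h refl) (grp (h ∷ g ∷ []) [] (var 0 ⁻ ⊕ (var 0 ⊕ var 1 ⊕ var 0 ⁻) ⊕ (var 0 ⁻) ⁻) (var 1) refl) (Q-conj (h ⁻¹) q)
    where
    subst₂′ : ∀ {a b c d} → a ≡ c → b ≡ d → Q a b → Q c d
    subst₂′ refl refl x = x

  fix-conj⁻ : ∀ h {g v} → (h ⁻¹ ∙ g ∙ h) ▹ v ≡ v → g ▹ (h ▹ v) ≡ h ▹ v
  fix-conj⁻ h {g} {v} e = ▹-inj (h ⁻¹) (trans (trans (sym (trans (∙▹ (h ⁻¹ ∙ g) h v) (∙▹ (h ⁻¹) g (h ▹ v)))) e) (sym (⁻¹▹ h refl)))

  comm-conj : ∀ {y h} → Comm y h → h ⁻¹ ∙ y ∙ h ≡ y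
  comm-conj {y} {h} c = grp (y ∷ h ∷ []) (κ 0 1 c ∷ []) (var 1 ⁻ ⊕ var 0 ⊕ var 1) (var 0) refl

  Q-pull : ∀ h {g v} → Q (h ▹ v) g → Q v (h ⁻¹ ∙ g ∙ h)
  Q-pull h {g} {v} q = Q-conj⁻ h (subst (Q (h ▹ v)) (grp (h ∷ g ∷ []) [] (var 1) (var 0 ⊕ (var 0 ⁻ ⊕ var 1 ⊕ var 0) ⊕ var 0 ⁻) refl) q)

  Q-back : ∀ {h g v} → h ▹ v ≡ v → Q v g → Q v (h ⁻¹ ∙ g ∙ h)
  Q-back {h} {g} {v} e q = Q-pull h (subst (λ x → Q x g) (sym e) q)

  walk++ : ∀ {m n u v w} → Walk m u v → Walk n v w → Walk (m + n) u w
  walk++ stay q = q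
  walk++ (a ▸ p) q = a ▸ walk++ p q

  _◂_ : ∀ {n u v w} → Walk n u v → Adj v w → Walk (suc n) u w
  stay ◂ a = a ▸ stay
  (b ▸ p) ◂ a = b ▸ (p ◂ a)
  infixl 5 _◂_

  walk-rev : ∀ {n u v} → Walk n u v → Walk n v u
  walk-rev stay = stay
  walk-rev (a ▸ p) = walk-rev p ◂ symA a

  walk-act : ∀ g {n u v} → Walk n u v → Walk n (g ▹ u) (g ▹ v)
  walk-act g stay = stay
  walk-act g (a ▸ p) = actA g a ▸ walk-act g p

  unsnocW : ∀ {n u w} → Walk (suc n) u w → ∃ λ v → Walk n u v × Adj v w
  unsnocW (a ▸ stay) = _ , stay , a
  unsnocW (a ▸ (b ▸ p)) with unsnocW (b ▸ p)
  ... | v , q , c = v , (a ▸ q) , c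

  -- A subgroup fixing a flag and normalised by groups transitive on the neighbours of both ends is trivial.
  record CoreData : Set₁ where
    field
      a b : V
      ab : Adj a b
      Y : G → Set
      Ya : ∀ y → Y y → y ▹ a ≡ a
      Yb : ∀ y → Y y → y ▹ b ≡ b
      atA : ∀ b′ → Adj a b′ → ∃ λ h → h ▹ a ≡ a × h ▹ b ≡ b′ × (∀ y → Y y → Y (h ⁻¹ ∙ y ∙ h))
      atB : ∀ a′ → Adj b a′ → ∃ λ h → h ▹ b ≡ b × h ▹ a ≡ a′ × (∀ y → Y y → Y (h ⁻¹ ∙ y ∙ h))

  module _ (C : CoreData) where
    open CoreData C
    Norm : G → Set
    Norm h = ∀ y → Y y → Y (h ⁻¹ ∙ y ∙ h)

    norm-∙ : ∀ g h → Norm g → Norm h → Norm (g ∙ h)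
    norm-∙ g h p q y Yy = subst Y (grp (g ∷ h ∷ y ∷ []) [] (var 1 ⁻ ⊕ (var 0 ⁻ ⊕ var 2 ⊕ var 0) ⊕ var 1) ((var 0 ⊕ var 1) ⁻ ⊕ var 2 ⊕ (var 0 ⊕ var 1)) refl) (q _ (p y Yy))

    Flg : V → V → Set
    Flg u v = (∃ λ g → Norm g × g ▹ a ≡ u × g ▹ b ≡ v) ⊎ (∃ λ g → Norm g × g ▹ b ≡ u × g ▹ a ≡ v)

    -- Pulled back along the normalising element, `w` becomes a neighbour of `a` or of `b`, and a
    -- normalising rotation there is composed with that element. So the flags reached by normalising
    -- elements follow every walk.
    flg-turn : ∀ {u v w} → Flg u v → Adj v w → Flg v w
    flg-turn {w = w} (inj₁ (g , ng , refl , refl)) vw with atB (g ⁻¹ ▹ w) (subst (λ x → Adj x (g ⁻¹ ▹ w)) (⁻¹▹ g refl) (actA (g ⁻¹) vw))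
    ... | h , hb , ha , nh = inj₂ (g ∙ h , norm-∙ g h ng nh , ∙▹≡ g h hb refl , ∙▹≡ g h ha (trans (sym (∙▹ _ _ _)) (trans (cong (_▹ w) (invʳ g)) (ε▹ w))))
    flg-turn {w = w} (inj₂ (g , ng , refl , refl)) vw with atA (g ⁻¹ ▹ w) (subst (λ x → Adj x (g ⁻¹ ▹ w)) (⁻¹▹ g refl) (actA (g ⁻¹) vw))
    ... | h , ha , hb , nh = inj₁ (g ∙ h , norm-∙ g h ng nh , ∙▹≡ g h ha refl , ∙▹≡ g h hb (trans (sym (∙▹ _ _ _)) (trans (cong (_▹ w) (invʳ g)) (ε▹ w))))

    flg-fix : ∀ {u v} → Flg u v → ∀ y → Y y → y ▹ v ≡ v
    flg-fix (inj₁ (g , ng , refl , refl)) y Yy = fix-conj⁻ g (Yb _ (ng y Yy))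
    flg-fix (inj₂ (g , ng , refl , refl)) y Yy = fix-conj⁻ g (Ya _ (ng y Yy))

    flg-walk : ∀ {u v n w} → Flg u v → Walk n v w → ∀ y → Y y → y ▹ w ≡ w
    flg-walk f stay = flg-fix f
    flg-walk f (x ▸ p) = flg-walk (flg-turn f x) p

    core : ∀ y → Y y → y ≡ ε
    core y Yy = faithful y λ v → flg-walk (inj₁ (ε , (λ y Yy → subst Y (grp (y ∷ []) [] (var 0) (e0 ⁻ ⊕ var 0 ⊕ e0) refl) Yy) , ε▹ _ , ε▹ _)) (proj₂ (proj₂ (conn b v))) y Yy

  -- Order at most `m`, measured by lists without repetition, because membership in `H` is in
  -- general neither decidable nor enumerated.
  Bnd : (G → Set) → ℕ → Set
  Bnd H m = ∀ xs → Unique xs → All H xs → length xs ≤ m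

  bnd-mono : ∀ {H m n} → m ≤ n → Bnd H m → Bnd H n
  bnd-mono le b xs u a = ≤-trans (b xs u a) le

  bnd-⊆ : ∀ {H K m} → (∀ g → H g → K g) → Bnd K m → Bnd H m
  bnd-⊆ f b xs u a = b xs u (All.map (f _) a)

  bnd-1 : ∀ {H} → (∀ g → H g → g ≡ ε) → Bnd H 1
  bnd-1 f [] u a = z≤n
  bnd-1 f (x ∷ []) u a = s≤s z≤n
  bnd-1 f (x ∷ y ∷ xs) ((n ∷ _) ∷ u) (p ∷ q ∷ a) = ⊥-elim (n (trans (f x p) (sym (f y q))))

  all-≢ : ∀ g {x xs} → All (x ≢_) xs → All (g ∙ x ≢_) (map (g ∙_) xs)
  all-≢ g [] = []
  all-≢ g (p ∷ ps) = (λ e → p (cancelˡ g e)) ∷ all-≢ g ps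

  uniq-map : ∀ g {xs} → Unique xs → Unique (map (g ∙_) xs)
  uniq-map g [] = []
  uniq-map g (p ∷ u) = all-≢ g p ∷ uniq-map g u

  record Split (H K : G → Set) (xs : List G) : Set where
    field
      ys zs : List G
      ysu : Unique ys
      zsu : Unique zs
      Ky : All K ys
      Hz : All (λ g → H g × ¬ K g) zs
      len : length xs ≡ length ys + length zs
      y∈ : ∀ x → All (x ≢_) xs → All (x ≢_) ys
      z∈ : ∀ x → All (x ≢_) xs → All (x ≢_) zs

  split : ∀ {H K} → (∀ g → H g → Dec (K g)) → ∀ xs → Unique xs → All H xs → Split H K xs
  split d [] u a = record { ys = [] ; zs = [] ; ysu = [] ; zsu = [] ; Ky = [] ; Hz = [] ; len = refl ; y∈ = λ _ _ → [] ; z∈ = λ _ _ → [] }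
  split d (x ∷ xs) (p ∷ u) (h ∷ a) with split d xs u a | d x h
  ... | r | yes k = record { ys = x ∷ Split.ys r ; zs = Split.zs r ; ysu = Split.y∈ r x p ∷ Split.ysu r ; zsu = Split.zsu r ; Ky = k ∷ Split.Ky r ; Hz = Split.Hz r ; len = cong suc (Split.len r)
                           ; y∈ = λ { y (q ∷ qs) → q ∷ Split.y∈ r y qs } ; z∈ = λ { y (q ∷ qs) → Split.z∈ r y qs } }
  ... | r | no k = record { ys = Split.ys r ; zs = x ∷ Split.zs r ; ysu = Split.ysu r ; zsu = Split.z∈ r x p ∷ Split.zsu r ; Ky = Split.Ky r ; Hz = (h , k) ∷ Split.Hz r ; len = trans (cong suc (Split.len r)) (sym (+-suc _ _))
                           ; y∈ = λ { y (q ∷ qs) → Split.y∈ r y qs } ; z∈ = λ { y (q ∷ qs) → q ∷ Split.z∈ r y qs } }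

  -- The elements outside `K` are translated into `K` by the inverse of the first of them, which
  -- creates no repetitions.
  index2 : ∀ {H K m} → (∀ g → H g → Dec (K g)) → (∀ g h → H g → H h → ¬ K g → ¬ K h → K (g ⁻¹ ∙ h)) → Bnd K m → Bnd H (m + m)
  index2 {H} {K} {m} d ix b xs u a = ≤-trans (≤-reflexive (Split.len r)) (+-mono-≤ (b _ (Split.ysu r) (Split.Ky r)) (zlen (Split.zs r) (Split.zsu r) (Split.Hz r)))
    where
    r = split d xs u a
    shift : ∀ g zs → H g → ¬ K g → All (λ g → H g × ¬ K g) zs → All K (map (g ⁻¹ ∙_) zs)
    shift g [] hg kg [] = []
    shift g (z ∷ zs) hg kg ((hz , kz) ∷ ps) = ix g z hg hz kg kz ∷ shift g zs hg kg ps
    zlen : ∀ zs → Unique zs → All (λ g → H g × ¬ K g) zs → length zs ≤ m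
    zlen [] _ _ = z≤n
    zlen (z ∷ zs) u ps@((hz , kz) ∷ _) = ≤-trans (≤-reflexive (sym (length-map (z ⁻¹ ∙_) (z ∷ zs)))) (b _ (uniq-map (z ⁻¹) u) (shift z (z ∷ zs) hz kz ps))

  -- Fixing `v` and its neighbour `a` leaves open only whether the two other neighbours are swapped,
  -- and two swaps compose into `Q v`.
  bnd-Q : ∀ {H : G → Set} {m v a b c} → St v a b c → (∀ g → H g → g ▹ v ≡ v × g ▹ a ≡ a) → (∀ g h → H g → H h → H (g ⁻¹ ∙ h)) →
          Bnd (λ g → H g × Q v g) m → Bnd H (m + m)
  bnd-Q {H} s f cl b = index2 dec (λ g h Hg Hh ng nh → cl g h Hg Hh , both g h Hg Hh (λ q → ng (Hg , q)) (λ q → nh (Hh , q))) b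
    where
    dec : ∀ g → H g → Dec (H g × Q _ g)
    dec g Hg with Q? s (proj₁ (f g Hg)) (proj₂ (f g Hg))
    ... | yes q = yes (Hg , q)
    ... | no n = no λ p → n (proj₂ p)
    both : ∀ g h → H g → H h → ¬ Q _ g → ¬ Q _ h → Q _ (g ⁻¹ ∙ h)
    both g h Hg Hh ng nh = mkQ₃ s (fix-∙ (fix-inv (proj₁ (f g Hg))) (proj₁ (f h Hh))) (fix-∙ (fix-inv (proj₂ (f g Hg))) (proj₂ (f h Hh)))
       (∙▹≡ (g ⁻¹) h (proj₁ (notQ s (proj₁ (f h Hh)) (proj₂ (f h Hh)) nh)) (⁻¹▹ g (proj₁ (notQ s (proj₁ (f g Hg)) (proj₂ (f g Hg)) ng))))

  S₀ : G → Set
  S₀ g = g ▹ o true ≡ o true × g ▹ o false ≡ o false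

  flag-bnd : ∀ {t u v m} → T t u → Adj u v → Bnd (λ g → g ▹ u ≡ u × g ▹ v ≡ v) m → Bnd S₀ m
  flag-bnd {t} {u} {v} {m} tu uv b xs un al = ≤-trans (≤-reflexive (sym (length-map2 xs))) (b (map (λ x → w ∙ x ∙ w ⁻¹) xs) (un′ un) (al′ al))
    where
    w = move t u v
    length-map2 : ∀ xs → length (map (λ x → w ∙ x ∙ w ⁻¹) xs) ≡ length xs
    length-map2 = length-map _
    ne : ∀ {x xs} → All (x ≢_) xs → All (w ∙ x ∙ w ⁻¹ ≢_) (map (λ x → w ∙ x ∙ w ⁻¹) xs)
    ne [] = []
    ne (p ∷ ps) = (λ e → p (cancelˡ w (cancelʳ (w ⁻¹) e))) ∷ ne ps
    un′ : ∀ {xs} → Unique xs → Unique (map (λ x → w ∙ x ∙ w ⁻¹) xs)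
    un′ [] = []
    un′ (p ∷ u) = ne p ∷ un′ u
    base : ∀ t {g} → S₀ g → g ▹ o t ≡ o t
    base true = proj₁
    base false = proj₂
    al′ : ∀ {xs} → All S₀ xs → All (λ g → g ▹ u ≡ u × g ▹ v ≡ v) (map (λ x → w ∙ x ∙ w ⁻¹) xs)
    al′ [] = []
    al′ (_∷_ {x} p ps) = ( subst (λ z → (w ∙ x ∙ w ⁻¹) ▹ z ≡ z) (move₁ tu uv) (fix-conj w (base t p))
                         , subst (λ z → (w ∙ x ∙ w ⁻¹) ▹ z ≡ z) (move₂ tu uv) (fix-conj w (base (not t) p)) ) ∷ al′ ps

-- A central involution in the stabiliser of a flag

module Centre (S : Setting) where
  open Basics S

  record Sub (H : G → Set) : Set where
    field
      cl : ∀ {g h} → H g → H h → H (g ∙ h)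
      ci : ∀ {g} → H g → H (g ⁻¹)
  open Sub public

  sub-Q : ∀ {H} v → Sub H → Sub (λ g → H g × Q v g)
  sub-Q v s = record { cl = λ { (a , b) (c , d) → cl s a c , Q-∙ b d } ; ci = λ { (a , b) → ci s a , Q-inv b } }

  sub-flag : ∀ u v → Sub (λ g → g ▹ u ≡ u × g ▹ v ≡ v)
  sub-flag u v = record { cl = λ { (a , b) (c , d) → fix-∙ a c , fix-∙ b d } ; ci = λ { (a , b) → fix-inv a , fix-inv b } }

  bnd-Qs : ∀ {H : G → Set} {m v a b c} → Sub H → St v a b c → (∀ g → H g → g ▹ v ≡ v × g ▹ a ≡ a) → Bnd (λ g → H g × Q v g) m → Bnd H (m + m)
  bnd-Qs s st f = bnd-Q st f (λ g h Hg Hh → cl s (ci s Hg) Hh)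

  -- A subgroup with a normal series all of whose factors have order at most 2.
  data Chain : (G → Set) → Set₁ where
    triv : ∀ {H} → (∀ g → H g → g ≡ ε) → Chain H
    step : ∀ {H} K → Sub K → (∀ g → K g → H g) → (∀ g h → H g → H h → K g ⊎ K h ⊎ K (g ⁻¹ ∙ h)) → Sub H → Chain K → Chain H

  record Vect (M : G → Set) : Set where
    field
      v∙ : ∀ {x y} → M x → M y → M (x ∙ y)
      v² : ∀ {x} → M x → x ∙ x ≡ ε
      vc : ∀ {x y} → M x → M y → Comm x y
  open Vect

  -- A 2-group acting on a nontrivial elementary abelian 2-group has a nontrivial fixed point. If
  -- `m` is fixed by `K` but moved by `h`, then `m` times its conjugate under `h` is nontrivial and
  -- is fixed by `h` and by `K`, as `K` has index 2 and `h ∙ h` lies in it.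
  chain-fix : ∀ {H} → Chain H → (M : G → Set) → Vect M → (∀ h m → H h → M m → M (h ∙ m ∙ h ⁻¹)) → ∃ (λ m → M m × m ≢ ε) →
              ¬ ¬ (∃ λ m → M m × m ≢ ε × (∀ h → H h → Comm h m))
  chain-fix (triv t) M vm inv (m , Mm , ne) k = k (m , Mm , ne , λ h Hh → subst (λ h → Comm h m) (sym (t h Hh)) (trans (idˡ m) (sym (idʳ m))))
  chain-fix {H} (step K sK K⊆H ix sH c) M vm inv ex k = chain-fix c M vm (λ h m Kh → inv h m (K⊆H h Kh)) ex go
    where
    go : (∃ λ m → M m × m ≢ ε × (∀ h → K h → Comm h m)) → ⊥
    go (m , Mm , ne , cK) = em⊥ (∃ λ h → H h × ¬ Comm h m) yes′ (λ no′ → k (m , Mm , ne , λ h Hh → decidable-stable (_ ≟ᴳ _) (λ nc → no′ (h , Hh , nc))))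
      where
      yes′ : (∃ λ h → H h × ¬ Comm h m) → ⊥
      yes′ (h , Hh , nc) = k (m ∙ m′ , v∙ vm Mm Mm′ , ne′ , λ g Hg → all g Hg)
        where
        m′ = h ∙ m ∙ h ⁻¹
        Mm′ = inv h m Hh Mm
        nK : ¬ K h
        nK Kh = nc (cK h Kh)
        ne′ : m ∙ m′ ≢ ε
        ne′ e = nc (cancelʳ (h ⁻¹) (trans (cancelˡ m (trans e (sym (v² vm Mm)))) (grp (h ∷ m ∷ []) [] (var 1) (var 1 ⊕ var 0 ⊕ var 0 ⁻) refl)))
        hh : Comm (h ∙ h) m
        hh with ix (h ⁻¹) h (ci sH Hh) Hh
        ... | inj₁ x = ⊥-elim (nK (subst K (grp (h ∷ []) [] ((var 0 ⁻) ⁻) (var 0) refl) (ci sK x)))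
        ... | inj₂ (inj₁ x) = ⊥-elim (nK x)
        ... | inj₂ (inj₂ x) = cK _ (subst K (grp (h ∷ []) [] ((var 0 ⁻) ⁻ ⊕ var 0) (var 0 ⊕ var 0) refl) x)
        hm : Comm h (m ∙ m′)
        hm = trans (grp (h ∷ m ∷ []) [] (var 0 ⊕ (var 1 ⊕ (var 0 ⊕ var 1 ⊕ var 0 ⁻))) ((var 0 ⊕ var 1 ⊕ var 0 ⁻) ⊕ (var 0 ⊕ var 0) ⊕ var 1 ⊕ var 0 ⁻) refl)
             (trans (cong (λ z → z ∙ h ⁻¹) (trans (assoc _ _ _) (cong (m′ ∙_) hh)))
             (trans (grp (h ∷ m ∷ m′ ∷ []) (κ 2 1 (vc vm Mm′ Mm) ∷ []) (var 2 ⊕ (var 1 ⊕ (var 0 ⊕ var 0)) ⊕ var 0 ⁻) (var 1 ⊕ var 2 ⊕ var 0) refl) refl))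
        onK : ∀ g → K g → Comm g (m ∙ m′)
        onK g Kg with ix h (g ∙ h) Hh (cl sH (K⊆H g Kg) Hh)
        ... | inj₁ x = ⊥-elim (nK x)
        ... | inj₂ (inj₁ x) = ⊥-elim (nK (subst K (grp (g ∷ h ∷ []) [] (var 0 ⁻ ⊕ (var 0 ⊕ var 1)) (var 1) refl) (cl sK (ci sK Kg) x)))
        ... | inj₂ (inj₂ x) = comm-∙ (cK g Kg) (trans (grp (g ∷ h ∷ m ∷ []) [] (var 0 ⊕ (var 1 ⊕ var 2 ⊕ var 1 ⁻)) (var 1 ⊕ ((var 1 ⁻ ⊕ (var 0 ⊕ var 1)) ⊕ var 2) ⊕ var 1 ⁻) refl)
               (trans (cong (λ z → h ∙ z ∙ h ⁻¹) (cK _ x)) (grp (g ∷ h ∷ m ∷ []) [] (var 1 ⊕ (var 2 ⊕ (var 1 ⁻ ⊕ (var 0 ⊕ var 1))) ⊕ var 1 ⁻) ((var 1 ⊕ var 2 ⊕ var 1 ⁻) ⊕ var 0) refl)))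
        all : ∀ g → H g → Comm g (m ∙ m′)
        all g Hg with ix h g Hh Hg
        ... | inj₁ x = ⊥-elim (nK x)
        ... | inj₂ (inj₁ x) = onK g x
        ... | inj₂ (inj₂ x) = trans (cong (_∙ (m ∙ m′)) (grp (g ∷ h ∷ []) [] (var 0) (var 1 ⊕ (var 1 ⁻ ⊕ var 0)) refl))
               (trans (sym (comm-∙ (sym hm) (sym (onK _ x)))) (cong ((m ∙ m′) ∙_) (grp (g ∷ h ∷ []) [] (var 1 ⊕ (var 1 ⁻ ⊕ var 0)) (var 0) refl)))

  sub-fix : ∀ {H} v → Sub H → Sub (λ g → H g × g ▹ v ≡ v)
  sub-fix v s = record { cl = λ { (a , b) (c , d) → cl s a c , fix-∙ b d } ; ci = λ { (a , b) → ci s a , fix-inv b } }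

  -- In continuation style: on the way to `w` each next vertex is fixed as well, at the price of
  -- index at most 2, and `k` treats the subgroup that arrives.
  chain-walk : ∀ {n H u v w} → Sub H → (∀ g → H g → g ▹ u ≡ u) → (∀ g → H g → g ▹ v ≡ v) → Adj v u → Walk n v w →
               (∀ K → Sub K → (∀ g → K g → H g) → (∀ g → K g → g ▹ w ≡ w) → Chain K) → Chain H
  chain-walk {H = H} s fu fv vu stay k = k H s (λ _ h → h) fv
  chain-walk {H = H} {u} {v} s fu fv vu (_▸_ {v = x} vx p) k with x ≟ⱽ u
  ... | yes refl = chain-walk s fv fu (symA vu) p k
  ... | no x≢u with third vu vx (≢-sym x≢u)
  ...   | c , st = step K sK (λ _ → proj₁) ix s (chain-walk sK (λ g q → fv g (proj₁ q)) (λ _ → proj₂) (symA vx) p (λ L sL L⊆K → k L sL (λ g q → proj₁ (L⊆K g q))))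
    where
    K = λ g → H g × g ▹ x ≡ x
    sK = sub-fix x s
    ix : ∀ g h → H g → H h → K g ⊎ K h ⊎ K (g ⁻¹ ∙ h)
    ix g h Hg Hh with swap? g st (fv g Hg) (fu g Hg) | swap? h st (fv h Hh) (fu h Hh)
    ... | inj₁ (e , _) | _ = inj₁ (Hg , e)
    ... | inj₂ _ | inj₁ (e , _) = inj₂ (inj₁ (Hh , e))
    ... | inj₂ (a , _) | inj₂ (b , _) = inj₂ (inj₂ (cl s (ci s Hg) Hh , ∙▹≡ (g ⁻¹) h b (⁻¹▹ g a)))

  chain-list : ∀ vs {H u v} → Sub H → (∀ g → H g → g ▹ u ≡ u) → (∀ g → H g → g ▹ v ≡ v) → Adj v u →
               (∀ K → Sub K → (∀ w → Any (w ≡_) vs → ∀ g → K g → g ▹ w ≡ w) → (∀ g → K g → H g) → Chain K) → Chain H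
  chain-list [] {H} s fu fv vu k = k H s (λ _ ()) (λ _ h → h)
  chain-list (w ∷ vs) {H} {u} {v} s fu fv vu k = chain-walk s fu fv vu (proj₂ (proj₂ (conn v w)))
    λ K sK K⊆H Kw → chain-list vs sK (λ g q → fu g (K⊆H g q)) (λ g q → fv g (K⊆H g q)) vu
      λ L sL Lvs L⊆K → k L sL (λ { w′ (here refl) g q → Kw g (L⊆K g q) ; w′ (there i) g q → Lvs w′ i g q }) (λ g q → K⊆H g (L⊆K g q))

  sub-S₀ : Sub S₀
  sub-S₀ = record { cl = λ { (a , b) (c , d) → fix-∙ a c , fix-∙ b d } ; ci = λ { (a , b) → fix-inv a , fix-inv b } }

  chain-S₀ : Chain S₀
  chain-S₀ = chain-list vertices sub-S₀ (λ _ → proj₂) (λ _ → proj₁) (Ao true)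
    λ K sK f K⊆ → triv (λ g Kg → faithful g (λ v → f v (complete v) g Kg))

  Ball : ℕ → G → Set
  Ball k g = S₀ g × (∀ n w → n ≤ k → Walk n (o true) w → g ▹ w ≡ w)

  perm-comm : ∀ {g h v a b} → Adj v a → Adj v b → g ▹ v ≡ v → g ▹ a ≡ a → h ▹ v ≡ v → h ▹ a ≡ a → (g ∙ h) ▹ b ≡ (h ∙ g) ▹ b
  perm-comm {g} {h} {v} {a} {b} va vb gv ga hv ha with a ≟ⱽ b
  ... | yes refl = trans (fix-∙ ga ha) (sym (fix-∙ ha ga))
  ... | no ab with third va vb ab
  ...   | c , st with swap? g st gv ga | swap? h st hv ha
  ...     | inj₁ (x , y) | inj₁ (z , w) = trans (fix-∙ x z) (sym (fix-∙ z x))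
  ...     | inj₁ (x , y) | inj₂ (z , w) = trans (∙▹≡ g h z y) (sym (∙▹≡ h g x z))
  ...     | inj₂ (x , y) | inj₁ (z , w) = trans (∙▹≡ g h z x) (sym (∙▹≡ h g x w))
  ...     | inj₂ (x , y) | inj₂ (z , w) = trans (∙▹≡ g h z y) (sym (∙▹≡ h g x w))

  perm-sq : ∀ {g v a b} → Adj v a → Adj v b → g ▹ v ≡ v → g ▹ a ≡ a → (g ∙ g) ▹ b ≡ b
  perm-sq {g} {v} {a} {b} va vb gv ga with a ≟ⱽ b
  ... | yes refl = fix-∙ ga ga
  ... | no ab with third va vb ab
  ...   | c , st with swap? g st gv ga
  ...     | inj₁ (x , y) = fix-∙ x x
  ...     | inj₂ (x , y) = ∙▹≡ g g x y

  comm-fix : ∀ {g h v} → (g ∙ h) ▹ v ≡ (h ∙ g) ▹ v → (g ∙ h ∙ g ⁻¹ ∙ h ⁻¹) ▹ ((h ∙ g) ▹ v) ≡ (h ∙ g) ▹ v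
  comm-fix {g} {h} {v} e = trans (sym (∙▹ (g ∙ h ∙ g ⁻¹ ∙ h ⁻¹) (h ∙ g) v)) (trans (cong (_▹ v) (grp (g ∷ h ∷ []) [] (var 0 ⊕ var 1 ⊕ var 0 ⁻ ⊕ var 1 ⁻ ⊕ (var 1 ⊕ var 0)) (var 0 ⊕ var 1) refl)) e)

  module _ (k : ℕ) (tr : ∀ g → Ball (suc k) g → g ≡ ε) where
    inner : ∀ {n w} → n ≤ suc k → Walk n (o true) w → ∃₂ λ v a → Adj v a × Adj v w × (∀ g → Ball k g → g ▹ v ≡ v × g ▹ a ≡ a)
    inner {zero} _ stay = o false , o true , Ao false , Ao false , λ g b → proj₂ (proj₁ b) , proj₁ (proj₁ b)
    inner {suc zero} _ (a ▸ stay) = o true , o false , Ao true , a , λ g b → proj₁ b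
    inner {suc (suc n)} (s≤s le) p with unsnocW p
    ... | v , q , vw with unsnocW q
    ...   | u , r , uv = v , u , symA uv , vw , λ g b → proj₂ b _ v le q , proj₂ b _ u (≤-trans (n≤1+n n) le) r

    ball-sub : Sub (Ball k)
    ball-sub = record { cl = λ { (s , a) (t , b) → cl sub-S₀ s t , λ n w le p → fix-∙ (a n w le p) (b n w le p) }
                      ; ci = λ { (s , a) → ci sub-S₀ s , λ n w le p → fix-inv (a n w le p) } }

    -- Beyond each vertex of the ball an element of `Ball k` at most swaps two neighbours. Squares
    -- and commutators therefore fix the next sphere and are trivial by `tr`.
    ball-vect : Vect (Ball k)
    ball-vect = record { v∙ = cl ball-sub
      ; v² = λ {x} b → tr _ (cl sub-S₀ (proj₁ b) (proj₁ b) , λ n w le p → case inner le p of λ { (v , a , va , vw , f) → perm-sq va vw (proj₁ (f _ b)) (proj₂ (f _ b)) })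
      ; vc = λ {x} {y} b c → let com = x ∙ y ∙ x ⁻¹ ∙ y ⁻¹ in
           cancelʳ (x ⁻¹ ∙ y ⁻¹) (trans (grp (x ∷ y ∷ []) [] (var 0 ⊕ var 1 ⊕ (var 0 ⁻ ⊕ var 1 ⁻)) (var 0 ⊕ var 1 ⊕ var 0 ⁻ ⊕ var 1 ⁻) refl)
           (trans (tr com (cl sub-S₀ (cl sub-S₀ (cl sub-S₀ (proj₁ b) (proj₁ c)) (ci sub-S₀ (proj₁ b))) (ci sub-S₀ (proj₁ c)) , fx b c)) (grp (x ∷ y ∷ []) [] e0 (var 1 ⊕ var 0 ⊕ (var 0 ⁻ ⊕ var 1 ⁻)) refl))) }
      where
      fx : ∀ {x y} → Ball k x → Ball k y → ∀ n w → n ≤ suc k → Walk n (o true) w → (x ∙ y ∙ x ⁻¹ ∙ y ⁻¹) ▹ w ≡ w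
      fx {x} {y} b c n w le p with inner le p
      ... | v , a , va , vw , f = subst (λ w → (x ∙ y ∙ x ⁻¹ ∙ y ⁻¹) ▹ w ≡ w) back (comm-fix {x} {y} {w′} (perm-comm va vw′ xv xa yv ya))
        where
        xv = proj₁ (f x b) ; xa = proj₂ (f x b) ; yv = proj₁ (f y c) ; ya = proj₂ (f y c)
        w′ = (y ∙ x) ⁻¹ ▹ w
        vw′ : Adj v w′
        vw′ = actAf ((y ∙ x) ⁻¹) (fix-inv (fix-∙ yv xv)) vw
        back : (y ∙ x) ▹ w′ ≡ w
        back = trans (sym (∙▹ _ _ _)) (trans (cong (_▹ w) (invʳ _)) (ε▹ w))

    ball-conj : ∀ h m → S₀ h → Ball k m → Ball k (h ∙ m ∙ h ⁻¹)
    ball-conj h m s (b , f) = cl sub-S₀ (cl sub-S₀ s b) (ci sub-S₀ s) , λ n w le p →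
      subst (λ w → (h ∙ m ∙ h ⁻¹) ▹ w ≡ w) (trans (sym (∙▹ _ _ _)) (trans (cong (_▹ w) (invʳ h)) (ε▹ w)))
        (fix-conj h (f n (h ⁻¹ ▹ w) le (subst (λ u → Walk n u (h ⁻¹ ▹ w)) (fix-inv (proj₁ s)) (walk-act (h ⁻¹) p))))

  Central : G → Set
  Central ω = S₀ ω × ω ∙ ω ≡ ε × (∀ s → S₀ s → Comm s ω)

  -- For the least radius with trivial `Ball`, the ball stabiliser one step before is elementary
  -- abelian, nontrivial and normalised by the 2-group `S₀`; a fixed point of this conjugation is a
  -- central involution. Radius 0 means that `S₀` is trivial.
  centre : ¬ ¬ ((∀ g → S₀ g → g ≡ ε) ⊎ ∃ λ ω → Central ω × ω ≢ ε)
  centre k = least (λ k → ∀ g → Ball k g → g ≡ ε) diam (λ g b → faithful g (λ v → proj₂ b _ v (proj₁ (proj₂ (conn (o true) v))) (proj₂ (proj₂ (conn (o true) v))))) go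
    where
    ball0 : ∀ g → S₀ g → Ball 0 g
    ball0 g s = s , λ { .0 w z≤n stay → proj₁ s }
    go : ∃ (λ n → (∀ g → Ball n g → g ≡ ε) × (∀ m → m < n → ¬ (∀ g → Ball m g → g ≡ ε))) → ⊥
    go (zero , tr , _) = k (inj₁ (λ g s → tr g (ball0 g s)))
    go (suc n , tr , mn) = mn n ≤-refl λ g b → decidable-stable (g ≟ᴳ ε) λ ne →
      chain-fix chain-S₀ (Ball n) (ball-vect n tr) (ball-conj n tr) (g , b , ne)
        λ { (ω , bω , ne′ , cω) → k (inj₂ (ω , (proj₁ bω , Vect.v² (ball-vect n tr) bω , cω) , ne′)) }

-- Both vertex stabilisers act on the neighbours as the symmetric group

record S3Data (S : Setting) : Set where
  open Basics S
  field
    turn : ∀ t {b c} → St (o t) (o (not t)) b c → ∃ λ g → g ▹ o t ≡ o t × g ▹ o (not t) ≡ o (not t) × g ▹ b ≡ c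
    -- When this fails, the kernel at one end of a flag lies in the kernel at the other end, and the
    -- flag stabiliser has order at most 2.
    deep : ∀ t {b c} → St (o (not t)) (o t) b c → ∃ λ g → Q (o t) g × g ▹ b ≡ c

module S3 (S : Setting) (D : S3Data S) where
  open Basics S public
  open Centre S public
  open S3Data D

  -- Transitivity on flags matches `v` and `a`; a turn about the target flag then corrects the order
  -- of the two other neighbours.
  st-move : ∀ {t v v′ a b c a′ b′ c′} → T t v → T t v′ → St v a b c → St v′ a′ b′ c′ →
            ∃ λ g → g ▹ v ≡ v′ × g ▹ a ≡ a′ × g ▹ b ≡ b′ × g ▹ c ≡ c′
  st-move {t} {v} {v′} {a} {b} {c} {a′} {b′} {c′} tv tv′ s s′ = fin (only s′ (k ▹ b) (subst (λ x → Adj x (k ▹ b)) kv (actA k (₂ s))))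
    where
    m = move t v a
    h = move t v′ a′
    k = h ∙ m ⁻¹
    kv : k ▹ v ≡ v′
    kv = ∙▹≡ h (m ⁻¹) (⁻¹▹ m (move₁ tv (₁ s))) (move₁ tv′ (₁ s′))
    ka : k ▹ a ≡ a′
    ka = ∙▹≡ h (m ⁻¹) (⁻¹▹ m (move₂ tv (₁ s))) (move₂ tv′ (₁ s′))
    base : St (o t) (o (not t)) (h ⁻¹ ▹ b′) (h ⁻¹ ▹ c′)
    base = subst₂′ (⁻¹▹ h (move₁ tv′ (₁ s′))) (⁻¹▹ h (move₂ tv′ (₁ s′))) (st-act (h ⁻¹) s′)
      where
      subst₂′ : ∀ {u u′ x x′ y z} → u ≡ u′ → x ≡ x′ → St u x y z → St u′ x′ y z
      subst₂′ refl refl q = q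
    w = proj₁ (turn t base)
    h∙ : ∀ x → h ▹ (h ⁻¹ ▹ x) ≡ x
    h∙ x = trans (sym (∙▹ _ _ _)) (trans (cong (_▹ x) (invʳ h)) (ε▹ x))
    l = h ∙ w ∙ h ⁻¹
    l-at : ∀ {x y z u} → h ⁻¹ ▹ x ≡ y → w ▹ y ≡ z → h ▹ z ≡ u → l ▹ x ≡ u
    l-at e f g = ∙▹≡ (h ∙ w) (h ⁻¹) e (∙▹≡ h w f g)
    tw = proj₂ (turn t base)
    lv : l ▹ v′ ≡ v′
    lv = l-at (⁻¹▹ h (move₁ tv′ (₁ s′))) (proj₁ tw) (move₁ tv′ (₁ s′))
    la : l ▹ a′ ≡ a′
    la = l-at (⁻¹▹ h (move₂ tv′ (₁ s′))) (proj₁ (proj₂ tw)) (move₂ tv′ (₁ s′))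
    lb : l ▹ b′ ≡ c′
    lb = l-at refl (proj₂ (proj₂ tw)) (h∙ c′)
    lc : l ▹ c′ ≡ b′
    lc with swap? l s′ lv la
    ... | inj₁ (e , _) = ⊥-elim (b≢c s′ (trans (sym e) lb))
    ... | inj₂ (_ , e) = e
    adjv′ : ∀ g → g ▹ v ≡ v′ → ∀ {x} → Adj v x → Adj v′ (g ▹ x)
    adjv′ g e {x} p = subst (λ y → Adj y (g ▹ x)) e (actA g p)
    fin : k ▹ b ≡ a′ ⊎ k ▹ b ≡ b′ ⊎ k ▹ b ≡ c′ → _
    fin (inj₁ e) = ⊥-elim (a≢b s (▹-inj k (trans ka (sym e))))
    fin (inj₂ (inj₁ e)) = k , kv , ka , e , st-uniq s′ (adjv′ k kv (₃ s)) (λ x → a≢c s (▹-inj k (trans ka (sym x)))) (λ x → b≢c s (▹-inj k (trans e (sym x))))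
    fin (inj₂ (inj₂ e)) = l ∙ k , ∙▹≡ l k kv lv , ∙▹≡ l k ka la , ∙▹≡ l k e lc
      , ∙▹≡ l k (st-uniq (st-132 s′) (adjv′ k kv (₃ s)) (λ x → a≢c s (▹-inj k (trans ka (sym x)))) (λ x → b≢c s (▹-inj k (trans e (sym x))))) lb

  qsw : ∀ {t u v b c} → T t u → St v u b c → ∃ λ g → Q u g × g ▹ b ≡ c × g ▹ c ≡ b
  qsw {t} {u} {v} {b} {c} tu s = l , Ql , lb , (case swap? l s (fixₙ Ql v (symA (₁ s))) (fix Ql) of λ { (inj₁ (e , _)) → ⊥-elim (b≢c s (trans (sym e) lb)) ; (inj₂ (_ , e)) → e })
    where
    h = move t u v
    h₁ = move₁ tu (symA (₁ s))
    h₂ = move₂ tu (symA (₁ s))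
    base : St (o (not t)) (o t) (h ⁻¹ ▹ b) (h ⁻¹ ▹ c)
    base = subst₂′ (⁻¹▹ h h₂) (⁻¹▹ h h₁) (st-act (h ⁻¹) s)
      where
      subst₂′ : ∀ {u u′ x x′ y z} → u ≡ u′ → x ≡ x′ → St u x y z → St u′ x′ y z
      subst₂′ refl refl q = q
    w = proj₁ (deep t base)
    l = h ∙ w ∙ h ⁻¹
    Ql : Q u l
    Ql = subst (λ x → Q x l) h₁ (Q-conj h (proj₁ (proj₂ (deep t base))))
    lb : l ▹ b ≡ c
    lb = ∙▹≡ (h ∙ w) (h ⁻¹) refl (∙▹≡ h w (proj₂ (proj₂ (deep t base))) (trans (sym (∙▹ _ _ _)) (trans (cong (_▹ c) (invʳ h)) (ε▹ c))))

  nb : ∀ y → ∃ λ x → Adj y x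
  nb y with conn y (o true)
  ... | _ , _ , stay = o false , Ao true
  ... | _ , _ , (a ▸ _) = _ , a

  eq→conj : ∀ {x y g} → x ∙ g ≡ g ∙ y → x ≡ g ∙ y ∙ g ⁻¹
  eq→conj {x} {y} {g} e = trans (grp (x ∷ g ∷ []) [] (var 0) (var 0 ⊕ var 1 ⊕ var 1 ⁻) refl) (cong (_∙ g ⁻¹) e)

  -- An involution z y for every vertex y of one type, depending equivariantly on y (hence central in the stabiliser
  -- of y), with product 1 around every vertex of the other type.
  record NFam (t : Bool) : Set where
    field
      z : V → G
      eqv : ∀ g y → T t y → z (g ▹ y) ∙ g ≡ g ∙ z y
      z² : ∀ y → T t y → z y ∙ z y ≡ ε
      z≢ε : ∀ y → T t y → z y ≢ ε
      nat : ∀ {x a b c} → T (not t) x → St x a b c → z a ∙ z b ≡ z c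
      zQ : ∀ {y} → T t y → Q y (z y)
      zQ₁ : ∀ {y x} → T t y → Adj y x → Q x (z y)

  -- The analogue for edges: an involution for every flag, with product 1 around every vertex.
  record FFam : Set where
    field
      r : Bool → V → V → G
      r-sym : ∀ {t u v} → T t u → Adj u v → r t u v ≡ r (not t) v u
      eqv : ∀ g {t u v} → T t u → Adj u v → r t (g ▹ u) (g ▹ v) ∙ g ≡ g ∙ r t u v
      r² : ∀ {t u v} → T t u → Adj u v → r t u v ∙ r t u v ≡ ε
      r≢ε : ∀ {t u v} → T t u → Adj u v → r t u v ≢ ε
      flow : ∀ {t u a b c} → T t u → St u a b c → r t u a ∙ r t u b ≡ r t u c
      rQ : ∀ {t u v} → T t u → Adj u v → Q u (r t u v)

  S₀-at : ∀ t {g} → S₀ g → g ▹ o t ≡ o t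
  S₀-at true = proj₁
  S₀-at false = proj₂

  S₀-mk : ∀ t {g} → g ▹ o t ≡ o t → g ▹ o (not t) ≡ o (not t) → S₀ g
  S₀-mk true a b = a , b
  S₀-mk false a b = b , a

  -- The element ω transported from the base flag to (`u` , `v`). For central ω the choice of the
  -- transporting element is immaterial (`conj-sub`), whence equivariance and symmetry.
  om : G → Bool → V → V → G
  om ω t u v = move t u v ∙ ω ∙ move t u v ⁻¹

  conj-sub : ∀ {g h ω} → Comm (h ⁻¹ ∙ g) ω → g ∙ ω ∙ g ⁻¹ ≡ h ∙ ω ∙ h ⁻¹
  conj-sub {g} {h} {ω} c = trans (grp (g ∷ h ∷ ω ∷ []) [] (var 0 ⊕ var 2 ⊕ var 0 ⁻) (var 1 ⊕ ((var 1 ⁻ ⊕ var 0) ⊕ var 2) ⊕ var 0 ⁻) refl)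
    (trans (cong (λ x → h ∙ x ∙ g ⁻¹) c) (grp (g ∷ h ∷ ω ∷ []) [] (var 1 ⊕ (var 2 ⊕ (var 1 ⁻ ⊕ var 0)) ⊕ var 0 ⁻) (var 1 ⊕ var 2 ⊕ var 1 ⁻) refl))

  om-eqv : ∀ {ω} → Central ω → ∀ g {t u v} → T t u → Adj u v → om ω t (g ▹ u) (g ▹ v) ≡ g ∙ om ω t u v ∙ g ⁻¹
  om-eqv {ω} (_ , _ , c) g {t} {u} {v} tu uv = trans (conj-sub (c _ (S₀-mk t
      (∙▹≡ (h ⁻¹) m (move₁ tgu guv) (⁻¹▹ h (∙▹≡ g n (move₁ tu uv) refl)))
      (∙▹≡ (h ⁻¹) m (move₂ tgu guv) (⁻¹▹ h (∙▹≡ g n (move₂ tu uv) refl))))))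
      (grp (g ∷ n ∷ ω ∷ []) [] ((var 0 ⊕ var 1) ⊕ var 2 ⊕ (var 0 ⊕ var 1) ⁻) (var 0 ⊕ (var 1 ⊕ var 2 ⊕ var 1 ⁻) ⊕ var 0 ⁻) refl)
    where
    tgu = T-act g tu
    guv = actA g uv
    m = move t (g ▹ u) (g ▹ v)
    n = move t u v
    h = g ∙ n

  om-sym : ∀ {ω} → Central ω → ∀ {t u v} → T t u → Adj u v → om ω t u v ≡ om ω (not t) v u
  om-sym {ω} (_ , _ , c) {t} {u} {v} tu uv = conj-sub (c _ (S₀-mk t
      (∙▹≡ (h ⁻¹) m (move₁ tu uv) (⁻¹▹ h h₂)) (∙▹≡ (h ⁻¹) m (move₂ tu uv) (⁻¹▹ h h₁))))
    where
    m = move t u v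
    h = move (not t) v u
    h₁ = move₁ (T-adj uv tu) (symA uv)
    h₂ : h ▹ o t ≡ u
    h₂ = subst (λ s → h ▹ o s ≡ u) (not-not t) (move₂ (T-adj uv tu) (symA uv))

  om-base : ∀ {ω} → Central ω → ∀ t → om ω t (o t) (o (not t)) ≡ ω
  om-base {ω} (_ , _ , c) t = trans (conj-sub (c _ (S₀-mk t (∙▹≡ (ε ⁻¹) m (move₁ (To t) (Ao t)) (⁻¹▹ ε (ε▹ _))) (∙▹≡ (ε ⁻¹) m (move₂ (To t) (Ao t)) (⁻¹▹ ε (ε▹ _))))))
    (grp (ω ∷ []) [] (e0 ⊕ var 0 ⊕ e0 ⁻) (var 0) refl)
    where m = move t (o t) (o (not t))

  om-fix : ∀ {ω} → Central ω → ∀ {t u v} → T t u → Adj u v → om ω t u v ▹ u ≡ u × om ω t u v ▹ v ≡ v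
  om-fix {ω} (s , _) {t} {u} {v} tu uv = subst (λ x → om ω t u v ▹ x ≡ x) (move₁ tu uv) (fix-conj (move t u v) (S₀-at t s))
    , subst (λ x → om ω t u v ▹ x ≡ x) (move₂ tu uv) (fix-conj (move t u v) (S₀-at (not t) s))

  om-comm : ∀ {ω} → Central ω → ∀ {g t u v} → T t u → Adj u v → g ▹ u ≡ u → g ▹ v ≡ v → Comm g (om ω t u v)
  om-comm {ω} c {g} {t} {u} {v} tu uv gu gv = sym (trans (cong (_∙ g) (trans (cong₂ (om ω t) (sym gu) (sym gv)) (om-eqv c g tu uv)))
    (grp (g ∷ om ω t u v ∷ []) [] (var 0 ⊕ var 1 ⊕ var 0 ⁻ ⊕ var 0) (var 0 ⊕ var 1) refl))

  om-∙ : ∀ ω ω′ t u v → om (ω ∙ ω′) t u v ≡ om ω t u v ∙ om ω′ t u v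
  om-∙ ω ω′ t u v = grp (move t u v ∷ ω ∷ ω′ ∷ []) [] (var 0 ⊕ (var 1 ⊕ var 2) ⊕ var 0 ⁻) ((var 0 ⊕ var 1 ⊕ var 0 ⁻) ⊕ (var 0 ⊕ var 2 ⊕ var 0 ⁻)) refl

  om² : ∀ {ω} → Central ω → ∀ t u v → om ω t u v ∙ om ω t u v ≡ ε
  om² {ω} (_ , i , _) t u v = grp (move t u v ∷ ω ∷ []) (ι 1 i ∷ []) ((var 0 ⊕ var 1 ⊕ var 0 ⁻) ⊕ (var 0 ⊕ var 1 ⊕ var 0 ⁻)) e0 refl

  om≢ε : ∀ {ω} → ω ≢ ε → ∀ t u v → om ω t u v ≢ ε
  om≢ε {ω} ne t u v e = ne (cancelˡ (move t u v) (cancelʳ (move t u v ⁻¹) (trans e (grp (move t u v ∷ []) [] e0 (var 0 ⊕ e0 ⊕ var 0 ⁻) refl))))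

  -- For central ω this says that ω centralises the whole stabiliser of `o t`.
  Cen : Bool → G → Set
  Cen t ω = ∀ {a b u} → T t u → Adj u a → Adj u b → om ω t u a ≡ om ω t u b

  cen : ∀ {ω} → Central ω → ∀ {t u a b} → T t u → Adj u a → Adj u b → a ≢ b → om ω t u a ≡ om ω t u b → Cen t ω
  cen {ω} c {t} {u} {a} {b} tu ua ub ab e {a′} {b′} {u′} tu′ ua′ ub′ with a′ ≟ⱽ b′
  ... | yes refl = refl
  ... | no ab′ with st-move tu tu′ (proj₂ (third ua ub ab)) (proj₂ (third ua′ ub′ ab′))
  ...   | g , refl , refl , refl , _ = trans (om-eqv c g tu ua) (trans (cong (λ x → g ∙ x ∙ g ⁻¹) e) (sym (om-eqv c g tu ub)))

  -- If a central involution does not fix all neighbours of both ends of its flag, then G_v^[2] = 1 at the other end v.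
  module _ {ω t u v} (c : Central ω) (tu : T t u) (uv : Adj u v) (nq : ¬ Q u (om ω t u v)) where
    private
      Y : G → Set
      Y g = Q v g × (∀ x → Adj v x → Q x g)
      R : V → G
      R x = om ω t u x
      s = proj₂ (proj₂ (star uv))
      s′ = proj₂ (proj₂ (star (symA uv)))
      p = proj₁ (star uv)
      q = proj₁ (proj₂ (star uv))
      swp : ∀ {x a b} → St u x a b → R x ▹ a ≡ b
      swp {x} {a} {b} s′ = proj₁ (notQ s′ (proj₁ (om-fix c tu (₁ s′))) (proj₂ (om-fix c tu (₁ s′))) nqx)
        where
        nqx : ¬ Q u (R x)
        nqx qx with st-move tu tu s s′
        ... | g , gu , refl , _ = nq (Q-conj⁻ g (subst (Q (g ▹ u)) (om-eqv c g tu uv) (subst (λ w → Q w (om ω t w (g ▹ v))) (sym gu) qx)))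
      Ycom : ∀ {x} → Adj u x → ∀ y → Y y → Y (R x ⁻¹ ∙ y ∙ R x)
      Ycom {x} ux y Yy = subst Y (sym (comm-conj (om-comm c tu ux (fix (proj₂ Yy u (symA uv))) (fixₙ (proj₂ Yy u (symA uv)) x ux)))) Yy
      triv-Y : ∀ y → Y y → y ≡ ε
      triv-Y = core record
        { a = u ; b = v ; ab = uv ; Y = Y
        ; Ya = λ y Yy → fix (proj₂ Yy u (symA uv)) ; Yb = λ y Yy → fix (proj₁ Yy)
        ; atA = atA ; atB = atB }
        where
        atA : ∀ b′ → Adj u b′ → ∃ λ h → h ▹ u ≡ u × h ▹ v ≡ b′ × (∀ y → Y y → Y (h ⁻¹ ∙ y ∙ h))
        atA b′ ub′ with only s b′ ub′
        ... | inj₁ refl = R v , proj₁ (om-fix c tu uv) , proj₂ (om-fix c tu uv) , Ycom uv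
        ... | inj₂ (inj₁ refl) = R q , proj₁ (om-fix c tu (₃ s)) , swp (st-312 s) , Ycom (₃ s)
        ... | inj₂ (inj₂ refl) = R p , proj₁ (om-fix c tu (₂ s)) , swp (st-213 s) , Ycom (₂ s)
        atB : ∀ a′ → Adj v a′ → ∃ λ h → h ▹ v ≡ v × h ▹ u ≡ a′ × (∀ y → Y y → Y (h ⁻¹ ∙ y ∙ h))
        atB a′ va′ = h , hv , ∙▹≡ m (n ⁻¹) (⁻¹▹ n (move₂ (T-adj uv tu) (symA uv))) (move₂ (T-adj uv tu) va′) , λ y Yy → Q-back hv (proj₁ Yy) ,
                     λ x vx → Q-pull h (proj₂ Yy (h ▹ x) (actAf h hv vx))
          where
          m = move (not t) v a′
          n = move (not t) v u
          h = m ∙ n ⁻¹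
          hv : h ▹ v ≡ v
          hv = ∙▹≡ m (n ⁻¹) (⁻¹▹ n (move₁ (T-adj uv tu) (symA uv))) (move₁ (T-adj uv tu) va′)

    -- The kernels at `v`, at `u` and at the two other neighbours of `v` are four steps of index 2
    -- down to `Y`, hence 16.
    case0 : Bnd S₀ 16
    case0 = flag-bnd tu uv
      (bnd-Qs (sub-flag u v) s′ (λ _ h → proj₂ h , proj₁ h)
      (bnd-Qs (sub-Q v (sub-flag u v)) s (λ _ h → proj₁ h)
      (bnd-Qs (sub-Q u (sub-Q v (sub-flag u v))) (proj₂ (proj₂ (star (symA (₂ s′))))) (λ _ h → fixₙ (proj₂ (proj₁ h)) _ (₂ s′) , fix (proj₂ (proj₁ h)))
      (bnd-Qs (sub-Q _ (sub-Q u (sub-Q v (sub-flag u v)))) (proj₂ (proj₂ (star (symA (₃ s′))))) (λ _ h → fixₙ (proj₂ (proj₁ (proj₁ h))) _ (₃ s′) , fix (proj₂ (proj₁ (proj₁ h))))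
      (bnd-1 λ { g ((((h , qv) , qu) , qb) , qc) → triv-Y g (qv , λ x vx → [ (λ { refl → qu }) , [ (λ { refl → qb }) , (λ { refl → qc }) ]′ ]′ (only s′ x vx)) })))))

-- From a central involution of an edge stabiliser to one of the two kinds of equivariant families.
module Families (S : Setting) (D : S3Data S) (q0 : ∀ ω → Centre.Central S ω → ∀ t → Basics.Q S (Setting.o S t) ω) where
  open S3 S D

  qom : ∀ {ω} → Central ω → ∀ {t u v} → T t u → Adj u v → Q u (om ω t u v)
  qom {ω} c {t} {u} {v} tu uv = subst (λ x → Q x (om ω t u v)) (move₁ tu uv) (Q-conj (move t u v) (q0 ω c t))

  omom : ∀ {ω ω′} → Central ω → Central ω′ → ∀ {t u a b} → T t u → Adj u a → Adj u b → Comm (om ω t u a) (om ω′ t u b)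
  omom c c′ tu ua ub = om-comm c′ tu ub (proj₁ (om-fix c tu ua)) (fixₙ (qom c tu ua) _ ub)

  cen→comm : ∀ {ω} → Central ω → ∀ {t g} → Cen t ω → g ▹ o t ≡ o t → Comm ω g
  cen→comm {ω} c {t} {g} ct gt = trans (cong (_∙ g) (trans (sym (om-base c t)) (trans (ct (To t) (Ao t) (actAf g gt (Ao t)))
     (trans (cong (λ x → om ω t x (g ▹ o (not t))) (sym gt)) (trans (om-eqv c g (To t) (Ao t)) (cong (λ x → g ∙ x ∙ g ⁻¹) (om-base c t)))))))
     (grp (g ∷ ω ∷ []) [] (var 0 ⊕ var 1 ⊕ var 0 ⁻ ⊕ var 0) (var 0 ⊕ var 1) refl)

  local : ∀ t {a b} → Adj (o t) a → Adj (o t) b → ∃ λ h → h ▹ o t ≡ o t × h ▹ a ≡ b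
  local t {a} {b} x y = m ∙ n ⁻¹ , ∙▹≡ m (n ⁻¹) (⁻¹▹ n (move₁ (To t) x)) (move₁ (To t) y) , ∙▹≡ m (n ⁻¹) (⁻¹▹ n (move₂ (To t) x)) (move₂ (To t) y)
    where
    m = move t (o t) b
    n = move t (o t) a

  cen-both : ∀ {ω} → Central ω → (∀ t → Cen t ω) → ω ≡ ε
  cen-both {ω} c ct = core record { a = o true ; b = o false ; ab = Ao true ; Y = λ y → y ≡ ω
    ; Ya = λ { y refl → proj₁ (proj₁ c) } ; Yb = λ { y refl → proj₂ (proj₁ c) } ; atA = at′ true ; atB = at′ false } ω refl
    where
    at′ : ∀ t b′ → Adj (o t) b′ → ∃ λ h → h ▹ o t ≡ o t × h ▹ o (not t) ≡ b′ × (∀ y → y ≡ ω → h ⁻¹ ∙ y ∙ h ≡ ω)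
    at′ t b′ ab with local t (Ao t) ab
    ... | h , h₁ , h₂ = h , h₁ , h₂ , λ { y refl → comm-conj (cen→comm c (ct t) h₁) }

  private
    p q : Bool → V
    p t = proj₁ (star (Ao t))
    q t = proj₁ (proj₂ (star (Ao t)))
    s : ∀ t → St (o t) (o (not t)) (p t) (q t)
    s t = proj₂ (proj₂ (star (Ao t)))

  -- The norm of ω about `o t`: the product of its conjugates over the three flags there, the first
  -- being ω itself.
  N : Bool → G → G
  N t ω = ω ∙ om ω t (o t) (p t) ∙ om ω t (o t) (q t)

  S₀-om : ∀ {ω} → Central ω → ∀ t {x} → Adj (o t) x → S₀ (om ω t (o t) x)
  S₀-om c t ax = S₀-mk t (proj₁ (om-fix c (To t) ax)) (fixₙ (qom c (To t) ax) _ (Ao t))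

  N-central : ∀ {ω} → Central ω → ∀ t → Central (N t ω)
  N-central {ω} c@(c₁ , c₂ , c₃) t = cl sub-S₀ (cl sub-S₀ c₁ (S₀-om c t (₂ (s t)))) (S₀-om c t (₃ (s t)))
    , grp (ω ∷ P ∷ R ∷ []) (ι 0 c₂ ∷ ι 1 (om² c t _ _) ∷ ι 2 (om² c t _ _) ∷ κ 1 0 (c₃ P sP) ∷ κ 2 0 (c₃ R sR) ∷ κ 1 2 PR ∷ []) ((var 0 ⊕ var 1 ⊕ var 2) ⊕ (var 0 ⊕ var 1 ⊕ var 2)) e0 refl
    , com
    where
    P = om ω t (o t) (p t)
    R = om ω t (o t) (q t)
    sP = S₀-om c t (₂ (s t))
    sR = S₀-om c t (₃ (s t))
    PR = omom c c (To t) (₂ (s t)) (₃ (s t))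
    com : ∀ g → S₀ g → Comm g (N t ω)
    com g sg with swap? g (s t) (S₀-at t sg) (S₀-at (not t) sg)
    ... | inj₁ (e , f) = comm-∙ (comm-∙ (c₃ g sg) (om-comm c (To t) (₂ (s t)) (S₀-at t sg) e)) (om-comm c (To t) (₃ (s t)) (S₀-at t sg) f)
    ... | inj₂ (e , f) = trans (grp (g ∷ ω ∷ P ∷ R ∷ []) (κ 0 1 (c₃ g sg) ∷ []) (var 0 ⊕ (var 1 ⊕ var 2 ⊕ var 3)) (var 1 ⊕ ((var 0 ⊕ var 2 ⊕ var 0 ⁻) ⊕ (var 0 ⊕ var 3 ⊕ var 0 ⁻)) ⊕ var 0) refl)
        (trans (cong₂ (λ x y → ω ∙ (x ∙ y) ∙ g) (trans (sym (om-eqv c g (To t) (₂ (s t)))) (cong₂ (om ω t) (S₀-at t sg) e)) (trans (sym (om-eqv c g (To t) (₃ (s t)))) (cong₂ (om ω t) (S₀-at t sg) f)))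
        (grp (g ∷ ω ∷ P ∷ R ∷ []) (κ 2 3 PR ∷ []) (var 1 ⊕ (var 3 ⊕ var 2) ⊕ var 0) ((var 1 ⊕ var 2 ⊕ var 3) ⊕ var 0) refl))

  norm-at : ∀ {ω} → Central ω → ∀ {t u a b c} → T t u → St u a b c → om (N t ω) t u a ≡ om ω t u a ∙ om ω t u b ∙ om ω t u c
  norm-at {ω} c {t} tu st with st-move (To t) tu (s t) st
  ... | g , refl , refl , refl , refl = trans (om-eqv (N-central c t) g (To t) (Ao t)) (trans (cong (λ x → g ∙ x ∙ g ⁻¹) (om-base (N-central c t) t))
      (trans (grp (g ∷ ω ∷ om ω t (o t) (p t) ∷ om ω t (o t) (q t) ∷ []) [] (var 0 ⊕ (var 1 ⊕ var 2 ⊕ var 3) ⊕ var 0 ⁻) ((var 0 ⊕ var 1 ⊕ var 0 ⁻) ⊕ (var 0 ⊕ var 2 ⊕ var 0 ⁻) ⊕ (var 0 ⊕ var 3 ⊕ var 0 ⁻)) refl)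
      (cong₂ _∙_ (cong₂ _∙_ (trans (cong (λ x → g ∙ x ∙ g ⁻¹) (sym (om-base c t))) (sym (om-eqv c g (To t) (Ao t)))) (sym (om-eqv c g (To t) (₂ (s t))))) (sym (om-eqv c g (To t) (₃ (s t)))))))

  N-cen : ∀ {ω} → Central ω → ∀ t → Cen t (N t ω)
  N-cen {ω} c t = cen (N-central c t) (To t) (Ao t) (₂ (s t)) (a≢b (s t)) (trans (norm-at c (To t) (s t)) (trans
    (cong (_∙ om ω t (o t) (q t)) (omom c c (To t) (Ao t) (₂ (s t)))) (sym (norm-at c (To t) (st-213 (s t))))))

  N-of-cen : ∀ {ω} → Central ω → ∀ t → Cen t ω → N t ω ≡ ω
  N-of-cen {ω} c t ct = trans (cong₂ (λ x y → ω ∙ x ∙ y) (e (₂ (s t))) (e (₃ (s t)))) (grp (ω ∷ []) (ι 0 (proj₁ (proj₂ c)) ∷ []) (var 0 ⊕ var 0 ⊕ var 0) (var 0) refl)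
    where
    e : ∀ {x} → Adj (o t) x → om ω t (o t) x ≡ ω
    e ax = trans (ct (To t) ax (Ao t)) (om-base c t)

  central-∙ : ∀ {x y} → Central x → Central y → Central (x ∙ y)
  central-∙ {x} {y} (a , b , c) (a′ , b′ , c′) = cl sub-S₀ a a′ , grp (x ∷ y ∷ []) (ι 0 b ∷ ι 1 b′ ∷ κ 0 1 (c′ x a) ∷ []) (var 0 ⊕ var 1 ⊕ (var 0 ⊕ var 1)) e0 refl , λ g sg → comm-∙ (c g sg) (c′ g sg)

  N-∙ : ∀ {x y} → Central x → Central y → ∀ t → N t (x ∙ y) ≡ N t x ∙ N t y
  N-∙ {x} {y} c d t = trans (cong₂ (λ a b → x ∙ y ∙ a ∙ b) (om-∙ x y t _ _) (om-∙ x y t _ _))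
    (grp (x ∷ om x t (o t) (p t) ∷ om x t (o t) (q t) ∷ y ∷ om y t (o t) (p t) ∷ om y t (o t) (q t) ∷ [])
      (κ 3 1 (sym (proj₂ (proj₂ d) _ (S₀-om c t (₂ (s t))))) ∷ κ 3 2 (sym (proj₂ (proj₂ d) _ (S₀-om c t (₃ (s t))))) ∷ κ 2 4 (omom c d (To t) (₃ (s t)) (₂ (s t))) ∷ [])
      (var 0 ⊕ var 3 ⊕ (var 1 ⊕ var 4) ⊕ (var 2 ⊕ var 5)) ((var 0 ⊕ var 1 ⊕ var 2) ⊕ (var 3 ⊕ var 4 ⊕ var 5)) refl)

  norm-ε : ∀ {ω} → Central ω → ∀ {t u a b c} → N t ω ≡ ε → T t u → St u a b c → om ω t u a ∙ om ω t u b ≡ om ω t u c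
  norm-ε {ω} w {t} {u} {a} {b} {c} e tu st = trans (grp (A ∷ B ∷ C ∷ []) (ι 2 (om² w t u c) ∷ []) (var 0 ⊕ var 1) (var 0 ⊕ var 1 ⊕ var 2 ⊕ var 2) refl)
    (trans (cong (_∙ C) (trans (sym (norm-at w tu st)) (trans (cong (λ x → om x t u a) e) (grp (move t u a ∷ []) [] (var 0 ⊕ e0 ⊕ var 0 ⁻) e0 refl)))) (idˡ C))
    where
    A = om ω t u a
    B = om ω t u b
    C = om ω t u c

  -- Centrality at the vertices of type `t` makes `om` depend on the vertex alone, and the trivial
  -- norm at the other type is the product relation.
  mkN : ∀ {ω} → Central ω → ω ≢ ε → ∀ t → Cen t ω → N (not t) ω ≡ ε → NFam t
  mkN {ω} c ne t ct n = record
    { z = λ y → om ω t y (proj₁ (nb y))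
    ; eqv = λ g y ty → trans (cong (_∙ g) (trans (ct (T-act g ty) (proj₂ (nb (g ▹ y))) (actA g (proj₂ (nb y)))) (om-eqv c g ty (proj₂ (nb y)))))
                        (grp (g ∷ om ω t y (proj₁ (nb y)) ∷ []) [] (var 0 ⊕ var 1 ⊕ var 0 ⁻ ⊕ var 0) (var 0 ⊕ var 1) refl)
    ; z² = λ y ty → om² c t y _
    ; z≢ε = λ y ty → om≢ε ne t y _
    ; nat = λ {x} {a} {b} {c′} tx st → trans (cong₂ _∙_ (l tx (₁ st)) (l tx (₂ st))) (trans (norm-ε c n tx st) (sym (l tx (₃ st))))
    ; zQ = λ {y} ty → qom c ty (proj₂ (nb y))
    ; zQ₁ = λ {y} {x} ty yx → subst (Q x) (trans (sym (om-sym c ty yx)) (ct ty yx (proj₂ (nb y)))) (qom c (T-adj yx ty) (symA yx)) }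
    where
    l : ∀ {x a} → T (not t) x → Adj x a → om ω t a (proj₁ (nb a)) ≡ om ω (not t) x a
    l {x} {a} tx xa = trans (ct (T-adj′ xa tx) (proj₂ (nb a)) (symA xa)) (om-sym c (T-adj′ xa tx) (symA xa))

  mkF : ∀ {ω} → Central ω → ω ≢ ε → (∀ t → N t ω ≡ ε) → FFam
  mkF {ω} c ne n = record { r = om ω ; r-sym = om-sym c
    ; eqv = λ g {t} {u} {v} tu uv → trans (cong (_∙ g) (om-eqv c g tu uv)) (grp (g ∷ om ω t u v ∷ []) [] (var 0 ⊕ var 1 ⊕ var 0 ⁻ ⊕ var 0) (var 0 ⊕ var 1) refl)
    ; r² = λ {t} {u} {v} tu uv → om² c t u v ; r≢ε = λ {t} {u} {v} tu uv → om≢ε ne t u v ; flow = λ {t} tu st → norm-ε c (n t) tu st ; rQ = qom c }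

  -- The critical pair argument: the centralisers of type t have index 2 in the group of central involutions.
  module _ (ρ : ∀ t → ∃ λ ω → Central ω × ¬ Cen t ω) where
    Out : ℕ → Set
    Out n = ∃ λ t → ∃ λ ω → ∃ λ v → Central ω × Walk n (o t) v × ¬ Q v ω

    T-walk : ∀ {n t u v} → T t u → Walk n u v → ∃ λ t′ → T t′ v
    T-walk tu stay = _ , tu
    T-walk tu (a ▸ p) = T-walk (T-adj a tu) p

    -- At the critical distance ω moves a neighbour `a` of `v`. The element `r` of the flag (`v` ,
    -- `a`), made from an `f` that is not `Cen`, does not commute with ω; as it fixes `o t`, it must
    -- move `o (not t)`. A central element fixing `a` commutes with `r`, so it takes equal values on
    -- two flags at `o t` and is `Cen t`. Of two elements swapping `a` and `b`, the product fixes
    -- `a`.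
    critical : ∀ n → Out n → (∀ m → m < n → ¬ Out m) → ∃ λ t → ∀ x y → Central x → Central y → ¬ Cen t x → ¬ Cen t y → ¬ ¬ Cen t (x ∙ y)
    critical n (t , ω , v , c , wk , nq) mn = t , concl
      where
      near : ∀ {m s x y} → m < n → ∀ {f} → Central f → T s x → Adj x y → ∀ {w} → Walk m x w → ¬ ¬ Q w (om f s x y)
      near {m} {s} {x} {y} lt {f} cf tx xy {w} pq k = mn m lt (s , f , h ⁻¹ ▹ w , cf , subst (λ u → Walk m u (h ⁻¹ ▹ w)) (⁻¹▹ h (move₁ tx xy)) (walk-act (h ⁻¹) pq) ,
          λ q′ → k (subst (λ u → Q u (om f s x y)) (trans (sym (∙▹ _ _ _)) (trans (cong (_▹ w) (invʳ h)) (ε▹ w))) (Q-conj h q′)))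
        where h = move s x y
      base : ∀ {m f s w} → m < n → Central f → Walk m (o s) w → ¬ ¬ Q w f
      base {s = s} lt cf p k = near lt cf (To s) (Ao s) p λ q → k (subst (Q _) (om-base cf s) q)
      prev : ∃ λ p → Adj v p × (∀ f → Central f → ¬ ¬ (f ▹ v ≡ v × f ▹ p ≡ p)) × (∀ s x → T s v → Adj v x → ∀ f → Central f → ¬ ¬ (om f s v x ▹ o t ≡ o t))
      prev = go n refl wk
        where
        go : ∀ m → m ≡ n → Walk m (o t) v → _
        go zero e stay = o (not t) , Ao t , (λ f cf k → k (S₀-at t (proj₁ cf) , S₀-at (not t) (proj₁ cf))) , λ s x ts vx f cf k → k (proj₁ (om-fix cf ts vx))
        go (suc m) e w with unsnocW w
        ... | p , w′ , pv = p , symA pv , (λ f cf k → base (≤-reflexive e) cf w′ λ q → k (fixₙ q _ pv , fix q)) ,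
              λ s x ts vx f cf k → case w of λ { (a ▸ w″) → near (≤-reflexive e) cf ts vx (walk-rev w″) λ q → k (fixₙ q _ (symA a)) }
      concl : ∀ x y → Central x → Central y → ¬ Cen t x → ¬ Cen t y → ¬ ¬ Cen t (x ∙ y)
      concl x y cx cy nx ny k with prev | T-walk (To t) wk
      ... | p , vp , fx , fr | s , ts with star vp | ρ s
      ...   | a , b , st | f , cf , nf = fx ω c λ { (ωv , ωp) → fr _ _ ts (₂ st) f cf λ rt → fx x cx λ { (xv , xp) → fx y cy λ { (yv , yp) →
                main (notQ st ωv ωp nq) rt (swap? x st xv xp) (swap? y st yv yp) xv yv ωv } } }
        where
        r = om f s v a
        ncom : ω ▹ v ≡ v → ω ▹ a ≡ b → ¬ Comm ω r
        ncom ωv ωa cm = nf (cen cf ts (₂ st) (₃ st) (b≢c st) (sym (trans (cong₂ (om f s) (sym ωv) (sym ωa)) (trans (om-eqv cf ω ts (₂ st))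
          (trans (cong (_∙ ω ⁻¹) cm) (grp (r ∷ ω ∷ []) [] (var 0 ⊕ var 1 ⊕ var 1 ⁻) (var 0) refl))))))
        main : ω ▹ a ≡ b × ω ▹ b ≡ a → r ▹ o t ≡ o t → (x ▹ a ≡ a × x ▹ b ≡ b) ⊎ (x ▹ a ≡ b × x ▹ b ≡ a) → (y ▹ a ≡ a × y ▹ b ≡ b) ⊎ (y ▹ a ≡ b × y ▹ b ≡ a) → x ▹ v ≡ v → y ▹ v ≡ v → ω ▹ v ≡ v → ⊥
        main (ωa , _) rt sx sy xv yv ωv = fin sx sy
          where
          moved : r ▹ o (not t) ≢ o (not t)
          moved e = ncom ωv ωa (sym (proj₂ (proj₂ c) r (S₀-mk t rt e)))
          toCen : ∀ {w} → Central w → w ▹ v ≡ v → w ▹ a ≡ a → Cen t w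
          toCen {w} cw wv wa = cen cw (To t) (actAf r rt (Ao t)) (Ao t) moved
            (trans (cong (λ u → om w t u (r ▹ o (not t))) (sym rt)) (trans (om-eqv cw r (To t) (Ao t)) (trans (cong (λ u → r ∙ u ∙ r ⁻¹) (om-base cw t))
              (trans (cong (_∙ r ⁻¹) (sym (om-comm cf ts (₂ st) wv wa))) (trans (grp (r ∷ w ∷ []) [] (var 1 ⊕ var 0 ⊕ var 0 ⁻) (var 1) refl) (sym (om-base cw t)))))))
          fin : _ → _ → ⊥
          fin (inj₁ (xa , _)) _ = nx (toCen cx xv xa)
          fin (inj₂ _) (inj₁ (ya , _)) = ny (toCen cy yv ya)
          fin (inj₂ (xa , xb)) (inj₂ (ya , yb)) = k (toCen (central-∙ cx cy) (fix-∙ xv yv) (∙▹≡ x y ya xb))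

    index : ∃ (λ ω → Central ω × ω ≢ ε) → ¬ ¬ (∃ λ t → ∀ x y → Central x → Central y → ¬ Cen t x → ¬ Cen t y → ¬ ¬ Cen t (x ∙ y))
    index (ω , c , ne) k = ne (faithful ω λ v → decidable-stable (_ ≟ⱽ _) λ nv →
      least Out _ (true , ω , v , c , proj₂ (proj₂ (conn (o true) v)) , λ q → nv (fix q)) λ { (n , on , mn) → k (critical n on mn) })

  N-ε-∙N : ∀ {ω} → Central ω → ∀ t → N t (ω ∙ N t ω) ≡ ε
  N-ε-∙N {ω} c t = trans (N-∙ c (N-central c t) t) (trans (cong (N t ω ∙_) (N-of-cen (N-central c t) t (N-cen c t))) (proj₁ (proj₂ (N-central c t))))

  ∙N≢ε : ∀ {ω} → Central ω → ∀ t → ¬ Cen t ω → ω ∙ N t ω ≢ ε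
  ∙N≢ε {ω} c t nc e = nc (subst (Cen t) (cancelʳ (N t ω) (trans (proj₁ (proj₂ (N-central c t))) (sym e))) (N-cen c t))

  -- Multiplying a central ω by its norm at one type makes that norm trivial, and the result is
  -- nontrivial unless ω is `Cen` there. The cases ask what becomes of the norm at the other type;
  -- in the last one the index 2 property allows a correction by this second norm.
  families : ∃ (λ ω → Central ω × ω ≢ ε) → ¬ ¬ ((∃ λ t → NFam t) ⊎ FFam)
  families ex@(ω₀ , c₀ , ne₀) k = em⊥ (∃ λ t → ∀ ω → Central ω → ¬ ¬ Cen t ω) caseA λ nA →
      allρ (λ t m → nA (t , λ ω c nc → m (ω , c , nc))) λ ρ → index ρ ex (caseB ρ)
    where
    caseA : (∃ λ t → ∀ ω → Central ω → ¬ ¬ Cen t ω) → ⊥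
    caseA (t , all) = all ω₀ c₀ λ ct₀ → em⊥ (Cen (not t) ω₀) (λ cn → ne₀ (cen-both c₀ (both t ct₀ cn)))
      λ nc → let n = ω₀ ∙ N (not t) ω₀ in all n (central-∙ c₀ (N-central c₀ (not t))) λ ctn →
        k (inj₁ (t , mkN (central-∙ c₀ (N-central c₀ (not t))) (∙N≢ε c₀ (not t) nc) t ctn (N-ε-∙N c₀ (not t))))
      where
      both : ∀ t → Cen t ω₀ → Cen (not t) ω₀ → ∀ s → Cen s ω₀
      both true a b true = a
      both true a b false = b
      both false a b true = b
      both false a b false = a
    allρ : (∀ t → ¬ ¬ ∃ λ ω → Central ω × ¬ Cen t ω) → ¬ ¬ (∀ t → ∃ λ ω → Central ω × ¬ Cen t ω)
    allρ f k = f true λ a → f false λ b → k λ { true → a ; false → b }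
    caseB : (∀ t → ∃ λ ω → Central ω × ¬ Cen t ω) → (∃ λ t → ∀ x y → Central x → Central y → ¬ Cen t x → ¬ Cen t y → ¬ ¬ Cen t (x ∙ y)) → ⊥
    caseB ρ (t , ix) = em⊥ (N t′ x ≡ ε)
        (λ e → k (inj₂ (mkF cx ne (flip t Ntx e))))
        λ ne′ → em⊥ (Cen t′ x)
          (λ cs → k (inj₁ (t′ , mkN cx ne t′ cs (subst (λ b → N b x ≡ ε) (sym (not-not t)) Ntx))))
          λ nc → em⊥ (Cen t (N t′ x))
            (λ ct → ne′ (cen-both (N-central cx t′) (both t ct (N-cen cx t′))))
            λ nct → ix x (N t′ x) cx (N-central cx t′) nx nct λ ctn → k (inj₁ (t , mkN (central-∙ cx (N-central cx t′)) (∙N≢ε cx t′ nc) t ctn (N-ε-∙N cx t′)))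
      where
      t′ = not t
      w = proj₁ (ρ t)
      cw = proj₁ (proj₂ (ρ t))
      nw = proj₂ (proj₂ (ρ t))
      x = w ∙ N t w
      cx = central-∙ cw (N-central cw t)
      ne : x ≢ ε
      ne = ∙N≢ε cw t nw
      Ntx : N t x ≡ ε
      Ntx = N-ε-∙N cw t
      nx : ¬ Cen t x
      nx ct = ne (trans (sym (N-of-cen cx t ct)) Ntx)
      both : ∀ t {y} → Cen t y → Cen (not t) y → ∀ s → Cen s y
      both true a b true = a
      both true a b false = b
      both false a b true = b
      both false a b false = a
      flip : ∀ t → N t x ≡ ε → N (not t) x ≡ ε → ∀ s → N s x ≡ ε
      flip true a b true = a
      flip true a b false = b
      flip false a b true = b
      flip false a b false = a

-- Involutions attached to edges: order at most 16

module EdgeFamily (S : Setting) (D : S3Data S) (F : S3.FFam S D) where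
  open S3 S D
  open FFam F

  r-comm : ∀ {g t u v} → T t u → Adj u v → g ▹ u ≡ u → g ▹ v ≡ v → Comm g (r t u v)
  r-comm {g} {t} {u} {v} tu uv gu gv = trans (sym (eqv g tu uv)) (cong₂ (λ x y → r t x y ∙ g) gu gv)

  r-conj : ∀ g {t u v u′ v′} → T t u → Adj u v → g ▹ u ≡ u′ → g ▹ v ≡ v′ → r t u′ v′ ≡ g ∙ r t u v ∙ g ⁻¹
  r-conj g {t} {u} {v} tu uv refl refl = eq→conj (eqv g tu uv)

  r-distinct : ∀ {t u a b} → T t u → Adj u a → Adj u b → a ≢ b → r t u a ≢ r t u b
  r-distinct {t} {u} {a} {b} tu ua ub ab e with third ua ub ab
  ... | c , st = r≢ε tu (₃ st) (trans (sym (flow tu st)) (trans (cong (_∙ r t u b) e) (r² tu ub)))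

  Out : ℕ → Set
  Out m = ∃ λ t → ∃ λ u₁ → ∃ λ u₀ → ∃ λ v → T t u₁ × Adj u₁ u₀ × Walk m u₁ v × ¬ Q v (r t u₁ u₀)

  module Critical (n : ℕ) (mn : ∀ m → m < suc n → ¬ Out m) where

    near : ∀ {m t u₁ u₀ v} → m < suc n → T t u₁ → Adj u₁ u₀ → Walk m u₁ v → Q v (r t u₁ u₀)
    near lt t₁ a w = Q-stable λ nq → mn _ lt (_ , _ , _ , _ , t₁ , a , w , nq)

    record Crit (t : Bool) (u₁ u₀ u₂ v : V) : Set where
      field
        u₀′ : V
        s₁ : St u₁ u₂ u₀ u₀′
        p x x′ : V
        w′ : Walk n u₁ p
        sv : St v p x x′
        moves : r t u₁ u₀ ▹ x ≡ x′
        nc : ∀ τ → T τ v → ¬ Comm (r t u₁ u₀) (r τ v x)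
        conc : ∀ τ → T τ v → r τ v x ▹ u₁ ≡ u₁ × r τ v x ▹ u₀ ≡ u₀′ × r t u₁ u₂ ≡ r τ v p

    -- The commutator of `R`, belonging to `u₁ u₀`, and `ρ`, belonging to `v x`, is evaluated twice:
    -- the relation at `u₁` gives the involution of `u₁ u₂`, the relation at `v` that of `v p`.
    -- Hence these two coincide.
    crit : ∀ {t u₁ u₀ u₂ v} → T t u₁ → (a₀ : Adj u₁ u₀) → Adj u₁ u₂ → Walk n u₂ v → ¬ Q v (r t u₁ u₀) → Crit t u₁ u₀ u₂ v
    crit {t} {u₁} {u₀} {u₂} {v} t₁ a₀ a w nq with unsnocW (a ▸ w)
    ... | p , w′ , pv with star (symA pv) | third a a₀ u₂≢u₀
      where
      u₂≢u₀ : u₂ ≢ u₀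
      u₂≢u₀ refl = nq (subst (Q v) (sym (r-sym t₁ a₀)) (near ≤-refl (T-adj a₀ t₁) (symA a₀) w))
    ...   | x , x′ , sv | u₀′ , s₁ = record { u₀′ = u₀′ ; s₁ = s₁ ; p = p ; x = x ; x′ = x′ ; w′ = w′ ; sv = sv ; moves = Rx ; nc = λ τ → nc ; conc = λ τ → conc }
      where
      R = r t u₁ u₀
      qp : Q p R
      qp = near ≤-refl t₁ a₀ w′
      Rx : R ▹ x ≡ x′
      Rx = proj₁ (notQ sv (fixₙ qp v pv) (fix qp) nq)
      module _ {τ} (tv : T τ v) where
        ρ = r τ v x
        q₂ : Q u₂ ρ
        q₂ = near ≤-refl tv (₂ sv) (walk-rev w)
        ρ₁ : ρ ▹ u₁ ≡ u₁
        ρ₁ = fixₙ q₂ u₁ (symA a)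
        Rρ : r τ v x′ ≡ R ∙ ρ ∙ R ⁻¹
        Rρ = r-conj R tv (₂ sv) (fixₙ qp v pv) Rx
        nc : ¬ Comm R ρ
        nc e = r-distinct tv (₂ sv) (₃ sv) (b≢c sv) (sym (trans Rρ (trans (cong (_∙ R ⁻¹) e) (grp (ρ ∷ R ∷ []) [] (var 0 ⊕ var 1 ⊕ var 1 ⁻) (var 0) refl))))
        ρ₀ : ρ ▹ u₀ ≡ u₀′
        ρ₀ with swap? ρ s₁ ρ₁ (fix q₂)
        ... | inj₂ (e , _) = e
        ... | inj₁ (e , _) = ⊥-elim (nc (sym (r-comm t₁ a₀ ρ₁ e)))
        conc : ρ ▹ u₁ ≡ u₁ × ρ ▹ u₀ ≡ u₀′ × r t u₁ u₂ ≡ r τ v p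
        conc = ρ₁ , ρ₀ , trans (sym (flow t₁ (st-231 s₁))) (trans (cong (R ∙_) (r-conj ρ t₁ a₀ ρ₁ ρ₀))
          (trans (grp (R ∷ ρ ∷ []) (ι 0 (r² t₁ a₀) ∷ ι 1 (r² tv (₂ sv)) ∷ []) (var 0 ⊕ (var 1 ⊕ var 0 ⊕ var 1 ⁻)) ((var 0 ⊕ var 1 ⊕ var 0 ⁻) ⊕ var 1) refl)
          (trans (cong (_∙ ρ) (sym Rρ)) (flow tv (st-321 sv)))))

  TwoArc : Bool → Set
  TwoArc t = ∀ {b a c} → T t b → Adj b a → Adj b c → a ≢ c → ¬ Q c (r t b a)

  two-arc : ∀ {t u₁ u₀ v} → T t u₁ → Adj u₁ u₀ → Adj u₁ v → u₀ ≢ v → ¬ Q v (r t u₁ u₀) → TwoArc t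
  two-arc {t} {u₁} {u₀} {v} t₁ a₀ a ne nq tb ba bc ac q with st-move t₁ tb (proj₂ (third a₀ a ne)) (proj₂ (third ba bc ac))
  ... | g , g₁ , g₀ , refl , _ = nq (Q-conj⁻ g (subst (Q (g ▹ v)) (r-conj g t₁ a₀ g₁ g₀) q))

  module _ (A : ∀ t → TwoArc t) where
    private
      u = o true
      v = o false
      tu = To true
      tv = To false
      su = star (Ao true)
      sv = star (Ao false)
      a = proj₁ su
      b = proj₁ (proj₂ su)
      c = proj₁ sv
      d = proj₁ (proj₂ sv)
      Su : St u v a b
      Su = proj₂ (proj₂ su)
      Sv : St v u c d
      Sv = proj₂ (proj₂ sv)
      a₁ = other (symA (₂ Su))
      c₁ = other (symA (₂ Sv))
      ta = T-adj (₂ Su) tu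
      tc = T-adj (₂ Sv) tv
      Y : G → Set
      Y g = ((Q v g × Q u g) × Q a g) × Q c g
      R₁ = r false a (proj₁ a₁)
      R₂ = r true c (proj₁ c₁)
      R₃ = r false v c
      R₄ = r true u a
      Rm : ∀ {t y z w p q} → T t y → (yz : Adj y z) → Adj y w → z ≢ w → St w y p q → r t y z ▹ w ≡ w × r t y z ▹ p ≡ q × r t y z ▹ q ≡ p
      Rm ty yz yw zw sw = fixₙ (rQ ty yz) _ yw , notQ sw (fixₙ (rQ ty yz) _ yw) (fix (rQ ty yz)) (A _ ty yz yw zw)
      m₁ = Rm ta (proj₁ (proj₂ a₁)) (symA (₂ Su)) (proj₂ (proj₂ a₁)) (st-213 Su)
      m₂ = Rm tc (proj₁ (proj₂ c₁)) (symA (₂ Sv)) (proj₂ (proj₂ c₁)) (st-213 Sv)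
      m₃ = Rm tv (₂ Sv) (Ao false) (≢-sym (a≢b Sv)) Su
      m₄ = Rm tu (₂ Su) (Ao true) (≢-sym (a≢b Su)) Sv
      nrm′ : ∀ {h} → (∀ y → Y y → Comm y h) → ∀ y → Y y → Y (h ⁻¹ ∙ y ∙ h)
      nrm′ f y Yy = subst Y (sym (comm-conj (f y Yy))) Yy
      n₁ : ∀ y → Y y → Comm y R₁
      n₁ y ((_ , qa) , _) = r-comm ta (proj₁ (proj₂ a₁)) (fix qa) (fixₙ qa _ (proj₁ (proj₂ a₁)))
      n₂ : ∀ y → Y y → Comm y R₂
      n₂ y (_ , qc) = r-comm tc (proj₁ (proj₂ c₁)) (fix qc) (fixₙ qc _ (proj₁ (proj₂ c₁)))
      n₃ : ∀ y → Y y → Comm y R₃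
      n₃ y (((qv , _) , _) , qc) = r-comm tv (₂ Sv) (fix qv) (fix qc)
      n₄ : ∀ y → Y y → Comm y R₄
      n₄ y (((_ , qu) , qa) , _) = r-comm tu (₂ Su) (fix qu) (fix qa)
      nε : ∀ y → Y y → Comm y ε
      nε y _ = trans (idʳ y) (sym (idˡ y))
      triv-Y : ∀ y → Y y → y ≡ ε
      triv-Y = core record { a = u ; b = v ; ab = Ao true ; Y = Y ; Ya = λ { y (((_ , qu) , _) , _) → fix qu } ; Yb = λ { y (((qv , _) , _) , _) → fix qv } ; atA = atA ; atB = atB }
        where
        atA : ∀ b′ → Adj u b′ → ∃ λ h → h ▹ u ≡ u × h ▹ v ≡ b′ × (∀ y → Y y → Y (h ⁻¹ ∙ y ∙ h))
        atA b′ e with only Su b′ e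
        ... | inj₁ refl = ε , ε▹ u , ε▹ v , nrm′ nε
        ... | inj₂ (inj₂ refl) = R₁ , proj₁ m₁ , proj₁ (proj₂ m₁) , nrm′ n₁
        ... | inj₂ (inj₁ refl) = R₃ ∙ R₁ , fix-∙ (proj₁ m₃) (proj₁ m₁) , ∙▹≡ R₃ R₁ (proj₁ (proj₂ m₁)) (proj₂ (proj₂ m₃)) , nrm′ λ y Yy → comm-∙ (n₃ y Yy) (n₁ y Yy)
        atB : ∀ b′ → Adj v b′ → ∃ λ h → h ▹ v ≡ v × h ▹ u ≡ b′ × (∀ y → Y y → Y (h ⁻¹ ∙ y ∙ h))
        atB b′ e with only Sv b′ e
        ... | inj₁ refl = ε , ε▹ v , ε▹ u , nrm′ nε
        ... | inj₂ (inj₂ refl) = R₂ , proj₁ m₂ , proj₁ (proj₂ m₂) , nrm′ n₂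
        ... | inj₂ (inj₁ refl) = R₄ ∙ R₂ , fix-∙ (proj₁ m₄) (proj₁ m₂) , ∙▹≡ R₄ R₂ (proj₁ (proj₂ m₂)) (proj₂ (proj₂ m₄)) , nrm′ λ y Yy → comm-∙ (n₄ y Yy) (n₂ y Yy)

    -- Elements of `Y` fix the edges to which `R₁` to `R₄` belong and so commute with them. By the
    -- condition on 2-arcs these involutions are transitive on the neighbours of `u` and on those of
    -- `v`, so `Y` is trivial after four steps.
    bound16 : Bnd S₀ 16
    bound16 = bnd-Qs sub-S₀ Sv (λ _ h → proj₂ h , proj₁ h)
      (bnd-Qs (sub-Q v sub-S₀) Su (λ _ h → proj₁ h)
      (bnd-Qs (sub-Q u (sub-Q v sub-S₀)) (proj₂ (proj₂ (star (symA (₂ Su))))) (λ _ h → fixₙ (proj₂ h) a (₂ Su) , fix (proj₂ h))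
      (bnd-Qs (sub-Q a (sub-Q u (sub-Q v sub-S₀))) (proj₂ (proj₂ (star (symA (₂ Sv))))) (λ _ h → fixₙ (proj₂ (proj₁ (proj₁ h))) c (₂ Sv) , fix (proj₂ (proj₁ (proj₁ h))))
      (bnd-1 λ { g ((((_ , qv) , qu) , qa) , qc) → triv-Y g (((qv , qu) , qa) , qc) }))))

  T-walk : ∀ {n t u v} → T t u → Walk n u v → ∃ λ t′ → T t′ v
  T-walk tu stay = _ , tu
  T-walk tu (a ▸ p) = T-walk (T-adj a tu) p

  -- `R` moves `x` and is the product of the involutions of the two other edges `u₀ m` and `u₀ m′`,
  -- so one of these fixes `x` and commutes with `ρ`. It then belongs to an edge at `u₀′` as well,
  -- and an element of `Q u₁` swapping `m` and `m′` produces equal involutions on distinct edges.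
  not-far : ∀ n → (∀ m → m < suc (suc (suc n)) → ¬ Out m) → ¬ Out (suc (suc (suc n)))
  not-far n mn (t , u₁ , u₀ , v , t₁ , a₀ , (_▸_ {v = u₂} a w) , nq) = pair (star (symA a₀))
    where
    open Critical (suc (suc n)) mn
    C : Crit t u₁ u₀ u₂ v
    C = crit t₁ a₀ a w nq
    open Crit C
    τ = proj₁ (T-walk t₁ (a ▸ w))
    tv : T τ v
    tv = proj₂ (T-walk t₁ (a ▸ w))
    t₀ : T (not t) u₀
    t₀ = T-adj a₀ t₁
    R = r t u₁ u₀
    ρ = r τ v x
    ρ₁ = proj₁ (conc τ tv)
    ρ₀ : ρ ▹ u₀ ≡ u₀′
    ρ₀ = proj₁ (proj₂ (conc τ tv))
    pv : Adj p v
    pv = symA (₁ sv)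
    -- Otherwise a second critical path, shifted back by one edge, makes `R` the involution of an
    -- edge at `p` as well, and so `R` would commute with `ρ`.
    qm : ∀ m → Adj u₀ m → Q p (r (not t) u₀ m)
    qm m um = Q-stable λ nq′ → let C′ = crit t₀ um (symA a₀) w′ nq′ in
      nc τ tv (sym (subst (Comm ρ) (trans (sym (proj₂ (proj₂ (Crit.conc C′ (not τ) (T-adj (₁ sv) tv))))) (sym (r-sym t₁ a₀)))
        (r-comm (T-adj (₁ sv) tv) (₁ (Crit.sv C′)) (fix qρ) (fixₙ qρ _ (₁ (Crit.sv C′))))))
      where
      qρ : Q p ρ
      qρ = near (s≤s (s≤s z≤n)) tv (₂ sv) (₁ sv ▸ stay)
    fin : ∀ {m m′} → St u₀ u₁ m m′ → r (not t) u₀ m ▹ v ≡ v → r (not t) u₀ m ▹ x ≡ x → ⊥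
    fin {m} {m′} s₀ mv mx = go (swap? g sy (fixₙ qg u₀′ (₃ s₁)) (fix qg))
      where
      M = r (not t) u₀ m
      y = ρ ▹ m
      t₀′ : T (not t) u₀′
      t₀′ = T-adj (₃ s₁) t₁
      yA : Adj u₀′ y
      yA = subst (λ u → Adj u y) ρ₀ (actA ρ (₂ s₀))
      third′ = third (symA (₃ s₁)) yA (λ e → a≢b s₀ (▹-inj ρ (trans ρ₁ e)))
      sy = proj₂ third′
      My : r (not t) u₀′ y ≡ M
      My = trans (r-conj ρ t₀ (₂ s₀) ρ₀ refl) (trans (cong (_∙ ρ ⁻¹) (sym (r-comm tv (₂ sv) mv mx))) (grp (ρ ∷ M ∷ []) [] (var 1 ⊕ var 0 ⊕ var 0 ⁻) (var 1) refl))
      g = proj₁ (qsw t₁ s₀)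
      qg : Q u₁ g
      qg = proj₁ (proj₂ (qsw t₁ s₀))
      gm : g ▹ m ≡ m′
      gm = proj₁ (proj₂ (proj₂ (qsw t₁ s₀)))
      M′ : r (not t) u₀ m′ ≡ r (not t) u₀′ (g ▹ y)
      M′ = trans (r-conj g t₀ (₂ s₀) (fixₙ qg u₀ a₀) gm) (trans (cong (λ z → g ∙ z ∙ g ⁻¹) (sym My)) (sym (r-conj g t₀′ yA (fixₙ qg u₀′ (₃ s₁)) refl)))
      go : _ → ⊥
      go (inj₁ (e , _)) = r-distinct t₀ (₂ s₀) (₃ s₀) (b≢c s₀) (sym (trans M′ (trans (cong (r (not t) u₀′) e) My)))
      go (inj₂ (e , _)) = r-distinct t₁ a₀ (₃ s₁) (b≢c s₁) (trans (r-sym t₁ a₀) (trans (sym (flow t₀ (st-231 s₀)))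
        (trans (cong₂ _∙_ (sym My) (trans M′ (cong (r (not t) u₀′) e))) (trans (flow t₀′ (st-231 sy)) (sym (r-sym t₁ (₃ s₁)))))))
    pair : (∃ λ m → ∃ λ m′ → St u₀ u₁ m m′) → ⊥
    pair (m , m′ , s₀) = go (swap? M sv Mv (fix (qm m (₂ s₀)))) (swap? M′ sv M′v (fix (qm m′ (₃ s₀))))
      where
      M = r (not t) u₀ m
      M′ = r (not t) u₀ m′
      Mv = fixₙ (qm m (₂ s₀)) v pv
      M′v = fixₙ (qm m′ (₃ s₀)) v pv
      go : _ → _ → ⊥
      go (inj₁ (e , _)) _ = fin s₀ Mv e
      go (inj₂ _) (inj₁ (e , _)) = fin (st-132 s₀) M′v e
      go (inj₂ (_ , e)) (inj₂ (f , _)) = b≢c sv (trans (sym (∙▹≡ M M′ f e)) (trans (cong (_▹ x) (trans (flow t₀ (st-231 s₀)) (sym (r-sym t₁ a₀)))) moves))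

  edge-bound : ¬ ¬ Bnd S₀ 16
  edge-bound k = r≢ε (To true) (Ao true) (faithful _ λ v → decidable-stable (_ ≟ⱽ _) λ nv →
      least Out _ (true , o true , o false , v , To true , Ao true , proj₂ (proj₂ (conn (o true) v)) , λ q → nv (fix q)) λ { (n , on , mn) → go n on mn })
    where
    go : ∀ n → Out n → (∀ m → m < n → ¬ Out m) → ⊥
    go zero (t , u₁ , u₀ , .u₁ , t₁ , a₀ , stay , nq) mn = nq (rQ t₁ a₀)
    go (suc zero) (t , u₁ , u₀ , v , t₁ , a₀ , (a ▸ stay) , nq) mn = k (bound16 (pick t A A′))
      where
      open Critical zero mn
      C = crit t₁ a₀ a stay nq
      u₀≢v : u₀ ≢ v
      u₀≢v refl = nq (subst (Q v) (sym (r-sym t₁ a₀)) (rQ (T-adj a₀ t₁) (symA a₀)))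
      A : TwoArc t
      A = two-arc t₁ a₀ a u₀≢v nq
      tv = T-adj a t₁
      ρu₁ = proj₁ (Crit.conc C (not t) tv)
      A′ : TwoArc (not t)
      A′ = two-arc tv (₂ (Crit.sv C)) (symA a) ne λ q → b≢c (Crit.s₁ C) (trans (sym (fixₙ q u₀ a₀)) (proj₁ (proj₂ (Crit.conc C (not t) tv))))
        where
        ne : Crit.x C ≢ u₁
        ne e = b≢c (Crit.s₁ C) (trans (sym (fixₙ (subst (Q u₁) (sym (trans (r-sym tv (₂ (Crit.sv C))) (cong (λ y → r (not (not t)) y v) e))) (rQ (T-adj′ (symA a) (subst (λ b → T b v) refl tv) ⟨t⟩) a)) u₀ a₀)) (proj₁ (proj₂ (Crit.conc C (not t) tv))))
          where
          _⟨t⟩ : T t u₁ → T (not (not t)) u₁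
          x ⟨t⟩ = subst (λ b → T b u₁) (sym (not-not t)) x
      pick : ∀ t → TwoArc t → TwoArc (not t) → ∀ s → TwoArc s
      pick true a b true = a
      pick true a b false = b
      pick false a b true = b
      pick false a b false = a
    -- Here `p` is `u₂`, so two distinct edges at `u₂` would carry the same involution.
    go (suc (suc zero)) (t , u₁ , u₀ , v , t₁ , a₀ , (_▸_ {v = u₂} a (b ▸ stay)) , nq) mn =
        em⊥ (u₁ ≡ v) (λ { refl → nq (rQ t₁ a₀) }) λ ne → r-distinct (T-adj a t₁) (symA a) b ne
          (trans (sym (r-sym t₁ a)) (trans (proj₂ (proj₂ (Crit.conc C t tv))) (trans (cong (r t v) pe) (r-sym tv (symA b)))))
      where
      open Critical (suc zero) mn
      C = crit t₁ a₀ a (b ▸ stay) nq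
      tv : T t v
      tv = T² a b t₁
      pe : Crit.p C ≡ u₂
      pe = refl
    go (suc (suc (suc n))) on mn = not-far n mn on

-- Non-backtracking paths and transitivity on them

module Rays (S : Setting) (D : S3Data S) where
  open S3 S D

  -- Infinite, so that tails and longer segments exist without conditions on the length.
  record Ray : Set where
    constructor mkRay
    field
      pt  : ℕ → V
      stp : ∀ i → Adj (pt i) (pt (suc i))
      nbt : ∀ i → pt (suc (suc i)) ≢ pt i
  open Ray public

  tl : Ray → Ray
  tl (mkRay p s n) = mkRay (λ i → p (suc i)) (λ i → s (suc i)) (λ i → n (suc i))

  cons : ∀ u (p : Ray) → Adj u (pt p 0) → pt p 1 ≢ u → Ray
  cons u p a ne = mkRay f s n
    where
    f : ℕ → V
    f zero = u
    f (suc i) = pt p i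
    s : ∀ i → Adj (f i) (f (suc i))
    s zero = a
    s (suc i) = stp p i
    n : ∀ i → f (suc (suc i)) ≢ f i
    n zero = ne
    n (suc i) = nbt p i

  from-arc : ∀ {u v} → Adj u v → Σ Ray λ p → pt p 0 ≡ u × pt p 1 ≡ v
  from-arc {u} {v} a = mkRay (λ i → proj₁ (it i)) (λ i → proj₂ (proj₂ (it i))) (λ i → proj₂ (proj₂ (other (symA (proj₂ (proj₂ (it i))))))) , refl , refl
    where
    it : ℕ → ∃₂ λ u v → Adj u v
    it zero = u , v , a
    it (suc i) with it i
    ... | u , v , a = v , proj₁ (other (symA a)) , proj₁ (proj₂ (other (symA a)))

  -- The condition on `pt q 1` keeps the reversed path free for prolongation by the next vertex of
  -- `p`; the induction consumes it.
  rev : ∀ n (p : Ray) → Σ Ray λ q → (∀ i j → i + j ≡ n → pt q i ≡ pt p j) × pt q 1 ≢ pt p (suc n)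
  rev zero p with star (stp p 0)
  ... | b , c , s with from-arc (₂ s)
  ...   | q , e₀ , e₁ = q , (λ { zero zero _ → e₀ }) , λ e → a≢b s (trans (sym e) e₁)
  rev (suc n) p with rev n p
  ... | q , f , ne = r , g
    , λ e → nbt p n (trans (sym e) (f 0 n refl))
    where
    r = cons (pt p (suc n)) q (subst (Adj _) (sym (f 0 n refl)) (symA (stp p n))) ne
    g : ∀ i j → i + j ≡ suc n → pt r i ≡ pt p j
    g zero j refl = refl
    g (suc i) j refl = f i j refl

  rw : ∀ (p : Ray) n → Walk n (pt p 0) (pt p n)
  rw p zero = stay
  rw p (suc n) = rw p n ◂ stp p n

  to-ray : ∀ {n u v} → Walk n u v → (∃ λ m → m < n × Walk m u v) ⊎ (Σ Ray λ p → pt p 0 ≡ u × pt p n ≡ v)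
  to-ray {u = u} stay = inj₂ (proj₁ (from-arc (proj₂ (nb u))) , refl , refl)
  to-ray (a ▸ stay) = inj₂ (from-arc a)
  to-ray {suc (suc n)} {u} (a ▸ w@(_ ▸ _)) with to-ray w
  ... | inj₁ (m , lt , w′) = inj₁ (suc m , s≤s lt , a ▸ w′)
  ... | inj₂ (p , e₀ , eₙ) with pt p 1 ≟ⱽ u
  ...   | yes refl = inj₁ (n , n≤1+n _ , subst (Walk n u) eₙ (rw (tl p) n))
  ...   | no ne = inj₂ (cons u p (subst (Adj u) (sym e₀) a) ne , refl , eₙ)

  Swap : Bool → ℕ → Set
  Swap t l = Σ Ray λ p → T t (pt p 0) × ∃ λ s → (∀ i → i ≤ l → s ▹ pt p i ≡ pt p i) × s ▹ pt p (suc l) ≢ pt p (suc l)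

  swap-tl : ∀ {t l} → Swap t (suc (suc l)) → Swap t l
  swap-tl (p , tp , s , f , ne) = tl (tl p) , T² (stp p 0) (stp p 1) tp , s , (λ i le → f (suc (suc i)) (s≤s (s≤s le))) , ne

  -- Dropping two vertices preserves the type of the start, so two consecutive lengths yield all
  -- smaller ones.
  swaps : ∀ {t} n → Swap t (suc n) → Swap t n → ∀ l → l ≤ n → Swap t l
  swaps zero a b zero z≤n = b
  swaps (suc n) a b l le with l ≟ℕ suc n
  ... | yes refl = b
  ... | no ne = swaps n b (swap-tl a) l (≤-pred (≤∧≢⇒< le ne))

  -- Induction on the length: once all but the last vertex are matched, a transported swap corrects
  -- the last one if it is wrong.
  path-trans : ∀ {t} L → (∀ l → l ≤ L → Swap t l) → ∀ p q → T t (pt p 0) → T t (pt q 0) → ∃ λ g → ∀ i → i ≤ suc L → g ▹ pt p i ≡ pt q i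
  path-trans {t} zero _ p q tp tq = h ∙ m ⁻¹ , f
    where
    m = move t (pt p 0) (pt p 1)
    h = move t (pt q 0) (pt q 1)
    f : ∀ i → i ≤ 1 → (h ∙ m ⁻¹) ▹ pt p i ≡ pt q i
    f zero _ = ∙▹≡ h (m ⁻¹) (⁻¹▹ m (move₁ tp (stp p 0))) (move₁ tq (stp q 0))
    f (suc zero) _ = ∙▹≡ h (m ⁻¹) (⁻¹▹ m (move₂ tp (stp p 0))) (move₂ tq (stp q 0))
    f (suc (suc _)) (s≤s ())
  path-trans {t} (suc L) H p q tp tq with path-trans L (λ l le → H l (m≤n⇒m≤1+n le)) p q tp tq | H (suc L) ≤-refl
  ... | g , gp | p* , tp* , s* , s*f , s*m with path-trans L (λ l le → H l (m≤n⇒m≤1+n le)) p* q tp* tq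
  ...   | h , hp with third (symA (stp q L)) (stp q (suc L)) (≢-sym (nbt q L))
  ...     | c , st = fin (st-two st (subst (λ x → Adj x (g ▹ pt p (suc (suc L)))) (gp (suc L) ≤-refl) (actA g (stp p (suc L)))) λ e → nbt p L (▹-inj g (trans e (sym (gp L (n≤1+n L))))))
    where
    h⁻ : ∀ i → i ≤ suc L → h ⁻¹ ▹ pt q i ≡ pt p* i
    h⁻ i le = ⁻¹▹ h (hp i le)
    s = h ∙ s* ∙ h ⁻¹
    sf : ∀ i → i ≤ suc L → s ▹ pt q i ≡ pt q i
    sf i le = ∙▹≡ (h ∙ s*) (h ⁻¹) (h⁻ i le) (∙▹≡ h s* (s*f i le) (hp i le))
    nq : ¬ Q (pt q (suc L)) s
    nq qs = s*m (fixₙ (Q-conj⁻ h (subst (λ x → Q x s) (sym (hp (suc L) ≤-refl)) qs)) _ (stp p* (suc L)))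
    ext : ∀ k → (∀ i → i ≤ suc L → k ▹ pt p i ≡ pt q i) → k ▹ pt p (suc (suc L)) ≡ pt q (suc (suc L)) → ∀ i → i ≤ suc (suc L) → k ▹ pt p i ≡ pt q i
    ext k f e i le with i ≟ℕ suc (suc L)
    ... | yes refl = e
    ... | no ne = f i (≤-pred (≤∧≢⇒< le ne))
    fin : _ → _
    fin (inj₁ e) = g , ext g gp e
    fin (inj₂ e) = s ∙ g , ext (s ∙ g) (λ i le → ∙▹≡ s g (gp i le) (sf i le)) (∙▹≡ s g e (proj₂ (notQ st (sf (suc L) ≤-refl) (sf L (n≤1+n L)) nq)))

-- Involutions attached to vertices and the critical distance

module VertexFamily (S : Setting) (D : S3Data S) {t : Bool} (F : S3.NFam S D t) where
  open S3 S D public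
  open Rays S D public
  open NFam F public

  z-conj : ∀ g {y y′} → T t y → g ▹ y ≡ y′ → z y′ ≡ g ∙ z y ∙ g ⁻¹
  z-conj g ty refl = eq→conj (eqv g _ ty)

  z-comm : ∀ {g y} → T t y → g ▹ y ≡ y → Comm g (z y)
  z-comm {g} {y} ty e = trans (sym (eqv g y ty)) (cong (λ x → z x ∙ g) e)

  z-sib : ∀ {x a b} → T (not t) x → Adj x a → Adj x b → z a ≡ z b → a ≡ b
  z-sib {x} {a} {b} tx xa xb e = decidable-stable (a ≟ⱽ b) λ ne → case third xa xb ne of λ { (c , s) →
    z≢ε c (T-adj′ (₃ s) tx) (trans (sym (nat tx s)) (trans (cong (_∙ z b) e) (z² b (T-adj′ xb tx)))) }

  z-fix : ∀ {g x y} → T t y → Adj x y → g ▹ x ≡ x → Comm g (z y) → g ▹ y ≡ y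
  z-fix {g} {x} {y} ty xy gx c = z-sib (T-adj (symA xy) ty) (actAf g gx xy) xy
    (trans (z-conj g ty refl) (trans (cong (_∙ g ⁻¹) c) (grp (g ∷ z y ∷ []) [] (var 1 ⊕ var 0 ⊕ var 0 ⁻) (var 1) refl)))

  -- By transitivity on stars the inclusion at one pair of neighbours of `w` holds at all such
  -- pairs. So `g` stays in `A` at every second vertex of a walk and fixes everything.
  const-triv : ∀ {s} (A : V → G → Set) → (∀ h {x g} → T s x → A x g → A (h ▹ x) (h ∙ g ∙ h ⁻¹)) → (∀ {x g} → T s x → A x g → Q x g) →
               ∀ {w a b c} → T (not s) w → St w a b c → (∀ g → A a g → A b g) → ∀ g → A a g → g ≡ ε
  const-triv {s} A Aeq AQ {w} {a} {b} {c} tw st sub g ag = faithful g λ v → go (proj₂ (proj₂ (conn a v))) (T-adj′ (₁ st) tw) ag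
    where
    hop : ∀ {w′ x x′} → T (not s) w′ → Adj w′ x → Adj w′ x′ → A x g → A x′ g
    hop {w′} {x} {x′} tw′ wx wx′ ax with x ≟ⱽ x′
    ... | yes refl = ax
    ... | no ne with st-move tw tw′ st (proj₂ (third wx wx′ ne))
    ...   | h , _ , refl , refl , _ = subst (A (h ▹ b)) (conj-conj h g) (Aeq h (T-adj′ (₂ st) tw)
              (sub _ (subst (λ y → A y (h ⁻¹ ∙ g ∙ (h ⁻¹) ⁻¹)) (⁻¹▹ h refl) (Aeq (h ⁻¹) (T-adj′ wx tw′) ax))))
    go : ∀ {n x v} → Walk n x v → T s x → A x g → g ▹ v ≡ v
    go stay tx ax = fix (AQ tx ax)
    go (e ▸ stay) tx ax = fixₙ (AQ tx ax) _ e
    go (e ▸ (f ▸ p)) tx ax = go p (T² e f tx) (hop (T-adj e tx) (symA e) f ax)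

  -- The involutions at the neighbours of `x` form, with `ε`, a four-group `P x`. If `z y` and
  -- `z y′` agreed, `P x` and `P x′` would share two generators and coincide, and `const-triv` would
  -- kill `z b`.
  cousins : ∀ {b x x′ y y′} → T t b → Adj b x → Adj b x′ → x ≢ x′ → Adj x y → y ≢ b → Adj x′ y′ → y′ ≢ b → z y ≢ z y′
  cousins {b} {x} {x′} {y} {y′} tb bx bx′ ne xy yb xy′ y′b e =
    z≢ε b tb (const-triv P Peq PQ (subst (λ s → T s b) (sym (not-not t)) tb) (proj₂ (third bx bx′ ne)) sub (z b) (inj₂ (b , symA bx , refl)))
    where
    P : V → G → Set
    P x g = g ≡ ε ⊎ ∃ λ y → Adj x y × g ≡ z y
    Peq : ∀ h {x g} → T (not t) x → P x g → P (h ▹ x) (h ∙ g ∙ h ⁻¹)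
    Peq h tx (inj₁ refl) = inj₁ (grp (h ∷ []) [] (var 0 ⊕ e0 ⊕ var 0 ⁻) e0 refl)
    Peq h tx (inj₂ (y , xy , refl)) = inj₂ (h ▹ y , actA h xy , sym (z-conj h (T-adj′ xy tx) refl))
    PQ : ∀ {x g} → T (not t) x → P x g → Q x g
    PQ tx (inj₁ refl) = mkQ (ε▹ _) λ w _ → ε▹ w
    PQ tx (inj₂ (y , xy , refl)) = zQ₁ (T-adj′ xy tx) (symA xy)
    tx = T-adj bx tb
    tx′ = T-adj bx′ tb
    sub : ∀ g → P x g → P x′ g
    sub g (inj₁ e) = inj₁ e
    sub g (inj₂ (w , xw , refl)) with third (symA bx) xy (≢-sym yb) | third (symA bx′) xy′ (≢-sym y′b)
    ... | c , s | c′ , s′ with only s w xw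
    ...   | inj₁ refl = inj₂ (b , symA bx′ , refl)
    ...   | inj₂ (inj₁ refl) = inj₂ (y′ , xy′ , e)
    ...   | inj₂ (inj₂ refl) = inj₂ (c′ , ₃ s′ , trans (sym (nat tx s)) (trans (cong (z b ∙_) e) (nat tx′ s′)))

  z-sq : ∀ {y} → T t y → z y ∙ z y ≡ ε
  z-sq ty = z² _ ty

  -- The subgroup generated by the involutions at the ends of walks of length `d` from `x`; closure
  -- under products is enough for involutions.
  data Gen (d : ℕ) (x : V) : G → Set where
    gen-ε : Gen d x ε
    gen-∙ : ∀ {y g} → Walk d y x → T t y → Gen d x g → Gen d x (z y ∙ g)

  gen-one : ∀ {d x y} → Walk d y x → T t y → Gen d x (z y)
  gen-one w ty = subst (Gen _ _) (idʳ _) (gen-∙ w ty gen-ε)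

  gen-mul : ∀ {d x g h} → Gen d x g → Gen d x h → Gen d x (g ∙ h)
  gen-mul {h = h} gen-ε q = subst (Gen _ _) (sym (idˡ h)) q
  gen-mul {h = h} (gen-∙ {y} {g} w ty p) q = subst (Gen _ _) (sym (assoc (z y) g h)) (gen-∙ w ty (gen-mul p q))

  gen-conj : ∀ {d} h {x g} → Gen d x g → Gen d (h ▹ x) (h ∙ g ∙ h ⁻¹)
  gen-conj h gen-ε = subst (Gen _ _) (grp (h ∷ []) [] e0 (var 0 ⊕ e0 ⊕ var 0 ⁻) refl) gen-ε
  gen-conj h (gen-∙ {y} {g} w ty p) = subst (Gen _ _)
    (trans (cong (_∙ (h ∙ g ∙ h ⁻¹)) (z-conj h ty refl)) (grp (h ∷ z y ∷ g ∷ []) [] ((var 0 ⊕ var 1 ⊕ var 0 ⁻) ⊕ (var 0 ⊕ var 2 ⊕ var 0 ⁻)) (var 0 ⊕ (var 1 ⊕ var 2) ⊕ var 0 ⁻) refl))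
    (gen-∙ (walk-act h w) (T-act h ty) (gen-conj h p))

  gen-sub : ∀ {d x x′} → (∀ {y} → Walk d y x → T t y → Gen d x′ (z y)) → ∀ {g} → Gen d x g → Gen d x′ g
  gen-sub f gen-ε = gen-ε
  gen-sub f (gen-∙ w ty p) = gen-mul (f w ty) (gen-sub f p)

  gen-Q : ∀ {d x} → (∀ {y} → Walk d y x → T t y → Q x (z y)) → ∀ {g} → Gen d x g → Q x g
  gen-Q f gen-ε = mkQ (ε▹ _) λ w _ → ε▹ w
  gen-Q f (gen-∙ w ty p) = Q-∙ (f w ty) (gen-Q f p)

  Out : ℕ → Set
  Out m = ∃₂ λ y v → T t y × Walk m y v × ¬ Q v (z y)

  module Min (e : ℕ) (mn : ∀ m → m < suc (suc e) → ¬ Out m) where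
    -- The critical distance; it is at least 2 because of `zQ` and `zQ₁`, and `suc e` is `k - 1`.
    k : ℕ
    k = suc (suc e)

    nearQ : ∀ {m y v} → m < k → T t y → Walk m y v → Q v (z y)
    nearQ lt ty w = Q-stable λ nq → mn _ lt (_ , _ , ty , w , nq)

    nearF : ∀ {m y v} → m ≤ k → T t y → Walk m y v → z y ▹ v ≡ v
    nearF {zero} le ty stay = fix (zQ ty)
    nearF {suc m} le ty w with unsnocW w
    ... | p , w′ , a = fixₙ (nearQ le ty w′) _ a

    nearC : ∀ {m y y′} → m ≤ k → T t y → T t y′ → Walk m y y′ → Comm (z y) (z y′)
    nearC le ty ty′ w = z-comm ty′ (nearF le ty w)

    K : Ray → Set
    K p = T t (pt p 0) × ¬ Q (pt p k) (z (pt p 0))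

    K-ext : ∀ p q → K p → pt p 0 ≡ pt q 0 → pt p k ≡ pt q k → K q
    K-ext p q (tp , nq) e f = subst (T t) e tp , λ qq → nq (subst (λ v → Q v _) (sym f) (subst (λ y → Q _ (z y)) (sym e) qq))

    out-ray : Out k → Σ Ray K
    out-ray (y , v , ty , w , nq) with to-ray w
    ... | inj₁ (m , lt , w′) = ⊥-elim (mn m lt (y , v , ty , w′ , nq))
    ... | inj₂ (p , refl , refl) = p , ty , nq

    K-act : ∀ g p q → K p → g ▹ pt p 0 ≡ pt q 0 → g ▹ pt p k ≡ pt q k → K q
    K-act g p q (tp , nq) e f = subst (T t) e (T-act g tp) , λ qq → nq (Q-conj⁻ g (subst (λ v → Q v _) (sym f) (subst (Q _) (z-conj g tp e) qq)))

    K-swap : ∀ p → K p → Swap t k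
    K-swap p (tp , nq) = p , tp , z (pt p 0) , (λ i le → nearF le tp (rw p i)) , λ f → nq (mkQ₃ (proj₂ (third (stp p k) (symA (stp p (suc e))) (nbt p (suc e))))
      (nearF ≤-refl tp (rw p k)) f (nearF (n≤1+n _) tp (rw p (suc e))))

    -- Swaps of lengths k and k - 1 make the group transitive on paths of length `k` from vertices
    -- of type `t`, and being critical depends on the two ends only.
    K-all : Swap t k → Swap t (suc e) → ∀ p → K p → ∀ q → T t (pt q 0) → K q
    K-all a b p Kp q tq with path-trans (suc e) (swaps (suc e) a b) p q (proj₁ Kp) tq
    ... | g , f = K-act g p q Kp (f 0 z≤n) (f k ≤-refl)

    -- If z is also defined at the vertex k + 1 of a critical ray then the commutator of the two ends can be computed in two ways.
    module Ends (p : Ray) (Kp : K p) (tk : T t (pt p (suc k))) {0′ x′ : V} (s₁ : St (pt p 1) (pt p 2) (pt p 0) 0′) (sₖ : St (pt p k) (pt p (suc e)) (pt p (suc k)) x′) where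
      z₀ ρ : G
      z₀ = z (pt p 0)
      ρ = z (pt p (suc k))
      tp = proj₁ Kp
      nq = proj₂ Kp
      tk₀ : T (not t) (pt p k)
      tk₀ = T-adj (symA (stp p k)) tk
      z₀k : z₀ ▹ pt p k ≡ pt p k
      z₀k = nearF ≤-refl tp (rw p k)
      moved : z₀ ▹ pt p (suc k) ≡ x′
      moved = proj₁ (notQ sₖ z₀k (nearF (n≤1+n _) tp (rw p (suc e))) nq)
      nc : ¬ Comm z₀ ρ
      nc c = b≢c sₖ (trans (sym (z-fix tk (stp p k) z₀k c)) moved)
      ρ₁ : ρ ▹ pt p 1 ≡ pt p 1
      ρ₁ = nearF ≤-refl tk (walk-rev (rw (tl p) k))
      ρ₂ : ρ ▹ pt p 2 ≡ pt p 2
      ρ₂ = nearF (n≤1+n _) tk (walk-rev (rw (tl (tl p)) (suc e)))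
      ρ₀ : ρ ▹ pt p 0 ≡ 0′
      ρ₀ with swap? ρ s₁ ρ₁ ρ₂
      ... | inj₂ (f , _) = f
      ... | inj₁ (f , _) = ⊥-elim (nc (sym (z-comm tp f)))
      same : z (pt p 2) ≡ z (pt p (suc e))
      same = trans (sym (nat (T-adj (stp p 0) tp) (st-231 s₁))) (trans (cong (z₀ ∙_) (z-conj ρ tp ρ₀))
        (trans (grp (z₀ ∷ ρ ∷ []) (ι 0 (z-sq tp) ∷ ι 1 (z-sq tk) ∷ []) (var 0 ⊕ (var 1 ⊕ var 0 ⊕ var 1 ⁻)) ((var 0 ⊕ var 1 ⊕ var 0 ⁻) ⊕ var 1) refl)
        (trans (cong (_∙ ρ) (sym (z-conj z₀ tk moved))) (nat tk₀ (st-321 sₖ)))))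

  T-walk : ∀ {n u v s} → T s u → Walk n u v → ∃ λ s′ → T s′ v
  T-walk tu stay = _ , tu
  T-walk tu (a ▸ p) = T-walk (T-adj a tu) p

  parity : ∀ n → (∀ {u v s} → T s u → Walk n u v → T s v) ⊎ (∀ {u v s} → T s u → Walk n u v → T (not s) v)
  parity zero = inj₁ λ { tu stay → tu }
  parity (suc n) with parity n
  ... | inj₁ f = inj₂ λ { tu (a ▸ w) → f (T-adj a tu) w }
  ... | inj₂ f = inj₁ λ { tu (a ▸ w) → subst (λ s → T s _) (not-not _) (f (T-adj a tu) w) }

  -- Odd k ≥ 5: either one of the involutions at distance 2 from the start of a critical ray makes the group transitive on paths of length k,
  -- or the group generated by these involutions does not change when the start moves.
  module OddFar (j : ℕ) (mn : ∀ m → m < suc (suc (suc (suc (suc j)))) → ¬ Out m) where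
    private
      e : ℕ
      e = suc (suc (suc j))
    open Min e mn

    module _ (p : Ray) (Kp : K p) (tk : T t (pt p (suc k))) {0′ x′ : V} (s₁ : St (pt p 1) (pt p 2) (pt p 0) 0′) (sₖ : St (pt p k) (pt p (suc e)) (pt p (suc k)) x′) where
      private
        open Ends p Kp tk s₁ sₖ
        t₂ = T² (stp p 0) (stp p 1) tp
        tk₁ : T t (pt p (suc e))
        tk₁ = T-adj′ (symA (stp p (suc e))) tk₀
        -- `z w` commutes with `z (pt p 2)`, which by `same` is also the involution at
        -- `pt p (suc e)`.
        fix₁ : ∀ {w} → T t w → Walk 2 w (pt p 0) → z w ▹ pt p (suc e) ≡ pt p (suc e)
        fix₁ tw w = z-fix tk₁ (stp p e) (nearF ≤-refl tw (walk++ w (rw p e)))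
          (subst (Comm _) same (nearC (s≤s (s≤s (s≤s (s≤s z≤n)))) tw t₂ (walk++ w (stp p 0 ▸ stp p 1 ▸ stay))))
        -- If `z w` moved `pt p k`, all rays would be critical, also the one from `pt p 2`. But
        -- `z (pt p 2)` is the involution at `pt p (suc e)`, only three steps from the end of that
        -- ray.
        fix₀ : ∀ {w} → T t w → Walk 2 w (pt p 0) → z w ▹ pt p k ≡ pt p k
        fix₀ {w} tw ww = decidable-stable (_ ≟ⱽ _) λ ne → proj₂ (K-all (K-swap p Kp) (p , tp , z w , below , ne) p Kp (tl (tl p)) t₂)
            (subst (Q _) (sym same) (nearQ (s≤s (s≤s (s≤s (s≤s z≤n)))) tk₁ (stp p (suc e) ▸ stp p k ▸ stp p (suc k) ▸ stay)))
          where
          below : ∀ i → i ≤ suc e → z w ▹ pt p i ≡ pt p i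
          below i le with i ≟ℕ suc e
          ... | yes refl = fix₁ tw ww
          ... | no ni = nearF (s≤s (s≤s (≤-pred (≤∧≢⇒< le ni)))) tw (walk++ ww (rw p i))
        sub : ∀ {w} → Walk 2 w (pt p 0) → T t w → Gen 2 0′ (z w)
        sub {w} ww tw = [ (λ f → fixed (proj₁ f)) , (λ f → moved′ (proj₁ f)) ]′ (swap? (z w) sₖ (fix₀ tw ww) (fix₁ tw ww))
          where
          fixed : z w ▹ pt p (suc k) ≡ pt p (suc k) → Gen 2 0′ (z w)
          fixed f = subst (Gen 2 0′) (trans (z-conj ρ tw refl) (trans (cong (_∙ ρ ⁻¹) (sym (z-comm tk f))) (grp (z w ∷ ρ ∷ []) [] (var 0 ⊕ var 1 ⊕ var 1 ⁻) (var 0) refl)))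
                (gen-one (subst (Walk 2 _) ρ₀ (walk-act ρ ww)) (T-act ρ tw))
          moved′ : z w ▹ pt p (suc k) ≡ x′ → Gen 2 0′ (z w)
          moved′ f = subst (Gen 2 0′) eq (gen-mul (gen-one (symA (stp p 1) ▸ ₃ s₁ ▸ stay) t₂) (gen-one (subst (Walk 2 _) ρ₀ (walk-act ρ ww)) (T-act ρ tw)))
            where
            eq : z (pt p 2) ∙ z (ρ ▹ w) ≡ z w
            eq = trans (cong₂ _∙_ (trans same (trans (sym (nat tk₀ (st-321 sₖ))) (cong (_∙ ρ) (z-conj (z w) tk f)))) (z-conj ρ tw refl))
              (grp (ρ ∷ z w ∷ []) (ι 0 (z-sq tk) ∷ ι 1 (z-sq tw) ∷ []) (((var 1 ⊕ var 0 ⊕ var 1 ⁻) ⊕ var 0) ⊕ (var 0 ⊕ var 1 ⊕ var 0 ⁻)) (var 1) refl)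

      odd-ray : ⊥
      odd-ray = z≢ε (pt p 0) tp (const-triv (Gen 2) (λ h _ → gen-conj h) (λ _ → gen-Q λ w ty → nearQ (s≤s (s≤s (s≤s z≤n))) ty w)
          (T-adj (stp p 0) tp) (st-231 s₁) (λ g → gen-sub sub) z₀ (gen-one (stp p 0 ▸ symA (stp p 0) ▸ stay) tp))

    odd-far : (∀ {u v s} → T s u → Walk k u v → T (not s) v) → ¬ Out k
    odd-far odd o with out-ray o
    ... | p , Kp = odd-ray p Kp (T-adj′ (stp p k) (odd (proj₁ Kp) (rw p k))) (proj₂ (third (stp p 1) (symA (stp p 0)) (nbt p 0))) (proj₂ (third (symA (stp p (suc e))) (stp p k) (≢-sym (nbt p (suc e)))))

  -- An element fixing `u` and taking `v` to another neighbour of `u` would spread the equality to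
  -- that neighbour, against `z-sib`.
  z-adj : (∀ s v → T s v) → ∀ {u v} → Adj u v → z u ≢ z v
  z-adj T∀ {u} {v} uv e with star uv
  ... | b , c , s with st-move (T∀ t u) (T∀ t u) s (st-213 s)
  ...   | g , gu , gv , _ = a≢b s (z-sib (T∀ _ u) uv (₂ s) (trans (sym e)
    (trans (z-conj g (T∀ t u) gu) (trans (cong (λ x → g ∙ x ∙ g ⁻¹) e) (sym (z-conj g (T∀ t v) gv))))))

-- Critical distance three

module VertexThree (S : Setting) (D : S3Data S) {t : Bool} (F : S3.NFam S D t) where
  open VertexFamily S D F public

  Q-mul : ∀ {v a b c g h} → St v a b c → g ▹ v ≡ v → g ▹ a ≡ a → h ▹ v ≡ v → h ▹ a ≡ a → ¬ Q v g → ¬ Q v h → Q v (g ∙ h)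
  Q-mul {g = g} {h} s gv ga hv ha ng nh = mkQ₃ s (fix-∙ gv hv) (fix-∙ ga ha) (∙▹≡ g h (proj₁ (notQ s hv ha nh)) (proj₂ (notQ s gv ga ng)))

  -- The pointwise stabiliser of the ball of radius 2 about `b`.
  W : V → G → Set
  W b g = Q b g × (∀ x → Adj b x → Q x g)

  W-mul : ∀ {b g h} → W b g → W b h → W b (g ∙ h)
  W-mul (p , f) (q , g) = Q-∙ p q , λ x bx → Q-∙ (f x bx) (g x bx)

  W-pull : ∀ h {b g} → W (h ▹ b) g → W b (h ⁻¹ ∙ g ∙ h)
  W-pull h (q , f) = Q-pull h q , λ x bx → Q-pull h (f (h ▹ x) (actA h bx))

  W-move : ∀ {h b b′ g} → Comm g h → h ▹ b ≡ b′ → W b g → W b′ g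
  W-move {h} {b} {b′} {g} c refl w = subst (W (h ▹ b)) (comm-conj (comm-inv c)) (W-pull (h ⁻¹) (subst (λ x → W x g) (sym (⁻¹▹ h refl)) w))

  W-comm : ∀ {b x y g} → T t b → W b g → Adj b x → Adj x y → Comm g (z y)
  W-comm tb (_ , f) bx xy = z-comm (T² bx xy tb) (fixₙ (f _ bx) _ xy)

  -- The pointwise stabiliser of the ball of radius 3 about `x`.
  Y : V → G → Set
  Y x g = ∀ b → Adj x b → W b g

  Y-mul : ∀ {x g h} → Y x g → Y x h → Y x (g ∙ h)
  Y-mul p q b xb = W-mul (p b xb) (q b xb)

  Y-pull : ∀ h {x g} → Y (h ▹ x) g → Y x (h ⁻¹ ∙ g ∙ h)
  Y-pull h y b xb = W-pull h (y (h ▹ b) (actA h xb))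

  -- Three involutions whose pairwise commutators are one involution `d` commuting with all of them,
  -- as for the Pauli matrices. Their product is a square root of `d` and commutes with each factor.
  module Anticommuting {a b c d : G} (a² : a ∙ a ≡ ε) (b² : b ∙ b ≡ ε) (c² : c ∙ c ≡ ε) (d² : d ∙ d ≡ ε) (da : Comm d a) (db : Comm d b) (dc : Comm d c)
    (ba : b ∙ a ≡ d ∙ a ∙ b) (ca : c ∙ a ≡ d ∙ a ∙ c) (cb : c ∙ b ≡ d ∙ b ∙ c) where
    private
      ρ : List G
      ρ = a ∷ b ∷ c ∷ d ∷ []
      f : List (WithFacts.Fact ρ)
      f = ι 0 a² ∷ ι 1 b² ∷ ι 2 c² ∷ ι 3 d² ∷ κ 3 0 da ∷ κ 3 1 db ∷ κ 3 2 dc ∷ []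
      A : Ex
      A = var 0
      B : Ex
      B = var 1
      C : Ex
      C = var 2
      E : Ex
      E = var 3
    c-ab : c ∙ (a ∙ b) ≡ (a ∙ b) ∙ c
    c-ab = trans (sym (assoc _ _ _)) (trans (cong (_∙ b) ca) (trans (assoc _ _ _) (trans (cong (d ∙ a ∙_) cb) (grp ρ f (E ⊕ A ⊕ (E ⊕ B ⊕ C)) ((A ⊕ B) ⊕ C) refl))))
    a-bc : a ∙ (b ∙ c) ≡ (b ∙ c) ∙ a
    a-bc = sym (trans (assoc _ _ _) (trans (cong (b ∙_) ca) (trans (grp ρ f (B ⊕ (E ⊕ A ⊕ C)) (E ⊕ (B ⊕ A) ⊕ C) refl) (trans (cong (λ x → d ∙ x ∙ c) ba) (grp ρ f (E ⊕ (E ⊕ A ⊕ B) ⊕ C) (A ⊕ (B ⊕ C)) refl)))))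
    sq : (a ∙ b ∙ c) ∙ (a ∙ b ∙ c) ≡ d
    sq = trans (assoc _ _ _) (trans (cong ((a ∙ b) ∙_) (trans (sym (assoc _ _ _)) (trans (cong (_∙ c) c-ab) (assoc _ _ _)))) (trans (grp ρ f ((A ⊕ B) ⊕ ((A ⊕ B) ⊕ (C ⊕ C))) (A ⊕ (B ⊕ A) ⊕ B) refl) (trans (cong (λ x → a ∙ x ∙ b) ba) (grp ρ f (A ⊕ (E ⊕ A ⊕ B) ⊕ B) E refl))))
    comm-a : Comm (a ∙ b ∙ c) a
    comm-a = trans (trans (assoc _ _ _) (trans (assoc _ _ _) (cong (a ∙_) (trans (sym (assoc _ _ _)) (sym a-bc))))) (cong (a ∙_) (sym (assoc _ _ _)))
    comm-c : Comm (a ∙ b ∙ c) c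
    comm-c = trans (cong (_∙ c) (sym c-ab)) (assoc _ _ _)
    comm-b : Comm (a ∙ b ∙ c) b
    comm-b = trans (assoc _ _ _) (trans (cong ((a ∙ b) ∙_) cb) (trans (grp ρ f ((A ⊕ B) ⊕ (E ⊕ B ⊕ C)) (E ⊕ A ⊕ C) refl)
      (sym (trans (grp ρ f (B ⊕ (A ⊕ B ⊕ C)) ((B ⊕ A) ⊕ B ⊕ C) refl) (trans (cong (λ x → x ∙ b ∙ c) ba) (grp ρ f ((E ⊕ A ⊕ B) ⊕ B ⊕ C) (E ⊕ A ⊕ C) refl))))))

  module _ (mn : ∀ m → m < 3 → ¬ Out m) (out : Out 3) where
    open Min 1 mn
    private
      p = proj₁ (out-ray out)
      Kp = proj₂ (out-ray out)
      sw2 : Swap t 2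
      sw2 with third (symA (stp p 1)) (stp p 2) (≢-sym (nbt p 1))
      ... | c , s with qsw (T-adj (stp p 0) (proj₁ Kp)) s
      ...   | g , qg , gb , _ = p , proj₁ Kp , g , (λ { 0 _ → fixₙ qg _ (symA (stp p 0)) ; 1 _ → fix qg ; 2 _ → fixₙ qg _ (stp p 1) ; (suc (suc (suc _))) (s≤s (s≤s ())) }) , λ e → b≢c s (trans (sym e) gb)

    -- The elements of `qsw` supply swaps of length 2, so `K-all` makes every non-backtracking path
    -- of length 3 from a vertex of type `t` critical.
    crit : ∀ {a x b x′} → T t a → Adj a x → Adj x b → b ≢ a → Adj b x′ → x′ ≢ x → ¬ Q x′ (z a)
    crit {a} {x} ta ax xb ba bx′ ne = proj₂ (K-all (K-swap p Kp) sw2 p Kp (cons a (cons x (proj₁ (from-arc bx′)) xb ne) ax ba) ta)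

    mv : ∀ {a x b x′ y y′} → T t a → Adj a x → Adj x b → b ≢ a → x′ ≢ x → St x′ b y y′ → z a ▹ x′ ≡ x′ × z a ▹ y ≡ y′ × z a ▹ y′ ≡ y
    mv ta ax xb ba ne s = f₃ , notQ s f₃ (nearF (s≤s (s≤s z≤n)) ta (ax ▸ xb ▸ stay)) (crit ta ax xb ba (symA (₁ s)) ne)
      where f₃ = nearF ≤-refl ta (ax ▸ xb ▸ symA (₁ s) ▸ stay)

    -- `z a` exchanges `y` with its sibling `y′`, and the involutions at these two have product
    -- `z b`.
    anti : ∀ {a x b x′ y} → T t a → Adj a x → Adj x b → b ≢ a → Adj b x′ → x′ ≢ x → Adj x′ y → y ≢ b → z y ∙ z a ≡ z b ∙ z a ∙ z y
    anti {a} {x} {b} {x′} {y} ta ax xb ba bx′ ne x′y yb with third (symA bx′) x′y (≢-sym yb)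
    ... | y′ , s = trans (grp (z a ∷ z y ∷ []) (ι 0 (z-sq ta) ∷ ι 1 (z-sq ty) ∷ []) (var 1 ⊕ var 0) (var 0 ⊕ (var 0 ⊕ var 1 ⊕ var 0 ⁻)) refl)
            (trans (cong (z a ∙_) (trans (sym (z-conj (z a) ty (proj₁ (proj₂ (mv ta ax xb ba ne s))))) (sym (nat (T-adj bx′ tb) s)))) (grp (z a ∷ z b ∷ z y ∷ []) (κ 0 1 (nearC (s≤s (s≤s z≤n)) ta tb (ax ▸ xb ▸ stay)) ∷ []) (var 0 ⊕ (var 1 ⊕ var 2)) (var 1 ⊕ var 0 ⊕ var 2) refl))
      where
      tb = T² ax xb ta
      ty = T² bx′ x′y tb

    record Root (b : V) : Set where
      field
        c : G
        Wc : W b c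
        cc : c ∙ c ≡ z b
        com : ∀ {w} → W b w → Comm w c

    -- The product of three involutions, one behind each neighbour of `b`; by `anti` they commute
    -- pairwise up to `z b`.
    root : ∀ {b} → T t b → Root b
    root {b} tb with star (proj₂ (nb b))
    ... | x₂ , x₃ , s = record
          { c = z y₁ ∙ z y₂ ∙ z y₃
          ; Wc = qb , λ x bx → at-x x (only s x bx)
          ; cc = A.sq
          ; com = λ w → comm-∙ (comm-∙ (W-comm tb w (₁ s) (a₁)) (W-comm tb w (₂ s) (a₂))) (W-comm tb w (₃ s) (a₃)) }
      where
      outer : ∀ {x} → Adj b x → ∃₂ λ y y′ → St x b y y′
      outer bx = star (symA bx)
      y₁ = proj₁ (outer (₁ s))
      y₂ = proj₁ (outer (₂ s))
      y₃ = proj₁ (outer (₃ s))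
      s₁ = proj₂ (proj₂ (outer (₁ s)))
      s₂ = proj₂ (proj₂ (outer (₂ s)))
      s₃ = proj₂ (proj₂ (outer (₃ s)))
      a₁ = ₂ s₁
      a₂ = ₂ s₂
      a₃ = ₂ s₃
      t₁ = T² (₁ s) a₁ tb
      t₂ = T² (₂ s) a₂ tb
      t₃ = T² (₃ s) a₃ tb
      cm : ∀ {x y} → Adj b x → Adj x y → Comm (z b) (z y)
      cm bx xy = nearC (s≤s (s≤s z≤n)) tb (T² bx xy tb) (bx ▸ xy ▸ stay)
      module A = Anticommuting (z-sq t₁) (z-sq t₂) (z-sq t₃) (z-sq tb) (cm (₁ s) a₁) (cm (₂ s) a₂) (cm (₃ s) a₃)
        (anti t₁ (symA a₁) (symA (₁ s)) (a≢b s₁) (₂ s) (≢-sym (a≢b s)) a₂ (≢-sym (a≢b s₂)))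
        (anti t₁ (symA a₁) (symA (₁ s)) (a≢b s₁) (₃ s) (≢-sym (a≢c s)) a₃ (≢-sym (a≢b s₃)))
        (anti t₂ (symA a₂) (symA (₂ s)) (a≢b s₂) (₃ s) (≢-sym (b≢c s)) a₃ (≢-sym (a≢b s₃)))
      qz : ∀ {x y} → Adj b x → Adj x y → Q b (z y)
      qz bx xy = nearQ (s≤s (s≤s (s≤s z≤n))) (T² bx xy tb) (symA xy ▸ symA bx ▸ stay)
      qb : Q b (z y₁ ∙ z y₂ ∙ z y₃)
      qb = Q-∙ (Q-∙ (qz (₁ s) a₁) (qz (₂ s) a₂)) (qz (₃ s) a₃)
      one : ∀ {x y y′} → St x b y y′ → Comm (z y₁ ∙ z y₂ ∙ z y₃) (z y) → Q x (z y₁ ∙ z y₂ ∙ z y₃)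
      one {x} sx c = mkQ₃ sx fx (fix qb) (z-fix (T² (symA (₁ sx)) (₂ sx) tb) (₂ sx) fx c)
        where fx = fixₙ qb x (symA (₁ sx))
      at-x : ∀ x → _ → Q x (z y₁ ∙ z y₂ ∙ z y₃)
      at-x x (inj₁ refl) = one s₁ A.comm-a
      at-x x (inj₂ (inj₁ refl)) = one s₂ A.comm-b
      at-x x (inj₂ (inj₂ refl)) = one s₃ A.comm-c

    -- z at distance 4 on the other side of b₂ moves b, and z on the other side of b moves b₂.
    to-Y : ∀ {b x b₂ x₃ w} → T t b → Adj b x → Adj x b₂ → b₂ ≢ b → Adj b₂ x₃ → x₃ ≢ x → W b w → Q x₃ w → Y x w
    to-Y {b} {x} {b₂} {x₃} {w} tb bx xb₂ ne b₂x₃ ne₃ Wb q₃ with third (symA bx) xb₂ (≢-sym ne) | other (symA b₂x₃) | other bx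
    ... | b′ , s | y₄ , x₃y₄ , ne₄ | x₁ , bx₁ , ne₁ with other (symA bx₁)
    ...   | y₁ , x₁y₁ , ne₁′ = at-b
      where
      t₄ = T² b₂x₃ x₃y₄ (T² bx xb₂ tb)
      Wb′ : W b′ w
      Wb′ = W-move (z-comm t₄ (fixₙ q₃ y₄ x₃y₄)) (proj₁ (proj₂ (mv t₄ (symA x₃y₄) (symA b₂x₃) (≢-sym ne₄) (≢-sym ne₃) (st-213 s)))) Wb
      t₁ = T² bx₁ x₁y₁ tb
      Wb₂ : W b₂ w
      Wb₂ = W-move (W-comm tb Wb bx₁ x₁y₁) (proj₂ (proj₂ (mv t₁ (symA x₁y₁) (symA bx₁) (≢-sym ne₁′) (≢-sym ne₁) s))) Wb′
      at-b : Y x w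
      at-b c xc with only s c xc
      ... | inj₁ refl = Wb
      ... | inj₂ (inj₁ refl) = Wb₂
      ... | inj₂ (inj₂ refl) = Wb′

    z∉Y : ∀ {b x} → T t b → Adj b x → ¬ Y x (z b)
    z∉Y tb bx Yz with other (symA bx)
    ... | b₂ , xb₂ , ne with other (symA xb₂)
    ...   | x₃ , b₂x₃ , ne₃ = crit tb bx xb₂ ne b₂x₃ ne₃ (proj₂ (Yz b₂ xb₂) x₃ b₂x₃)

    W-z : ∀ {b} → T t b → W b (z b)
    W-z tb = zQ tb , λ x bx → zQ₁ tb bx

    -- On the neighbours of `x₃` an element of `Q b₂` acts trivially or as `z b` does, so one of `w`
    -- and `z b ∙ w` acts trivially and `to-Y` applies.
    half : ∀ {b x b₂ x₃ w} → T t b → Adj b x → Adj x b₂ → b₂ ≢ b → Adj b₂ x₃ → x₃ ≢ x → W b w → Q b₂ w → Y x w ⊎ Y x (z b ∙ w)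
    half {b} {x} {b₂} {x₃} {w} tb bx xb₂ ne b₂x₃ ne₃ Wb q₂ with star (symA b₂x₃)
    ... | y , y′ , s with Q? s (fixₙ q₂ x₃ b₂x₃) (fix q₂)
    ...   | yes q = inj₁ (to-Y tb bx xb₂ ne b₂x₃ ne₃ Wb q)
    ...   | no nq = inj₂ (to-Y tb bx xb₂ ne b₂x₃ ne₃ (W-mul (W-z tb) Wb) (Q-mul s (nearF ≤-refl tb (bx ▸ xb₂ ▸ b₂x₃ ▸ stay)) (nearF (s≤s (s≤s z≤n)) tb (bx ▸ xb₂ ▸ stay)) (fixₙ q₂ x₃ b₂x₃) (fix q₂)
                      (crit tb bx xb₂ ne b₂x₃ ne₃) nq))

    -- Otherwise the root or its product with `z b` lies in `Y x` by `half`. Either one has square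
    -- `z b`, against `z∉Y`.
    root∉Q : ∀ {b x b₂} (R : Root b) → T t b → Adj b x → Adj x b₂ → b₂ ≢ b → ¬ Q b₂ (Root.c R)
    root∉Q {b} {x} {b₂} R tb bx xb₂ ne q with other (symA xb₂)
    ... | x₃ , b₂x₃ , ne₃ with half tb bx xb₂ ne b₂x₃ ne₃ (Root.Wc R) q
    ...   | inj₁ y = z∉Y tb bx (subst (Y x) (Root.cc R) (Y-mul y y))
    ...   | inj₂ y = z∉Y tb bx (subst (Y x) (trans (grp (z b ∷ Root.c R ∷ []) (ι 0 (z-sq tb) ∷ κ 0 1 (Root.com R (W-z tb)) ∷ []) ((var 0 ⊕ var 1) ⊕ (var 0 ⊕ var 1)) (var 1 ⊕ var 1) refl) (Root.cc R)) (Y-mul y y))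

    -- Modulo `Y x` only the four powers of the root are left in `W b`.
    quarter : ∀ {b x w} (R : Root b) → T t b → Adj b x → W b w → (Y x w ⊎ Y x (z b ∙ w)) ⊎ (Y x (Root.c R ∙ w) ⊎ Y x (z b ∙ (Root.c R ∙ w)))
    quarter {b} {x} {w} R tb bx Wb with other (symA bx)
    ... | b₂ , xb₂ , ne with star (symA xb₂)
    ...   | x₃ , _ , s with Q? s (fixₙ (proj₂ Wb x bx) b₂ xb₂) (fix (proj₂ Wb x bx))
    ...     | yes q = inj₁ (half tb bx xb₂ ne (₂ s) (≢-sym (a≢b s)) Wb q)
    ...     | no nq = inj₂ (half tb bx xb₂ ne (₂ s) (≢-sym (a≢b s)) (W-mul (Root.Wc R) Wb)
        (Q-mul s (fixₙ qc b₂ xb₂) (fix qc) (fixₙ (proj₂ Wb x bx) b₂ xb₂) (fix (proj₂ Wb x bx)) (root∉Q R tb bx xb₂ ne) nq))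
      where
      qc = proj₂ (Root.Wc R) x bx

    -- The root at a neighbour of x moves the other neighbours of b, so such an element is in all Y x with x next to b.
    Y∩Y : ∀ {b x x′ r} → T t b → Adj b x → Adj b x′ → x ≢ x′ → Y x r → Y x′ r → r ≡ ε
    Y∩Y {b} {x} {x′} {r} tb bx bx′ ne Yx Yx′ with third bx bx′ ne | third (symA bx) (proj₁ (proj₂ (other (symA bx)))) (≢-sym (proj₂ (proj₂ (other (symA bx)))))
    ... | x″ , s | b′ , sx = core record
          { a = b ; b = x ; ab = bx ; Y = R
          ; Ya = λ y Ry → fix (proj₁ (Ry x bx b (symA bx))) ; Yb = λ y Ry → fixₙ (proj₁ (Ry x bx b (symA bx))) x bx
          ; atA = atA ; atB = atB } r Rr
      where
      R : G → Set
      R g = ∀ x → Adj b x → Y x g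
      b₂ = proj₁ (other (symA bx))
      C : Root b₂
      C = root (T² bx (₂ sx) tb)
      c = Root.c C
      qc : Q x c
      qc = proj₂ (Root.Wc C) x (symA (₂ sx))
      cx : c ▹ x′ ≡ x″
      cx = proj₁ (notQ s (fixₙ qc b (symA bx)) (fix qc) (root∉Q C (T² bx (₂ sx) tb) (symA (₂ sx)) (symA bx) (a≢b sx)))
      rc : Comm r c
      rc = Root.com C (Yx b₂ (₂ sx))
      Yx″ : Y x″ r
      Yx″ = subst (λ y → Y y r) cx (subst (Y (c ▹ x′)) (comm-conj (comm-inv rc)) (Y-pull (c ⁻¹) (subst (λ y → Y y r) (sym (⁻¹▹ c refl)) Yx′)))
      Rr : R r
      Rr y by with only s y by
      ... | inj₁ refl = Yx
      ... | inj₂ (inj₁ refl) = Yx′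
      ... | inj₂ (inj₂ refl) = Yx″
      atA : ∀ y → Adj b y → ∃ λ h → h ▹ b ≡ b × h ▹ x ≡ y × (∀ g → R g → R (h ⁻¹ ∙ g ∙ h))
      atA y by = h , hb , ∙▹≡ m (n ⁻¹) (⁻¹▹ n (move₂ tb bx)) (move₂ tb by) , λ g Rg w bw → Y-pull h (Rg (h ▹ w) (actAf h hb bw))
        where
        m = move t b y
        n = move t b x
        h = m ∙ n ⁻¹
        hb : h ▹ b ≡ b
        hb = ∙▹≡ m (n ⁻¹) (⁻¹▹ n (move₁ tb bx)) (move₁ tb by)
      cent : ∀ {h} → (∀ g → R g → Comm g h) → ∀ g → R g → R (h ⁻¹ ∙ g ∙ h)
      cent f g Rg = subst R (sym (comm-conj (f g Rg))) Rg
      o₂ = other (symA (₂ sx))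
      o₄ = other (symA (proj₁ (proj₂ o₂)))
      t₄ = T² (proj₁ (proj₂ o₂)) (proj₁ (proj₂ o₄)) (T² bx (₂ sx) tb)
      h₁ = z (proj₁ o₄)
      m₁ = mv t₄ (symA (proj₁ (proj₂ o₄))) (symA (proj₁ (proj₂ o₂))) (≢-sym (proj₂ (proj₂ o₄))) (≢-sym (proj₂ (proj₂ o₂))) (st-213 sx)
      k₁ : ∀ g → R g → Comm g h₁
      k₁ g Rg = W-comm (T² bx (₂ sx) tb) (Rg x bx b₂ (₂ sx)) (proj₁ (proj₂ o₂)) (proj₁ (proj₂ o₄))
      o₁ = other bx
      o₃ = other (symA (proj₁ (proj₂ o₁)))
      t₁ = T² (proj₁ (proj₂ o₁)) (proj₁ (proj₂ o₃)) tb
      h₂ = z (proj₁ o₃)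
      m₂ = mv t₁ (symA (proj₁ (proj₂ o₃))) (symA (proj₁ (proj₂ o₁))) (≢-sym (proj₂ (proj₂ o₃))) (≢-sym (proj₂ (proj₂ o₁))) sx
      k₂ : ∀ g → R g → Comm g h₂
      k₂ g Rg = W-comm tb (Rg x bx b (symA bx)) (proj₁ (proj₂ o₁)) (proj₁ (proj₂ o₃))
      atB : ∀ y → Adj x y → ∃ λ h → h ▹ x ≡ x × h ▹ b ≡ y × (∀ g → R g → R (h ⁻¹ ∙ g ∙ h))
      atB y xy with only sx y xy
      ... | inj₁ refl = ε , ε▹ x , ε▹ b , cent λ g _ → trans (idʳ g) (sym (idˡ g))
      ... | inj₂ (inj₂ refl) = h₁ , proj₁ m₁ , proj₁ (proj₂ m₁) , cent k₁
      ... | inj₂ (inj₁ refl) = h₂ ∙ h₁ , fix-∙ (proj₁ m₂) (proj₁ m₁) , ∙▹≡ h₂ h₁ (proj₁ (proj₂ m₁)) (proj₂ (proj₂ m₂)) , cent λ g Rg → comm-∙ (k₂ g Rg) (k₁ g Rg)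

    -- `y` is compared with the powers of the root modulo `Y x₂` and modulo `Y x₃`. Unless `y` is
    -- trivial at once, `Y∩Y` or a square forces `z b` into a `Y` next to `b`, against `z∉Y`.
    Y-trivial : ∀ {b x y} → T t b → Adj b x → Y x y → y ≡ ε
    Y-trivial {b} {x} {y} tb bx Yy with star bx
    ... | x₂ , x₃ , s = fin (cases (₂ s) (a≢b s)) (cases (₃ s) (a≢c s))
      where
      R = root tb
      c = Root.c R
      ζ = z b
      Wy : W b y
      Wy = Yy b (symA bx)
      cζ : Comm ζ c
      cζ = Root.com R (W-z tb)
      cy : Comm y c
      cy = Root.com R Wy
      ζy : Comm y ζ
      ζy = z-comm tb (fix (proj₁ Wy))
      facts = ι 1 (z-sq tb) ∷ κ 1 0 cζ ∷ κ 2 0 cy ∷ κ 2 1 ζy ∷ []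
      Alt : V → Set
      Alt x′ = y ≡ ε ⊎ (Y x′ (ζ ∙ y) × y ∙ y ≡ ε) ⊎ Y x′ (ζ ∙ (y ∙ y))
      cases : ∀ {x′} → Adj b x′ → x ≢ x′ → Alt x′
      cases {x′} bx′ ne with quarter R tb bx′ Wy
      ... | inj₁ (inj₁ p) = inj₁ (Y∩Y tb bx bx′ ne Yy p)
      ... | inj₁ (inj₂ p) = inj₂ (inj₁ (p , Y∩Y tb bx bx′ ne (Y-mul Yy Yy) (subst (Y x′) (grp (c ∷ ζ ∷ y ∷ []) facts ((var 1 ⊕ var 2) ⊕ (var 1 ⊕ var 2)) (var 2 ⊕ var 2) refl) (Y-mul p p))))
      ... | inj₂ (inj₁ p) = inj₂ (inj₂ (subst (Y x′) (trans (grp (c ∷ ζ ∷ y ∷ []) facts ((var 0 ⊕ var 2) ⊕ (var 0 ⊕ var 2)) ((var 0 ⊕ var 0) ⊕ (var 2 ⊕ var 2)) refl) (cong (_∙ (y ∙ y)) (Root.cc R))) (Y-mul p p)))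
      ... | inj₂ (inj₂ p) = inj₂ (inj₂ (subst (Y x′) (trans (grp (c ∷ ζ ∷ y ∷ []) facts ((var 1 ⊕ (var 0 ⊕ var 2)) ⊕ (var 1 ⊕ (var 0 ⊕ var 2))) ((var 0 ⊕ var 0) ⊕ (var 2 ⊕ var 2)) refl) (cong (_∙ (y ∙ y)) (Root.cc R))) (Y-mul p p)))
      ζ≡ : ∀ {g} → ζ ∙ g ≡ ε → g ≡ ζ
      ζ≡ e = cancelˡ ζ (trans e (sym (z-sq tb)))
      no-ζ : ∀ {x′} → Adj b x′ → y ∙ y ≡ ε → ¬ Y x′ (ζ ∙ (y ∙ y))
      no-ζ {x′} bx′ e p = z∉Y tb bx′ (subst (Y x′) (trans (cong (ζ ∙_) e) (idʳ ζ)) p)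
      fin : Alt x₂ → Alt x₃ → y ≡ ε
      fin (inj₁ e) _ = e
      fin _ (inj₁ e) = e
      fin (inj₂ (inj₁ (p , _))) (inj₂ (inj₁ (q , _))) = ⊥-elim (z∉Y tb bx (subst (Y x) (ζ≡ (Y∩Y tb (₂ s) (₃ s) (b≢c s) p q)) Yy))
      fin (inj₂ (inj₁ (_ , e))) (inj₂ (inj₂ q)) = ⊥-elim (no-ζ (₃ s) e q)
      fin (inj₂ (inj₂ p)) (inj₂ (inj₁ (_ , e))) = ⊥-elim (no-ζ (₂ s) e p)
      fin (inj₂ (inj₂ p)) (inj₂ (inj₂ q)) = ⊥-elim (z∉Y tb bx (subst (Y x) (ζ≡ (Y∩Y tb (₂ s) (₃ s) (b≢c s) p q)) (Y-mul Yy Yy)))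

    -- Kernels at `b`, at its three neighbours, at `b₂` and at one further neighbour of `b₂`: six
    -- steps, after which `to-Y` leads into a trivial group.
    three-bound : Bnd S₀ 64
    three-bound = flag-bnd tb (₁ s)
      (bnd-Qs s₁ s (λ _ h → h)
      (bnd-Qs s₂ (proj₂ (proj₂ (star (symA (₁ s))))) (λ _ h → fixₙ (proj₂ h) _ (₁ s) , fix (proj₂ h))
      (bnd-Qs s₃ (proj₂ (proj₂ (star (symA (₂ s))))) (λ { _ ((_ , q) , _) → fixₙ q _ (₂ s) , fix q })
      (bnd-Qs s₄ (proj₂ (proj₂ (star (symA (₃ s))))) (λ { _ (((_ , q) , _) , _) → fixₙ q _ (₃ s) , fix q })
      (bnd-Qs s₅ (st-213 st₂) (λ { _ ((((_ , q) , q₁) , _) , _) → fixₙ q₁ b₂ xb₂ , fix q₁ }) (bnd-Qs s₆ (proj₂ (proj₂ (star (symA (₁ st₂))))) (λ { _ (_ , q) → fixₙ q _ (₁ st₂) , fix q })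
      (bnd-1 λ { g ((((((_ , q) , q₁) , q₂) , q₃) , q₄) , q₅) → Y-trivial tb (₁ s) (to-Y tb (₁ s) xb₂ ne (₁ st₂) (a≢b st₂)
         (q , λ { x bx → [ (λ { refl → q₁ }) , [ (λ { refl → q₂ }) , (λ { refl → q₃ }) ]′ ]′ (only s x bx) }) q₅) })))))))
      where
      b = o t
      tb = To t
      s = proj₂ (proj₂ (star (proj₂ (nb b))))
      b₂ = proj₁ (other (symA (₁ s)))
      xb₂ = proj₁ (proj₂ (other (symA (₁ s))))
      ne = proj₂ (proj₂ (other (symA (₁ s))))
      st₂ = st-213 (proj₂ (proj₂ (star (symA xb₂))))
      s₁ = sub-flag b (proj₁ (nb b))
      s₂ = sub-Q b s₁
      s₃ = sub-Q _ s₂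
      s₄ = sub-Q _ s₃
      s₅ = sub-Q _ s₄
      s₆ = sub-Q _ s₅

-- Critical distance two

module VertexTwo (S : Setting) (D : S3Data S) {t : Bool} (F : S3.NFam S D t) where
  open VertexThree S D F public

  move-at : ∀ {s x} → T s x → ∀ {a} → Adj x a → ∀ b → Adj x b → ∃ λ h → h ▹ x ≡ x × h ▹ a ≡ b
  move-at {s} {x} tx {a} xa b xb = m ∙ n ⁻¹ , ∙▹≡ m (n ⁻¹) (⁻¹▹ n (move₁ tx xa)) (move₁ tx xb) , ∙▹≡ m (n ⁻¹) (⁻¹▹ n (move₂ tx xa)) (move₂ tx xb)
    where
    m = move s x b
    n = move s x a

  module _ (mn : ∀ m → m < 2 → ¬ Out m) (out : Out 2) where
    open Min 0 mn
    private
      p = proj₁ (out-ray out)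
      Kp = proj₂ (out-ray out)

    sib-out : ∀ {a x b} → T t a → Adj a x → Adj x b → b ≢ a → ¬ Q b (z a)
    sib-out {a} {x} {b} ta ax xb ba q with st-move (T-adj (stp p 0) (proj₁ Kp)) (T-adj ax ta) (proj₂ (third (symA (stp p 0)) (stp p 1) (≢-sym (nbt p 0)))) (proj₂ (third (symA ax) xb (≢-sym ba)))
    ... | g , _ , g₀ , refl , _ = proj₂ Kp (Q-conj⁻ g (subst (Q _) (z-conj g (proj₁ Kp) g₀) q))

    mv₂ : ∀ {a x b y y′} → T t a → Adj a x → b ≢ a → St b x y y′ → z a ▹ b ≡ b × z a ▹ y ≡ y′ × z a ▹ y′ ≡ y
    mv₂ ta ax ba s = f , notQ s f (nearF (s≤s z≤n) ta (ax ▸ stay)) (sib-out ta ax (symA (₁ s)) ba)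
      where f = nearF ≤-refl ta (ax ▸ symA (₁ s) ▸ stay)

    -- Seven kernels: at `b`, `x` and one more neighbour of `b`, and at `c`, `c′` and one more
    -- neighbour of each. The last neighbour of each of the three vertices comes for free in `mkW`,
    -- by conjugation with an involution that commutes with `g`.
    two-bound : Bnd S₀ 128
    two-bound = flag-bnd tb bx
      (bnd-Qs s₁ s (λ _ h → h)
      (bnd-Qs s₂ sx (λ _ h → fixₙ (proj₂ h) x bx , fix (proj₂ h))
      (bnd-Qs s₃ (proj₂ (proj₂ (star (symA (₂ s))))) (λ { _ ((_ , q) , _) → fixₙ q _ (₂ s) , fix q })
      (bnd-Qs s₄ sc (λ { _ (((_ , _) , q) , _) → fixₙ q c xc , fix q })
      (bnd-Qs s₅ (proj₂ (proj₂ (star (symA (₂ sc))))) (λ { _ (_ , q) → fixₙ q _ (₂ sc) , fix q })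
      (bnd-Qs s₆ sc′ (λ { _ ((((_ , q) , _) , _) , _) → fixₙ q c′ xc′ , fix q })
      (bnd-Qs s₇ (proj₂ (proj₂ (star (symA (₂ sc′))))) (λ { _ (_ , q) → fixₙ q _ (₂ sc′) , fix q })
      (bnd-1 λ { g (((((((_ , qb) , qx) , qx₂) , qc) , q₃) , qc′) , q₅) → triv-Y g (λ y xy → [ (λ { refl → mkW s tb qb qx qx₂ xc (≢-sym (a≢b sx)) }) , [ (λ { refl → mkW sc (T² bx xc tb) qc qx q₃ (₁ sx) (a≢b sx) }) , (λ { refl → mkW sc′ (T² bx xc′ tb) qc′ qx q₅ (₁ sx) (a≢c sx) }) ]′ ]′ (only sx y xy)) }))))))))
      where
      b = o t
      tb = To t
      x = o (not t)
      bx = Ao t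
      s : St b x _ _
      s = proj₂ (proj₂ (star bx))
      sx : St x b _ _
      sx = proj₂ (proj₂ (star (symA bx)))
      c = proj₁ (star (symA bx))
      c′ = proj₁ (proj₂ (star (symA bx)))
      xc = ₂ sx
      xc′ = ₃ sx
      sc = proj₂ (proj₂ (star (symA xc)))
      sc′ = proj₂ (proj₂ (star (symA xc′)))
      s₁ = sub-flag b x
      s₂ = sub-Q b s₁
      s₃ = sub-Q x s₂
      s₄ = sub-Q _ s₃
      s₅ = sub-Q _ s₄
      s₆ = sub-Q _ s₅
      s₇ = sub-Q _ s₆
      mkW : ∀ {b x y y′ a g} → St b x y y′ → T t b → Q b g → Q x g → Q y g → Adj x a → a ≢ b → W b g
      mkW {b} {x} {y} {y′} {a} {g} s tb qb qx qy xa ab = qb , λ u bu → [ (λ { refl → qx }) , [ (λ { refl → qy }) , (λ { refl → qy′ }) ]′ ]′ (only s u bu)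
        where
        ta : T t a
        ta = T² (₁ s) xa tb
        qy′ : Q y′ g
        qy′ = subst (λ u → Q u g) (proj₁ (proj₂ (mv₂ ta (symA xa) (≢-sym ab) s)))
          (subst (Q (z a ▹ y)) (comm-conj (comm-inv (z-comm ta (fixₙ qx a xa)))) (Q-pull (z a ⁻¹) (subst (λ u → Q u g) (sym (⁻¹▹ (z a) refl)) qy)))
      -- `Y x` is normal in the stabiliser of `x` and commutes with `z c` and `z d`, which are
      -- transitive on the neighbours of `b`.
      triv-Y : ∀ g → Y x g → g ≡ ε
      triv-Y = core record { a = b ; b = x ; ab = bx ; Y = Y x ; Ya = λ y Yy → fix (proj₁ (Yy b (symA bx))) ; Yb = λ y Yy → fixₙ (proj₁ (Yy b (symA bx))) x bx ; atA = atA
                           ; atB = λ y xy → let h , hx , hb = move-at (T-adj bx tb) (symA bx) y xy in h , hx , hb , λ g Yg → Y-pull h (subst (λ u → Y u g) (sym hx) Yg) }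
        where
        d = proj₁ (star (symA (₂ s)))
        x₂d = ₂ (proj₂ (proj₂ (star (symA (₂ s)))))
        d≢b = ≢-sym (a≢b (proj₂ (proj₂ (star (symA (₂ s))))))
        tc = T² bx xc tb
        td = T² (₂ s) x₂d tb
        m₁ = mv₂ tc (symA xc) (a≢b sx) s
        m₂ = mv₂ td (symA x₂d) (≢-sym d≢b) (st-213 s)
        cent : ∀ {h} → (∀ g → Y x g → Comm g h) → ∀ g → Y x g → Y x (h ⁻¹ ∙ g ∙ h)
        cent f g Yg = subst (Y x) (sym (comm-conj (f g Yg))) Yg
        k₁ : ∀ g → Y x g → Comm g (z c)
        k₁ g Yg = W-comm tb (Yg b (symA bx)) bx xc
        k₂ : ∀ g → Y x g → Comm g (z d)
        k₂ g Yg = W-comm tb (Yg b (symA bx)) (₂ s) x₂d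
        atA : ∀ y → Adj b y → ∃ λ h → h ▹ b ≡ b × h ▹ x ≡ y × (∀ g → Y x g → Y x (h ⁻¹ ∙ g ∙ h))
        atA y by with only s y by
        ... | inj₁ refl = ε , ε▹ b , ε▹ x , cent λ g _ → trans (idʳ g) (sym (idˡ g))
        ... | inj₂ (inj₂ refl) = z d , proj₁ m₂ , proj₁ (proj₂ m₂) , cent k₂
        ... | inj₂ (inj₁ refl) = z c ∙ z d , fix-∙ (proj₁ m₁) (proj₁ m₂) , ∙▹≡ (z c) (z d) (proj₁ (proj₂ m₂)) (proj₂ (proj₂ m₁)) , cent λ g Yg → comm-∙ (k₁ g Yg) (k₂ g Yg)

-- Critical distance four: commutators of involutions on two sides of a vertex

module VertexFour (S : Setting) (D : S3Data S) {t : Bool} (F : S3.NFam S D t) where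
  open VertexTwo S D F public

  -- u is reached from y in two steps through m, away from x.
  record Far (x y m u : V) : Set where
    constructor mkFar
    field
      ym : Adj y m
      m≢x : m ≢ x
      mu : Adj m u
      u≢y : u ≢ y
  open Far public

  far : ∀ x {y m} → Adj y m → m ≢ x → ∃ λ u → Far x y m u
  far x ym mx with other (symA ym)
  ... | u , mu , uy = u , mkFar ym mx mu uy

  far-act : ∀ g {x y m u} → Far x y m u → Far (g ▹ x) (g ▹ y) (g ▹ m) (g ▹ u)
  far-act g f = mkFar (actA g (ym f)) (λ e → m≢x f (▹-inj g e)) (actA g (mu f)) (λ e → u≢y f (▹-inj g e))

  far-w : ∀ {x y m u} → Far x y m u → Walk 2 u y
  far-w f = symA (mu f) ▸ symA (ym f) ▸ stay

  far-T : ∀ {x y m u} → Far x y m u → T t y → T t u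
  far-T f = T² (ym f) (mu f)

  far-st : ∀ {x y m u} → Far x y m u → ∃ λ u′ → St m y u u′
  far-st f = third (symA (ym f)) (mu f) (≢-sym (u≢y f))

  far-mid : ∀ {x y m u} → Far x y m u → Adj x y → ∃ λ m′ → St y x m m′
  far-mid f xy = third (symA xy) (ym f) (≢-sym (m≢x f))

  module Four (mn : ∀ m → m < 4 → ¬ Out m) (out : Out 4) where
    open Min 2 mn
    private
      p : Ray
      p = proj₁ (out-ray out)
      Kp : K p
      Kp = proj₂ (out-ray out)

    nc4 : ∀ {y y′ m} → m ≤ 4 → T t y → T t y′ → Walk m y y′ → Comm (z y) (z y′)
    nc4 = nearC

    sib-Q : ∀ {m b u u′ v} → T t b → St m b u u′ → Q v (z b) → Q v (z u) → Q v (z u′)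
    sib-Q tb s q₁ q₂ = subst (Q _) (nat (T-adj (symA (₁ s)) tb) s) (Q-∙ q₁ q₂)

    -- A critical path is laid over `m`, `a`, `x`. Its last vertex is adjusted by an element of
    -- `Q a` swapping the other neighbours of `x`; its first one by `sib`, since the involution at a
    -- sibling differs by `z a`, which acts trivially at `b`.
    crit₄ : ∀ {s m a x b} → T t a → Far x a m s → Adj x a → Adj x b → b ≢ a → ¬ Q b (z s)
    crit₄ {s} {m} {a} {x} {b} ta f xa xb ba q = go (st-move (T² (stp p 0) (stp p 1) tp) ta
        (proj₂ (third (symA (stp p 1)) (stp p 2) (≢-sym (nbt p 1)))) (proj₂ (third (ym f) (symA xa) (m≢x f))))
      where
      tp : T t (pt p 0)
      tp = proj₁ Kp
      tb : T t b
      tb = T² (symA xa) xb ta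
      go : (∃ λ g → g ▹ pt p 2 ≡ a × g ▹ pt p 1 ≡ m × g ▹ pt p 3 ≡ x × _) → ⊥
      go (g , g₂ , g₁ , g₃ , _) = end (st-two sx′ (subst (λ y → Adj y (g ▹ pt p 4)) g₃ (actA g (stp p 3))) λ e → nbt p 2 (▹-inj g (trans e (sym g₂))))
        where
        sx′ : St x a b _
        sx′ = proj₂ (third xa xb (≢-sym ba))
        b′ : V
        b′ = proj₁ (third xa xb (≢-sym ba))
        t₀ : T t (g ▹ pt p 0)
        t₀ = T-act g tp
        n₀ : ¬ Q (g ▹ pt p 4) (z (g ▹ pt p 0))
        n₀ qq = proj₂ Kp (Q-conj⁻ g (subst (Q _) (z-conj g tp refl) qq))
        A₀ : Adj m (g ▹ pt p 0)
        A₀ = subst (λ y → Adj y (g ▹ pt p 0)) g₁ (actA g (symA (stp p 0)))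
        ne₀ : g ▹ pt p 0 ≢ a
        ne₀ e = nbt p 0 (sym (▹-inj g (trans e (sym g₂))))
        Qa : ∀ {b} → Adj x b → Q b (z a)
        Qa xb = nearQ (s≤s (s≤s (s≤s z≤n))) ta (symA xa ▸ xb ▸ stay)
        sib : ∀ {b u u′} → Adj x b → Adj m u → u ≢ a → Adj m u′ → u′ ≢ a → Q b (z u) → Q b (z u′)
        sib {b} {u} {u′} xb mu ua mu′ u′a qq with third (symA (ym f)) mu (≢-sym ua)
        ... | c , s = [ (λ e → subst (λ y → Q b (z y)) (sym e) qq) , (λ e → subst (λ y → Q b (z y)) (sym e) (sib-Q ta s (Qa xb) qq)) ]′ (st-two s mu′ u′a)
        end : g ▹ pt p 4 ≡ b ⊎ g ▹ pt p 4 ≡ b′ → ⊥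
        end (inj₁ e) = n₀ (subst (λ y → Q y (z (g ▹ pt p 0))) (sym e) (sib xb (mu f) (u≢y f) A₀ ne₀ q))
        end (inj₂ e) = n₀ (subst (λ y → Q y (z (g ▹ pt p 0))) (sym e) (sib (₃ sx′) hs (λ e′ → u≢y f (▹-inj h (trans e′ (sym (fix qh))))) A₀ ne₀ qq))
          where
          h : G
          h = proj₁ (qsw ta sx′)
          qh : Q a h
          qh = proj₁ (proj₂ (qsw ta sx′))
          hb : h ▹ b ≡ b′
          hb = proj₁ (proj₂ (proj₂ (qsw ta sx′)))
          hs : Adj m (h ▹ s)
          hs = actAf h (fixₙ qh m (ym f)) (mu f)
          qq : Q b′ (z (h ▹ s))
          qq = subst (λ y → Q y (z (h ▹ s))) hb (subst (Q (h ▹ b)) (sym (z-conj h (far-T f ta) refl)) (Q-conj h q))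

    mv₄ : ∀ {s m a x b u u′} → T t a → Far x a m s → Adj x a → b ≢ a → St b x u u′ → z s ▹ b ≡ b × z s ▹ u ≡ u′ × z s ▹ u′ ≡ u
    mv₄ ta f xa ba s = fb , notQ s fb (nearF (s≤s (s≤s (s≤s z≤n))) ts (walk++ (far-w f) (symA xa ▸ stay))) (crit₄ ta f xa (symA (₁ s)) ba)
      where
      ts = far-T f ta
      fb = nearF ≤-refl ts (walk++ (far-w f) (symA xa ▸ symA (₁ s) ▸ stay))

    -- g is the commutator of z s and z r for all vertices s and r at distance 3 from x behind a and behind b, respectively.
    record Cm (x a b : V) (g : G) : Set where
      constructor mkCm
      field
        com : ∀ {m s n r} → Far x a m s → Far x b n r → z s ∙ z r ≡ g ∙ (z r ∙ z s)
    open Cm public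

    module _ {x a b : V} (tx : T (not t) x) (xa : Adj x a) (xb : Adj x b) (ab : a ≢ b) where
      private
        ta : T t a
        ta = T-adj′ xa tx
        tb : T t b
        tb = T-adj′ xb tx
      cm-vary : ∀ {m s n r} (f : Far x a m s) → Far x b n r → ∀ {g} → z s ∙ z r ≡ g ∙ (z r ∙ z s) → ∀ {n′ r′} → Far x b n′ r′ → z s ∙ z r′ ≡ g ∙ (z r′ ∙ z s)
      cm-vary {m} {s} {n} {r} f f₁ {g} e {n′} {r′} f₂ = [ (λ { refl → sib f₁ e f₂ }) , (λ { refl → sib f₃ eq f₂ }) ]′ (st-two sb (ym f₂) (m≢x f₂))
        where
        ts : T t s
        ts = far-T f ta
        tr : T t r
        tr = far-T f₁ tb
        csb : Comm (z s) (z b)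
        csb = nc4 ≤-refl ts tb (walk++ (far-w f) (symA xa ▸ xb ▸ stay))
        sib : ∀ {n r r′} → Far x b n r → z s ∙ z r ≡ g ∙ (z r ∙ z s) → Far x b n r′ → z s ∙ z r′ ≡ g ∙ (z r′ ∙ z s)
        sib {n} {r} {r′} f₁ e f₂ with far-st f₁
        ... | c , st = [ (λ { refl → e }) , (λ { refl → trans (cong (z s ∙_) (sym (nat tn st)))
              (trans (grp (z s ∷ z b ∷ z r ∷ []) (κ 0 1 csb ∷ []) (var 0 ⊕ (var 1 ⊕ var 2)) (var 1 ⊕ (var 0 ⊕ var 2)) refl)
              (trans (cong (z b ∙_) e) (trans (grp (z s ∷ z b ∷ z r ∷ g ∷ []) (κ 1 3 cgb ∷ []) (var 1 ⊕ (var 3 ⊕ (var 2 ⊕ var 0))) (var 3 ⊕ ((var 1 ⊕ var 2) ⊕ var 0)) refl)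
              (cong (λ y → g ∙ (y ∙ z s)) (nat tn st))))) }) ]′ (st-two st (mu f₂) (u≢y f₂))
          where
          tn : T (not t) n
          tn = T-adj (ym f₁) tb
          tr′ : T t r
          tr′ = far-T f₁ tb
          cgb : Comm (z b) g
          cgb = subst (Comm (z b)) (trans (cong (_∙ (z r ∙ z s) ⁻¹) e) (grp (g ∷ z r ∷ z s ∷ []) [] (var 0 ⊕ (var 1 ⊕ var 2) ⊕ (var 1 ⊕ var 2) ⁻) (var 0) refl))
            (comm-∙ (comm-∙ (sym csb) cbr) (comm-inv (comm-∙ cbr (sym csb))))
            where
            cbr : Comm (z b) (z r)
            cbr = nc4 (s≤s (s≤s z≤n)) tb tr′ (ym f₁ ▸ mu f₁ ▸ stay)
        sb : St b x n _
        sb = proj₂ (far-mid f₁ xb)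
        m₁ = mv₄ ta f xa (≢-sym ab) sb
        f₃ : Far x b _ (z s ▹ r)
        f₃ = mkFar (₃ sb) (≢-sym (a≢c sb)) (subst (λ y → Adj y (z s ▹ r)) (proj₁ (proj₂ m₁)) (actA (z s) (mu f₁))) (λ q → u≢y f₁ (▹-inj (z s) (trans q (sym (proj₁ m₁)))))
        zr : z (z s ▹ r) ≡ z s ∙ z r ∙ z s ⁻¹
        zr = z-conj (z s) tr refl
        g≡ : g ≡ z s ∙ z r ∙ z s ∙ z r
        g≡ = cancelʳ (z r ∙ z s) (trans (sym e) (grp (z s ∷ z r ∷ []) (ι 0 (z-sq ts) ∷ ι 1 (z-sq tr) ∷ []) (var 0 ⊕ var 1) ((var 0 ⊕ var 1 ⊕ var 0 ⊕ var 1) ⊕ (var 1 ⊕ var 0)) refl))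
        c₁ : Comm (z r) (z s ∙ z r ∙ z s ⁻¹)
        c₁ = subst (Comm (z r)) zr (nc4 ≤-refl tr (T-act (z s) tr) (walk++ (far-w f₁) (ym f₃ ▸ mu f₃ ▸ stay)))
        eq : z s ∙ z (z s ▹ r) ≡ g ∙ (z (z s ▹ r) ∙ z s)
        eq = trans (cong (z s ∙_) zr) (trans (grp (z s ∷ z r ∷ []) (ι 0 (z-sq ts) ∷ []) (var 0 ⊕ (var 0 ⊕ var 1 ⊕ var 0 ⁻)) (var 1 ⊕ var 0) refl)
          (sym (trans (cong₂ (λ y w → y ∙ (w ∙ z s)) g≡ zr) (trans (grp (z s ∷ z r ∷ []) (ι 0 (z-sq ts) ∷ []) ((var 0 ⊕ var 1 ⊕ var 0 ⊕ var 1) ⊕ ((var 0 ⊕ var 1 ⊕ var 0 ⁻) ⊕ var 0)) ((var 0 ⊕ var 1 ⊕ var 0 ⁻) ⊕ (var 1 ⊕ (var 0 ⊕ var 1 ⊕ var 0 ⁻)) ⊕ var 0) refl)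
            (trans (cong (λ y → (z s ∙ z r ∙ z s ⁻¹) ∙ y ∙ z s) c₁) (grp (z s ∷ z r ∷ []) (ι 0 (z-sq ts) ∷ ι 1 (z-sq tr) ∷ []) ((var 0 ⊕ var 1 ⊕ var 0 ⁻) ⊕ ((var 0 ⊕ var 1 ⊕ var 0 ⁻) ⊕ var 1) ⊕ var 0) (var 1 ⊕ var 0) refl))))))

    cm-unique : ∀ {x a b g h} → Adj x a → Adj x b → Cm x a b g → Cm x a b h → g ≡ h
    cm-unique {x} xa xb c d with other (symA xa) | other (symA xb)
    ... | m , am , mx | n , bn , nx with far x am mx | far x bn nx
    ...   | s , f | r , f₁ = cancelʳ _ (trans (sym (com c f f₁)) (com d f f₁))

    -- The commutator is `z s` times its conjugate under `z r`, and `z r` moves `s` behind the other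
    -- neighbour `m′` of `a`.
    cm-form : ∀ {x a b g m m′ s} → T (not t) x → Adj x b → a ≢ b → St a x m m′ → Far x a m s → Cm x a b g → ∃ λ s′ → Far x a m′ s′ × g ≡ z s ∙ z s′
    cm-form {x} {a} {b} {g} {m} {m′} {s} tx xb ab sa f c with other (symA xb)
    ... | n , bn , nx with far x bn nx
    ...   | r , f₁ = z r ▹ s , mkFar (₃ sa) (≢-sym (a≢c sa)) (subst (λ y → Adj y (z r ▹ s)) (proj₁ (proj₂ m₁)) (actA (z r) (mu f))) (λ q → u≢y f (▹-inj (z r) (trans q (sym (proj₁ m₁)))))
        , trans (cancelʳ (z r ∙ z s) (trans (sym (com c f f₁)) (grp (z s ∷ z r ∷ []) (ι 0 (z-sq ts) ∷ ι 1 (z-sq tr) ∷ []) (var 0 ⊕ var 1) ((var 0 ⊕ (var 1 ⊕ var 0 ⊕ var 1 ⁻)) ⊕ (var 1 ⊕ var 0)) refl)))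
          (cong (z s ∙_) (sym (z-conj (z r) ts refl)))
      where
      tb : T t b
      tb = T-adj′ xb tx
      tr : T t r
      tr = far-T f₁ tb
      ts : T t s
      ts = far-T f (T-adj′ (symA (₁ sa)) tx)
      m₁ = mv₄ tb f₁ xb ab sa

    cm-sym : ∀ {x a b g} → T (not t) x → Adj x a → Adj x b → a ≢ b → Cm x a b g → Cm x b a g
    cm-sym {x} {a} {b} {g} tx xa xb ab c = mkCm go
      where
      ta : T t a
      ta = T-adj′ xa tx
      go : ∀ {m s n r} → Far x b m s → Far x a n r → z s ∙ z r ≡ g ∙ (z r ∙ z s)
      go {m} {s} {n} {r} f f₁ = trans (sym (idˡ _)) (trans (cong (_∙ (z s ∙ z r)) (sym gg)) (trans (assoc g g _) (cong (g ∙_) (sym (com c f₁ f)))))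
        where
        form = cm-form tx xb ab (proj₂ (far-mid f₁ xa)) f₁ c
        r′ : V
        r′ = proj₁ form
        f₂ = proj₁ (proj₂ form)
        gg : g ∙ g ≡ ε
        gg = trans (cong₂ _∙_ (proj₂ (proj₂ form)) (proj₂ (proj₂ form))) (grp (z r ∷ z r′ ∷ []) (ι 0 (z-sq (far-T f₁ ta)) ∷ ι 1 (z-sq (far-T f₂ ta)) ∷ κ 0 1 (nc4 ≤-refl (far-T f₁ ta) (far-T f₂ ta) (walk++ (far-w f₁) (ym f₂ ▸ mu f₂ ▸ stay))) ∷ []) ((var 0 ⊕ var 1) ⊕ (var 0 ⊕ var 1)) e0 refl)

    abstract
      cm-raw : ∀ {x a b} → Adj x a → Adj x b → G
      cm-raw {x} xa xb = z s ∙ z r ∙ z s ∙ z r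
        where
        s : V
        s = proj₁ (far x (proj₁ (proj₂ (other (symA xa)))) (proj₂ (proj₂ (other (symA xa)))))
        r : V
        r = proj₁ (far x (proj₁ (proj₂ (other (symA xb)))) (proj₂ (proj₂ (other (symA xb)))))

      cm-exists : ∀ {x a b} → T (not t) x → (xa : Adj x a) (xb : Adj x b) → a ≢ b → Cm x a b (cm-raw xa xb)
      cm-exists {x} {a} {b} tx xa xb ab = mkCm all
        where
        f : Far x a (proj₁ (other (symA xa))) (proj₁ (far x (proj₁ (proj₂ (other (symA xa)))) (proj₂ (proj₂ (other (symA xa))))))
        f = proj₂ (far x (proj₁ (proj₂ (other (symA xa)))) (proj₂ (proj₂ (other (symA xa)))))
        f₁ : Far x b (proj₁ (other (symA xb))) (proj₁ (far x (proj₁ (proj₂ (other (symA xb)))) (proj₂ (proj₂ (other (symA xb))))))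
        f₁ = proj₂ (far x (proj₁ (proj₂ (other (symA xb)))) (proj₂ (proj₂ (other (symA xb)))))
        s : V
        s = proj₁ (far x (proj₁ (proj₂ (other (symA xa)))) (proj₂ (proj₂ (other (symA xa)))))
        r : V
        r = proj₁ (far x (proj₁ (proj₂ (other (symA xb)))) (proj₂ (proj₂ (other (symA xb)))))
        ta : T t a
        ta = T-adj′ xa tx
        tb : T t b
        tb = T-adj′ xb tx
        g : G
        g = z s ∙ z r ∙ z s ∙ z r
        inv : ∀ {s r} → z s ∙ z r ≡ g ∙ (z r ∙ z s) → z r ∙ z s ≡ g ⁻¹ ∙ (z s ∙ z r)
        inv {s} {r} e = sym (trans (cong (g ⁻¹ ∙_) e) (grp (g ∷ z s ∷ z r ∷ []) [] (var 0 ⁻ ⊕ (var 0 ⊕ (var 2 ⊕ var 1))) (var 2 ⊕ var 1) refl))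
        inv′ : ∀ {s r} → z r ∙ z s ≡ g ⁻¹ ∙ (z s ∙ z r) → z s ∙ z r ≡ g ∙ (z r ∙ z s)
        inv′ {s} {r} e = sym (trans (cong (g ∙_) e) (grp (g ∷ z s ∷ z r ∷ []) [] (var 0 ⊕ (var 0 ⁻ ⊕ (var 1 ⊕ var 2))) (var 1 ⊕ var 2) refl))
        all : ∀ {m s n r} → Far x a m s → Far x b n r → z s ∙ z r ≡ g ∙ (z r ∙ z s)
        all f′ f₁′ = inv′ (cm-vary tx xb xa (≢-sym ab) f₁′ f (inv
          (cm-vary tx xa xb ab f f₁ (grp (z s ∷ z r ∷ []) (ι 0 (z-sq (far-T f ta)) ∷ ι 1 (z-sq (far-T f₁ tb)) ∷ []) (var 0 ⊕ var 1) ((var 0 ⊕ var 1 ⊕ var 0 ⊕ var 1) ⊕ (var 1 ⊕ var 0)) refl) f₁′)) f′)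

    cm-act : ∀ h {x a b g} → T (not t) x → Adj x a → Adj x b → Cm x a b g → Cm (h ▹ x) (h ▹ a) (h ▹ b) (h ∙ g ∙ h ⁻¹)
    cm-act h {x} {a} {b} {g} tx xa xb c = mkCm go
      where
      ta : T t a
      ta = T-adj′ xa tx
      tb : T t b
      tb = T-adj′ xb tx
      far-back : ∀ {y m u} → Far (h ▹ x) (h ▹ y) m u → Far x y (h ⁻¹ ▹ m) (h ⁻¹ ▹ u)
      far-back {y} f = subst₂F (⁻¹▹ h refl) (⁻¹▹ h refl) (far-act (h ⁻¹) f)
        where
        subst₂F : ∀ {x x′ y y′ m u} → x ≡ x′ → y ≡ y′ → Far x y m u → Far x′ y′ m u
        subst₂F refl refl f = f
      back : ∀ {u} → T t (h ⁻¹ ▹ u) → z u ≡ h ∙ z (h ⁻¹ ▹ u) ∙ h ⁻¹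
      back {u} tu = z-conj h tu (trans (sym (∙▹ _ _ _)) (trans (cong (_▹ u) (invʳ h)) (ε▹ u)))
      go : ∀ {m s n r} → Far (h ▹ x) (h ▹ a) m s → Far (h ▹ x) (h ▹ b) n r → z s ∙ z r ≡ (h ∙ g ∙ h ⁻¹) ∙ (z r ∙ z s)
      go {m} {s} {n} {r} f f₁ = trans (cong₂ _∙_ (back ts) (back tr))
          (trans (grp (h ∷ z s₀ ∷ z r₀ ∷ []) [] ((var 0 ⊕ var 1 ⊕ var 0 ⁻) ⊕ (var 0 ⊕ var 2 ⊕ var 0 ⁻)) (var 0 ⊕ (var 1 ⊕ var 2) ⊕ var 0 ⁻) refl)
          (trans (cong (λ y → h ∙ y ∙ h ⁻¹) (com c (far-back f) (far-back f₁))) (trans (grp (h ∷ z s₀ ∷ z r₀ ∷ g ∷ []) [] (var 0 ⊕ (var 3 ⊕ (var 2 ⊕ var 1)) ⊕ var 0 ⁻) ((var 0 ⊕ var 3 ⊕ var 0 ⁻) ⊕ ((var 0 ⊕ var 2 ⊕ var 0 ⁻) ⊕ (var 0 ⊕ var 1 ⊕ var 0 ⁻))) refl)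
          (cong₂ (λ y w → (h ∙ g ∙ h ⁻¹) ∙ (y ∙ w)) (sym (back tr)) (sym (back ts))))))
        where
        s₀ : V
        s₀ = h ⁻¹ ▹ s
        r₀ : V
        r₀ = h ⁻¹ ▹ r
        ts : T t s₀
        ts = far-T (far-back f) ta
        tr : T t r₀
        tr = far-T (far-back f₁) tb

    cm≢ε : ∀ {x a b g} → T (not t) x → Adj x a → Adj x b → a ≢ b → Cm x a b g → g ≢ ε
    cm≢ε {x} {a} tx xa xb ab c e with star (symA xa)
    ... | m , m′ , sa with far x (₂ sa) (≢-sym (a≢b sa))
    ...   | s , f with cm-form tx xb ab sa f c
    ...     | s′ , f′ , g≡ = cousins (T-adj′ xa tx) (ym f) (ym f′) (b≢c sa) (mu f) (u≢y f) (mu f′) (u≢y f′)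
              (cancelʳ (z s′) (trans (trans (sym g≡) e) (sym (z-sq (far-T f′ (T-adj′ xa tx))))))

    -- By `cm-form` both commutators are `z u` times an involution behind `m′`. Only two siblings
    -- are available there, and they differ by the factor `z a`.
    cm-alt : ∀ {x a b c g} → T (not t) x → St x a b c → Cm x a b g → Cm x a c g ⊎ Cm x a c (z a ∙ g)
    cm-alt {x} {a} {b} {c} {g} tx s C with star (symA (₁ s))
    ... | m , m′ , sa with far x (₂ sa) (≢-sym (a≢b sa))
    ...   | u , f = fin (cm-form tx (₂ s) (a≢b s) sa f C) (cm-form tx (₃ s) (a≢c s) sa f C′)
      where
      C′ : Cm x a c (cm-raw (₁ s) (₃ s))
      C′ = cm-exists tx (₁ s) (₃ s) (a≢c s)
      ta : T t a
      ta = T-adj′ (₁ s) tx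
      fin : _ → _ → Cm x a c g ⊎ Cm x a c (z a ∙ g)
      fin (u₁ , f₁ , g≡) (u₂ , f₂ , h≡) with far-st f₁
      ... | u′ , su = [ (λ e → inj₁ (subst (λ y → Cm x a c y) (trans h≡ (trans (cong (λ y → z u ∙ z y) e) (sym g≡))) C′))
        , (λ e → inj₂ (subst (λ y → Cm x a c y) (trans h≡ (trans (cong (λ y → z u ∙ z y) e) (trans (cong (z u ∙_) (sym (nat (T-adj (ym f₁) ta) su)))
           (trans (grp (z u ∷ z a ∷ z u₁ ∷ []) (κ 0 1 (nc4 (s≤s (s≤s z≤n)) (far-T f ta) ta (far-w f)) ∷ []) (var 0 ⊕ (var 1 ⊕ var 2)) (var 1 ⊕ (var 0 ⊕ var 2)) refl) (cong (z a ∙_) (sym g≡)))))) C′)) ]′ (st-two su (mu f₂) (u≢y f₂))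

    perm-all : ∀ {x} (P : V → V → V → Set) → (∀ {a b c} → St x a b c → P a b c → P b a c) → (∀ {a b c} → St x a b c → P a b c → P a c b) →
               ∀ {a b c} → St x a b c → P a b c → ∀ {a′ b′ c′} → St x a′ b′ c′ → P a′ b′ c′
    perm-all {x} P p₁₂ p₂₃ s q s′ = first (only s _ (₁ s′))
      where
      rest : ∀ {a b c a′ b′ c′} → St x a b c → P a b c → St x a′ b′ c′ → a′ ≡ a → P a′ b′ c′
      rest {a} {b} {c} s q s′ refl = [ (λ { refl → subst (P a b) (sym (st-uniq s (₃ s′) (≢-sym (a≢c s′)) (≢-sym (b≢c s′)))) q })
        , (λ { refl → subst (P a c) (sym (st-uniq (st-132 s) (₃ s′) (≢-sym (a≢c s′)) (≢-sym (b≢c s′)))) (p₂₃ s q) }) ]′ (st-two s (₂ s′) (≢-sym (a≢b s′)))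
      first : _ → _
      first (inj₁ e) = rest s q s′ e
      first (inj₂ (inj₁ e)) = rest (st-213 s) (p₁₂ s q) s′ e
      first (inj₂ (inj₂ e)) = rest (st-312 s) (p₁₂ (st-132 s) (p₂₃ s q)) s′ e

    cm-fix : ∀ {x a b g m v} → T (not t) x → Adj x a → Adj x b → a ≢ b → Cm x a b g → m ≤ 2 → Walk m a v → g ▹ v ≡ v
    cm-fix {x} {a} {m = m} tx xa xb ab c le w with star (symA xa)
    ... | m₁ , m₂ , sa with far x (₂ sa) (≢-sym (a≢b sa))
    ...   | s , f with cm-form tx xb ab sa f c
    ...     | s′ , f′ , refl = fix-∙ (one f) (one f′)
      where
      one : ∀ {n u} → Far x a n u → z u ▹ _ ≡ _
      one f = nearF (s≤s (s≤s le)) (far-T f (T-adj′ xa tx)) (walk++ (far-w f) w)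

    cm-Q : ∀ {x a b g m v} → T (not t) x → Adj x a → Adj x b → a ≢ b → Cm x a b g → m ≤ 1 → Walk m a v → Q v g
    cm-Q tx xa xb ab c le w = mkQ (cm-fix tx xa xb ab c (≤-trans le (s≤s z≤n)) w) λ u vu → cm-fix tx xa xb ab c (s≤s le) (w ◂ vu)

    cm² : ∀ {x a b g} → T (not t) x → Adj x a → Adj x b → a ≢ b → Cm x a b g → g ∙ g ≡ ε
    cm² {x} {a} tx xa xb ab c with star (symA xa)
    ... | m₁ , m₂ , sa with far x (₂ sa) (≢-sym (a≢b sa))
    ...   | s , f with cm-form tx xb ab sa f c
    ...     | s′ , f′ , refl = grp (z s ∷ z s′ ∷ []) (ι 0 (z-sq (far-T f ta)) ∷ ι 1 (z-sq (far-T f′ ta)) ∷ κ 0 1 (nc4 ≤-refl (far-T f ta) (far-T f′ ta) (walk++ (far-w f) (ym f′ ▸ mu f′ ▸ stay))) ∷ []) ((var 0 ⊕ var 1) ⊕ (var 0 ⊕ var 1)) e0 refl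
      where
      ta : T t a
      ta = T-adj′ xa tx

    cm-comm : ∀ {x a b g} → T (not t) x → Adj x a → Adj x b → a ≢ b → Cm x a b g → ∀ {u} → Adj x u → Comm g (z u)
    cm-comm tx xa xb ab c xu = z-comm (T-adj′ xu tx) (cm-fix tx xa xb ab c ≤-refl (symA xa ▸ xu ▸ stay))

-- Distance four: do the commutators around a vertex agree?

module FourSplit (S : Setting) (D : S3Data S) {t : Bool} (F : S3.NFam S D t) where
  open VertexFour S D F public

  module FourCases (mn : ∀ m → m < 4 → ¬ Out m) (out : Out 4) where
    open Four mn out public
    private
      module M = Min 2 mn

    -- If the three commutators around a vertex agree, they form a family for the other type of vertices.
    module Agree (eqA : ∀ {x a b c g} → T (not t) x → St x a b c → Cm x a b g → Cm x a c g) where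
      star-at : ∀ x → ∃₂ λ b c → St x (proj₁ (nb x)) b c
      star-at x = star (proj₂ (nb x))

      abstract
        i : V → G
        i x = cm-raw (₁ (proj₂ (proj₂ (star-at x)))) (₂ (proj₂ (proj₂ (star-at x))))

        iA : ∀ {x} → T (not t) x → ∀ {a b} → Adj x a → Adj x b → a ≢ b → Cm x a b (i x)
        iA {x} tx xa xb ab = perm-all (λ a b _ → Cm x a b (i x)) (λ s → cm-sym tx (₁ s) (₂ s) (a≢b s)) (λ s → eqA tx s) (proj₂ (proj₂ (star-at x)))
          (cm-exists tx _ _ (a≢b (proj₂ (proj₂ (star-at x))))) (proj₂ (third xa xb ab))

      i-with : ∀ {x} → T (not t) x → ∀ {a} → Adj x a → ∃ λ b → Adj x b × a ≢ b × Cm x a b (i x)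
      i-with tx xa with other xa
      ... | b , xb , ba = b , xb , ≢-sym ba , iA tx xa xb (≢-sym ba)

      i-fix : ∀ {x a m v} → T (not t) x → Adj x a → m ≤ 2 → Walk m a v → i x ▹ v ≡ v
      i-fix tx xa with i-with tx xa
      ... | b , xb , ab , c = cm-fix tx xa xb ab c

      i-Q : ∀ {x a m v} → T (not t) x → Adj x a → m ≤ 1 → Walk m a v → Q v (i x)
      i-Q tx xa with i-with tx xa
      ... | b , xb , ab , c = cm-Q tx xa xb ab c

      i-eqv : ∀ g x → T (not t) x → i (g ▹ x) ∙ g ≡ g ∙ i x
      i-eqv g x tx with i-with tx (proj₂ (nb x))
      ... | b , xb , ab , c = trans (cong (_∙ g) (cm-unique (actA g xa) (actA g xb) (iA (T-act g tx) (actA g xa) (actA g xb) (λ e → ab (▹-inj g e))) (cm-act g tx xa xb c)))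
          (grp (g ∷ i x ∷ []) [] ((var 0 ⊕ var 1 ⊕ var 0 ⁻) ⊕ var 0) (var 0 ⊕ var 1) refl)
        where
        xa = proj₂ (nb x)

      i² : ∀ x → T (not t) x → i x ∙ i x ≡ ε
      i² x tx with i-with tx (proj₂ (nb x))
      ... | b , xb , ab , c = cm² tx (proj₂ (nb x)) xb ab c

      i≢ε : ∀ x → T (not t) x → i x ≢ ε
      i≢ε x tx with i-with tx (proj₂ (nb x))
      ... | b , xb , ab , c = cm≢ε tx (proj₂ (nb x)) xb ab c

      i-comm : ∀ {x a} → T (not t) x → Adj x a → Comm (i x) (z a)
      i-comm tx xa = z-comm (T-adj′ xa tx) (i-fix tx xa z≤n stay)

      module _ {b x₁ x₂ x₃ : V} (tb : T t b) (s : St b x₁ x₂ x₃) where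
        private
          o₁ = far x₂ (₁ s) (a≢b s)
          u : V
          u = proj₁ o₁
          fu : Far x₂ b x₁ u
          fu = proj₂ o₁
          su = proj₂ (proj₂ (star (symA (mu fu))))
          m : V
          m = proj₁ (star (symA (mu fu)))
          m′ : V
          m′ = proj₁ (proj₂ (star (symA (mu fu))))
          t₁ : T (not t) x₁
          t₁ = T-adj (₁ s) tb
          t₂ : T (not t) x₂
          t₂ = T-adj (₂ s) tb
          tu : T t u
          tu = far-T fu tb
          tm : T (not t) m
          tm = T-adj (₂ su) tu
          w₁ = i-with tm (symA (₂ su))
          w₂ = i-with t₂ (symA (₂ s))
          f₁ = cm-form tm (proj₁ (proj₂ w₁)) (proj₁ (proj₂ (proj₂ w₁))) (st-213 su) (mkFar (₁ su) (a≢b su) (symA (₁ s)) (≢-sym (u≢y fu))) (proj₂ (proj₂ (proj₂ w₁)))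
          f₂ = cm-form t₂ (proj₁ (proj₂ w₂)) (proj₁ (proj₂ (proj₂ w₂))) (st-213 s) fu (proj₂ (proj₂ (proj₂ w₂)))
          p r : V
          p = proj₁ f₁
          r = proj₁ f₂
          fp : Far m u m′ p
          fp = proj₁ (proj₂ f₁)
          fr : Far x₂ b x₃ r
          fr = proj₁ (proj₂ f₂)
          tp : T t p
          tp = far-T fp tu
          tr : T t r
          tr = far-T fr tb
          im : i m ≡ z b ∙ z p
          im = proj₂ (proj₂ f₁)
          i₂ : i x₂ ≡ z u ∙ z r
          i₂ = proj₂ (proj₂ f₂)
          pr : z p ∙ z r ≡ i x₁ ∙ (z r ∙ z p)
          pr = com (iA t₁ (mu fu) (symA (₁ s)) (u≢y fu)) (mkFar (₃ su) (≢-sym (a≢c su)) (mu fp) (u≢y fp)) (mkFar (₃ s) (≢-sym (a≢c s)) (mu fr) (u≢y fr))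
          -- Written as `z b ∙ z p` and `z u ∙ z r`, the elements `i m` and `i x₂` have the
          -- commutator of `z p` and `z r`, which lie behind two neighbours of `x₁`. Since `i m`
          -- exchanges `x₂` and `x₃`, this is the product relation around `b`.
          key : i m ∙ i x₂ ≡ i x₁ ∙ (i x₂ ∙ i m)
          key = trans (cong₂ _∙_ im i₂) (trans (grp (z b ∷ z p ∷ z u ∷ z r ∷ []) (κ 1 2 (nearC (s≤s (s≤s z≤n)) tp tu (far-w fp)) ∷ []) ((var 0 ⊕ var 1) ⊕ (var 2 ⊕ var 3)) (var 0 ⊕ var 2 ⊕ (var 1 ⊕ var 3)) refl)
            (trans (cong (λ y → (z b ∙ z u) ∙ y) pr) (trans (grp (z b ∷ z p ∷ z u ∷ z r ∷ i x₁ ∷ [])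
               (κ 0 4 (sym (i-comm t₁ (symA (₁ s)))) ∷ κ 2 4 (sym (i-comm t₁ (mu fu))) ∷ κ 0 2 (nearC (s≤s (s≤s z≤n)) tb tu (₁ s ▸ mu fu ▸ stay)) ∷ κ 0 3 (nearC (s≤s (s≤s z≤n)) tb tr (₃ s ▸ mu fr ▸ stay)) ∷ [])
               ((var 0 ⊕ var 2) ⊕ (var 4 ⊕ (var 3 ⊕ var 1))) (var 4 ⊕ ((var 2 ⊕ var 3) ⊕ (var 0 ⊕ var 1))) refl) (cong₂ (λ y w → i x₁ ∙ (y ∙ w)) (sym i₂) (sym im)))))
            where
            open M
          imb : i m ▹ b ≡ b
          imb = i-fix tm (symA (₂ su)) (s≤s (s≤s z≤n)) (symA (mu fu) ▸ symA (₁ s) ▸ stay)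
          im₁ : i m ▹ x₁ ≡ x₁
          im₁ = i-fix tm (symA (₂ su)) (s≤s z≤n) (symA (mu fu) ▸ stay)
          nc : ¬ (i m ▹ x₂ ≡ x₂)
          nc e = i≢ε x₁ t₁ (cancelʳ (i x₂ ∙ i m) (trans (sym key) (trans (trans (sym (i-eqv (i m) x₂ t₂)) (cong (λ y → i y ∙ i m) e)) (sym (idˡ _)))))

        i-out : ∃ λ y → T (not t) y × Walk 3 y b × ¬ Q b (i y)
        i-out = m , tm , (symA (₂ su) ▸ symA (mu fu) ▸ symA (₁ s) ▸ stay) , λ q → nc (fixₙ q x₂ (₂ s))

        i-nat : i x₁ ∙ i x₂ ≡ i x₃
        i-nat = [ (λ e → ⊥-elim (nc (proj₁ e))) , (λ e → cancelʳ (i m) (trans (assoc _ _ _) (trans (sym key) (sym (trans (cong (λ y → i y ∙ i m) (sym (proj₁ e))) (i-eqv (i m) x₂ t₂)))))) ]′ (swap? (i m) s imb im₁)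

      F′ : NFam (not t)
      F′ = record
        { z = i ; eqv = i-eqv ; z² = i² ; z≢ε = i≢ε
        ; nat = λ {b} tb s → i-nat (subst (λ q → T q b) (not-not t) tb) s
        ; zQ = λ {x} tx → i-Q tx (proj₂ (nb x)) ≤-refl (symA (proj₂ (nb x)) ▸ stay)
        ; zQ₁ = λ tx xa → i-Q tx xa z≤n stay }

      -- The new family has critical distance exactly 3: `i-out` exhibits that distance, and smaller
      -- ones are excluded by `i-Q`.
      agree-bound : Bnd S₀ 64
      agree-bound = VertexThree.three-bound S D F′ (λ m lt → λ { (y , v , ty , w , nq) → nq (near lt ty w) }) (proj₁ io , o t , proj₁ (proj₂ io) , proj₁ (proj₂ (proj₂ io)) , proj₂ (proj₂ (proj₂ io)))
        where
        io = i-out (To t) (proj₂ (proj₂ (star (Ao t))))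
        near : ∀ {m y v} → m < 3 → T (not t) y → Walk m y v → Q v (i y)
        near lt ty stay = i-Q ty (proj₂ (nb _)) ≤-refl (symA (proj₂ (nb _)) ▸ stay)
        near (s≤s lt) ty (a ▸ w) = i-Q ty a (≤-pred lt) w

    -- Otherwise the elements j below satisfy j ∙ z c = [z s , z r]; two of the three around a vertex agree, so that they are trivial.
    module Differ (eqB : ∀ {x a b c g} → T (not t) x → St x a b c → Cm x a b g → Cm x a c (z a ∙ g)) where
      record J (x : V) (j : G) : Set where
        constructor mkJ
        field
          at-J : ∀ {a b c} → St x a b c → Cm x a b (j ∙ z c)
      open J

      J-mk : ∀ {x a b c j} → T (not t) x → St x a b c → Cm x a b (j ∙ z c) → J x j
      J-mk {x} {j = j} tx s c = mkJ (perm-all (λ a b c → Cm x a b (j ∙ z c)) (λ s → cm-sym tx (₁ s) (₂ s) (a≢b s)) sw s c)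
        where
        sw : ∀ {a b c} → St x a b c → Cm x a b (j ∙ z c) → Cm x a c (j ∙ z b)
        sw {a} {b} {c} s C = subst (Cm x a c) (trans (grp (z a ∷ j ∙ z c ∷ []) (κ 1 0 (cm-comm tx (₁ s) (₂ s) (a≢b s) C (₁ s)) ∷ []) (var 0 ⊕ var 1) (var 1 ⊕ var 0) refl)
          (trans (assoc _ _ _) (cong (j ∙_) (nat tx (st-312 s))))) (eqB tx s C)

      J-make : ∀ {x} → T (not t) x → ∃ (J x)
      J-make {x} tx with star (proj₂ (nb x))
      ... | b , c , s = cm-raw (₁ s) (₂ s) ∙ z c , J-mk tx s (subst (Cm x _ b) (grp (cm-raw (₁ s) (₂ s) ∷ z c ∷ []) (ι 1 (z-sq (T-adj′ (₃ s) tx)) ∷ []) (var 0) (var 0 ⊕ var 1 ⊕ var 1) refl) (cm-exists tx (₁ s) (₂ s) (a≢b s)))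

      J-unique : ∀ {x j j′} → J x j → J x j′ → j ≡ j′
      J-unique {x} p q with star (proj₂ (nb x))
      ... | b , c , s = cancelʳ (z c) (cm-unique (₁ s) (₂ s) (at-J p s) (at-J q s))

      J-act : ∀ h {x j} → T (not t) x → J x j → J (h ▹ x) (h ∙ j ∙ h ⁻¹)
      J-act h {x} {j} tx p with star (proj₂ (nb x))
      ... | b , c , s = J-mk (T-act h tx) (st-act h s) (subst (Cm (h ▹ x) _ (h ▹ b)) (trans (grp (h ∷ j ∷ z c ∷ []) [] (var 0 ⊕ (var 1 ⊕ var 2) ⊕ var 0 ⁻) ((var 0 ⊕ var 1 ⊕ var 0 ⁻) ⊕ (var 0 ⊕ var 2 ⊕ var 0 ⁻)) refl)
          (cong (h ∙ j ∙ h ⁻¹ ∙_) (sym (z-conj h (T-adj′ (₃ s) tx) refl)))) (cm-act h tx (₁ s) (₂ s) (at-J p s)))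

      J-Q : ∀ {x j} → T (not t) x → J x j → Q x j
      J-Q {x} {j} tx p with star (proj₂ (nb x))
      ... | b , c , s = subst (Q x) (grp (j ∷ z c ∷ []) (ι 1 (z-sq tc) ∷ []) (var 0 ⊕ var 1 ⊕ var 1) (var 0) refl)
          (Q-∙ (cm-Q tx (₁ s) (₂ s) (a≢b s) (at-J p s) ≤-refl (symA (₁ s) ▸ stay)) (zQ₁ tc (symA (₃ s))))
        where
        tc : T t c
        tc = T-adj′ (₃ s) tx

      -- `cm-form` describes `j ∙ z y₁′` up to the choice of a sibling behind `x₃`, and this choice
      -- costs a factor `z b`.
      J-value : ∀ {b x₁ x₂ x₃ y₁ y₁′ y₂ y₂′ y₃ y₃′ j} → T t b → St b x₁ x₂ x₃ → St x₁ b y₁ y₁′ → St x₂ b y₂ y₂′ → St x₃ b y₃ y₃′ → J x₁ j →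
                j ≡ z y₁ ∙ z y₂ ∙ z y₃ ⊎ j ≡ z b ∙ (z y₁ ∙ z y₂ ∙ z y₃)
      J-value {b} {x₁} {x₂} {x₃} {y₁} {y₁′} {y₂} {y₂′} {y₃} {y₃′} {j} tb s s₁ s₂ s₃ p =
          fin (cm-form t₁ (₂ s₁) (a≢b s₁) s (mkFar (₂ s) (≢-sym (a≢b s)) (₂ s₂) (≢-sym (a≢b s₂))) (at-J p s₁))
        where
        open M
        t₁ : T (not t) x₁
        t₁ = T-adj (₁ s) tb
        ty : ∀ {x y} → Adj b x → Adj x y → T t y
        ty bx xy = T² bx xy tb
        c2 : ∀ {x y} → Adj b x → Adj x y → Comm (z b) (z y)
        c2 bx xy = nearC (s≤s (s≤s z≤n)) tb (ty bx xy) (bx ▸ xy ▸ stay)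
        c4 : ∀ {x y x′ y′} → Adj b x → Adj x y → Adj b x′ → Adj x′ y′ → Comm (z y) (z y′)
        c4 bx xy bx′ xy′ = nearC ≤-refl (ty bx xy) (ty bx′ xy′) (symA xy ▸ symA bx ▸ bx′ ▸ xy′ ▸ stay)
        c₁₂ : Comm (z y₁) (z y₂)
        c₁₂ = c4 (₁ s) (₂ s₁) (₂ s) (₂ s₂)
        c₁₃ : Comm (z y₁) (z y₃)
        c₁₃ = c4 (₁ s) (₂ s₁) (₃ s) (₂ s₃)
        c₂₃ : Comm (z y₂) (z y₃)
        c₂₃ = c4 (₂ s) (₂ s₂) (₃ s) (₂ s₃)
        solve : ∀ {y} → j ∙ z y₁′ ≡ z y₂ ∙ z y → j ≡ z y₂ ∙ z y ∙ (z b ∙ z y₁)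
        solve {y} e = cancelʳ (z y₁′) (trans e (trans (grp (z y₂ ∷ z y ∷ z y₁′ ∷ []) (ι 2 (z-sq (ty (₁ s) (₃ s₁))) ∷ []) (var 0 ⊕ var 1) ((var 0 ⊕ var 1 ⊕ var 2) ⊕ var 2) refl) (cong (λ w → (z y₂ ∙ z y ∙ w) ∙ z y₁′) (sym (nat t₁ s₁)))))
        facts : List (WithFacts.Fact (z b ∷ z y₁ ∷ z y₂ ∷ z y₃ ∷ []))
        facts = ι 0 (z-sq tb) ∷ κ 1 2 c₁₂ ∷ κ 1 3 c₁₃ ∷ κ 2 3 c₂₃ ∷ κ 0 1 (c2 (₁ s) (₂ s₁)) ∷ κ 0 2 (c2 (₂ s) (₂ s₂)) ∷ κ 0 3 (c2 (₃ s) (₂ s₃)) ∷ []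
        fin : (∃ λ y → Far x₁ b x₃ y × j ∙ z y₁′ ≡ z y₂ ∙ z y) → _
        fin (y , f , e) = [ (λ { refl → inj₂ (trans (solve e) (grp (z b ∷ z y₁ ∷ z y₂ ∷ z y₃ ∷ []) facts (var 2 ⊕ var 3 ⊕ (var 0 ⊕ var 1)) (var 0 ⊕ (var 1 ⊕ var 2 ⊕ var 3)) refl)) })
          , (λ { refl → inj₁ (trans (solve e) (trans (cong (λ w → z y₂ ∙ w ∙ (z b ∙ z y₁)) (sym (nat (T-adj (₃ s) tb) s₃))) (grp (z b ∷ z y₁ ∷ z y₂ ∷ z y₃ ∷ []) facts (var 2 ⊕ (var 0 ⊕ var 3) ⊕ (var 0 ⊕ var 1)) (var 1 ⊕ var 2 ⊕ var 3) refl))) }) ]′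
          (st-two s₃ (mu f) (u≢y f))

      J-equal-trivial : ∀ {b x₁ x₂ x₃ j} → T t b → St b x₁ x₂ x₃ → J x₁ j → J x₂ j → ∀ {x g} → T (not t) x → J x g → g ≡ ε
      J-equal-trivial {b} {x₁} {x₂} {x₃} {j} tb s p q {x} {g} tx r = cancelˡ h (cancelʳ (h ⁻¹) (trans (J≡ε _ (subst (λ y → J y (h ∙ g ∙ h ⁻¹)) hx (J-act h tx r))) (grp (h ∷ []) [] e0 (var 0 ⊕ e0 ⊕ var 0 ⁻) refl)))
        where
        J≡ε : ∀ g → J x₁ g → g ≡ ε
        J≡ε = const-triv J J-act J-Q (subst (λ c → T c b) (sym (not-not t)) tb) s λ g Jg → subst (J x₂) (J-unique p Jg) q
        st₀ = proj₂ (proj₂ (star (proj₂ (nb x))))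
        st₁ = proj₂ (proj₂ (star (symA (₁ s))))
        hh = st-move tx (T-adj (₁ s) tb) st₀ st₁
        h : G
        h = proj₁ hh
        hx : h ▹ x ≡ x₁
        hx = proj₁ (proj₂ hh)

      J-trivial : ∀ {x g} → T (not t) x → J x g → g ≡ ε
      J-trivial = fin (J-value tb s s₁ s₂ s₃ (proj₂ j₁)) (J-value tb (st-213 s) s₂ s₁ s₃ (proj₂ j₂)) (J-value tb (st-321 s) s₃ s₂ s₁ (proj₂ j₃))
        where
        b : V
        b = o t
        tb : T t b
        tb = To t
        s = proj₂ (proj₂ (star (Ao t)))
        s₁ = proj₂ (proj₂ (star (symA (₁ s))))
        s₂ = proj₂ (proj₂ (star (symA (₂ s))))
        s₃ = proj₂ (proj₂ (star (symA (₃ s))))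
        j₁ = J-make (T-adj (₁ s) tb)
        j₂ = J-make (T-adj (₂ s) tb)
        j₃ = J-make (T-adj (₃ s) tb)
        y₁ y₂ y₃ : V
        y₁ = proj₁ (star (symA (₁ s)))
        y₂ = proj₁ (star (symA (₂ s)))
        y₃ = proj₁ (star (symA (₃ s)))
        c4 : ∀ {x y x′ y′} → Adj b x → Adj x y → Adj b x′ → Adj x′ y′ → Comm (z y) (z y′)
        c4 bx xy bx′ xy′ = nc4 ≤-refl (T² bx xy tb) (T² bx′ xy′ tb) (symA xy ▸ symA bx ▸ bx′ ▸ xy′ ▸ stay)
        facts : List (WithFacts.Fact (z y₁ ∷ z y₂ ∷ z y₃ ∷ []))
        facts = κ 0 1 (c4 (₁ s) (₂ s₁) (₂ s) (₂ s₂)) ∷ κ 0 2 (c4 (₁ s) (₂ s₁) (₃ s) (₂ s₃)) ∷ κ 1 2 (c4 (₂ s) (₂ s₂) (₃ s) (₂ s₃)) ∷ []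
        e₂ : z y₂ ∙ z y₁ ∙ z y₃ ≡ z y₁ ∙ z y₂ ∙ z y₃
        e₂ = grp (z y₁ ∷ z y₂ ∷ z y₃ ∷ []) facts (var 1 ⊕ var 0 ⊕ var 2) (var 0 ⊕ var 1 ⊕ var 2) refl
        e₃ : z y₃ ∙ z y₂ ∙ z y₁ ≡ z y₁ ∙ z y₂ ∙ z y₃
        e₃ = grp (z y₁ ∷ z y₂ ∷ z y₃ ∷ []) facts (var 2 ⊕ var 1 ⊕ var 0) (var 0 ⊕ var 1 ⊕ var 2) refl
        eq₁₂ : proj₁ j₁ ≡ proj₁ j₂ → ∀ {x g} → T (not t) x → J x g → g ≡ ε
        eq₁₂ e = J-equal-trivial tb s (proj₂ j₁) (subst (J _) (sym e) (proj₂ j₂))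
        eq₁₃ : proj₁ j₁ ≡ proj₁ j₃ → ∀ {x g} → T (not t) x → J x g → g ≡ ε
        eq₁₃ e = J-equal-trivial tb (st-132 s) (proj₂ j₁) (subst (J _) (sym e) (proj₂ j₃))
        eq₂₃ : proj₁ j₂ ≡ proj₁ j₃ → ∀ {x g} → T (not t) x → J x g → g ≡ ε
        eq₂₃ e = J-equal-trivial tb (st-231 s) (proj₂ j₂) (subst (J _) (sym e) (proj₂ j₃))
        fin : proj₁ j₁ ≡ z y₁ ∙ z y₂ ∙ z y₃ ⊎ proj₁ j₁ ≡ z b ∙ (z y₁ ∙ z y₂ ∙ z y₃) →
              proj₁ j₂ ≡ z y₂ ∙ z y₁ ∙ z y₃ ⊎ proj₁ j₂ ≡ z b ∙ (z y₂ ∙ z y₁ ∙ z y₃) →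
              proj₁ j₃ ≡ z y₃ ∙ z y₂ ∙ z y₁ ⊎ proj₁ j₃ ≡ z b ∙ (z y₃ ∙ z y₂ ∙ z y₁) → ∀ {x g} → T (not t) x → J x g → g ≡ ε
        fin (inj₁ p) (inj₁ q) _ = eq₁₂ (trans p (sym (trans q e₂)))
        fin (inj₂ p) (inj₂ q) _ = eq₁₂ (trans p (sym (trans q (cong (z b ∙_) e₂))))
        fin (inj₁ p) _ (inj₁ q) = eq₁₃ (trans p (sym (trans q e₃)))
        fin (inj₂ p) _ (inj₂ q) = eq₁₃ (trans p (sym (trans q (cong (z b ∙_) e₃))))
        fin _ (inj₁ p) (inj₁ q) = eq₂₃ (trans p (trans e₂ (sym (trans q e₃))))
        fin _ (inj₂ p) (inj₂ q) = eq₂₃ (trans p (trans (cong (z b ∙_) e₂) (sym (trans q (cong (z b ∙_) e₃)))))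

      third-cm : ∀ {x a b c} → T (not t) x → St x a b c → Cm x a b (z c)
      third-cm {x} {a} {b} {c} tx s = fin (J-make tx)
        where
        fin : ∃ (J x) → Cm x a b (z c)
        fin (j , p) = subst (Cm x a b) (trans (cong (_∙ z c) (J-trivial tx p)) (idˡ _)) (at-J p s)

      outer-product : ∀ {b x₁ x₂ x₃ y₁ y₁′ y₂ y₂′ y₃ y₃′} → T t b → St b x₁ x₂ x₃ → St x₁ b y₁ y₁′ → St x₂ b y₂ y₂′ → St x₃ b y₃ y₃′ →
                      z y₁ ∙ z y₂ ∙ z y₃ ≡ ε ⊎ z y₁ ∙ z y₂ ∙ z y₃ ≡ z b
      outer-product {b} {x₁} {y₁ = y₁} {y₂ = y₂} {y₃ = y₃} tb s s₁ s₂ s₃ = fin (J-make (T-adj (₁ s) tb))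
        where
        fin : ∃ (J x₁) → z y₁ ∙ z y₂ ∙ z y₃ ≡ ε ⊎ z y₁ ∙ z y₂ ∙ z y₃ ≡ z b
        fin (j , p) = [ (λ e → inj₁ (trans (sym e) j≡ε)) , (λ e → inj₂ (cancelˡ (z b) (trans (sym e) (trans j≡ε (sym (z-sq tb)))))) ]′ (J-value tb s s₁ s₂ s₃ p)
          where
          j≡ε : j ≡ ε
          j≡ε = J-trivial (T-adj (₁ s) tb) p

    spread : ∀ {x a b c g x′ a′ b′ c′ g′} → T (not t) x → T (not t) x′ → St x a b c → St x′ a′ b′ c′ → Cm x a b g → Cm x′ a′ b′ g′ →
             (Cm x a c g → Cm x′ a′ c′ g′) × (Cm x a c (z a ∙ g) → Cm x′ a′ c′ (z a′ ∙ g′))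
    spread {a = a} {g = g} tx tx′ s s′ C C′ with st-move tx tx′ s s′
    ... | h , refl , refl , refl , refl = (λ E → subst (Cm _ _ _) g≡ (cm-act h tx (₁ s) (₃ s) E))
        , λ E → subst (Cm _ _ _) (trans (grp (h ∷ z a ∷ g ∷ []) [] (var 0 ⊕ (var 1 ⊕ var 2) ⊕ var 0 ⁻) ((var 0 ⊕ var 1 ⊕ var 0 ⁻) ⊕ (var 0 ⊕ var 2 ⊕ var 0 ⁻)) refl)
            (cong₂ _∙_ (sym (z-conj h (T-adj′ (₁ s) tx) refl)) g≡)) (cm-act h tx (₁ s) (₃ s) E)
      where
      g≡ = cm-unique (₁ s′) (₂ s′) (cm-act h tx (₁ s) (₂ s) C) C′

    EqA EqB : Set
    EqA = ∀ {x a b c g} → T (not t) x → St x a b c → Cm x a b g → Cm x a c g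
    EqB = ∀ {x a b c g} → T (not t) x → St x a b c → Cm x a b g → Cm x a c (z a ∙ g)

    -- Which alternative of `cm-alt` holds is read off at one star and carried to all others by
    -- `spread`.
    agree-or-differ : EqA ⊎ EqB
    agree-or-differ = fin (proj₂ (proj₂ (star (Ao (not t)))))
      where
      tx₀ : T (not t) (o (not t))
      tx₀ = To (not t)
      fin : ∀ {b c} → St (o (not t)) (o (not (not t))) b c → EqA ⊎ EqB
      fin {b} {c} s₀ = split′ (cm-alt tx₀ s₀ C₀)
        where
        g₀ : G
        g₀ = cm-raw (₁ s₀) (₂ s₀)
        C₀ : Cm (o (not t)) (o (not (not t))) b g₀
        C₀ = cm-exists tx₀ (₁ s₀) (₂ s₀) (a≢b s₀)
        split′ : Cm (o (not t)) (o (not (not t))) c g₀ ⊎ Cm (o (not t)) (o (not (not t))) c (z (o (not (not t))) ∙ g₀) → EqA ⊎ EqB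
        split′ (inj₁ E) = inj₁ (λ {x} {a} {b} {c} {g} tx s C → proj₁ (spread tx₀ tx s₀ s C₀ C) E)
        split′ (inj₂ E) = inj₂ (λ {x} {a} {b} {c} {g} tx s C → proj₂ (spread tx₀ tx s₀ s C₀ C) E)

-- Distance four, differing commutators: how an element acts behind a vertex

module FourBound (S : Setting) (D : S3Data S) {t : Bool} (F : S3.NFam S D t) where
  open FourSplit S D F public

  module DifferBound (mn : ∀ m → m < 4 → ¬ Out m) (out : Out 4) (eqB : FourCases.EqB mn out) where
    open FourCases mn out public
    open Differ eqB public
    private
      module M = Min 2 mn

    c2 : ∀ {b x y} → T t b → Adj b x → Adj x y → Comm (z b) (z y)
    c2 tb bx xy = M.nearC (s≤s (s≤s z≤n)) tb (T² bx xy tb) (bx ▸ xy ▸ stay)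

    c4 : ∀ {b x y x′ y′} → T t b → Adj b x → Adj x y → Adj b x′ → Adj x′ y′ → Comm (z y) (z y′)
    c4 tb bx xy bx′ xy′ = M.nearC ≤-refl (T² bx xy tb) (T² bx′ xy′ tb) (symA xy ▸ symA bx ▸ bx′ ▸ xy′ ▸ stay)

    conj-swap : ∀ {d p v} → v ∙ v ≡ ε → p ∙ p ≡ ε → Comm p v → d ∙ v ≡ p ∙ (v ∙ d) → p ∙ (v ∙ d ∙ v ⁻¹) ≡ d
    conj-swap {d} {p} {v} v² p² c e = trans (grp (d ∷ p ∷ v ∷ []) (κ 1 2 c ∷ []) (var 1 ⊕ (var 2 ⊕ var 0 ⊕ var 2 ⁻)) ((var 1 ⊕ (var 2 ⊕ var 0)) ⊕ var 2 ⁻) refl)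
      (trans (cong (_∙ v ⁻¹) (sym e)) (grp (d ∷ v ∷ []) [] (var 0 ⊕ var 1 ⊕ var 1 ⁻) (var 0) refl))

    -- `p` is the commutator of `d` with the involutions behind `y`, required to be the same for all
    -- of them; it measures how far `d` is from fixing the ball about `y`.
    record Val (x y : V) (d p : G) : Set where
      constructor mkVal
      field
        val : ∀ {m u} → Far x y m u → d ∙ z u ≡ p ∙ (z u ∙ d)
    open Val public

    -- The four-group of the vertex between `b` and `y`, which contains all commutators that occur.
    data PV (b y y′ : V) : G → Set where
      pε : PV b y y′ ε
      pb : PV b y y′ (z b)
      py : PV b y y′ (z y)
      py′ : PV b y y′ (z y′)

    ε-comm : ∀ g → Comm g ε
    ε-comm g = trans (idʳ g) (sym (idˡ g))

    W-comm₀ : ∀ {b g} → T t b → W b g → Comm g (z b)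
    W-comm₀ tb Wb = z-comm tb (fix (proj₁ Wb))

    val-uniq : ∀ {x y d p q} → Adj x y → Val x y d p → Val x y d q → p ≡ q
    val-uniq {x} xy v w with other (symA xy)
    ... | m , ym , mx with far x ym mx
    ...   | u , f = cancelʳ _ (trans (sym (val v f)) (val w f))

    val-mul : ∀ {x y d e p q} → Val x y d p → Val x y e q → Comm d q → Val x y (d ∙ e) (q ∙ p)
    val-mul {x} {y} {d} {e} {p} {q} v w c = mkVal go
      where
      go : ∀ {m u} → Far x y m u → (d ∙ e) ∙ z u ≡ (q ∙ p) ∙ (z u ∙ (d ∙ e))
      go {u = u} f = trans (assoc _ _ _) (trans (cong (d ∙_) (val w f)) (trans (grp (d ∷ e ∷ q ∷ z u ∷ []) (κ 0 2 c ∷ []) (var 0 ⊕ (var 2 ⊕ (var 3 ⊕ var 1))) (var 2 ⊕ (var 0 ⊕ var 3) ⊕ var 1) refl)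
        (trans (cong (λ k → q ∙ k ∙ e) (val v f)) (grp (d ∷ e ∷ q ∷ z u ∷ p ∷ []) [] (var 2 ⊕ (var 4 ⊕ (var 3 ⊕ var 0)) ⊕ var 1) ((var 2 ⊕ var 4) ⊕ (var 3 ⊕ (var 0 ⊕ var 1))) refl))))

    val-act : ∀ h {x y d p x′ y′} → T t y → h ▹ x ≡ x′ → h ▹ y ≡ y′ → Val x y d p → Val x′ y′ (h ∙ d ∙ h ⁻¹) (h ∙ p ∙ h ⁻¹)
    val-act h {x} {y} {d} {p} ty refl refl v = mkVal go
      where
      go : ∀ {m u} → Far (h ▹ x) (h ▹ y) m u → (h ∙ d ∙ h ⁻¹) ∙ z u ≡ (h ∙ p ∙ h ⁻¹) ∙ (z u ∙ (h ∙ d ∙ h ⁻¹))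
      go {m} {u} f = trans (cong (h ∙ d ∙ h ⁻¹ ∙_) zu) (trans (grp (h ∷ d ∷ z u₀ ∷ []) [] ((var 0 ⊕ var 1 ⊕ var 0 ⁻) ⊕ (var 0 ⊕ var 2 ⊕ var 0 ⁻)) (var 0 ⊕ (var 1 ⊕ var 2) ⊕ var 0 ⁻) refl)
          (trans (cong (λ k → h ∙ k ∙ h ⁻¹) (val v f₀)) (trans (grp (h ∷ d ∷ z u₀ ∷ p ∷ []) [] (var 0 ⊕ (var 3 ⊕ (var 2 ⊕ var 1)) ⊕ var 0 ⁻) ((var 0 ⊕ var 3 ⊕ var 0 ⁻) ⊕ ((var 0 ⊕ var 2 ⊕ var 0 ⁻) ⊕ (var 0 ⊕ var 1 ⊕ var 0 ⁻))) refl)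
          (cong (λ k → (h ∙ p ∙ h ⁻¹) ∙ (k ∙ (h ∙ d ∙ h ⁻¹))) (sym zu)))))
        where
        u₀ : V
        u₀ = h ⁻¹ ▹ u
        subst₂F : ∀ {x x′ y y′ m u} → x ≡ x′ → y ≡ y′ → Far x y m u → Far x′ y′ m u
        subst₂F refl refl f = f
        f₀ : Far x y (h ⁻¹ ▹ m) u₀
        f₀ = subst₂F (⁻¹▹ h refl) (⁻¹▹ h refl) (far-act (h ⁻¹) f)
        zu : z u ≡ h ∙ z u₀ ∙ h ⁻¹
        zu = z-conj h (far-T f₀ ty) (trans (sym (∙▹ _ _ _)) (trans (cong (_▹ u) (invʳ h)) (ε▹ u)))

    val-subst : ∀ {x y d d′ p p′} → d ≡ d′ → p ≡ p′ → Val x y d p → Val x y d′ p′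
    val-subst refl refl v = v

    val-W : ∀ {b x y d} → T t b → Adj b x → Adj x y → W y d → Val x y d ε
    val-W {b} {x} {y} {d} tb bx xy Wy = mkVal λ f → trans (W-comm (T² bx xy tb) Wy (ym f) (mu f)) (sym (idˡ _))

    val-z : ∀ {b x x₁ c y y′} → T t b → Far x b x₁ c → St x b y y′ → Val x y (z c) (z y′)
    val-z tb f s = mkVal λ f₁ → com (third-cm (T-adj (symA (₁ s)) tb) s) f f₁

    val-zb : ∀ {b x y} → T t b → Adj b x → Adj x y → Val x y (z b) ε
    val-zb tb bx xy = mkVal λ f → trans (M.nearC ≤-refl tb (far-T f (T² bx xy tb)) (bx ▸ xy ▸ ym f ▸ mu f ▸ stay)) (sym (idˡ _))

    -- A sibling of `u` contributes a factor `z y`, with which `d` and `p` commute. The other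
    -- neighbour of `y` is reached by conjugation with some `z s` from the far side of `b`, and `d`
    -- commutes with it as an element of `W b`.
    val-ext : ∀ {b x y d p m u} → T t b → Adj b x → Adj x y → y ≢ b → W b d → (∀ {x₁ s} → Far x b x₁ s → Comm p (z s)) → Comm p (z y) → Far x y m u → d ∙ z u ≡ p ∙ (z u ∙ d) → Val x y d p
    val-ext {b} {x} {y} {d} {p} {m} {u} tb bx xy yb Wb cs cy f e = go (other bx)
      where
      ty : T t y
      ty = T² bx xy tb
      dy : Comm d (z y)
      dy = W-comm tb Wb bx xy
      sib : ∀ {m u u′} → Far x y m u → d ∙ z u ≡ p ∙ (z u ∙ d) → Far x y m u′ → d ∙ z u′ ≡ p ∙ (z u′ ∙ d)
      sib {m} {u} {u′} f e f′ with far-st f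
      ... | c , st = [ (λ { refl → e }) , (λ { refl → trans (cong (d ∙_) (sym (nat (T-adj (ym f) ty) st))) (trans (grp (d ∷ z y ∷ z u ∷ []) (κ 0 1 dy ∷ []) (var 0 ⊕ (var 1 ⊕ var 2)) (var 1 ⊕ (var 0 ⊕ var 2)) refl)
          (trans (cong (z y ∙_) e) (trans (grp (d ∷ z y ∷ z u ∷ p ∷ []) (κ 3 1 cy ∷ []) (var 1 ⊕ (var 3 ⊕ (var 2 ⊕ var 0))) (var 3 ⊕ ((var 1 ⊕ var 2) ⊕ var 0)) refl) (cong (λ k → p ∙ (k ∙ d)) (nat (T-adj (ym f) ty) st))))) }) ]′ (st-two st (mu f′) (u≢y f′))
      go : (∃ λ x₁ → Adj b x₁ × x₁ ≢ x) → Val x y d p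
      go (x₁ , bx₁ , ne) = go′ (far x bx₁ ne) (far-mid f xy)
        where
        go′ : (∃ λ s → Far x b x₁ s) → (∃ λ m′ → St y x m m′) → Val x y d p
        go′ (s , fs) (m′ , sy) = mkVal λ f₂ → [ (λ { refl → sib f e f₂ }) , (λ { refl → sib f₃ e₃ f₂ }) ]′ (st-two sy (ym f₂) (m≢x f₂))
          where
          m₁ = mv₄ tb fs (symA bx) yb sy
          f₃ : Far x y m′ (z s ▹ u)
          f₃ = mkFar (₃ sy) (≢-sym (a≢c sy)) (subst (λ k → Adj k (z s ▹ u)) (proj₁ (proj₂ m₁)) (actA (z s) (mu f))) (λ q → u≢y f (▹-inj (z s) (trans q (sym (proj₁ m₁)))))
          zu : z (z s ▹ u) ≡ z s ∙ z u ∙ z s ⁻¹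
          zu = z-conj (z s) (far-T f ty) refl
          ds : Comm d (z s)
          ds = W-comm tb Wb bx₁ (mu fs)
          e₃ : d ∙ z (z s ▹ u) ≡ p ∙ (z (z s ▹ u) ∙ d)
          e₃ = trans (cong (d ∙_) zu) (trans (grp (d ∷ z s ∷ z u ∷ []) (κ 0 1 ds ∷ []) (var 0 ⊕ (var 1 ⊕ var 2 ⊕ var 1 ⁻)) (var 1 ⊕ (var 0 ⊕ var 2) ⊕ var 1 ⁻) refl)
            (trans (cong (λ k → z s ∙ k ∙ z s ⁻¹) e) (trans (grp (d ∷ z s ∷ z u ∷ p ∷ []) (κ 0 1 ds ∷ κ 3 1 (cs fs) ∷ []) (var 1 ⊕ (var 3 ⊕ (var 2 ⊕ var 0)) ⊕ var 1 ⁻) (var 3 ⊕ ((var 1 ⊕ var 2 ⊕ var 1 ⁻) ⊕ var 0)) refl) (cong (λ k → p ∙ (k ∙ d)) (sym zu)))))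

    -- Siblings and cousins carry distinct involutions, so commuting with the involutions behind `y`
    -- makes `d` fix their vertices.
    val-ε : ∀ {b x y d} → T t b → Adj b x → Adj x y → y ≢ b → W b d → Val x y d ε → W y d
    val-ε {b} {x} {y} {d} tb bx xy yb Wb v = at-y (star (symA xy))
      where
      ty : T t y
      ty = T² bx xy tb
      qx : Q x d
      qx = proj₂ Wb x bx
      dy : d ▹ y ≡ y
      dy = fixₙ qx y xy
      dc : ∀ {m u} → Far x y m u → Comm d (z u)
      dc f = trans (val v f) (idˡ _)
      one : ∀ {m m′} → St y x m m′ → d ▹ m ≡ m
      one {m} {m′} sy with far x (₂ sy) (≢-sym (a≢b sy))
      ... | u , f = [ proj₁ , (λ e → ⊥-elim (cousins ty (₂ sy) (₃ sy) (b≢c sy) (mu f) (u≢y f) (subst (λ k → Adj k (d ▹ u)) (proj₁ e) (actA d (mu f))) (λ q → u≢y f (▹-inj d (trans q (sym dy))))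
           (sym (trans (z-conj d (far-T f ty) refl) (trans (cong (_∙ d ⁻¹) (dc f)) (grp (d ∷ z u ∷ []) [] (var 1 ⊕ var 0 ⊕ var 0 ⁻) (var 1) refl)))))) ]′ (swap? d sy dy (fix qx))
      qm : ∀ {m m′} → St y x m m′ → Q m d
      qm {m} sy with far x (₂ sy) (≢-sym (a≢b sy))
      ... | u , f = mkQ₃ (proj₂ (far-st f)) (one sy) dy (z-fix (far-T f ty) (mu f) (one sy) (dc f))
      at-y : (∃ λ m → ∃ λ m′ → St y x m m′) → W y d
      at-y (m , m′ , sy) = mkQ₃ sy dy (fix qx) (one sy) , λ w yw → [ (λ { refl → qx }) , [ (λ { refl → qm sy }) , (λ { refl → qm (st-132 sy) }) ]′ ]′ (only sy w yw)

    -- If `d` fixes the neighbour `m` of `y`, it fixes `u` or moves it to its sibling: values `ε`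
    -- and `z y`. If it moves `m`, the same is said of `d ∙ z v` with `v` on the far side of `b`;
    -- the commutator of `z v` and `z u` is `z y′`, which gives the two other values.
    val-exists : ∀ {b x y y′ d} → T t b → St x b y y′ → W b d → ∃ λ p → PV b y y′ p × Val x y d p
    val-exists {b} {x} {y} {y′} {d} tb s Wb = at-y (star (symA xy))
      where
      bx : Adj b x
      bx = symA (₁ s)
      xy : Adj x y
      xy = ₂ s
      yb : y ≢ b
      yb = ≢-sym (a≢b s)
      tx : T (not t) x
      tx = T-adj bx tb
      ty : T t y
      ty = T² bx xy tb
      ty′ : T t y′
      ty′ = T² bx (₃ s) tb
      qx : Q x d
      qx = proj₂ Wb x bx
      dy : d ▹ y ≡ y
      dy = fixₙ qx y xy
      pvc : ∀ {p w} → PV b y y′ p → Comm (z b) (z w) → Comm (z y) (z w) → Comm (z y′) (z w) → Comm p (z w)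
      pvc pε _ _ _ = trans (idˡ _) (sym (idʳ _))
      pvc pb c _ _ = c
      pvc py _ c _ = c
      pvc py′ _ _ c = c
      one : ∀ {p m u} → PV b y y′ p → Far x y m u → d ∙ z u ≡ p ∙ (z u ∙ d) → ∃ λ p → PV b y y′ p × Val x y d p
      one {p} pv f e = p , pv , val-ext tb bx xy yb Wb (λ fs → pvc pv (c2 tb (ym fs) (mu fs)) (c4 tb bx xy (ym fs) (mu fs)) (c4 tb bx (₃ s) (ym fs) (mu fs))) (pvc pv (c2 tb bx xy) refl (c2 ty′ (symA (₃ s)) xy)) f e
      val₁ : ∀ {m u h} → Far x y m u → h ▹ m ≡ m → h ▹ y ≡ y → h ∙ z u ≡ z u ∙ h ⊎ h ∙ z u ≡ z y ∙ (z u ∙ h)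
      val₁ {m} {u} {h} f hm hy with far-st f
      ... | u′ , sm = [ (λ e → inj₁ (trans (eq→ (proj₁ e)) refl)) , (λ e → inj₂ (trans (eq→ (proj₁ e)) (trans (cong (_∙ h) (sym (nat (T-adj (ym f) ty) sm))) (assoc _ _ _)))) ]′ (swap? h sm hm hy)
        where
        eq→ : ∀ {w} → h ▹ u ≡ w → h ∙ z u ≡ z w ∙ h
        eq→ e = trans (sym (eqv h u (far-T f ty))) (cong (λ k → z k ∙ h) e)
      at-y : (∃ λ m → ∃ λ m′ → St y x m m′) → _
      at-y (m , m′ , sy) with far x (₂ sy) (≢-sym (a≢b sy)) | swap? d sy dy (fix qx)
      ... | u , f | inj₁ (dm , _) = [ (λ e → one pε f (trans e (sym (idˡ _)))) , (λ e → one py f e) ]′ (val₁ f dm dy)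
      ... | u , f | inj₂ (dm , dm′) = at-b (other bx)
        where
        at-b : (∃ λ x₁ → Adj b x₁ × x₁ ≢ x) → _
        at-b (x₁ , bx₁ , ne) with far x bx₁ ne
        ... | v , fs = fin (val₁ f (∙▹≡ d (z v) (proj₁ (proj₂ m₁)) dm′) (fix-∙ dy (proj₁ m₁)))
          where
          m₁ = mv₄ tb fs (symA bx) yb sy
          tv : T t v
          tv = far-T fs tb
          dv : Comm d (z v)
          dv = W-comm tb Wb bx₁ (mu fs)
          d′ : Comm d (z y′)
          d′ = W-comm tb Wb bx (₃ s)
          cm : z v ∙ z u ≡ z y′ ∙ (z u ∙ z v)
          cm = com (third-cm tx s) fs f
          dvu : (d ∙ z v) ∙ z u ≡ z y′ ∙ (d ∙ z u) ∙ z v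
          dvu = trans (assoc _ _ _) (trans (cong (d ∙_) cm) (grp (d ∷ z v ∷ z u ∷ z y′ ∷ []) (κ 0 3 d′ ∷ []) (var 0 ⊕ (var 3 ⊕ (var 2 ⊕ var 1))) (var 3 ⊕ (var 0 ⊕ var 2) ⊕ var 1) refl))
          iy′ : z y′ ∙ z y′ ≡ ε
          iy′ = z-sq ty′
          fin : (d ∙ z v) ∙ z u ≡ z u ∙ (d ∙ z v) ⊎ (d ∙ z v) ∙ z u ≡ z y ∙ (z u ∙ (d ∙ z v)) → _
          fin (inj₁ e) = one py′ f (trans (grp (d ∷ z v ∷ z u ∷ z y′ ∷ []) (ι 3 iy′ ∷ []) (var 0 ⊕ var 2) (var 3 ⊕ (var 3 ⊕ (var 0 ⊕ var 2) ⊕ var 1) ⊕ var 1 ⁻) refl)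
            (trans (cong (λ k → z y′ ∙ k ∙ z v ⁻¹) (trans (sym dvu) e)) (grp (d ∷ z v ∷ z u ∷ z y′ ∷ []) [] (var 3 ⊕ (var 2 ⊕ (var 0 ⊕ var 1)) ⊕ var 1 ⁻) (var 3 ⊕ (var 2 ⊕ var 0)) refl)))
          fin (inj₂ e) = one pb f (trans (grp (d ∷ z v ∷ z u ∷ z y′ ∷ []) (ι 3 iy′ ∷ []) (var 0 ⊕ var 2) (var 3 ⊕ (var 3 ⊕ (var 0 ⊕ var 2) ⊕ var 1) ⊕ var 1 ⁻) refl)
            (trans (cong (λ k → z y′ ∙ k ∙ z v ⁻¹) (trans (sym dvu) e)) (trans (grp (d ∷ z v ∷ z u ∷ z y′ ∷ z y ∷ []) [] (var 3 ⊕ (var 4 ⊕ (var 2 ⊕ (var 0 ⊕ var 1))) ⊕ var 1 ⁻) ((var 3 ⊕ var 4) ⊕ (var 2 ⊕ var 0)) refl) (cong (_∙ (z u ∙ d)) (nat tx (st-321 s))))))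

-- Distance four: excluding a value

module FourFinal (S : Setting) (D : S3Data S) {t : Bool} (F : S3.NFam S D t) where
  open FourBound S D F public

  module DifferFinal (mn : ∀ m → m < 4 → ¬ Out m) (out : Out 4) (eqB : FourCases.EqB mn out) where
    open DifferBound mn out eqB public
    private
      module M = Min 2 mn

    W-act : ∀ h {b g} → W b g → W (h ▹ b) (h ∙ g ∙ h ⁻¹)
    W-act h {b} {g} w = subst (W (h ▹ b)) (grp (h ∷ g ∷ []) [] ((var 0 ⁻) ⁻ ⊕ var 1 ⊕ var 0 ⁻) (var 0 ⊕ var 1 ⊕ var 0 ⁻) refl) (W-pull (h ⁻¹) (subst (λ x → W x g) (sym (⁻¹▹ h refl)) w))

    Y-act : ∀ h {x g} → Y x g → Y (h ▹ x) (h ∙ g ∙ h ⁻¹)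
    Y-act h {x} {g} w = subst (Y (h ▹ x)) (grp (h ∷ g ∷ []) [] ((var 0 ⁻) ⁻ ⊕ var 1 ⊕ var 0 ⁻) (var 0 ⊕ var 1 ⊕ var 0 ⁻) refl) (Y-pull (h ⁻¹) (subst (λ x → Y x g) (sym (⁻¹▹ h refl)) w))

    W-near : ∀ {b u m} → T t b → m ≤ 2 → Walk m b u → W u (z b)
    W-near tb le w = M.nearQ (s≤s (≤-trans le (s≤s (s≤s z≤n)))) tb w , λ x ux → M.nearQ (s≤s (s≤s le)) tb (w ◂ ux)

    c4′ : ∀ {x y m u a} → T t y → Far x y m u → Adj x y → Adj x a → Comm (z u) (z a)
    c4′ ty f xy xa = M.nearC ≤-refl (far-T f ty) (T² (symA xy) xa ty) (walk++ (far-w f) (symA xy ▸ xa ▸ stay))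

    -- Combining elements behind y₂ and behind y₃ gives q which swaps the vertices behind b, and d^q = d ∙ z y₃.
    module Twist {b x₁ y₂ y₃ : V} {d : G} (tb : T t b) (s : St x₁ b y₂ y₃) (Wb : W b d) (W₂ : W y₂ d) (v₃ : Val x₁ y₃ d (z y₃)) where
      t₁ : T (not t) x₁
      t₁ = T-adj (symA (₁ s)) tb
      t₂ : T t y₂
      t₂ = T-adj′ (₂ s) t₁
      t₃ : T t y₃
      t₃ = T-adj′ (₃ s) t₁
      o₂ : ∃₂ λ m u → Far x₁ y₂ m u
      o₂ = proj₁ (other (symA (₂ s))) , far x₁ (proj₁ (proj₂ (other (symA (₂ s))))) (proj₂ (proj₂ (other (symA (₂ s)))))
      o₃ : ∃₂ λ m u → Far x₁ y₃ m u
      o₃ = proj₁ (other (symA (₃ s))) , far x₁ (proj₁ (proj₂ (other (symA (₃ s))))) (proj₂ (proj₂ (other (symA (₃ s)))))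
      u₂ u₃ : V
      u₂ = proj₁ (proj₂ o₂)
      u₃ = proj₁ (proj₂ o₃)
      f₂ : Far x₁ y₂ (proj₁ o₂) u₂
      f₂ = proj₂ (proj₂ o₂)
      f₃ : Far x₁ y₃ (proj₁ o₃) u₃
      f₃ = proj₂ (proj₂ o₃)
      q : G
      q = z u₂ ∙ z u₃
      qb : q ▹ b ≡ b
      qb = fix-∙ (M.nearF ≤-refl (far-T f₂ t₂) (walk++ (far-w f₂) (symA (₂ s) ▸ ₁ s ▸ stay))) (M.nearF ≤-refl (far-T f₃ t₃) (walk++ (far-w f₃) (symA (₃ s) ▸ ₁ s ▸ stay)))
      q₃ : Comm (z y₃) q
      q₃ = comm-∙ (sym (c4′ t₂ f₂ (₂ s) (₃ s))) (c2 t₃ (ym f₃) (mu f₃))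
      dq : q ∙ d ∙ q ⁻¹ ≡ z y₃ ∙ d
      dq = trans (grp (z u₂ ∷ z u₃ ∷ d ∷ z y₃ ∷ []) (ι 3 (z-sq t₃) ∷ κ 3 0 (sym (c4′ t₂ f₂ (₂ s) (₃ s))) ∷ []) ((var 0 ⊕ var 1) ⊕ var 2 ⊕ (var 0 ⊕ var 1) ⁻) (var 3 ⊕ (var 0 ⊕ (var 3 ⊕ (var 1 ⊕ var 2))) ⊕ (var 0 ⊕ var 1) ⁻) refl)
        (trans (cong (λ k → z y₃ ∙ (z u₂ ∙ k) ∙ q ⁻¹) (sym (val v₃ f₃))) (grp (z u₂ ∷ z u₃ ∷ d ∷ z y₃ ∷ []) (κ 2 0 (W-comm t₂ W₂ (ym f₂) (mu f₂)) ∷ []) (var 3 ⊕ (var 0 ⊕ (var 2 ⊕ var 1)) ⊕ (var 0 ⊕ var 1) ⁻) (var 3 ⊕ var 2) refl))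

      module _ {m₁ m₂ n n′ : V} (sb : St b x₁ m₁ m₂) (sn : St m₁ b n n′) where
        private
          tn : T t n
          tn = T² (symA (₁ sn)) (₂ sn) tb
        qm : q ▹ m₁ ≡ m₁
        qm = ∙▹≡ (z u₂) (z u₃) (proj₁ (proj₂ (mv₄ t₃ f₃ (₃ s) (a≢c s) sb))) (proj₂ (proj₂ (mv₄ t₂ f₂ (₂ s) (a≢b s) sb)))
        qz : ∀ {n n′} → St m₁ b n n′ → q ∙ z n ≡ z n′ ∙ q
        qz {n} {n′} sn = trans (assoc _ _ _) (trans (cong (z u₂ ∙_) (com (third-cm t₁ (st-312 s)) f₃ fn))
          (trans (grp (z u₂ ∷ z u₃ ∷ z n ∷ z y₂ ∷ []) (κ 0 3 (sym (c2 t₂ (ym f₂) (mu f₂))) ∷ []) (var 0 ⊕ (var 3 ⊕ (var 2 ⊕ var 1))) (var 3 ⊕ (var 0 ⊕ var 2) ⊕ var 1) refl)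
          (trans (cong (λ k → z y₂ ∙ k ∙ z u₃) (com (third-cm t₁ (st-213 s)) f₂ fn))
          (trans (grp (z u₂ ∷ z u₃ ∷ z n ∷ z y₂ ∷ z y₃ ∷ []) [] (var 3 ⊕ (var 4 ⊕ (var 2 ⊕ var 0)) ⊕ var 1) ((var 3 ⊕ var 4) ⊕ var 2 ⊕ (var 0 ⊕ var 1)) refl)
          (cong (_∙ q) (trans (cong (_∙ z n) (nat t₁ (st-231 s))) (nat (T-adj (symA (₁ sn)) tb) sn)))))))
          where
          fn : Far x₁ b m₁ n
          fn = mkFar (symA (₁ sn)) (≢-sym (a≢b sb)) (₂ sn) (≢-sym (a≢b sn))
        qn : q ▹ n ≡ n′
        qn = z-sib (T-adj (symA (₁ sn)) tb) (subst (λ k → Adj k (q ▹ n)) qm (actA q (₂ sn))) (₃ sn)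
          (trans (z-conj q tn refl) (trans (cong (_∙ q ⁻¹) (qz sn)) (grp (z n′ ∷ q ∷ []) [] (var 0 ⊕ var 1 ⊕ var 1 ⁻) (var 0) refl)))
        -- Conjugation by `q` carries the value at `n` to `n′` and turns `d` into `z y₃ ∙ d`; the
        -- extra factor `z y₃` contributes `z n`.
        pattern′ : ∀ {p p′} → q ∙ p ≡ p′ ∙ q → Comm (z y₃) p′ → Val m₁ n d p → Val m₁ n′ d (p′ ∙ z n)
        pattern′ {p} {p′} e c v = val-subst (trans (cong (z y₃ ∙_) dq) (grp (z y₃ ∷ d ∷ []) (ι 0 (z-sq t₃) ∷ []) (var 0 ⊕ (var 0 ⊕ var 1)) (var 1) refl)) refl
          (val-mul (val-z tb (mkFar (symA (₁ s)) (a≢b sb) (₃ s) (≢-sym (a≢c s))) (st-132 sn))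
             (val-subst refl (trans (cong (_∙ q ⁻¹) e) (grp (p′ ∷ q ∷ []) [] (var 0 ⊕ var 1 ⊕ var 1 ⁻) (var 0) refl)) (val-act q tn qm qn v)) c)
        y₃n : ∀ {n} → Adj m₁ n → Comm (z y₃) (z n)
        y₃n mn = c4 tb (symA (₁ s)) (₃ s) (symA (₁ sn)) mn

      Small : V → V → Set
      Small m n = Val m n d ε ⊎ Val m n d (z b)

      -- One of the two vertices behind b has a value in {1 , z b} ...
      small : ∀ {m₁ m₂ n n′} → St b x₁ m₁ m₂ → St m₁ b n n′ → Small m₁ n ⊎ Small m₁ n′
      small {m₁} {m₂} {n} {n′} sb sn = fin (val-exists tb sn Wb)
        where
        tm : T (not t) m₁
        tm = T-adj (symA (₁ sn)) tb
        fin : (∃ λ p → PV b n n′ p × Val m₁ n d p) → Small m₁ n ⊎ Small m₁ n′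
        fin (_ , pε , v) = inj₁ (inj₁ v)
        fin (_ , pb , v) = inj₁ (inj₂ v)
        fin (_ , py , v) = inj₂ (inj₂ (val-subst refl (nat tm (st-321 sn)) (pattern′ sb sn (qz sb sn sn) (y₃n sb sn (₃ sn)) v)))
        fin (_ , py′ , v) = inj₂ (inj₁ (val-subst refl (z-sq (T-adj′ (₂ sn) tm)) (pattern′ sb sn (qz sb sn (st-132 sn)) (y₃n sb sn (₂ sn)) v)))

      -- ... and elements behind it move this pattern to one that is impossible.
      bad : ∀ {m₁ m₂ n n′} → St b x₁ m₁ m₂ → St m₁ b n n′ → Small m₁ n → ⊥
      bad {m₁} {m₂} {n} {n′} sb sn sm = fin (other (symA (₂ sn)))
        where
        tn : T t n
        tn = T² (symA (₁ sn)) (₂ sn) tb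
        fin : (∃ λ k → Adj n k × k ≢ m₁) → ⊥
        fin (k , nk , ne) with far m₁ nk ne
        ... | w , fw = go sm
          where
          v : G
          v = z w
          v² : v ∙ v ≡ ε
          v² = z-sq (far-T fw tn)
          mw = mv₄ tn fw (₂ sn) (a≢b sn) (st-213 sb)
          vb : v ▹ b ≡ b
          vb = proj₁ mw
          vx : v ▹ x₁ ≡ m₂
          vx = proj₁ (proj₂ mw)
          sv : St m₂ b (v ▹ y₂) (v ▹ y₃)
          sv = subst₂S vx vb (st-act v s)
            where
            subst₂S : ∀ {x x′ y y′ u w} → x ≡ x′ → y ≡ y′ → St x y u w → St x′ y′ u w
            subst₂S refl refl s = s
          -- By `conj-swap`, `d` is its own conjugate under `v` up to `p`, so the values at `y₂` and
          -- `y₃` reappear at their images under `v`. From the first of them `pattern′` predicts a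
          -- different second one.
          end : ∀ {p} → p ∙ p ≡ ε → Comm p v → Comm p (z y₃) → Val m₂ (v ▹ y₂) p ε → Val m₂ (v ▹ y₃) p ε → d ∙ v ≡ p ∙ (v ∙ d) → ⊥
          end {p} p² pc p₃ e₂ e₃ e = b≢c s (▹-inj v (z-sib (T-adj (₃ sb) tb) (₂ sv) (₃ sv) (sym (trans (z-conj v t₃ refl) (trans (sym (idʳ _)) (trans (val-uniq (₃ sv) k₃ k₃′) (idˡ _)))))))
            where
            dd : p ∙ (v ∙ d ∙ v ⁻¹) ≡ d
            dd = conj-swap v² p² pc e
            k₂ : Val m₂ (v ▹ y₂) d ε
            k₂ = val-subst dd (trans (grp (v ∷ []) [] ((var 0 ⊕ e0 ⊕ var 0 ⁻) ⊕ e0) e0 refl) refl) (val-mul e₂ (val-act v t₂ vx refl (val-W tb (symA (₁ s)) (₂ s) W₂)) (trans (cong (p ∙_) (grp (v ∷ []) [] (var 0 ⊕ e0 ⊕ var 0 ⁻) e0 refl)) (trans (ε-comm p) (cong (_∙ p) (grp (v ∷ []) [] e0 (var 0 ⊕ e0 ⊕ var 0 ⁻) refl)))))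
            v₃c : Comm p (v ∙ z y₃ ∙ v ⁻¹)
            v₃c = comm-∙ (comm-∙ pc p₃) (comm-inv pc)
            k₃ : Val m₂ (v ▹ y₃) d ((v ∙ z y₃ ∙ v ⁻¹) ∙ ε)
            k₃ = val-subst dd refl (val-mul e₃ (val-act v t₃ vx refl v₃) v₃c)
            k₃′ : Val m₂ (v ▹ y₃) d (ε ∙ z (v ▹ y₂))
            k₃′ = pattern′ (st-132 sb) sv (trans (idʳ q) (sym (idˡ q))) (ε-comm _) k₂
          go : Small m₁ n → ⊥
          go (inj₁ e) = end (idˡ ε) (trans (idˡ v) (sym (idʳ v))) (trans (idˡ _) (sym (idʳ _))) one one (val e fw)
            where
            one : ∀ {x y} → Val x y ε ε
            one = mkVal λ _ → cong (ε ∙_) (sym (idʳ _))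
          go (inj₂ e) = end (z-sq tb) (M.nearC ≤-refl tb (far-T fw tn) (symA (₁ sn) ▸ ₂ sn ▸ ym fw ▸ mu fw ▸ stay)) (c2 tb (symA (₁ s)) (₃ s)) (val-zb tb (₃ sb) (₂ sv)) (val-zb tb (₃ sb) (₃ sv)) (val e fw)

-- Distance four: the stabilisers of large balls

module FourEnd (S : Setting) (D : S3Data S) {t : Bool} (F : S3.NFam S D t) where
  open FourFinal S D F public

  module DifferEnd (mn : ∀ m → m < 4 → ¬ Out m) (out : Out 4) (eqB : FourCases.EqB mn out) where
    open DifferFinal mn out eqB public
    private
      module M = Min 2 mn

    spread-W₀ : ∀ {b x₁ y₂ y₃ d} → T t b → St x₁ b y₂ y₃ → W b d → W y₂ d → ¬ Val x₁ y₃ d (z y₃)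
    spread-W₀ {b} tb s Wb W₂ v₃ = fin (star (symA (₁ s)))
      where
      module A = Twist tb s Wb W₂ v₃
      fin : ∃₂ (λ m₁ m₂ → St b _ m₁ m₂) → ⊥
      fin (m₁ , m₂ , sb) = go (star (symA (₂ sb)))
        where
        go : ∃₂ (λ n n′ → St m₁ b n n′) → ⊥
        go (n , n′ , sn) = [ A.bad sb sn , A.bad sb (st-132 sn) ]′ (A.small sb sn)

    -- Of the four values at `y₃`, `ε` is the claim and `z y₃` is excluded by `spread-W₀`. The two
    -- others become `z y₃` when `d` is multiplied by its conjugate under an element exchanging `b`
    -- and `y₂` and fixing `y₃`.
    spread-W : ∀ {b x₁ y₂ y₃ d} → T t b → St x₁ b y₂ y₃ → W b d → W y₂ d → W y₃ d
    spread-W {b} {x₁} {y₂} {y₃} {d} tb s Wb W₂ = fin (val-exists tb (st-132 s) Wb)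
      where
      tx : T (not t) x₁
      tx = T-adj (symA (₁ s)) tb
      t₂ : T t y₂
      t₂ = T-adj′ (₂ s) tx
      t₃ : T t y₃
      t₃ = T-adj′ (₃ s) tx
      other-value : ∀ {p p′} → (∀ σ → σ ▹ b ≡ y₂ → σ ▹ y₂ ≡ b → σ ▹ y₃ ≡ y₃ → p′ ≡ σ ∙ p ∙ σ ⁻¹) → Comm d p′ → p′ ∙ p ≡ z y₃ → Val x₁ y₃ d p → ⊥
      other-value {p} {p′} pσ c e v = go (st-move tx tx s (st-213 s))
        where
        go : _ → ⊥
        go (σ , σx , σb , σ₂ , σ₃) = spread-W₀ tb s (W-mul Wb (subst (λ y → W y d′) σ₂ (W-act σ W₂))) (W-mul W₂ (subst (λ y → W y d′) σb (W-act σ Wb)))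
            (val-subst refl e (val-mul v (val-subst refl (sym (pσ σ σb σ₂ σ₃)) (val-act σ t₃ σx σ₃ v)) c))
          where
          d′ : G
          d′ = σ ∙ d ∙ σ ⁻¹
      fin : (∃ λ p → PV b y₃ y₂ p × Val x₁ y₃ d p) → W y₃ d
      fin (_ , pε , v) = val-ε tb (symA (₁ s)) (₃ s) (≢-sym (a≢c s)) Wb v
      fin (_ , py , v) = ⊥-elim (spread-W₀ tb s Wb W₂ v)
      fin (_ , pb , v) = ⊥-elim (other-value (λ σ σb _ _ → z-conj σ tb σb) (W-comm₀ t₂ W₂) (nat tx (st-213 s)) v)
      fin (_ , py′ , v) = ⊥-elim (other-value (λ σ _ σ₂ _ → z-conj σ t₂ σ₂) (W-comm₀ tb Wb) (nat tx s) v)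

    -- The pointwise stabiliser of the ball of radius 4 about `b`.
    N : V → G → Set
    N b d = ∀ x → Adj b x → Y x d

    N-mul : ∀ {b g h} → N b g → N b h → N b (g ∙ h)
    N-mul p q x bx = Y-mul (p x bx) (q x bx)

    N-pull : ∀ h {b g} → N (h ▹ b) g → N b (h ⁻¹ ∙ g ∙ h)
    N-pull h n x bx = Y-pull h (n (h ▹ x) (actA h bx))

    N-act : ∀ h {b b′ g} → h ▹ b ≡ b′ → N b g → N b′ (h ∙ g ∙ h ⁻¹)
    N-act h {b} {_} {g} refl w = subst (N (h ▹ b)) (grp (h ∷ g ∷ []) [] ((var 0 ⁻) ⁻ ⊕ var 1 ⊕ var 0 ⁻) (var 0 ⊕ var 1 ⊕ var 0 ⁻) refl) (N-pull (h ⁻¹) (subst (λ x → N x g) (sym (⁻¹▹ h refl)) w))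

    N-z : ∀ {b} → T t b → N b (z b)
    N-z tb x bx y xy = W-near tb ≤-refl (bx ▸ xy ▸ stay)

    W-inv : ∀ {b g} → W b g → W b (g ⁻¹)
    W-inv (p , f) = Q-inv p , λ x bx → Q-inv (f x bx)

    N-inv : ∀ {b g} → N b g → N b (g ⁻¹)
    N-inv n x bx y xy = W-inv (n x bx y xy)

    N-W : ∀ {b g} → N b g → W b g
    N-W {b} n = n (proj₁ (nb b)) (proj₂ (nb b)) b (symA (proj₂ (nb b)))

    z∉N : ∀ {b x y} → T t b → Adj b x → Adj x y → y ≢ b → ¬ N y (z b)
    z∉N {b} {x} {y} tb bx xy yb n = fin (other (symA xy))
      where
      fin : (∃ λ m → Adj y m × m ≢ x) → ⊥
      fin (m , ym , mx) with far x ym mx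
      ... | u , f = crit₄ (T² bx xy tb) (mkFar (symA xy) (≢-sym mx) (symA bx) (≢-sym yb)) (symA ym) (mu f) (u≢y f) (proj₁ (n m ym u (mu f)))

    Y-shift : ∀ {b x₁ m₁ m₂ n k w d p} → T t b → St b x₁ m₁ m₂ → Adj m₁ n → n ≢ b → Far m₁ n k w → p ≡ ε ⊎ p ≡ z b → d ∙ z w ≡ p ∙ (z w ∙ d) → Y x₁ d → Y m₂ d
    Y-shift {b} {x₁} {m₁} {m₂} {n} {k} {w} {d} tb sb mn nb fw pp e y₁ = [ (λ { refl → fin (idˡ ε) (trans (idˡ v) (sym (idʳ v))) (λ c _ → (mkQ (ε▹ c) λ w _ → ε▹ w) , λ x _ → mkQ (ε▹ x) λ w _ → ε▹ w) e })
        , (λ { refl → fin (z-sq tb) (M.nearC ≤-refl tb (far-T fw tn) (₂ sb ▸ mn ▸ ym fw ▸ mu fw ▸ stay)) (λ c m₂c → W-near tb ≤-refl (₃ sb ▸ m₂c ▸ stay)) e }) ]′ pp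
      where
      tn : T t n
      tn = T² (₂ sb) mn tb
      v : G
      v = z w
      vx : v ▹ x₁ ≡ m₂
      vx = proj₁ (proj₂ (mv₄ tn fw mn (≢-sym nb) (st-213 sb)))
      fin : ∀ {p} → p ∙ p ≡ ε → Comm p v → Y m₂ p → d ∙ v ≡ p ∙ (v ∙ d) → Y m₂ d
      fin p² pc yp e = subst (Y m₂) (conj-swap (z-sq (far-T fw tn)) p² pc e) (Y-mul yp (subst (λ x → Y x (v ∙ d ∙ v ⁻¹)) vx (Y-act v y₁)))

    -- The small value behind `m₁` lets an involution there transport membership from `Y x₁` to
    -- `Y m₂`; afterwards an involution behind `m₂` transports it to `Y m₁`.
    Y⇒N : ∀ {b x₁ m₁ m₂ n n′ d p} → T t b → St b x₁ m₁ m₂ → St m₁ b n n′ → p ≡ ε ⊎ p ≡ z b → Val m₁ n d p → Y x₁ d → N b d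
    Y⇒N {b} {x₁} {m₁} {m₂} {n} {n′} {d} tb sb sn pp v y₁ = λ x bx → [ (λ { refl → y₁ }) , [ (λ { refl → ym₁ }) , (λ { refl → ym₂ }) ]′ ]′ (only sb x bx)
      where
      ym₂ : Y m₂ d
      ym₂ with other (symA (₂ sn))
      ... | k , nk , ne with far m₁ nk ne
      ...   | w , fw = Y-shift tb sb (₂ sn) (≢-sym (a≢b sn)) fw pp (val v fw) y₁
      ym₁ : Y m₁ d
      ym₁ with other (symA (₃ sb))
      ... | l , ml , ne₁ with other (symA ml)
      ...   | k , nk , ne with far m₂ nk ne
      ...     | w , fw = Y-shift tb (st-132 sb) ml ne₁ fw (inj₁ refl) (trans (W-comm (T² (₃ sb) ml tb) (ym₂ l ml) (ym fw) (mu fw)) (sym (idˡ _))) y₁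

    -- `N b` has index at most 2 in `Y x₁`, because one of `d` and `z y ∙ d` has a value in the
    -- group of order 2 generated by `z b`.
    Y-cases : ∀ {b x₁ y y′ d} → T t b → St x₁ b y y′ → Y x₁ d → N b d ⊎ N b (z y ∙ d)
    Y-cases {b} {x₁} {y} {y′} {d} tb s y₁ = at-b (star (symA (₁ s)))
      where
      ty : T t y
      ty = T² (symA (₁ s)) (₂ s) tb
      yz : Y x₁ (z y ∙ d)
      yz = Y-mul (λ c x₁c → W-near ty ≤-refl (symA (₂ s) ▸ x₁c ▸ stay)) y₁
      at-b : ∃₂ (λ m₁ m₂ → St b x₁ m₁ m₂) → N b d ⊎ N b (z y ∙ d)
      at-b (m₁ , m₂ , sb) = at-m (star (symA (₂ sb)))
        where
        at-m : ∃₂ (λ n n′ → St m₁ b n n′) → N b d ⊎ N b (z y ∙ d)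
        at-m (n , n′ , sn) = fin (val-exists tb sn (y₁ b (₁ s)))
          where
          tm : T (not t) m₁
          tm = T-adj (₂ sb) tb
          tn : T t n
          tn = T-adj′ (₂ sn) tm
          yc : ∀ {k} → Adj m₁ k → Comm (z y) (z k)
          yc mk = c4 tb (symA (₁ s)) (₂ s) (₂ sb) mk
          zd : ∀ {p} → Comm (z y) p → Val m₁ n d p → Val m₁ n (z y ∙ d) (p ∙ z n′)
          zd c v = val-mul (val-z tb (mkFar (symA (₁ s)) (a≢b sb) (₂ s) (≢-sym (a≢b s))) sn) v c
          fin : (∃ λ p → PV b n n′ p × Val m₁ n d p) → N b d ⊎ N b (z y ∙ d)
          fin (_ , pε , v) = inj₁ (Y⇒N tb sb sn (inj₁ refl) v y₁)
          fin (_ , pb , v) = inj₁ (Y⇒N tb sb sn (inj₂ refl) v y₁)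
          fin (_ , py , v) = inj₂ (Y⇒N tb sb sn (inj₂ (nat tm (st-231 sn))) (zd (yc (₂ sn)) v) yz)
          fin (_ , py′ , v) = inj₂ (Y⇒N tb sb sn (inj₁ (z-sq (T-adj′ (₃ sn) tm))) (zd (yc (₃ sn)) v) yz)

    -- The elements lying in `N` at all neighbours of `x₁` form a subgroup normalised by the
    -- stabiliser of `x₁`. They commute with distant involutions that are transitive on the
    -- neighbours of `b`.
    N-triple : ∀ {b x₁ y y′ g} → T t b → St x₁ b y y′ → N b g → N y g → N y′ g → g ≡ ε
    N-triple {b} {x₁} {y} {y′} {g} tb s nb′ ny ny′ = fin (star (symA (₁ s)))
      where
      P : G → Set
      P h = ∀ c → Adj x₁ c → N c h
      fin : ∃₂ (λ m₁ m₂ → St b x₁ m₁ m₂) → g ≡ ε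
      fin (m₁ , m₂ , sb) = core record
          { a = b ; b = x₁ ; ab = symA (₁ s) ; Y = P ; Ya = λ h p → fix (proj₁ (N-W (p b (₁ s)))) ; Yb = λ h p → fixₙ (proj₁ (N-W (p b (₁ s)))) x₁ (symA (₁ s)) ; atA = atA
          ; atB = λ c x₁c → let h , hx , hb = move-at (T-adj (symA (₁ s)) tb) (₁ s) c x₁c in h , hx , hb , λ k p a x₁a → N-pull h (p (h ▹ a) (actAf h hx x₁a)) }
          g λ c x₁c → [ (λ { refl → nb′ }) , [ (λ { refl → ny }) , (λ { refl → ny′ }) ]′ ]′ (only s c x₁c)
        where
        via : ∀ {m₁ m₂} → St b x₁ m₁ m₂ → ∃ λ h → h ▹ b ≡ b × h ▹ x₁ ≡ m₂ × (∀ k → P k → P (h ⁻¹ ∙ k ∙ h))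
        via {m₁} sb with other (symA (₂ sb))
        ... | n , mn , ne₁ with other (symA mn)
        ...   | k , nk , ne with far m₁ nk ne
        ...     | w , fw = z w , proj₁ m , proj₁ (proj₂ m) , λ h p → subst P (sym (comm-conj (W-comm (T² (₂ sb) mn tb) (p b (₁ s) m₁ (₂ sb) n mn) (ym fw) (mu fw)))) p
          where
          m = mv₄ (T² (₂ sb) mn tb) fw mn (≢-sym ne₁) (st-213 sb)
        atA : ∀ c → Adj b c → ∃ λ h → h ▹ b ≡ b × h ▹ x₁ ≡ c × (∀ k → P k → P (h ⁻¹ ∙ k ∙ h))
        atA c bc = [ (λ { refl → ε , ε▹ b , ε▹ x₁ , λ k p → subst P (sym (comm-conj (ε-comm k))) p }) , [ (λ { refl → via (st-132 sb) }) , (λ { refl → via sb }) ]′ ]′ (only sb c bc)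

    N-pair : ∀ {b x₁ y y′ g} → T t b → St x₁ b y y′ → N b g → N y g → g ≡ ε ⊎ N y′ (z b ∙ g)
    N-pair {b} {x₁} {y} {y′} tb s nb′ ny = [ (λ n → inj₁ (N-triple tb s nb′ ny n)) , inj₂ ]′ (Y-cases (T² (symA (₁ s)) (₃ s) tb) (st-312 s) (nb′ x₁ (symA (₁ s))))

    -- Both `z b ∙ g` and `z b ∙ h` lie in `N y′`, so the quotient of `g` and `h` lies in `N` at all
    -- three vertices and is trivial.
    N-unique : ∀ {b x₁ y y′ g h} → T t b → St x₁ b y y′ → N b g → N y g → g ≢ ε → N b h → N y h → h ≢ ε → g ≡ h
    N-unique {b} {x₁} {y} {y′} {g} {h} tb s gb gy g≢ hb hy h≢ = [ (λ e → ⊥-elim (g≢ e)) , (λ n → [ (λ e → ⊥-elim (h≢ e)) , fin n ]′ (N-pair tb s hb hy)) ]′ (N-pair tb s gb gy)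
      where
      fin : N y′ (z b ∙ g) → N y′ (z b ∙ h) → g ≡ h
      fin n n₁ = cancelˡ (g ⁻¹) (trans (invˡ g) (sym (N-triple tb s (N-mul (N-inv gb) hb) (N-mul (N-inv gy) hy)
        (subst (N y′) (grp (z b ∷ g ∷ h ∷ []) [] ((var 0 ⊕ var 1) ⁻ ⊕ (var 0 ⊕ var 2)) (var 1 ⁻ ⊕ var 2) refl) (N-mul (N-inv n) n₁)))))

    -- If `s` fixes `y`, it centralises `v` by uniqueness. If it swaps `y` and `y′`, it turns `v`
    -- into `z b ∙ v`, and the change of `z y′` compensates.
    s-comm : ∀ {b x y y′ v s} → T t b → St x b y y′ → N b v → N y v → v ≢ ε → Q b s → Comm s (v ∙ z y′)
    s-comm {b} {x} {y} {y′} {v} {s} tb sx nb′ ny v≢ qs = [ same , swapped ]′ (swap? s sx (fixₙ qs x (symA (₁ sx))) (fix qs))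
      where
      tx : T (not t) x
      tx = T-adj (symA (₁ sx)) tb
      ty : T t y
      ty = T-adj′ (₂ sx) tx
      v′ : G
      v′ = s ∙ v ∙ s ⁻¹
      v′≢ : v′ ≢ ε
      v′≢ e = v≢ (cancelˡ s (cancelʳ (s ⁻¹) (trans e (grp (s ∷ []) [] e0 (var 0 ⊕ e0 ⊕ var 0 ⁻) refl))))
      un : ∀ {w} → v′ ≡ w → s ∙ v ≡ w ∙ s
      un e = trans (grp (s ∷ v ∷ []) [] (var 0 ⊕ var 1) ((var 0 ⊕ var 1 ⊕ var 0 ⁻) ⊕ var 0) refl) (cong (_∙ s) e)
      same : s ▹ y ≡ y × s ▹ y′ ≡ y′ → Comm s (v ∙ z y′)
      same (e , e′) = comm-∙ (un (N-unique tb sx (N-act s (fix qs) nb′) (N-act s e ny) v′≢ nb′ ny v≢)) (z-comm (T-adj′ (₃ sx) tx) e′)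
      swapped : s ▹ y ≡ y′ × s ▹ y′ ≡ y → Comm s (v ∙ z y′)
      swapped (e , e′) = [ (λ x → ⊥-elim (v≢ x)) , fin ]′ (N-pair tb sx nb′ ny)
        where
        fin : N y′ (z b ∙ v) → Comm s (v ∙ z y′)
        fin n = trans (sym (assoc _ _ _)) (trans (cong (_∙ z y′) (un (N-unique tb (st-132 sx) (N-act s (fix qs) nb′) (N-act s e ny) v′≢ (N-mul (N-z tb) nb′) n zv≢)))
            (trans (trans (assoc _ _ _) (cong ((z b ∙ v) ∙_) (trans (sym (eqv s y′ (T-adj′ (₃ sx) tx))) (cong (λ k → z k ∙ s) e′))))
            (trans (grp (z b ∷ v ∷ z y ∷ s ∷ []) (κ 0 1 (sym (W-comm₀ tb (N-W nb′))) ∷ []) ((var 0 ⊕ var 1) ⊕ (var 2 ⊕ var 3)) ((var 1 ⊕ (var 0 ⊕ var 2)) ⊕ var 3) refl) (cong (λ k → v ∙ k ∙ s) (nat tx sx)))))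
          where
          zv≢ : z b ∙ v ≢ ε
          zv≢ x = z∉N tb (symA (₁ sx)) (₂ sx) (≢-sym (a≢b sx)) (subst (N y) (cancelˡ (z b) (trans x (sym (z-sq tb)))) ny)

    -- By `s-comm` at the three neighbours of `b`, `σ` commutes with a product `P` of three factors.
    -- By `outer-product` it equals `u` up to powers of `z b`, so `σ` centralises `u` and carries
    -- `N y` to `N y′`: now `u` lies in `N` at all three vertices.
    mixed : ∀ {b x₁ y y′ u} → T t b → St x₁ b y y′ → N b u → N y u → N y′ (z b ∙ u) → u ≢ ε → ⊥
    mixed {b} {x₁} {y} {y′} {u} tb s nu ny ny′ u≢ = at-b (star (symA (₁ s)))
      where
      ζu : Comm (z b) u
      ζu = sym (W-comm₀ tb (N-W nu))
      u² : u ∙ u ≡ ε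
      u² = N-triple tb s (N-mul nu nu) (N-mul ny ny) (subst (N y′) (grp (z b ∷ u ∷ []) (ι 0 (z-sq tb) ∷ κ 0 1 ζu ∷ []) ((var 0 ⊕ var 1) ⊕ (var 0 ⊕ var 1)) (var 1 ⊕ var 1) refl) (N-mul ny′ ny′))
      Ζ : G → Set
      Ζ g = g ≡ ε ⊎ g ≡ z b
      Ζ-comm : ∀ {g h} → Ζ g → Comm h (z b) → Comm h g
      Ζ-comm (inj₁ refl) _ = ε-comm _
      Ζ-comm (inj₂ refl) c = c
      factor : ∀ {x n n′} → St x b n n′ → ∃ λ ζ → Ζ ζ × N n (ζ ∙ u) × N b (ζ ∙ u) × ζ ∙ u ≢ ε
      factor {x} {n} {n′} sx = [ (λ k → ε , inj₁ refl , subst (N n) (sym (idˡ u)) k , subst (N b) (sym (idˡ u)) nu , λ e → u≢ (trans (sym (idˡ u)) e))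
          , (λ k → z b , inj₂ refl , k , N-mul (N-z tb) nu , λ e → z∉N tb (symA (₁ s)) (₂ s) (≢-sym (a≢b s)) (subst (N y) (cancelˡ (z b) (trans e (sym (z-sq tb)))) ny)) ]′
          (Y-cases (T² (symA (₁ sx)) (₂ sx) tb) (st-213 sx) (nu x (symA (₁ sx))))
      σs = qsw tb s
      σ : G
      σ = proj₁ σs
      qσ : Q b σ
      qσ = proj₁ (proj₂ σs)
      σy : σ ▹ y ≡ y′
      σy = proj₁ (proj₂ (proj₂ σs))
      σζ : Comm σ (z b)
      σζ = z-comm tb (fix qσ)
      at-b : ∃₂ (λ x₂ x₃ → St b x₁ x₂ x₃) → ⊥
      at-b (x₂ , x₃ , sb) = at-o (star (symA (₂ sb))) (star (symA (₃ sb)))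
        where
        at-o : ∃₂ (λ n n′ → St x₂ b n n′) → ∃₂ (λ k k′ → St x₃ b k k′) → ⊥
        at-o (n , n′ , s₂) (k , k′ , s₃) = fin (factor s₂) (factor s₃)
          where
          uc : ∀ {x w} → Adj b x → Adj x w → Comm u (z w)
          uc bx xw = W-comm tb (N-W nu) bx xw
          π : G
          π = z y′ ∙ z n′ ∙ z k′
          Ζπ : Ζ π
          Ζπ = outer-product tb sb (st-132 s) (st-132 s₂) (st-132 s₃)
          fin : _ → _ → ⊥
          fin (ζ₂ , Z₂ , n₂ , b₂ , ne₂) (ζ₃ , Z₃ , n₃ , b₃ , ne₃) = u≢ (N-triple tb s nu ny (subst (N y′) σu (N-act σ σy ny)))
            where
            P : G
            P = (u ∙ z y′) ∙ ((ζ₂ ∙ u) ∙ z n′) ∙ ((ζ₃ ∙ u) ∙ z k′)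
            σP : Comm σ P
            σP = comm-∙ (comm-∙ (s-comm tb s nu ny u≢ qσ) (s-comm tb s₂ b₂ n₂ ne₂ qσ)) (s-comm tb s₃ b₃ n₃ ne₃ qσ)
            P≡ : P ≡ ζ₂ ∙ ζ₃ ∙ π ∙ u
            P≡ = grp (u ∷ z y′ ∷ z n′ ∷ z k′ ∷ ζ₂ ∷ ζ₃ ∷ [])
              (ι 0 u² ∷ κ 0 1 (uc (symA (₁ s)) (₃ s)) ∷ κ 0 2 (uc (₂ sb) (₃ s₂)) ∷ κ 0 3 (uc (₃ sb) (₃ s₃)) ∷ κ 0 4 (Ζ-comm Z₂ (sym ζu)) ∷ κ 0 5 (Ζ-comm Z₃ (sym ζu))
               ∷ κ 1 4 (Ζ-comm Z₂ (sym (c2 tb (symA (₁ s)) (₃ s)))) ∷ κ 1 5 (Ζ-comm Z₃ (sym (c2 tb (symA (₁ s)) (₃ s)))) ∷ κ 2 5 (Ζ-comm Z₃ (sym (c2 tb (₂ sb) (₃ s₂)))) ∷ [])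
              ((var 0 ⊕ var 1) ⊕ ((var 4 ⊕ var 0) ⊕ var 2) ⊕ ((var 5 ⊕ var 0) ⊕ var 3)) (var 4 ⊕ var 5 ⊕ (var 1 ⊕ var 2 ⊕ var 3) ⊕ var 0) refl
            σζ′ : Comm σ (ζ₂ ∙ ζ₃ ∙ π)
            σζ′ = comm-∙ (comm-∙ (Ζ-comm Z₂ σζ) (Ζ-comm Z₃ σζ)) (Ζ-comm Ζπ σζ)
            cu : Comm σ u
            cu = subst (Comm σ) (trans (cong ((ζ₂ ∙ ζ₃ ∙ π) ⁻¹ ∙_) P≡) (grp (ζ₂ ∙ ζ₃ ∙ π ∷ u ∷ []) [] (var 0 ⁻ ⊕ (var 0 ⊕ var 1)) (var 1) refl)) (comm-∙ (comm-inv σζ′) σP)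
            σu : σ ∙ u ∙ σ ⁻¹ ≡ u
            σu = trans (cong (_∙ σ ⁻¹) cu) (grp (u ∷ σ ∷ []) [] (var 0 ⊕ var 1 ⊕ var 1 ⁻) (var 0) refl)

    N-small : ∀ {b g} → T t b → N b g → g ≡ ε ⊎ g ≡ z b
    N-small {b} {g} tb n = decide (g ≟ᴳ ε)
      where
      s = proj₂ (proj₂ (star (symA (proj₂ (nb b)))))
      y y′ : V
      y = proj₁ (star (symA (proj₂ (nb b))))
      y′ = proj₁ (proj₂ (star (symA (proj₂ (nb b)))))
      fin : g ≢ ε → N y g ⊎ N y (z b ∙ g) → N y′ g ⊎ N y′ (z b ∙ g) → g ≡ ε ⊎ g ≡ z b
      fin ne (inj₁ p) (inj₁ q) = inj₁ (N-triple tb s n p q)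
      fin ne (inj₁ p) (inj₂ q) = ⊥-elim (mixed tb s n p q ne)
      fin ne (inj₂ p) (inj₁ q) = ⊥-elim (mixed tb (st-132 s) n q p ne)
      fin ne (inj₂ p) (inj₂ q) = inj₂ (cancelˡ (z b) (trans (N-triple tb s (N-mul (N-z tb) n) p q) (sym (z-sq tb))))
      decide : Dec (g ≡ ε) → g ≡ ε ⊎ g ≡ z b
      decide (yes e) = inj₁ e
      decide (no ne) = fin ne (Y-cases (T² (symA (₁ s)) (₂ s) tb) (st-213 s) (n _ (symA (₁ s)))) (Y-cases (T² (symA (₁ s)) (₃ s) tb) (st-312 s) (n _ (symA (₁ s))))

    -- The kernels at `b`, `x`, `m₁`, `y` and `k` lead into `Y x`. In it the group generated by
    -- `z b` has index at most 2, so `Y x` has order at most 4, and 32 times 4 is 128.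
    differ-bound : Bnd S₀ 128
    differ-bound = flag-bnd tb bx
      (bnd-Qs s₁ sb (λ _ h → h)
      (bnd-Qs s₂ s (λ _ h → fixₙ (proj₂ h) x bx , fix (proj₂ h))
      (bnd-Qs s₃ sm (λ { _ ((_ , q) , _) → fixₙ q m₁ (₂ sb) , fix q })
      (bnd-Qs s₄ sy (λ { _ ((_ , q) , _) → fixₙ q y (₂ s) , fix q })
      (bnd-Qs s₅ sk (λ { _ (_ , q) → fixₙ q k (₂ sy) , fix q })
      (bnd-⊆ inY Y-bound))))))
      where
      b : V
      b = o t
      tb : T t b
      tb = To t
      x : V
      x = o (not t)
      bx : Adj b x
      bx = Ao t
      m₁ m₂ y y′ k k′ n n′ : V
      m₁ = proj₁ (star bx)
      m₂ = proj₁ (proj₂ (star bx))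
      sb : St b x m₁ m₂
      sb = proj₂ (proj₂ (star bx))
      y = proj₁ (star (symA bx))
      y′ = proj₁ (proj₂ (star (symA bx)))
      s : St x b y y′
      s = proj₂ (proj₂ (star (symA bx)))
      k = proj₁ (star (symA (₂ s)))
      k′ = proj₁ (proj₂ (star (symA (₂ s))))
      sy : St y x k k′
      sy = proj₂ (proj₂ (star (symA (₂ s))))
      n = proj₁ (star (symA (₂ sb)))
      n′ = proj₁ (proj₂ (star (symA (₂ sb))))
      sm : St m₁ b n n′
      sm = proj₂ (proj₂ (star (symA (₂ sb))))
      sk = proj₂ (proj₂ (star (symA (₂ sy))))
      sm₂ = proj₂ (proj₂ (star (symA (₃ sb))))
      s₁ = sub-flag b x
      s₂ = sub-Q b s₁
      s₃ = sub-Q x s₂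
      s₄ = sub-Q m₁ s₃
      s₅ = sub-Q y s₄
      tx : T (not t) x
      tx = T-adj bx tb
      ty : T t y
      ty = T-adj′ (₂ s) tx
      W-of : ∀ {g} → Q b g → Q x g → Q m₁ g → W b g
      W-of {g} qb qx q₁ = qb , λ w bw → [ (λ { refl → qx }) , [ (λ { refl → q₁ }) , (λ { refl → q₂ }) ]′ ]′ (only sb w bw)
        where
        l : V
        l = proj₁ (star (symA (₃ sb)))
        t-l : T t l
        t-l = T² (₃ sb) (₂ sm₂) tb
        gm : g ▹ m₂ ≡ m₂
        gm = fixₙ qb m₂ (₃ sb)
        π : G
        π = z y ∙ z n ∙ z l
        cπ : Comm g π
        cπ = [ (λ e → subst (Comm g) (sym e) (ε-comm g)) , (λ e → subst (Comm g) (sym e) (z-comm tb (fix qb))) ]′ (outer-product tb sb s sm sm₂)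
        c-l : Comm g (z l)
        c-l = subst (Comm g) (grp (z y ∷ z n ∷ z l ∷ []) [] ((var 0 ⊕ var 1) ⁻ ⊕ (var 0 ⊕ var 1 ⊕ var 2)) (var 2) refl)
          (comm-∙ (comm-inv (comm-∙ (z-comm ty (fixₙ qx y (₂ s))) (z-comm (T² (₂ sb) (₂ sm) tb) (fixₙ q₁ n (₂ sm))))) cπ)
        q₂ : Q m₂ g
        q₂ = mkQ₃ sm₂ gm (fix qb) (z-fix t-l (₂ sm₂) gm c-l)
      inY : ∀ g → (((((g ▹ b ≡ b × g ▹ x ≡ x) × Q b g) × Q x g) × Q m₁ g) × Q y g) × Q k g → Y x g
      inY g (((((_ , qb) , qx) , q₁) , qy) , qk) = λ c xc → [ (λ { refl → Wb }) , [ (λ { refl → Wy }) , (λ { refl → spread-W tb s Wb Wy }) ]′ ]′ (only s c xc)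
        where
        Wb : W b g
        Wb = W-of qb qx q₁
        f : Far x y k (proj₁ (far x (₂ sy) (≢-sym (a≢b sy))))
        f = proj₂ (far x (₂ sy) (≢-sym (a≢b sy)))
        Wy : W y g
        Wy = val-ε tb bx (₂ s) (≢-sym (a≢b s)) Wb (val-ext tb bx (₂ s) (≢-sym (a≢b s)) Wb (λ _ → trans (idˡ _) (sym (idʳ _))) (trans (idˡ _) (sym (idʳ _))) f
          (trans (z-comm (far-T f ty) (fixₙ qk _ (mu f))) (sym (idˡ _))))
      Y-bound : Bnd (Y x) 4
      Y-bound = index2 {K = λ g → Y x g × (g ≡ ε ⊎ g ≡ z b)} (λ g Yg → dec Yg (g ≟ᴳ ε) (g ≟ᴳ z b)) ix
          (index2 {K = λ g → g ≡ ε} (λ g _ → g ≟ᴳ ε) ix₂ (bnd-1 λ g e → e))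
        where
        dec : ∀ {g} → Y x g → Dec (g ≡ ε) → Dec (g ≡ z b) → Dec (Y x g × (g ≡ ε ⊎ g ≡ z b))
        dec Yg (yes e) _ = yes (Yg , inj₁ e)
        dec Yg (no _) (yes e) = yes (Yg , inj₂ e)
        dec Yg (no p) (no q) = no λ { (_ , inj₁ e) → p e ; (_ , inj₂ e) → q e }
        ix₂ : ∀ g h → Y x g × (g ≡ ε ⊎ g ≡ z b) → Y x h × (h ≡ ε ⊎ h ≡ z b) → ¬ (g ≡ ε) → ¬ (h ≡ ε) → g ⁻¹ ∙ h ≡ ε
        ix₂ g h (_ , inj₁ e) _ ng _ = ⊥-elim (ng e)
        ix₂ g h _ (_ , inj₁ e) _ nh = ⊥-elim (nh e)
        ix₂ g h (_ , inj₂ refl) (_ , inj₂ refl) _ _ = invˡ _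
        big : ∀ {g} → Y x g → ¬ (Y x g × (g ≡ ε ⊎ g ≡ z b)) → z y ∙ g ≡ ε ⊎ z y ∙ g ≡ z b
        big Yg ng = [ (λ n → ⊥-elim (ng (Yg , N-small tb n))) , N-small tb ]′ (Y-cases tb s Yg)
        ix : ∀ g h → Y x g → Y x h → ¬ (Y x g × (g ≡ ε ⊎ g ≡ z b)) → ¬ (Y x h × (h ≡ ε ⊎ h ≡ z b)) → Y x (g ⁻¹ ∙ h) × (g ⁻¹ ∙ h ≡ ε ⊎ g ⁻¹ ∙ h ≡ z b)
        ix g h Yg Yh ng nh = Y-mul (λ c xc → W-inv (Yg c xc)) Yh , subst (λ k → k ≡ ε ⊎ k ≡ z b) (grp (z y ∷ g ∷ h ∷ []) [] ((var 0 ⊕ var 1) ⁻ ⊕ (var 0 ⊕ var 2)) (var 1 ⁻ ⊕ var 2) refl) (quot (big Yg ng) (big Yh nh))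
          where
          ib : z b ⁻¹ ≡ z b
          ib = grp (z b ∷ []) (ι 0 (z-sq tb) ∷ []) (var 0 ⁻) (var 0) refl
          quot : ∀ {k l} → k ≡ ε ⊎ k ≡ z b → l ≡ ε ⊎ l ≡ z b → k ⁻¹ ∙ l ≡ ε ⊎ k ⁻¹ ∙ l ≡ z b
          quot (inj₁ refl) (inj₁ refl) = inj₁ (invˡ _)
          quot (inj₂ refl) (inj₂ refl) = inj₁ (invˡ _)
          quot (inj₁ refl) (inj₂ refl) = inj₂ (grp (z b ∷ []) [] (e0 ⁻ ⊕ var 0) (var 0) refl)
          quot (inj₂ refl) (inj₁ refl) = inj₂ (trans (idʳ _) ib)

-- Even critical distance at least six: shifting critical paths

module VertexEven (S : Setting) (D : S3Data S) {t : Bool} (F : S3.NFam S D t) where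
  open FourEnd S D F public

  module Even (j : ℕ) (mn : ∀ m → m < suc (suc (suc (suc (suc (suc j))))) → ¬ Out m) where
    e : ℕ
    e = suc (suc (suc (suc j)))
    open Min e mn public

    le4 : ∀ {n} → 4 ≤ suc (suc (suc (suc n)))
    le4 = s≤s (s≤s (s≤s (s≤s z≤n)))

    module End (p : Ray) (Kp : K p) (tk : T t (pt p k)) {u′ : V} (su : St (pt p k) (pt p (suc e)) (pt p (suc k)) u′) where
      z₀ ρ : G
      z₀ = z (pt p 0)
      ρ = z (pt p (suc (suc k)))
      tp : T t (pt p 0)
      tp = proj₁ Kp
      tρ : T t (pt p (suc (suc k)))
      tρ = T² (stp p k) (stp p (suc k)) tk
      fk : z₀ ▹ pt p k ≡ pt p k
      fk = nearF ≤-refl tp (rw p k)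
      swp : z₀ ▹ pt p (suc k) ≡ u′ × z₀ ▹ u′ ≡ pt p (suc k)
      swp = notQ su fk (nearF (n≤1+n _) tp (rw p (suc e))) (proj₂ Kp)
      opp : V
      opp = z₀ ▹ pt p (suc (suc k))
      opp-adj : Adj u′ opp
      opp-adj = subst (λ x → Adj x opp) (proj₁ swp) (actA z₀ (stp p (suc k)))
      opp≢ : opp ≢ pt p k
      opp≢ x = nbt p k (▹-inj z₀ (trans x (sym fk)))
      z-opp : z opp ≡ z₀ ∙ ρ ∙ z₀ ⁻¹
      z-opp = z-conj z₀ tρ refl
      nc : ¬ Comm z₀ ρ
      nc c = cousins tk (₂ su) (₃ su) (b≢c su) (stp p (suc k)) (nbt p k) opp-adj opp≢
        (sym (trans z-opp (trans (cong (_∙ z₀ ⁻¹) c) (grp (z₀ ∷ ρ ∷ []) [] (var 1 ⊕ var 0 ⊕ var 0 ⁻) (var 1) refl))))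
      ρ₃ : Q (pt p 3) ρ
      ρ₃ = nearQ ≤-refl tρ (walk-rev (rw (tl (tl (tl p))) (suc e)))
      ρ₂ : ρ ▹ pt p 2 ≡ pt p 2
      ρ₂ = nearF ≤-refl tρ (walk-rev (rw (tl (tl p)) k))

    end-star : ∀ p → ∃ λ u′ → St (pt p k) (pt p (suc e)) (pt p (suc k)) u′
    end-star p = third (symA (stp p (suc e))) (stp p k) (≢-sym (nbt p (suc e)))

    module _ (even : ∀ {u v s} → T s u → Walk k u v → T s v) where
      Tk : ∀ p → T t (pt p 0) → T t (pt p k)
      Tk p tp = even tp (rw p k)

      -- If `ρ` fixed the neighbours of `pt p 2`, it would move `pt p 0`, and this swap would make
      -- all rays critical, also the one from `pt p 2`. But `z (pt p 2)` would then be a product of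
      -- `ρ` and a conjugate of it, both too close to the end of that ray to act there.
      rev-out : ∀ p → K p → ¬ Q (pt p 2) (z (pt p (suc (suc k))))
      rev-out p Kp q = go (end-star p) (third (stp p 1) (symA (stp p 0)) (nbt p 0)) (rev (suc (suc k)) p)
        where
        go : (∃ λ u′ → St (pt p k) (pt p (suc e)) (pt p (suc k)) u′) → (∃ λ v → St (pt p 1) (pt p 2) (pt p 0) v) →
             (Σ Ray λ r → (∀ i l → i + l ≡ suc (suc k) → pt r i ≡ pt p l) × pt r 1 ≢ pt p (suc (suc (suc k)))) → ⊥
        go (u′ , su) (v , sv) (r , f , _) = contra (swap? ρ sv ρ₁ (fix q))
          where
          open End p Kp (Tk p (proj₁ Kp)) su
          ρ₁ : ρ ▹ pt p 1 ≡ pt p 1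
          ρ₁ = fixₙ q (pt p 1) (symA (stp p 1))
          contra : _ → ⊥
          contra (inj₁ (e₀ , _)) = nc (sym (z-comm tp e₀))
          contra (inj₂ (e₀ , _)) = proj₂ (K-all (K-swap p Kp) (swap-tl sw) p Kp (tl (tl p)) (T² (stp p 0) (stp p 1) tp))
              (subst (Q _) z₂ (Q-∙ (nearQ (s≤s le4) (T-act z₀ tρ) (symA opp-adj ▸ symA (₃ su) ▸ stp p k ▸ stp p (suc k) ▸ stay)) (zQ tρ)))
            where
            r₀ : pt r 0 ≡ pt p (suc (suc k))
            r₀ = f 0 _ refl
            below : ∀ i → i ≤ suc k → ρ ▹ pt r i ≡ pt r i
            below i le with i ≟ℕ suc k
            ... | yes refl = subst (λ x → ρ ▹ x ≡ x) (sym (f (suc k) 1 (+-comm (suc k) 1))) ρ₁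
            ... | no ne = nearF (≤-pred (≤∧≢⇒< le ne)) tρ (subst (λ x → Walk i x (pt r i)) r₀ (rw r i))
            sw : Swap t (suc k)
            sw = r , subst (T t) (sym r₀) tρ , ρ , below , λ x → b≢c sv (trans (sym (subst (λ w → ρ ▹ w ≡ w) (f (suc (suc k)) 0 (+-identityʳ _)) x)) e₀)
            z₂ : z opp ∙ ρ ≡ z (pt p 2)
            z₂ = trans (cong (_∙ ρ) z-opp) (trans (grp (z₀ ∷ ρ ∷ []) (ι 0 (z-sq tp) ∷ ι 1 (z-sq tρ) ∷ []) ((var 0 ⊕ var 1 ⊕ var 0 ⁻) ⊕ var 1) (var 0 ⊕ (var 1 ⊕ var 0 ⊕ var 1 ⁻)) refl)
              (trans (cong (z₀ ∙_) (sym (z-conj ρ tp e₀))) (nat (T-adj (stp p 0) tp) (st-231 sv))))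

      K-rev : ∀ p → K p → ∀ q → pt q 0 ≡ pt p (suc (suc k)) → pt q k ≡ pt p 2 → K q
      K-rev p Kp q e₀ eₖ = subst (T t) (sym e₀) (T² (stp p k) (stp p (suc k)) (Tk p (proj₁ Kp)))
        , λ x → rev-out p Kp (subst (λ v → Q v _) eₖ (subst (λ v → Q _ (z v)) e₀ x))

      -- The reversed path is critical as far as `pt p 2` only, so the first two vertices may be
      -- exchanged before reversing back.
      K-core : ∀ p → K p → ∀ r → (∀ i → i ≤ e → pt r (suc (suc i)) ≡ pt p (suc (suc i))) → K r
      K-core p Kp r h = tr , λ x → rev-out q (K-rev p Kp q (f 0 _ refl) (f k 2 (+-comm k 2)))
           (subst (λ v → Q v (z (pt q (suc (suc k))))) (trans (h e ≤-refl) (sym (f 2 k refl))) (subst (λ v → Q _ (z v)) (sym (f (suc (suc k)) 0 (+-identityʳ _))) x))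
        where
        p′ : Ray
        p′ = cons (pt r 0) (cons (pt r 1) (tl (tl p)) (subst (Adj (pt r 1)) (h 0 z≤n) (stp r 1)) λ x → nbt r 1 (trans (h 1 (s≤s z≤n)) x)) (stp r 0) λ x → nbt r 0 (trans (h 0 z≤n) x)
        q : Ray
        q = proj₁ (rev (suc (suc k)) p′)
        f : ∀ i l → i + l ≡ suc (suc k) → pt q i ≡ pt p′ l
        f = proj₁ (proj₂ (rev (suc (suc k)) p′))
        tr : T t (pt r 0)
        tr = T² (symA (stp r 1)) (symA (stp r 0)) (subst (T t) (sym (h 0 z≤n)) (T² (stp p 0) (stp p 1) (proj₁ Kp)))

      -- If the ray s is not critical but its shift is, then conjugation by ρ shows that the involutions near s₃ generate the same
      -- group as those near the other neighbour m of s₄.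
      module Shift (s : Ray) (Kt : K (tl (tl s))) (q : Q (pt s k) (z (pt s 0)))
          {m n u′ : V} (sm : St (pt s 4) (pt s 5) (pt s 3) m) (sn : St (pt s 3) (pt s 4) (pt s 2) n) (su : St (pt s (suc (suc k))) (pt s (suc k)) (pt s (suc (suc (suc k)))) u′) where
        open End (tl (tl s)) Kt (Tk (tl (tl s)) (proj₁ Kt)) su
        t₀ : T t (pt s 0)
        t₀ = T² (symA (stp s 1)) (symA (stp s 0)) tp
        t₄ : T t (pt s 4)
        t₄ = T² (stp s 2) (stp s 3) tp
        tn : T t n
        tn = T² (symA (₁ sn)) (₃ sn) t₄
        ρm : ρ ▹ pt s 3 ≡ m
        ρm = proj₁ (notQ sm ρ₂ (fix ρ₃) (rev-out (tl (tl s)) Kt))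
        -- A swap of length k - 1 would make every ray critical, but `z (pt s 0)` acts trivially at
        -- `pt s k`.
        no-swap : ¬ Swap t (suc e)
        no-swap sw = proj₂ (K-all (K-swap (tl (tl s)) Kt) sw (tl (tl s)) Kt s t₀) q
        to-m : ∀ {y} → T t y → Adj y (pt s 3) → Gen 3 m (z y)
        to-m ty a = gen-one (a ▸ stp s 3 ▸ ₃ sm ▸ stay) ty
        by-ρ : ∀ {y} → T t y → Walk 3 y (pt s 3) → Gen 3 m (z (ρ ▹ y))
        by-ρ ty w = gen-one (subst (Walk 3 _) ρm (walk-act ρ w)) (T-act ρ ty)
        rn : Ray
        rn = cons n (tl (tl (tl s))) (symA (₃ sn)) λ x → a≢c sn x
        Kn : K rn
        Kn = K-core (tl (tl s)) Kt rn λ _ _ → refl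
        zn : z n ▹ pt s (suc (suc (suc k))) ≡ u′ × z n ▹ u′ ≡ pt s (suc (suc (suc k)))
        zn = notQ su (nearF ≤-refl tn (rw rn k)) (nearF (n≤1+n _) tn (rw rn (suc e))) (proj₂ Kn)

        module Behind {y a : V} (ty : T t y) (ya : Adj y a) (as : Adj a (pt s 2)) (a≢ : a ≢ pt s 3) (y≢ : y ≢ pt s 2) where
          ry : Ray
          ry = cons y (cons a (tl (tl s)) as λ x → a≢ (sym x)) ya λ x → y≢ (sym x)
          qk : Q (pt s k) (z y)
          qk = Q-stable λ nq → proj₂ (K-core ry (ty , nq) s λ _ _ → refl) q
          fy : ∀ i → i ≤ suc k → z y ▹ pt ry i ≡ pt ry i
          fy i le with i ≟ℕ suc k
          ... | yes refl = fixₙ qk _ (stp s k)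
          ... | no ne = nearF (≤-pred (≤∧≢⇒< le ne)) ty (rw ry i)
          fe : z y ▹ pt s (suc (suc k)) ≡ pt s (suc (suc k))
          fe = decidable-stable (_ ≟ⱽ _) λ ne → no-swap (swap-tl (ry , ty , z y , fy , ne))
          fy′ : ∀ i → i ≤ suc (suc k) → z y ▹ pt ry i ≡ pt ry i
          fy′ i le with i ≟ℕ suc (suc k)
          ... | yes refl = fe
          ... | no ne = fy i (≤-pred (≤∧≢⇒< le ne))
          wy : Walk 3 y (pt s 3)
          wy = ya ▸ as ▸ stp s 2 ▸ stay
          fixed : z y ▹ pt s (suc (suc (suc k))) ≡ pt s (suc (suc (suc k))) → Gen 3 m (z y)
          fixed f₃ = subst (Gen 3 m) (trans (z-conj ρ ty refl) (trans (cong (_∙ ρ ⁻¹) (sym (z-comm tρ f₄))) (grp (z y ∷ ρ ∷ []) [] (var 0 ⊕ var 1 ⊕ var 1 ⁻) (var 0) refl))) (by-ρ ty wy)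
            where
            fy″ : ∀ i → i ≤ suc (suc (suc k)) → z y ▹ pt ry i ≡ pt ry i
            fy″ i le with i ≟ℕ suc (suc (suc k))
            ... | yes refl = f₃
            ... | no ne = fy′ i (≤-pred (≤∧≢⇒< le ne))
            f₄ : z y ▹ pt s (suc (suc (suc (suc k)))) ≡ pt s (suc (suc (suc (suc k))))
            f₄ = decidable-stable (_ ≟ⱽ _) λ ne → no-swap (swap-tl (swap-tl (ry , ty , z y , fy″ , ne)))
          -- `z n` makes the same exchange, so `z n ∙ z y` fixes the path; by `no-swap` it fixes the
          -- vertex of `ρ` too. It commutes with `ρ`, and this expresses `z y` by involutions near
          -- `m`.
          swapped : z y ▹ pt s (suc (suc (suc k))) ≡ u′ → Gen 3 m (z y)
          swapped f₃ = subst (Gen 3 m) eq (gen-mul (gen-mul (to-m tn (symA (₃ sn))) (by-ρ tn (symA (₃ sn) ▸ ₃ sn ▸ symA (₃ sn) ▸ stay))) (by-ρ ty wy))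
            where
            h : G
            h = z n ∙ z y
            fh : ∀ i → i ≤ suc k → h ▹ pt s (suc (suc i)) ≡ pt s (suc (suc i))
            fh zero _ = fix-∙ (nearF (s≤s (s≤s z≤n)) tn (symA (₃ sn) ▸ ₂ sn ▸ stay)) (nearF (s≤s (s≤s z≤n)) ty (ya ▸ as ▸ stay))
            fh (suc i) le with i ≟ℕ k
            ... | yes refl = ∙▹≡ (z n) (z y) f₃ (proj₂ zn)
            ... | no ne = fix-∙ (nearF (≤∧≢⇒< (≤-pred le) ne) tn (rw rn (suc i))) (fy′ (suc (suc (suc i))) (s≤s (s≤s (≤∧≢⇒< (≤-pred le) ne))))
            f₄ : h ▹ pt s (suc (suc (suc (suc k)))) ≡ pt s (suc (suc (suc (suc k))))
            f₄ = decidable-stable (_ ≟ⱽ _) λ ne → no-swap (swap-tl (tl (tl s) , tp , h , fh , ne))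
            eq : z n ∙ z (ρ ▹ n) ∙ z (ρ ▹ y) ≡ z y
            eq = trans (cong₂ (λ a b → z n ∙ a ∙ b) (z-conj ρ tn refl) (z-conj ρ ty refl)) (trans (grp (z n ∷ ρ ∷ z y ∷ []) [] (var 0 ⊕ (var 1 ⊕ var 0 ⊕ var 1 ⁻) ⊕ (var 1 ⊕ var 2 ⊕ var 1 ⁻)) (var 0 ⊕ (var 1 ⊕ (var 0 ⊕ var 2)) ⊕ var 1 ⁻) refl)
              (trans (cong (λ w → z n ∙ w ∙ ρ ⁻¹) (sym (z-comm tρ f₄))) (grp (z n ∷ ρ ∷ z y ∷ []) (ι 0 (z-sq tn) ∷ []) (var 0 ⊕ ((var 0 ⊕ var 2) ⊕ var 1) ⊕ var 1 ⁻) (var 2) refl)))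
          behind : Gen 3 m (z y)
          behind = [ (λ x → fixed (proj₁ x)) , (λ x → swapped (proj₁ x)) ]′ (swap? (z y) su fe (fixₙ qk _ (stp s k)))

        via₂ : ∀ {y} → T t y → Walk 2 y (pt s 2) → Gen 3 m (z y)
        via₂ {y} ty (_▸_ {v = a} ya (as ▸ stay)) with a ≟ⱽ pt s 3 | y ≟ⱽ pt s 2
        ... | yes refl | _ = to-m ty ya
        ... | no _ | yes refl = to-m ty (stp s 2)
        ... | no a≢ | no y≢ = Behind.behind ty ya as a≢ y≢

        via-n : ∀ {y} → T t y → Walk 2 y n → Gen 3 m (z y)
        via-n {y} ty w = go (qsw t₄ sn)
          where
          go : (∃ λ σ → Q (pt s 4) σ × σ ▹ pt s 2 ≡ n × σ ▹ n ≡ pt s 2) → Gen 3 m (z y)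
          go (σ , qσ , _ , σn) = subst₂G (⁻¹▹ σ (fixₙ qσ m (₃ sm))) (trans (cong (λ x → σ ⁻¹ ∙ x ∙ (σ ⁻¹) ⁻¹) (z-conj σ ty refl)) (grp (σ ∷ z y ∷ []) [] (var 0 ⁻ ⊕ (var 0 ⊕ var 1 ⊕ var 0 ⁻) ⊕ (var 0 ⁻) ⁻) (var 1) refl))
              (gen-conj (σ ⁻¹) (via₂ (T-act σ ty) (subst (Walk 2 _) σn (walk-act σ w))))
            where
            subst₂G : ∀ {x x′ g g′} → x ≡ x′ → g ≡ g′ → Gen 3 x g → Gen 3 x′ g′
            subst₂G refl refl p = p

        sub-m : ∀ {y} → Walk 3 y (pt s 3) → T t y → Gen 3 m (z y)
        sub-m {y} w ty = go (unsnocW w)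
          where
          go : (∃ λ b → Walk 2 y b × Adj b (pt s 3)) → Gen 3 m (z y)
          go (b , w′ , a) = [ (λ { refl → gen-one (w′ ◂ ₃ sm) ty }) , [ (λ { refl → via₂ ty w′ }) , (λ { refl → via-n ty w′ }) ]′ ]′ (only sn b (symA a))

        shift-⊥ : ⊥
        shift-⊥ = z≢ε (pt s 4) t₄ (const-triv {s = not t} (Gen 3) (λ h _ → gen-conj h) (λ _ → gen-Q λ w ty → nearQ (s≤s (s≤s (s≤s (s≤s z≤n)))) ty w)
           (subst (λ c → T c (pt s 4)) (sym (not-not t)) t₄) (st-231 sm) (λ g → gen-sub sub-m) _ (gen-one (₂ sm ▸ symA (₂ sm) ▸ ₂ sm ▸ stay) t₄))

      shiftˡ : ∀ s → K (tl (tl s)) → K s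
      shiftˡ s Kt = T² (symA (stp s 1)) (symA (stp s 0)) (proj₁ Kt) , λ q → Shift.shift-⊥ s Kt q
        (proj₂ (third (stp s 4) (symA (stp s 3)) (nbt s 3))) (proj₂ (third (stp s 3) (symA (stp s 2)) (nbt s 2))) (proj₂ (end-star (tl (tl s))))

      shiftʳ : ∀ s → K s → K (tl (tl s))
      shiftʳ s Ks = K-rev q (shiftˡ q (K-rev s Ks (tl (tl q)) (f 2 (suc (suc k)) refl) (f (suc (suc k)) 2 (cong (λ x → suc (suc x)) (+-comm k 2))))) (tl (tl s))
          (sym (f (suc (suc k)) 2 (cong (λ x → suc (suc x)) (+-comm k 2)))) (sym (f 2 (suc (suc k)) refl))
        where
        n : ℕ
        n = suc (suc (suc (suc k)))
        q : Ray
        q = proj₁ (rev n s)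
        f : ∀ i l → i + l ≡ n → pt q i ≡ pt s l
        f = proj₁ (proj₂ (rev n s))

-- Even distance: the commutator of the ends of a long path

module VertexEvenEnd (S : Setting) (D : S3Data S) {t : Bool} (F : S3.NFam S D t) where
  open VertexEven S D F public

  module EvenEnd (j : ℕ) (mn : ∀ m → m < suc (suc (suc (suc (suc (suc j))))) → ¬ Out m)
                 (even : ∀ {u v s} → T s u → Walk (suc (suc (suc (suc (suc (suc j)))))) u v → T s v) where
    open Even j mn public
    tl² : Ray → Ray
    tl² p = tl (tl p)

    private
      k≡ : ∀ {n} → n ≤ 6 → n ≤ k
      k≡ le = ≤-trans le (s≤s (s≤s (s≤s (s≤s (s≤s (s≤s z≤n))))))

    -- A product of two involutions two steps from `b`, one behind each neighbour other than `x`.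
    -- Siblings differ by `z b`, so ω is determined up to that factor.
    record R (x b : V) (ω : G) : Set where
      constructor mkR
      field
        {m m′ u u′} : V
        sb : St b x m m′
        f : Far x b m u
        f′ : Far x b m′ u′
        ω≡ : ω ≡ z u ∙ z u′

    R-act : ∀ g {x b x′ b′ ω} → T t b → g ▹ x ≡ x′ → g ▹ b ≡ b′ → R x b ω → R x′ b′ (g ∙ ω ∙ g ⁻¹)
    R-act g tb refl refl (mkR {u = u} {u′} sb f f′ refl) = mkR (st-act g sb) (far-act g f) (far-act g f′)
      (trans (grp (g ∷ z u ∷ z u′ ∷ []) [] (var 0 ⊕ (var 1 ⊕ var 2) ⊕ var 0 ⁻) ((var 0 ⊕ var 1 ⊕ var 0 ⁻) ⊕ (var 0 ⊕ var 2 ⊕ var 0 ⁻)) refl)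
        (sym (cong₂ _∙_ (z-conj g (far-T f tb) refl) (z-conj g (far-T f′ tb) refl))))

    far-c2 : ∀ {x b m u} → T t b → Far x b m u → Comm (z b) (z u)
    far-c2 tb f = nearC (k≡ (s≤s (s≤s z≤n))) tb (far-T f tb) (ym f ▸ mu f ▸ stay)

    far-c4 : ∀ {x b m u m′ u′} → T t b → Far x b m u → Far x b m′ u′ → Comm (z u) (z u′)
    far-c4 tb f f′ = nearC (k≡ (s≤s (s≤s (s≤s (s≤s z≤n))))) (far-T f tb) (far-T f′ tb) (walk++ (far-w f) (ym f′ ▸ mu f′ ▸ stay))

    far-same : ∀ {b m u v} → T t b → Adj b m → Adj m u → u ≢ b → Adj m v → v ≢ b → z v ≡ z u ⊎ z v ≡ z b ∙ z u
    far-same tb bm mu ub mv vb with third (symA bm) mu (≢-sym ub)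
    ... | c , s = [ (λ e → inj₁ (cong z e)) , (λ e → inj₂ (trans (cong z e) (sym (nat (T-adj bm tb) s)))) ]′ (st-two s mv vb)

    R-unique : ∀ {x b ω ω′} → T t b → R x b ω → R x b ω′ → ω′ ≡ ω ⊎ ω′ ≡ ω ∙ z b
    R-unique {x} {b} {ω} {ω′} tb (mkR {m} {m′} {u} {u′} sb f f′ ω≡) (mkR {l} {l′} {v} {v′} sc g g′ ω′≡) =
        [ (λ { refl → fin sc g g′ ω′≡ }) , (λ { refl → swp (st-uniq (st-132 sb) (₃ sc) (≢-sym (a≢c sc)) (≢-sym (b≢c sc))) sc g g′ }) ]′ (st-two sb (₂ sc) (≢-sym (a≢b sc)))
      where
      facts : List (WithFacts.Fact (z u ∷ z u′ ∷ z b ∷ []))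
      facts = ι 2 (z-sq tb) ∷ κ 2 0 (far-c2 tb f) ∷ κ 2 1 (far-c2 tb f′) ∷ []
      fin : ∀ {l′ v v′} → St b x m l′ → Far x b m v → Far x b l′ v′ → ω′ ≡ z v ∙ z v′ → ω′ ≡ ω ⊎ ω′ ≡ ω ∙ z b
      fin {l′} {v} {v′} sc g g′ e = go (st-uniq sb (₃ sc) (≢-sym (a≢c sc)) (≢-sym (b≢c sc))) g′
        where
        go : l′ ≡ m′ → Far x b l′ v′ → ω′ ≡ ω ⊎ ω′ ≡ ω ∙ z b
        go refl g′ = cases (far-same tb (ym f) (mu f) (u≢y f) (mu g) (u≢y g)) (far-same tb (ym f′) (mu f′) (u≢y f′) (mu g′) (u≢y g′))
          where
          cases : z v ≡ z u ⊎ z v ≡ z b ∙ z u → z v′ ≡ z u′ ⊎ z v′ ≡ z b ∙ z u′ → ω′ ≡ ω ⊎ ω′ ≡ ω ∙ z b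
          cases (inj₁ p) (inj₁ q) = inj₁ (trans e (trans (cong₂ _∙_ p q) (sym ω≡)))
          cases (inj₂ p) (inj₂ q) = inj₁ (trans e (trans (cong₂ _∙_ p q) (trans (grp (z u ∷ z u′ ∷ z b ∷ []) facts ((var 2 ⊕ var 0) ⊕ (var 2 ⊕ var 1)) (var 0 ⊕ var 1) refl) (sym ω≡))))
          cases (inj₁ p) (inj₂ q) = inj₂ (trans e (trans (cong₂ _∙_ p q) (trans (grp (z u ∷ z u′ ∷ z b ∷ []) facts (var 0 ⊕ (var 2 ⊕ var 1)) ((var 0 ⊕ var 1) ⊕ var 2) refl) (cong (_∙ z b) (sym ω≡)))))
          cases (inj₂ p) (inj₁ q) = inj₂ (trans e (trans (cong₂ _∙_ p q) (trans (grp (z u ∷ z u′ ∷ z b ∷ []) facts ((var 2 ⊕ var 0) ⊕ var 1) ((var 0 ⊕ var 1) ⊕ var 2) refl) (cong (_∙ z b) (sym ω≡)))))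
      swp : ∀ {l l′} → l′ ≡ m → St b x l l′ → Far x b l v → Far x b l′ v′ → ω′ ≡ ω ⊎ ω′ ≡ ω ∙ z b
      swp refl sc g g′ = fin (st-132 sc) g′ g (trans ω′≡ (far-c4 tb g g′))

    conj-comm : ∀ {g w} → g ∙ w ∙ g ⁻¹ ≡ w → Comm g w
    conj-comm {g} {w} e = trans (grp (g ∷ w ∷ []) [] (var 0 ⊕ var 1) ((var 0 ⊕ var 1 ⊕ var 0 ⁻) ⊕ var 0) refl) (cong (_∙ g) e)

    comm-conj′ : ∀ {g w} → Comm g w → g ∙ w ∙ g ⁻¹ ≡ w
    comm-conj′ {g} {w} e = trans (cong (_∙ g ⁻¹) e) (grp (g ∷ w ∷ []) [] (var 1 ⊕ var 0 ⊕ var 0 ⁻) (var 1) refl)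

    -- The conjugates of ω form a family with one element at each vertex, equal at `b₀` and at `b₁`,
    -- so that `const-triv` applies.
    fixed-trivial : ∀ {x b₀ b₁ b₂ ω σ} → T t b₀ → St x b₀ b₁ b₂ → Q b₀ ω → (∀ g → g ▹ b₀ ≡ b₀ → Comm g ω) → σ ▹ b₀ ≡ b₁ → Comm σ ω → ω ≡ ε
    fixed-trivial {x} {b₀} {b₁} {b₂} {ω} {σ} tb s qω cen₀ σb σω = const-triv A Aeq AQ (T-adj (symA (₁ s)) tb) s sub ω
        (ε , ε▹ b₀ , grp (ω ∷ []) [] (var 0) (e0 ⊕ var 0 ⊕ e0 ⁻) refl)
      where
      A : V → G → Set
      A y g = ∃ λ h → h ▹ b₀ ≡ y × g ≡ h ∙ ω ∙ h ⁻¹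
      Aeq : ∀ h {y g} → T t y → A y g → A (h ▹ y) (h ∙ g ∙ h ⁻¹)
      Aeq h _ (k , refl , refl) = h ∙ k , ∙▹ h k b₀ , grp (h ∷ k ∷ ω ∷ []) [] (var 0 ⊕ (var 1 ⊕ var 2 ⊕ var 1 ⁻) ⊕ var 0 ⁻) ((var 0 ⊕ var 1) ⊕ var 2 ⊕ (var 0 ⊕ var 1) ⁻) refl
      AQ : ∀ {y g} → T t y → A y g → Q y g
      AQ _ (h , refl , refl) = Q-conj h qω
      sub : ∀ g → A b₀ g → A b₁ g
      sub g (h , hb , refl) = σ , σb , trans (comm-conj′ (cen₀ h hb)) (sym (comm-conj′ σω))

    -- The two forms determine ω up to `z b₁` and up to `z b₂`, hence completely, so the stabiliser
    -- of `b₀` and `x` centralises ω; together with `ρ` the whole stabiliser of `b₀` does. An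
    -- element exchanging `b₀` and `b₁` takes ω to ω or to `ω ∙ z b₂`: in the first case
    -- `fixed-trivial` kills ω, in the second `ω ∙ z b₀`.
    central-value : ∀ {x x₁ b₀ b₁ b₂ ω ρ} → T t b₀ → St x b₀ b₁ b₂ → R x b₁ ω → R x b₂ ω → ω ≢ ε → ρ ▹ b₀ ≡ b₀ → ρ ▹ x ≡ x₁ → x₁ ≢ x → Comm ρ ω → ω ≡ z b₀
    central-value {x} {x₁} {b₀} {b₁} {b₂} {ω} {ρ} tb s r₁ r₂ ω≢ ρb ρx x₁≢ ρω = go (st-move tx tx s (st-213 s))
      where
      tx : T (not t) x
      tx = T-adj (symA (₁ s)) tb
      tb₁ : T t b₁
      tb₁ = T-adj′ (₂ s) tx
      tb₂ : T t b₂
      tb₂ = T-adj′ (₃ s) tx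
      both : ∀ {w} → R x b₁ w → R x b₂ w → w ≡ ω
      both p q = [ id , (λ e → [ id , (λ e′ → ⊥-elim (b≢c s (z-sib tx (₂ s) (₃ s) (cancelˡ ω (trans (sym e) e′))))) ]′ (R-unique tb₂ r₂ q)) ]′ (R-unique tb₁ r₁ p)
      arc : ∀ g → g ▹ b₀ ≡ b₀ → g ▹ x ≡ x → Comm g ω
      arc g gb gx = [ (λ e → conj-comm (both (R-act g tb₁ gx (proj₁ e) r₁) (R-act g tb₂ gx (proj₂ e) r₂)))
                    , (λ e → conj-comm (both (R-act g tb₂ gx (proj₂ e) r₂) (R-act g tb₁ gx (proj₁ e) r₁))) ]′ (swap? g s gx gb)
      bx₁ : Adj b₀ x₁
      bx₁ = subst (Adj b₀) ρx (actAf ρ ρb (symA (₁ s)))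
      via : ∀ h g → h ▹ b₀ ≡ b₀ → g ▹ b₀ ≡ b₀ → h ▹ x ≡ g ▹ x → Comm h ω → Comm g ω
      via h g hb gb e c = sym (subst (Comm ω) (grp (h ∷ g ∷ []) [] (var 0 ⊕ (var 0 ⁻ ⊕ var 1)) (var 1) refl)
        (comm-∙ (sym c) (sym (arc (h ⁻¹ ∙ g) (∙▹≡ (h ⁻¹) g gb (⁻¹▹ h hb)) (∙▹≡ (h ⁻¹) g refl (⁻¹▹ h e))))))
      cen₀ : ∀ g → g ▹ b₀ ≡ b₀ → Comm g ω
      cen₀ g gb = at′ (third (symA (₁ s)) bx₁ (≢-sym x₁≢))
        where
        at′ : (∃ λ x₂ → St b₀ x x₁ x₂) → Comm g ω
        at′ (x₂ , sb) = [ (λ e → arc g gb e) , [ (λ e → via ρ g ρb gb (trans ρx (sym e)) ρω) , (λ e → turn′ e (st-move tb tb sb (st-132 sb))) ]′ ]′ (only sb (g ▹ x) (actAf g gb (symA (₁ s))))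
          where
          turn′ : g ▹ x ≡ x₂ → (∃ λ τ → τ ▹ b₀ ≡ b₀ × τ ▹ x ≡ x × τ ▹ x₁ ≡ x₂ × τ ▹ x₂ ≡ x₁) → Comm g ω
          turn′ e (τ , τb , τx , τ₁ , _) = via (τ ∙ ρ) g (fix-∙ τb ρb) gb (trans (∙▹≡ τ ρ ρx τ₁) (sym e)) (sym (comm-∙ (sym (arc τ τb τx)) (sym ρω)))
      qω : ∀ {ω} → R x b₁ ω → Q b₀ ω
      qω (mkR sb f f′ refl) = Q-∙ (one f) (one f′)
        where
        one : ∀ {m u} → Far x b₁ m u → Q b₀ (z u)
        one f = nearQ (k≡ (s≤s le4)) (far-T f tb₁) (walk++ (far-w f) (symA (₂ s) ▸ ₁ s ▸ stay))
      go : (∃ λ σ → σ ▹ x ≡ x × σ ▹ b₀ ≡ b₁ × σ ▹ b₁ ≡ b₀ × σ ▹ b₂ ≡ b₂) → ω ≡ z b₀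
      go (σ , σx , σ₀ , σ₁ , σ₂) = [ (λ e → ⊥-elim (ω≢ (fixed-trivial tb s (qω r₁) cen₀ σ₀ (conj-comm e)))) , late ]′ (R-unique tb₂ r₂ (R-act σ tb₂ σx σ₂ r₂))
        where
        late : σ ∙ ω ∙ σ ⁻¹ ≡ ω ∙ z b₂ → ω ≡ z b₀
        late e = cancelʳ (z b₀) (trans (fixed-trivial tb s (Q-∙ (qω r₁) (zQ tb)) (λ g gb → comm-∙ (cen₀ g gb) (z-comm tb gb)) σ₀ (conj-comm
            (trans (grp (σ ∷ ω ∷ z b₀ ∷ []) [] (var 0 ⊕ (var 1 ⊕ var 2) ⊕ var 0 ⁻) ((var 0 ⊕ var 1 ⊕ var 0 ⁻) ⊕ (var 0 ⊕ var 2 ⊕ var 0 ⁻)) refl)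
              (trans (cong₂ _∙_ e (sym (z-conj σ tb σ₀))) (trans (assoc _ _ _) (cong (ω ∙_) (nat tx (st-321 s)))))))) (sym (z-sq tb)))

    -- The commutator of the involutions at the vertices 0 and k + 2. The two forms below write it
    -- as a product of two involutions near vertex 2 and near vertex k.
    Wc : Ray → G
    Wc r = z (pt r 0) ∙ z (pt r (suc (suc k))) ∙ z (pt r 0) ∙ z (pt r (suc (suc k)))

    Tend : ∀ r → K r → T t (pt r (suc (suc k)))
    Tend r Kr = T² (stp r k) (stp r (suc k)) (Tk even r (proj₁ Kr))

    T₂ : ∀ r → K r → T t (pt r 2)
    T₂ r Kr = T² (stp r 0) (stp r 1) (proj₁ Kr)

    left-form : ∀ r → K r → ∀ {m} → St (pt r 2) (pt r 3) (pt r 1) m → ∃ λ u → Far (pt r 3) (pt r 2) m u × Wc r ≡ z (pt r 0) ∙ z u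
    left-form r Kr {m} s = ρ ▹ pt r 0 , mkFar (₃ s) (≢-sym (a≢c s)) (subst (λ x → Adj x (ρ ▹ pt r 0)) ρm (actA ρ (symA (stp r 0)))) (λ e → nbt r 0 (sym (▹-inj ρ (trans e (sym ρ₂)))))
        , trans (grp (z₀ ∷ ρ ∷ []) (ι 1 (z-sq tρ) ∷ []) (var 0 ⊕ var 1 ⊕ var 0 ⊕ var 1) (var 0 ⊕ (var 1 ⊕ var 0 ⊕ var 1 ⁻)) refl) (cong (z₀ ∙_) (sym (z-conj ρ tp refl)))
      where
      open End r Kr (Tk even r (proj₁ Kr)) (proj₂ (end-star r))
      ρm : ρ ▹ pt r 1 ≡ m
      ρm = proj₁ (notQ s ρ₂ (fix ρ₃) (rev-out even r Kr))

    right-form : ∀ r → K r → ∀ {u′} → St (pt r k) (pt r (suc e)) (pt r (suc k)) u′ → ∃ λ v → Far (pt r (suc e)) (pt r k) u′ v × Wc r ≡ z v ∙ z (pt r (suc (suc k)))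
    right-form r Kr {u′} su = opp , mkFar (₃ su) (≢-sym (a≢c su)) opp-adj opp≢
        , trans (grp (z₀ ∷ ρ ∷ []) (ι 0 (z-sq tp) ∷ []) (var 0 ⊕ var 1 ⊕ var 0 ⊕ var 1) ((var 0 ⊕ var 1 ⊕ var 0 ⁻) ⊕ var 1) refl) (cong (_∙ ρ) (sym z-opp))
      where
      open End r Kr (Tk even r (proj₁ Kr)) su

    end-nc : ∀ r → K r → ¬ Comm (z (pt r 0)) (z (pt r (suc (suc k))))
    end-nc r Kr = End.nc r Kr (Tk even r (proj₁ Kr)) (proj₂ (end-star r))

    right-far : ∀ r → Far (pt r (suc e)) (pt r k) (pt r (suc k)) (pt r (suc (suc k)))
    right-far r = mkFar (stp r k) (nbt r (suc e)) (stp r (suc k)) (nbt r k)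

    Wc² : ∀ r → K r → Wc r ∙ Wc r ≡ ε
    Wc² r Kr with right-form r Kr (proj₂ (end-star r))
    ... | v , f , e = trans (cong₂ _∙_ e e) (grp (z v ∷ z (pt r (suc (suc k))) ∷ []) (ι 0 (z-sq (far-T f tk)) ∷ ι 1 (z-sq (Tend r Kr)) ∷ κ 0 1 (far-c4 tk f (right-far r)) ∷ []) ((var 0 ⊕ var 1) ⊕ (var 0 ⊕ var 1)) e0 refl)
      where
      tk : T t (pt r k)
      tk = Tk even r (proj₁ Kr)

    left-R : ∀ r → K r → R (pt r 3) (pt r 2) (Wc r)
    left-R r Kr = go (third (stp r 2) (symA (stp r 1)) (nbt r 1))
      where
      go : (∃ λ m → St (pt r 2) (pt r 3) (pt r 1) m) → R (pt r 3) (pt r 2) (Wc r)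
      go (m , s) with left-form r Kr s
      ... | u , f , e = mkR s (mkFar (symA (stp r 1)) (≢-sym (nbt r 1)) (symA (stp r 0)) (≢-sym (nbt r 0))) f e

    right-comm : ∀ r → K r → ∀ {y m} → 2 + m ≤ k → T t y → Walk m y (pt r k) → Comm (z y) (Wc r)
    right-comm r Kr {y} le ty w with right-form r Kr (proj₂ (end-star r))
    ... | v , f , eq = subst (Comm (z y)) (sym eq) (comm-∙ (one f) (one (right-far r)))
      where
      one : ∀ {m u} → Far (pt r (suc e)) (pt r k) m u → Comm (z y) (z u)
      one f = nearC (≤-trans (≤-reflexive (+-comm _ 2)) le) ty (far-T f (Tk even r (proj₁ Kr))) (walk++ w (ym f ▸ mu f ▸ stay))

    left-comm : ∀ r → K r → ∀ {y m} → 2 + m ≤ k → T t y → Walk m y (pt r 2) → Comm (z y) (Wc r)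
    left-comm r Kr {y} le ty w = go (left-R r Kr)
      where
      go : R (pt r 3) (pt r 2) (Wc r) → Comm (z y) (Wc r)
      go (mkR _ f f′ eq) = subst (Comm (z y)) (sym eq) (comm-∙ (one f) (one f′))
        where
        one : ∀ {m u} → Far (pt r 3) (pt r 2) m u → Comm (z y) (z u)
        one f = nearC (≤-trans (≤-reflexive (+-comm _ 2)) le) ty (far-T f (T₂ r Kr)) (walk++ w (ym f ▸ mu f ▸ stay))

    shifts : ∀ s → K s → K (tl² s)
    shifts = shiftʳ even

    -- The ray that enters tl⁴ s from the other neighbour of s₅.
    module Bend (s : Ray) (Ks : K s) where
      K₂ : K (tl² s)
      K₂ = shifts s Ks
      K₄ : K (tl² (tl² s))
      K₄ = shifts (tl² s) K₂
      tn = third (stp s 5) (symA (stp s 4)) (nbt s 4)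
      n : V
      n = proj₁ tn
      sn : St (pt s 5) (pt s 6) (pt s 4) n
      sn = proj₂ tn
      oc = other (symA (₃ sn))
      c : V
      c = proj₁ oc
      oa = other (symA (proj₁ (proj₂ oc)))
      a : V
      a = proj₁ oa
      r₂ : Ray
      r₂ = cons n (tl (tl (tl (tl (tl s))))) (symA (₃ sn)) (a≢c sn)
      r : Ray
      r = cons a (cons c r₂ (symA (proj₁ (proj₂ oc))) (λ x → proj₂ (proj₂ oc) (sym x))) (symA (proj₁ (proj₂ oa))) (λ x → proj₂ (proj₂ oa) (sym x))
      Kr₂ : K r₂
      Kr₂ = K-core even (tl² (tl² s)) K₄ r₂ λ _ _ → refl
      Kr : K r
      Kr = shiftˡ even r Kr₂

      -- The shifted ray gives the form `R` at `pt s 4`, the bent one at `n`. Both are neighbours of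
      -- `pt s 5`, whose third neighbour `pt s 6` carries the value.
      middle : Wc r ≡ Wc (tl² s) → Wc (tl² s) ≡ z (pt s 6)
      middle e = central-value t₆ sn (left-R (tl² s) K₂) (subst (R (pt s 5) n) e (left-R r Kr))
          (λ x → end-nc (tl² s) K₂ (trans (grp (A ∷ B ∷ []) (ι 0 (z-sq (proj₁ K₂)) ∷ ι 1 (z-sq (Tend (tl² s) K₂)) ∷ []) (var 0 ⊕ var 1) ((var 0 ⊕ var 1 ⊕ var 0 ⊕ var 1) ⊕ (var 1 ⊕ var 0)) refl) (trans (cong (_∙ (B ∙ A)) x) (idˡ _))))
          fρ₆ mv₅ m≢ (right-comm (tl² s) K₂ (k≡ (s≤s (s≤s le4))) tρ (symA (stp s (suc (suc (suc (suc (suc k)))))) ▸ symA (stp s (suc (suc (suc (suc k))))) ▸ symA (stp s (suc (suc (suc k)))) ▸ symA (stp s (suc (suc k))) ▸ stay))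
        where
        A B : G
        A = z (pt s 2)
        B = z (pt s (suc (suc (suc (suc k)))))
        t₆ : T t (pt s 6)
        t₆ = T₂ (tl² (tl² s)) K₄
        tρ : T t (pt s (suc (suc (suc (suc (suc (suc k)))))))
        tρ = Tend (tl² (tl² s)) K₄
        open End (tl² (tl² s)) K₄ (Tk even (tl² (tl² s)) (proj₁ K₄)) (proj₂ (end-star (tl² (tl² s)))) using (ρ; ρ₂; ρ₃)
        fρ₆ : ρ ▹ pt s 6 ≡ pt s 6
        fρ₆ = ρ₂
        s₆ = third (stp s 6) (symA (stp s 5)) (nbt s 5)
        mv₅ : ρ ▹ pt s 5 ≡ proj₁ s₆
        mv₅ = proj₁ (notQ (proj₂ s₆) ρ₂ (fix ρ₃) (rev-out even (tl² (tl² s)) K₄))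
        m≢ : proj₁ s₆ ≢ pt s 5
        m≢ x = b≢c (proj₂ s₆) (sym x)

    shift-≢ : ∀ s → K s → z (pt s 6) ≢ z (pt s 8)
    shift-≢ s Ks x = nbt s 6 (sym (z-sib (T-adj (stp s 6) (T₂ (tl² (tl² s)) (shifts (tl² s) (shifts s Ks)))) (symA (stp s 6)) (stp s 7) x))

-- Exclusion of even critical distances from six on

module VertexEvenLong (S : Setting) (D : S3Data S) {t : Bool} (F : S3.NFam S D t) where
  open VertexEvenEnd S D F public

  -- The shifted and the bent commutator can differ only by the involution at vertex k + 2 of `s`.
  -- This would commute with `z (pt s 0)`, since both commutators do, against `end-nc`. So `middle`
  -- applies, and `z (pt s 6)` commutes with an involution that `end-nc` forbids. The distances
  -- involved require k to be at least 8.
  even-8 : ∀ j → (∀ m → m < suc (suc (suc (suc (suc (suc (suc (suc j))))))) → ¬ Out m) →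
           (∀ {u v s} → T s u → Walk (suc (suc (suc (suc (suc (suc (suc (suc j)))))))) u v → T s v) → ¬ Out (suc (suc (suc (suc (suc (suc (suc (suc j))))))))
  even-8 j mn even o = final (out-ray o)
    where
    open EvenEnd (suc (suc j)) mn even
    le8 : ∀ {n} → 8 ≤ suc (suc (suc (suc (suc (suc (suc (suc n)))))))
    le8 = s≤s (s≤s (s≤s (s≤s (s≤s (s≤s (s≤s (s≤s z≤n)))))))
    same : ∀ s (Ks : K s) → Wc (Bend.r s Ks) ≡ Wc (tl² s)
    same s Ks = go (end-star (tl² s))
      where
      open Bend s Ks
      A : G
      A = z (pt s 0)
      ζ B : G
      ζ = z (pt s (suc (suc k)))
      B = z (pt s (suc (suc (suc (suc k)))))
      tk : T t (pt s (suc (suc k)))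
      tk = Tk even (tl² s) (proj₁ K₂)
      c₁ : Comm A (Wc (tl² s))
      c₁ = left-comm (tl² s) K₂ (s≤s (s≤s (s≤s (s≤s (s≤s (s≤s z≤n)))))) (proj₁ Ks) (stp s 0 ▸ stp s 1 ▸ stp s 2 ▸ stp s 3 ▸ stay)
      c₂ : Comm A (Wc r)
      c₂ = left-comm r Kr le8 (proj₁ Ks) (stp s 0 ▸ stp s 1 ▸ stp s 2 ▸ stp s 3 ▸ stp s 4 ▸ ₃ sn ▸ stay)
      go : (∃ λ u′ → St (pt s (suc (suc k))) (pt s (suc k)) (pt s (suc (suc (suc k)))) u′) → Wc r ≡ Wc (tl² s)
      go (u′ , su) = fin (right-form (tl² s) K₂ su) (right-form r Kr su)
        where
        fin : (∃ λ v → Far (pt s (suc k)) (pt s (suc (suc k))) u′ v × Wc (tl² s) ≡ z v ∙ z (pt s (suc (suc (suc (suc k)))))) →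
              (∃ λ v → Far (pt s (suc k)) (pt s (suc (suc k))) u′ v × Wc r ≡ z v ∙ z (pt s (suc (suc (suc (suc k)))))) → Wc r ≡ Wc (tl² s)
        fin (v , f , p) (w , g , q) = [ (λ x → trans q (trans (cong (_∙ B) x) (sym p))) , (λ x → ⊥-elim (end-nc s Ks (late x))) ]′ (far-same tk (ym f) (mu f) (u≢y f) (mu g) (u≢y g))
          where
          late : z w ≡ ζ ∙ z v → Comm A ζ
          late x = subst (Comm A) (trans (cong (_∙ Wc (tl² s) ⁻¹) (trans q (trans (cong (_∙ B) x) (trans (assoc _ _ _) (cong (ζ ∙_) (sym p))))))
            (grp (ζ ∷ Wc (tl² s) ∷ []) [] ((var 0 ⊕ var 1) ⊕ var 1 ⁻) (var 0) refl)) (comm-∙ c₂ (comm-inv c₁))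
    final : Σ Ray K → ⊥
    final (s , Ks) = end-nc (tl² (tl² (tl² s))) K₆ (sym (subst (Comm _) (Bend.middle s Ks (same s Ks))
        (right-comm (tl² s) (shifts s Ks) le8 (Tend (tl² (tl² (tl² s))) K₆)
          (symA (stp s (suc (suc (suc (suc (suc (suc (suc k)))))))) ▸ symA (stp s (suc (suc (suc (suc (suc (suc k))))))) ▸ symA (stp s (suc (suc (suc (suc (suc k)))))) ▸ symA (stp s (suc (suc (suc (suc k)))))
           ▸ symA (stp s (suc (suc (suc k)))) ▸ symA (stp s (suc (suc k))) ▸ stay))))
      where
      K₆ : K (tl² (tl² (tl² s)))
      K₆ = shifts (tl² (tl² s)) (shifts (tl² s) (shifts s Ks))

  -- The path is too short for the previous argument and is instead reflected by the involution at
  -- `pt s 0`. The commutator along the reflected path is `Sq s`, the square of the commutator at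
  -- distance 10. Reading this from both ends makes `Wc` invariant under the shift by two, and
  -- `middle` yields equal involutions at `pt s 6` and `pt s 8`.
  even-6 : (∀ m → m < 6 → ¬ Out m) → (∀ {u v s} → T s u → Walk 6 u v → T s v) → ¬ Out 6
  even-6 mn even o = final (out-ray o)
    where
    open EvenEnd 0 mn even
    Sq : Ray → G
    Sq s = (z (pt s 0) ∙ z (pt s 10) ∙ z (pt s 0) ∙ z (pt s 10)) ∙ (z (pt s 0) ∙ z (pt s 10) ∙ z (pt s 0) ∙ z (pt s 10))
    right : ∀ s → K s → Wc (tl² s) ≡ Sq s
    right s Ks = go (end-star s) (end-star (tl² s))
      where
      K₂ : K (tl² s)
      K₂ = shifts s Ks
      K₆ : K (tl² (tl² (tl² s)))
      K₆ = shifts (tl² (tl² s)) (shifts (tl² s) K₂)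
      t₁₀ : T t (pt s 10)
      t₁₀ = Tend (tl² s) K₂
      A B : G
      A = z (pt s 0)
      B = z (pt s 10)
      A² : A ∙ A ≡ ε
      A² = z-sq (proj₁ Ks)
      B² : B ∙ B ≡ ε
      B² = z-sq t₁₀
      f₆ : A ▹ pt s 6 ≡ pt s 6
      f₆ = nearF ≤-refl (proj₁ Ks) (rw s 6)
      go : (∃ λ u → St (pt s 6) (pt s 5) (pt s 7) u) → (∃ λ u′ → St (pt s 8) (pt s 7) (pt s 9) u′) → Wc (tl² s) ≡ Sq s
      go (u , s₆) (u′ , s₈) = fin (right-form (tl² s) K₂ s₈) (right-form r Kr s₈)
        where
        open End s Ks (Tk even s (proj₁ Ks)) s₆ using (swp)
        a₇ : A ▹ pt s 7 ≡ u
        a₇ = proj₁ swp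
        ne₇ : pt s 7 ≢ A ▹ pt s 7
        ne₇ x = b≢c s₆ (trans x a₇)
        inj : ∀ {v w} → v ≢ w → A ▹ v ≢ A ▹ w
        inj ne x = ne (▹-inj A x)
        r₁ : Ray
        r₁ = cons (A ▹ pt s 7) (tl² (tl² (tl² s))) (subst (Adj _) f₆ (actA A (symA (stp s 6)))) ne₇
        r₂ : Ray
        r₂ = cons (A ▹ pt s 8) r₁ (actA A (symA (stp s 7))) λ x → inj (nbt s 6) (trans (sym x) (sym f₆))
        r₃ : Ray
        r₃ = cons (A ▹ pt s 9) r₂ (actA A (symA (stp s 8))) λ x → inj (nbt s 7) (sym x)
        r : Ray
        r = cons (A ▹ pt s 10) r₃ (actA A (symA (stp s 9))) λ x → inj (nbt s 8) (sym x)
        Kr : K r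
        Kr = shiftˡ even r (shiftˡ even r₂ (K-ext (tl² (tl² (tl² s))) (tl r₁) K₆ refl refl))
        Wr : Wc r ≡ Sq s
        Wr = trans (cong (λ w → w ∙ B ∙ w ∙ B) (z-conj A t₁₀ refl)) (grp (A ∷ B ∷ []) (ι 0 A² ∷ []) ((var 0 ⊕ var 1 ⊕ var 0 ⁻) ⊕ var 1 ⊕ (var 0 ⊕ var 1 ⊕ var 0 ⁻) ⊕ var 1) ((var 0 ⊕ var 1 ⊕ var 0 ⊕ var 1) ⊕ (var 0 ⊕ var 1 ⊕ var 0 ⊕ var 1)) refl)
        c₁ : Comm A (Wc (tl² s))
        c₁ = left-comm (tl² s) K₂ ≤-refl (proj₁ Ks) (stp s 0 ▸ stp s 1 ▸ stp s 2 ▸ stp s 3 ▸ stay)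
        c₂ : Comm A (Sq s)
        c₂ = conj-comm (trans (grp (A ∷ B ∷ []) (ι 0 A² ∷ ι 1 B² ∷ []) (var 0 ⊕ ((var 0 ⊕ var 1 ⊕ var 0 ⊕ var 1) ⊕ (var 0 ⊕ var 1 ⊕ var 0 ⊕ var 1)) ⊕ var 0 ⁻) (((var 0 ⊕ var 1 ⊕ var 0 ⊕ var 1) ⊕ (var 0 ⊕ var 1 ⊕ var 0 ⊕ var 1)) ⁻) refl)
          (cancelˡ (Sq s) (trans (invʳ _) (sym (trans (cong₂ _∙_ (sym Wr) (sym Wr)) (Wc² r Kr))))))
        ζ : G
        ζ = z (pt s 8)
        fin : (∃ λ v → Far (pt s 7) (pt s 8) u′ v × Wc (tl² s) ≡ z v ∙ B) → (∃ λ v → Far (pt s 7) (pt s 8) u′ v × Wc r ≡ z v ∙ B) → Wc (tl² s) ≡ Sq s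
        fin (v , f , p) (w , g , q) = [ (λ x → trans p (trans (cong (_∙ B) (sym x)) (trans (sym q) Wr))) , (λ x → ⊥-elim (end-nc s Ks (late x))) ]′
            (far-same (Tk even (tl² s) (proj₁ K₂)) (ym f) (mu f) (u≢y f) (mu g) (u≢y g))
          where
          late : z w ≡ ζ ∙ z v → Comm A ζ
          late x = subst (Comm A) (trans (cong (_∙ Wc (tl² s) ⁻¹) (trans (sym Wr) (trans q (trans (cong (_∙ B) x) (trans (assoc _ _ _) (cong (ζ ∙_) (sym p)))))))
            (grp (ζ ∷ Wc (tl² s) ∷ []) [] ((var 0 ⊕ var 1) ⊕ var 1 ⁻) (var 0) refl)) (comm-∙ c₂ (comm-inv c₁))
    left : ∀ s → K s → Wc s ≡ Sq s
    left s Ks = trans (grp (z₀ ∷ z₈ ∷ []) (ι 0 (z-sq (proj₁ Ks)) ∷ ι 1 (z-sq (Tend s Ks)) ∷ []) (var 0 ⊕ var 1 ⊕ var 0 ⊕ var 1) ((var 1 ⊕ var 0 ⊕ var 1 ⊕ var 0) ⁻) refl)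
        (trans (cong _⁻¹ (trans (cong₂ (λ x y → z x ∙ z y ∙ z x ∙ z y) (sym (f 2 8 refl)) (sym (f 10 0 refl))) (trans (right q Kq) (cong₂ (λ x y → (z x ∙ z y ∙ z x ∙ z y) ∙ (z x ∙ z y ∙ z x ∙ z y)) (f 0 10 refl) (f 10 0 refl)))))
        (grp (z₀ ∷ z₁₀ ∷ []) (ι 0 (z-sq (proj₁ Ks)) ∷ ι 1 (z-sq (Tend (tl² s) K₂)) ∷ []) (((var 1 ⊕ var 0 ⊕ var 1 ⊕ var 0) ⊕ (var 1 ⊕ var 0 ⊕ var 1 ⊕ var 0)) ⁻) ((var 0 ⊕ var 1 ⊕ var 0 ⊕ var 1) ⊕ (var 0 ⊕ var 1 ⊕ var 0 ⊕ var 1)) refl))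
      where
      z₀ z₈ z₁₀ : G
      z₀ = z (pt s 0)
      z₈ = z (pt s 8)
      z₁₀ = z (pt s 10)
      K₂ : K (tl² s)
      K₂ = shifts s Ks
      q : Ray
      q = proj₁ (rev 10 s)
      f : ∀ i l → i + l ≡ 10 → pt q i ≡ pt s l
      f = proj₁ (proj₂ (rev 10 s))
      Kq : K q
      Kq = K-rev even (tl² s) K₂ q (f 0 10 refl) (f 6 4 refl)
    same : ∀ s → K s → Wc s ≡ Wc (tl² s)
    same s Ks = trans (left s Ks) (sym (right s Ks))
    bent : ∀ s (Ks : K s) → Wc (Bend.r s Ks) ≡ Wc (tl² s)
    bent s Ks = trans (same r Kr) (trans mid (sym (same (tl² s) K₂)))
      where
      open Bend s Ks
      t₆ : T t (pt s 6)
      t₆ = T₂ (tl² (tl² s)) K₄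
      mid : Wc r₂ ≡ Wc (tl² (tl² s))
      mid = trans (cong (λ w → w ∙ z (pt s 12) ∙ w ∙ z (pt s 12)) (sym (nat (T-adj (symA (₁ sn)) t₆) sn)))
        (grp (z (pt s 6) ∷ z (pt s 4) ∷ z (pt s 12) ∷ []) (ι 0 (z-sq t₆) ∷ κ 0 1 (nearC (s≤s (s≤s z≤n)) t₆ (proj₁ K₄) (symA (stp s 5) ▸ symA (stp s 4) ▸ stay))
            ∷ κ 0 2 (nearC ≤-refl t₆ (Tend (tl² (tl² s)) K₄) (rw (tl² (tl² (tl² s))) 6)) ∷ [])
          ((var 0 ⊕ var 1) ⊕ var 2 ⊕ (var 0 ⊕ var 1) ⊕ var 2) (var 1 ⊕ var 2 ⊕ var 1 ⊕ var 2) refl)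
    final : Σ Ray K → ⊥
    final (s , Ks) = shift-≢ s Ks (trans (sym (Bend.middle s Ks (bent s Ks))) (trans (same (tl² s) K₂) (Bend.middle (tl² s) K₂ (bent (tl² s) K₂))))
      where
      K₂ : K (tl² s)
      K₂ = shifts s Ks

-- The bound has to be better if there are elements reversing an edge.
Outcome : Setting → Set
Outcome S = Bnd S₀ 64 ⊎ (Bnd S₀ 128 × ¬ (∀ s v → T s v))
  where
  open Basics S

-- Collecting the critical distances

module VertexOutcome (S : Setting) (D : S3Data S) {t : Bool} (F : S3.NFam S D t) where
  open FourEnd S D F

  -- For k = 2 and k = 4 the vertices 2 and k - 1 of a critical ray are adjacent. When every vertex
  -- carries both types, `same` gives them equal involutions, against `z-adj`.
  near-swap : ∀ e → (mn : ∀ m → m < suc (suc e) → ¬ Out m) → Out (suc (suc e)) → (∀ (p : Ray) → Adj (pt p 2) (pt p (suc e)) ⊎ Adj (pt p (suc e)) (pt p 2)) → ¬ (∀ s v → T s v)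
  near-swap e mn o adj T∀ = go (Min.out-ray e mn o)
    where
    go : Σ Ray (Min.K e mn) → ⊥
    go (p , Kp) = [ (λ a → z-adj T∀ a same) , (λ a → z-adj T∀ a (sym same)) ]′ (adj p)
      where
      same : z (pt p 2) ≡ z (pt p (suc e))
      same = Min.Ends.same e mn p Kp (T∀ t _) (proj₂ (third (stp p 1) (symA (stp p 0)) (nbt p 0))) (proj₂ (third (symA (stp p (suc e))) (stp p (suc (suc e))) (≢-sym (nbt p (suc e)))))

  vertex-outcome : ¬ ¬ Outcome S
  vertex-outcome k = z≢ε (o t) (To t) (faithful _ λ v → decidable-stable (_ ≟ⱽ _) λ nv →
      least Out _ (o t , v , To t , proj₂ (proj₂ (conn (o t) v)) , λ q → nv (fix q)) λ { (n , on , mn) → k (go n on mn) })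
    where
    go : ∀ n → Out n → (∀ m → m < n → ¬ Out m) → Outcome S
    go 0 (y , .y , ty , stay , nq) mn = ⊥-elim (nq (zQ ty))
    go 1 (y , v , ty , (a ▸ stay) , nq) mn = ⊥-elim (nq (zQ₁ ty a))
    go 2 o mn = inj₂ (two-bound mn o , near-swap 0 mn o λ p → inj₂ (stp p 1))
    go 3 o mn = inj₁ (three-bound mn o)
    go 4 o mn = split4 (FourCases.agree-or-differ mn o)
      where
      split4 : FourCases.EqA mn o ⊎ FourCases.EqB mn o → Outcome S
      split4 (inj₁ eqA) = inj₁ (FourCases.Agree.agree-bound mn o eqA)
      split4 (inj₂ eqB) = inj₂ (DifferEnd.differ-bound mn o eqB , near-swap 2 mn o λ p → inj₁ (stp p 2))
    go 5 o mn = ⊥-elim (OddFar.odd-far 0 mn (λ { tu (a ▸ b ▸ c ▸ d ▸ e ▸ stay) → T-adj e (T² c d (T² a b tu)) }) o)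
    go 6 o mn = ⊥-elim (VertexEvenLong.even-6 S D F mn (λ { tu (a ▸ b ▸ c ▸ d ▸ e ▸ f ▸ stay) → T² e f (T² c d (T² a b tu)) }) o)
    go 7 o mn = ⊥-elim (OddFar.odd-far 2 mn (λ { tu (a ▸ b ▸ c ▸ d ▸ e ▸ f ▸ g ▸ stay) → T-adj g (T² e f (T² c d (T² a b tu))) }) o)
    go (suc (suc (suc (suc (suc (suc (suc (suc j)))))))) o mn with parity (suc (suc (suc (suc (suc (suc (suc (suc j))))))))
    ... | inj₁ even = ⊥-elim (VertexEvenLong.even-8 S D F j mn even o)
    ... | inj₂ odd = ⊥-elim (OddFar.odd-far (suc (suc (suc j))) mn odd o)

module DeepOutcome (S : Setting) (D : S3Data S) where
  open S3 S D

  private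
    16≤64 : 16 ≤ 64
    16≤64 = m≤m+n 16 48

  deep-outcome : ¬ ¬ Outcome S
  deep-outcome k = centre [ (λ triv → k (inj₁ (bnd-mono (s≤s z≤n) (bnd-1 triv)))) , central ]′
    where
    central : (∃ λ ω → Central ω × ω ≢ ε) → ⊥
    central ex = em⊥ (∃ λ ω → ∃ λ t → Central ω × ¬ Q (o t) ω)
      (λ { (ω , t , c , nq) → k (inj₁ (bnd-mono 16≤64 (case0 c (To t) (Ao t) (subst (λ g → ¬ Q (o t) g) (sym (om-base c t)) nq)))) })
      λ none → Families.families S D (λ ω c t → Q-stable λ nq → none (ω , t , c , nq)) ex
        [ (λ { (t , F) → VertexOutcome.vertex-outcome S D F k }) , (λ F → EdgeFamily.edge-bound S D F λ b → k (inj₁ (bnd-mono 16≤64 b))) ]′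

-- Kernels contained in one another

module S3Bound (S : Setting) where
  open Basics S
  open Centre S

  -- If the pointwise stabilisers of the neighbourhoods of the ends of a flag are contained in each other, they are equal and hence trivial.
  shallow-bound : (∀ t {b c} → St (o t) (o (not t)) b c → ∃ λ g → g ▹ o t ≡ o t × g ▹ o (not t) ≡ o (not t) × g ▹ b ≡ c) →
                  ∀ t → (∀ g → Q (o t) g → Q (o (not t)) g) → Bnd S₀ 2
  shallow-bound turn t sub = bnd-Qs sub-S₀ su (λ g h → at′ t h , at′ (not t) h) (bnd-1 λ g h → triv-Q g (proj₂ h))
    where
    at′ : ∀ t {g} → S₀ g → g ▹ o t ≡ o t
    at′ true = proj₁
    at′ false = proj₂
    u v : V
    u = o t
    v = o (not t)
    su = proj₂ (proj₂ (star (Ao t)))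
    vu : Adj v u
    vu = symA (Ao t)
    sv = proj₂ (proj₂ (star vu))
    tv : ∃ λ g → g ▹ v ≡ v × g ▹ u ≡ u × g ▹ _ ≡ _
    tv = subst₂T (not-not t) (turn (not t)) sv
      where
      subst₂T : ∀ {t′} → t′ ≡ t → (∀ {b c} → St v (o t′) b c → ∃ λ g → g ▹ v ≡ v × g ▹ o t′ ≡ o t′ × g ▹ b ≡ c) → ∀ {b c} → St v u b c → ∃ λ g → g ▹ v ≡ v × g ▹ u ≡ u × g ▹ b ≡ c
      subst₂T refl f = f
    h : G
    h = proj₁ tv
    hv : h ▹ v ≡ v
    hv = proj₁ (proj₂ tv)
    hu : h ▹ u ≡ u
    hu = proj₁ (proj₂ (proj₂ tv))
    nq : ¬ Q v h
    nq q = b≢c sv (trans (sym (fixₙ q _ (₂ sv))) (proj₂ (proj₂ (proj₂ tv))))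
    -- If `g` swapped two neighbours of `u`, then `h ∙ g` would lie in `Q u`, hence in `Q v`, and so
    -- would `h`.
    back : ∀ g → Q v g → Q u g
    back g q with Q? su (fixₙ q u vu) (fix q)
    ... | yes p = p
    ... | no ng = ⊥-elim (nq (subst (Q v) (grp (h ∷ g ∷ []) [] ((var 0 ⊕ var 1) ⊕ var 1 ⁻) (var 0) refl) (Q-∙ (sub _ (mkQ₃ su (fix-∙ hu (fixₙ q u vu)) (fix-∙ hv (fix q))
           (∙▹≡ h g (proj₁ (notQ su (fixₙ q u vu) (fix q) ng)) (proj₂ (notQ su hu hv λ qu → nq (sub h qu)))))) (Q-inv q))))
    spin : ∀ {s x a b} → T s x → Adj x a → Adj x b → ∃ λ g → g ▹ x ≡ x × g ▹ a ≡ b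
    spin {s} {x} {a} {b} tx xa xb = m ∙ n ⁻¹ , ∙▹≡ m (n ⁻¹) (⁻¹▹ n (move₁ tx xa)) (move₁ tx xb) , ∙▹≡ m (n ⁻¹) (⁻¹▹ n (move₂ tx xa)) (move₂ tx xb)
      where
      m = move s x b
      n = move s x a
    triv-Q : ∀ g → Q u g → g ≡ ε
    triv-Q = core record { a = u ; b = v ; ab = Ao t ; Y = Q u ; Ya = λ g q → fix q ; Yb = λ g q → fixₙ q v (Ao t)
      ; atA = λ b ub → let g , gu , gv = spin (To t) (Ao t) ub in g , gu , gv , λ y q → Q-back gu q
      ; atB = λ a va → let g , gv , gu = spin (To (not t)) vu va in g , gv , gu , λ y q → back _ (Q-back gv (sub y q)) }

  s3-outcome : (∀ t {b c} → St (o t) (o (not t)) b c → ∃ λ g → g ▹ o t ≡ o t × g ▹ o (not t) ≡ o (not t) × g ▹ b ≡ c) → ¬ ¬ Outcome S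
  s3-outcome turn k = deep-or false λ { (inj₂ s) → shallow false s ; (inj₁ d₀) → deep-or true λ { (inj₂ s) → shallow true s ; (inj₁ d₁) → DeepOutcome.deep-outcome S (record { turn = turn ; deep = λ { false → d₀ ; true → d₁ } }) k } }
    where
    shallow : ∀ t → (∀ g → Q (o t) g → Q (o (not t)) g) → ⊥
    shallow t s = k (inj₁ (bnd-mono (s≤s (s≤s z≤n)) (shallow-bound turn t s)))
    deep-or : ∀ t → ¬ ¬ ((∀ {b c} → St (o (not t)) (o t) b c → ∃ λ g → Q (o t) g × g ▹ b ≡ c) ⊎ (∀ g → Q (o t) g → Q (o (not t)) g))
    deep-or t r = em⊥ (∃ λ g → Q (o t) g × ¬ Q (o (not t)) g)
      (λ { (g , q , nq) → r (inj₁ λ s → g , q , proj₁ (notQ s (fixₙ q _ (Ao t)) (fix q) nq)) })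
      λ none → r (inj₂ λ g q → Q-stable λ nq → none (g , q , nq))

-- Vertices of type t whose flag stabiliser acts trivially on their neighbours, next to vertices where it does not.
module Rigid (S : Setting) (t : Bool) (rigid₀ : ∀ g → Basics.S₀ S g → Basics.Q S (Setting.o S t) g)
    (turn₀ : ∀ {b c} → Basics.St S (Setting.o S (not t)) (Setting.o S t) b c →
       ∃ λ g → Setting._▹_ S g (Setting.o S (not t)) ≡ Setting.o S (not t) × Setting._▹_ S g (Setting.o S t) ≡ Setting.o S t × Setting._▹_ S g b ≡ c) where
  open Basics S public
  open Centre S public

  S₀-of : ∀ s {g} → g ▹ o s ≡ o s → g ▹ o (not s) ≡ o (not s) → S₀ g
  S₀-of true a b = a , b
  S₀-of false a b = b , a

  rigid : ∀ {a x g} → T t a → Adj a x → g ▹ a ≡ a → g ▹ x ≡ x → Q a g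
  rigid {a} {x} {g} ta ax ga gx = subst (λ y → Q y g) m₁ (subst (Q (m ▹ o t)) (conj-conj m g) (Q-conj m (rigid₀ _ (S₀-of t (back m₁ ga) (back m₂ gx)))))
    where
    m : G
    m = move t a x
    m₁ : m ▹ o t ≡ a
    m₁ = move₁ ta ax
    m₂ : m ▹ o (not t) ≡ x
    m₂ = move₂ ta ax
    back : ∀ {u v} → m ▹ u ≡ v → g ▹ v ≡ v → (m ⁻¹ ∙ g ∙ (m ⁻¹) ⁻¹) ▹ u ≡ u
    back e f = subst (λ w → (m ⁻¹ ∙ g ∙ (m ⁻¹) ⁻¹) ▹ w ≡ w) (⁻¹▹ m e) (fix-conj (m ⁻¹) f)

  β-turn : ∀ {x a b c} → T (not t) x → St x a b c → ∃ λ g → g ▹ x ≡ x × g ▹ a ≡ a × g ▹ b ≡ c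
  β-turn {x} {a} {b} {c} tx s = h ∙ w ∙ h ⁻¹ , at′ h₁ (proj₁ (proj₂ tw)) h₁ , at′ h₂ (proj₁ (proj₂ (proj₂ tw))) h₂
      , ∙▹≡ (h ∙ w) (h ⁻¹) refl (∙▹≡ h w (proj₂ (proj₂ (proj₂ tw))) (trans (sym (∙▹ h (h ⁻¹) c)) (trans (cong (_▹ c) (invʳ h)) (ε▹ c))))
    where
    h : G
    h = move (not t) x a
    h₁ : h ▹ o (not t) ≡ x
    h₁ = move₁ tx (₁ s)
    h₂ : h ▹ o t ≡ a
    h₂ = subst (λ q → h ▹ o q ≡ a) (not-not t) (move₂ tx (₁ s))
    base : St (o (not t)) (o t) (h ⁻¹ ▹ b) (h ⁻¹ ▹ c)
    base = subst₂S (⁻¹▹ h h₁) (⁻¹▹ h h₂) (st-act (h ⁻¹) s)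
      where
      subst₂S : ∀ {u u′ v v′ y z} → u ≡ u′ → v ≡ v′ → St u v y z → St u′ v′ y z
      subst₂S refl refl q = q
    tw = turn₀ base
    w : G
    w = proj₁ tw
    at′ : ∀ {u v y} → h ▹ u ≡ v → w ▹ u ≡ u → h ▹ u ≡ y → (h ∙ w ∙ h ⁻¹) ▹ v ≡ y
    at′ e f e′ = ∙▹≡ (h ∙ w) (h ⁻¹) (⁻¹▹ h e) (∙▹≡ h w f e′)

  private
    x₀ α₀ x₁ α₁ : V
    x₀ = o (not t)
    α₀ = o t
    αx : Adj α₀ x₀
    αx = Ao t
    x₁ = proj₁ (other αx)
    αx₁ : Adj α₀ x₁
    αx₁ = proj₁ (proj₂ (other αx))
    α₁ = proj₁ (other (symA αx₁))
    xα₁ : Adj x₁ α₁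
    xα₁ = proj₁ (proj₂ (other (symA αx₁)))
    tx₀ : T (not t) x₀
    tx₀ = To (not t)
    m₀ m₁ : G
    m₀ = move (not t) x₀ α₀
    m₁ = move (not t) x₁ α₁

  γ : G
  γ = m₁ ∙ m₀ ⁻¹

  private
    nn : ∀ {m v} → m ▹ o (not (not t)) ≡ v → m ▹ o t ≡ v
    nn {m} {v} = subst (λ q → m ▹ o q ≡ v) (not-not t)
    γx : γ ▹ x₀ ≡ x₁
    γx = ∙▹≡ m₁ (m₀ ⁻¹) (⁻¹▹ m₀ (move₁ tx₀ (symA αx))) (move₁ (T-adj αx₁ (To t)) xα₁)
    γα : γ ▹ α₀ ≡ α₁
    γα = ∙▹≡ m₁ (m₀ ⁻¹) (⁻¹▹ m₀ (nn (move₂ tx₀ (symA αx)))) (nn (move₂ (T-adj αx₁ (To t)) xα₁))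

  -- The path runs through `xs 0`, `αs 0`, `xs 1`, `αs 1` and so on; the vertices `αs` are the rigid
  -- ones.
  xs αs : ℕ → V
  xs zero = x₀
  xs (suc i) = γ ▹ xs i
  αs zero = α₀
  αs (suc i) = γ ▹ αs i

  xα : ∀ i → Adj (xs i) (αs i)
  xα zero = symA αx
  xα (suc i) = actA γ (xα i)

  αx⁺ : ∀ i → Adj (αs i) (xs (suc i))
  αx⁺ zero = subst (Adj α₀) (sym γx) αx₁
  αx⁺ (suc i) = actA γ (αx⁺ i)

  xs≢ : ∀ i → xs (suc i) ≢ xs i
  xs≢ zero e = proj₂ (proj₂ (other αx)) (trans (sym γx) e)
  xs≢ (suc i) e = xs≢ i (▹-inj γ e)

  αs≢ : ∀ i → αs (suc i) ≢ αs i
  αs≢ zero e = proj₂ (proj₂ (other (symA αx₁))) (trans (sym γα) e)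
  αs≢ (suc i) e = αs≢ i (▹-inj γ e)

  Tα : ∀ i → T t (αs i)
  Tα zero = To t
  Tα (suc i) = T-act γ (Tα i)

  Tx : ∀ i → T (not t) (xs i)
  Tx zero = tx₀
  Tx (suc i) = T-act γ (Tx i)

  x-star : ∀ i → ∃ λ c → St (xs (suc i)) (αs i) (αs (suc i)) c
  x-star i = third (symA (αx⁺ i)) (xα (suc i)) (≢-sym (αs≢ i))

  α-star : ∀ i → ∃ λ c → St (αs i) (xs i) (xs (suc i)) c
  α-star i = third (symA (xα i)) (αx⁺ i) (≢-sym (xs≢ i))

  -- On a nonempty interval rigidity of the last `αs` makes `P a b` fix `xs b` as well, so that an
  -- extension by one index costs only the condition on `αs b`.
  P : ℕ → ℕ → G → Set
  P a b y = ∀ i → a ≤ i → i < b → y ▹ xs i ≡ xs i × y ▹ αs i ≡ αs i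

  P-mul : ∀ {a b g h} → P a b g → P a b h → P a b (g ∙ h)
  P-mul p q i l u = fix-∙ (proj₁ (p i l u)) (proj₁ (q i l u)) , fix-∙ (proj₂ (p i l u)) (proj₂ (q i l u))

  P-inv : ∀ {a b g} → P a b g → P a b (g ⁻¹)
  P-inv p i l u = fix-inv (proj₁ (p i l u)) , fix-inv (proj₂ (p i l u))

  P-mono : ∀ {a b a′ b′ g} → a ≤ a′ → b′ ≤ b → P a b g → P a′ b′ g
  P-mono la lb p i l u = p i (≤-trans la l) (≤-trans u lb)

  P-Q : ∀ {a b g} i → a ≤ i → i < b → P a b g → Q (αs i) g
  P-Q i l u p = rigid (Tα i) (symA (xα i)) (proj₂ (p i l u)) (proj₁ (p i l u))

  P-x : ∀ {a b g} i → a ≤ i → i < b → P a b g → g ▹ xs (suc i) ≡ xs (suc i)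
  P-x i l u p = fixₙ (P-Q i l u p) _ (αx⁺ i)

  P-xQ : ∀ {a b g} i → a ≤ i → suc i < b → P a b g → Q (xs (suc i)) g
  P-xQ i l u p = mkQ₃ (proj₂ (x-star i)) (P-x i l (<⇒≤ u) p) (proj₂ (p i l (<⇒≤ u))) (proj₂ (p (suc i) (m≤n⇒m≤1+n l) u))

  P-shift : ∀ {a b g} → P a b g → P (suc a) (suc b) (γ ∙ g ∙ γ ⁻¹)
  P-shift p (suc i) (s≤s l) (s≤s u) = fix-conj γ (proj₁ (p i l u)) , fix-conj γ (proj₂ (p i l u))

  P-back : ∀ {a b g} → P (suc a) (suc b) g → P a b (γ ⁻¹ ∙ g ∙ γ)
  P-back p i l u = pull (proj₁ (p (suc i) (s≤s l) (s≤s u))) , pull (proj₂ (p (suc i) (s≤s l) (s≤s u)))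
    where
    pull : ∀ {g v} → g ▹ (γ ▹ v) ≡ γ ▹ v → (γ ⁻¹ ∙ g ∙ γ) ▹ v ≡ v
    pull {g} {v} e = ∙▹≡ (γ ⁻¹ ∙ g) γ refl (∙▹≡ (γ ⁻¹) g e (⁻¹▹ γ refl))

  P-up : ∀ {a b g} → a ≤ b → P a (suc b) g → g ▹ αs (suc b) ≡ αs (suc b) → P a (suc (suc b)) g
  P-up {a} {b} le p e i l u with i ≟ℕ suc b
  ... | yes refl = P-x b le ≤-refl p , e
  ... | no ne = p i l (≤∧≢⇒< (≤-pred u) ne)

  P-down : ∀ {a b g} → suc a < b → P (suc a) b g → g ▹ αs a ≡ αs a → P a b g
  P-down {a} {b} lt p e i l u with i ≟ℕ a
  ... | yes refl = fixₙ q (xs a) (symA (xα a)) , e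
    where q = rigid (Tα a) (αx⁺ a) e (proj₁ (p (suc a) ≤-refl lt))
  ... | no ne = p i (≤∧≢⇒< l (≢-sym ne)) u

  -- Since vertices of type t are rigid, an element rotating their neighbours has no fixed neighbour.
  rotates : ∀ {a x x′ x″ ρ} → T t a → St a x x′ x″ → ρ ▹ a ≡ a → ρ ▹ x ≡ x′ → ρ ▹ x′ ≡ x″ × ρ ▹ x″ ≡ x
  rotates {a} {x} {x′} {x″} {ρ} ta s ρa ρ₀ = ρ₁ , st-uniq (st-231 s) (actAf ρ ρa (₃ s)) (λ e → a≢c s (▹-inj ρ (trans ρ₀ (sym e)))) (λ e → b≢c s (▹-inj ρ (trans ρ₁ (sym e))))
    where
    ne₀ : ρ ▹ x′ ≢ x
    ne₀ e = a≢b s (trans (sym (fixₙ (rigid ta (₃ s) ρa (st-uniq s (actAf ρ ρa (₃ s)) (λ f → b≢c s (▹-inj ρ (trans e (sym f)))) (λ f → a≢c s (▹-inj ρ (trans ρ₀ (sym f)))))) _ (₁ s))) ρ₀)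
    ρ₁ : ρ ▹ x′ ≡ x″
    ρ₁ = st-uniq s (actAf ρ ρa (₂ s)) ne₀ λ e → a≢b s (▹-inj ρ (trans ρ₀ (sym e)))

  rotation : ∀ {a x x′ x″} → T t a → St a x x′ x″ → ∃ λ ρ → ρ ▹ a ≡ a × ρ ▹ x ≡ x′ × ρ ▹ x′ ≡ x″ × ρ ▹ x″ ≡ x
  rotation {a} {x} {x′} ta s = m ∙ n ⁻¹ , ρa , ρ₀ , rotates ta s ρa ρ₀
    where
    m n : G
    m = move t a x′
    n = move t a x
    ρa : (m ∙ n ⁻¹) ▹ a ≡ a
    ρa = ∙▹≡ m (n ⁻¹) (⁻¹▹ n (move₁ ta (₁ s))) (move₁ ta (₂ s))
    ρ₀ : (m ∙ n ⁻¹) ▹ x ≡ x′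
    ρ₀ = ∙▹≡ m (n ⁻¹) (⁻¹▹ n (move₂ ta (₁ s))) (move₂ ta (₂ s))

  Stop : ℕ → Set
  Stop m = ∀ y → P 0 (suc m) y → P 0 (suc (suc m)) y

  γ^ : ℕ → G
  γ^ zero = γ
  γ^ (suc i) = γ ∙ γ^ i

  γ^x : ∀ i → γ^ i ▹ x₀ ≡ xs (suc i) × γ^ i ▹ α₀ ≡ αs (suc i)
  γ^x zero = refl , refl
  γ^x (suc i) = ∙▹≡ γ (γ^ i) (proj₁ (γ^x i)) refl , ∙▹≡ γ (γ^ i) (proj₂ (γ^x i)) refl

  -- The translation has finite order, so the path closes up and the next flag is one that is
  -- already fixed.
  stops : ∃ Stop
  stops with torsion (λ h → ∃ λ i → h ≡ γ^ i) γ (0 , refl) (λ { h (i , e) → suc i , cong (γ ∙_) e })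
  ... | i , e = suc i , λ y p j l u → case j ≟ℕ suc (suc i) of λ
      { (yes refl) → subst (λ v → y ▹ v ≡ v) (sym px) (proj₁ (p 0 z≤n (s≤s z≤n))) , subst (λ v → y ▹ v ≡ v) (sym pα) (proj₂ (p 0 z≤n (s≤s z≤n)))
      ; (no ne) → p j l (≤∧≢⇒< (≤-pred u) ne) }
    where
    one : γ^ (suc i) ≡ ε
    one = trans (cong (γ ∙_) (sym e)) (invʳ γ)
    px : xs (suc (suc i)) ≡ x₀
    px = trans (sym (proj₁ (γ^x (suc i)))) (trans (cong (_▹ x₀) one) (ε▹ _))
    pα : αs (suc (suc i)) ≡ α₀
    pα = trans (sym (proj₂ (γ^x (suc i)))) (trans (cong (_▹ α₀) one) (ε▹ _))

  not-stop-0 : ¬ Stop 0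
  not-stop-0 st with x-star 0
  ... | c , s with β-turn (Tx 1) s
  ...   | g , g₁ , gα , gc = b≢c s (trans (sym (proj₂ (st g pg 1 z≤n ≤-refl))) gc)
    where
    qg : Q (αs 0) g
    qg = rigid (Tα 0) (αx⁺ 0) gα g₁
    pg : P 0 1 g
    pg zero _ _ = fixₙ qg _ (symA (xα 0)) , gα
    pg (suc i) _ (s≤s ())

  -- If fixing one more vertex of the path is automatic, then the pointwise stabiliser is normalised by enough elements to be trivial.
  module Stopped (n : ℕ) (stop : Stop (suc n)) (s : G) (ps : P 0 (suc n) s) (ms : s ▹ αs (suc n) ≢ αs (suc n)) where
    Y : G → Set
    Y = P 0 (suc (suc n))

    Nrm : G → Set
    Nrm h = ∀ y → Y y → Y (h ⁻¹ ∙ y ∙ h)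

    norm-mul : ∀ g h → Nrm g → Nrm h → Nrm (g ∙ h)
    norm-mul g h p q y Yy = subst Y (grp (g ∷ h ∷ y ∷ []) [] (var 1 ⁻ ⊕ (var 0 ⁻ ⊕ var 2 ⊕ var 0) ⊕ var 1) ((var 0 ⊕ var 1) ⁻ ⊕ var 2 ⊕ (var 0 ⊕ var 1)) refl) (q _ (p y Yy))

    norm-γ : Nrm γ
    norm-γ y Yy = P-back (P-mono z≤n ≤-refl (stop y Yy))

    norm-γ⁻ : Nrm (γ ⁻¹)
    norm-γ⁻ = torsion Nrm γ norm-γ λ h nh → norm-mul γ h norm-γ nh

    pull-fix : ∀ {h y v} → y ▹ (h ▹ v) ≡ h ▹ v → (h ⁻¹ ∙ y ∙ h) ▹ v ≡ v
    pull-fix {h} {y} {v} e = ∙▹≡ (h ⁻¹ ∙ y) h refl (∙▹≡ (h ⁻¹) y e (⁻¹▹ h refl))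

    norm-s : Nrm s
    norm-s y Yy = P-up z≤n (P-mul (P-mul (P-inv ps) (P-mono z≤n (n≤1+n _) Yy)) ps)
      (pull-fix (fixₙ (P-xQ n z≤n ≤-refl Yy) _ (subst (λ v → Adj v (s ▹ αs (suc n))) (P-x n z≤n ≤-refl ps) (actA s (xα (suc n))))))

    τ : G
    τ = γ ∙ s ∙ γ ⁻¹
    pτ : P 1 (suc (suc n)) τ
    pτ = P-shift ps
    τx : τ ▹ xs 1 ≡ xs 1
    τx = proj₁ (pτ 1 ≤-refl (s≤s (s≤s z≤n)))
    τα₁ : τ ▹ αs 1 ≡ αs 1
    τα₁ = proj₂ (pτ 1 ≤-refl (s≤s (s≤s z≤n)))
    τα₀ : τ ▹ αs 0 ≢ αs 0
    τα₀ e = ms (proj₂ (subst Y (grp (γ ∷ s ∷ []) [] (var 0 ⁻ ⊕ (var 0 ⊕ var 1 ⊕ var 0 ⁻) ⊕ var 0) (var 1) refl) (norm-γ τ (P-down (s≤s (s≤s z≤n)) pτ e)) (suc n) z≤n ≤-refl))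

    norm-τ : Nrm τ
    norm-τ y Yy = P-down (s≤s (s≤s z≤n)) (P-mul (P-mul (P-inv pτ) (P-mono z≤n ≤-refl Yy)) pτ)
      (pull-fix (fixₙ (P-xQ 0 z≤n (s≤s (s≤s z≤n)) Yy) _ (subst (λ v → Adj v (τ ▹ αs 0)) τx (actA τ (symA (αx⁺ 0))))))

    -- Conjugation by the normalising element `γ ⁻¹` brings a swap from the far end of the path to
    -- its beginning.
    Sw : ℕ → Set
    Sw k = ∃ λ s → Nrm s × s ▹ xs (suc k) ≡ xs (suc k) × s ▹ αs k ≡ αs k × s ▹ αs (suc k) ≢ αs (suc k)

    sw-down : ∀ k → Sw k → Sw 0
    sw-down zero w = w
    sw-down (suc k) (s , ns , sx , sα , sm) = sw-down k (γ ⁻¹ ∙ s ∙ (γ ⁻¹) ⁻¹ , norm-mul (γ ⁻¹ ∙ s) ((γ ⁻¹) ⁻¹) (norm-mul (γ ⁻¹) s norm-γ⁻ ns) (subst Nrm (grp (γ ∷ []) [] (var 0) ((var 0 ⁻) ⁻) refl) norm-γ)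
        , back sx , back sα , λ e → sm (trans (cong (_▹ αs (suc (suc k))) (grp (γ ∷ s ∷ []) [] (var 1) (var 0 ⊕ (var 0 ⁻ ⊕ var 1 ⊕ (var 0 ⁻) ⁻) ⊕ var 0 ⁻) refl)) (fix-conj γ e)))
      where
      back : ∀ {v} → s ▹ (γ ▹ v) ≡ γ ▹ v → (γ ⁻¹ ∙ s ∙ (γ ⁻¹) ⁻¹) ▹ v ≡ v
      back {v} e = subst (λ w → (γ ⁻¹ ∙ s ∙ (γ ⁻¹) ⁻¹) ▹ w ≡ w) (⁻¹▹ γ refl) (fix-conj (γ ⁻¹) e)

    P-trivial : ∀ y → Y y → y ≡ ε
    P-trivial = fin (x-star 0) (α-star 0) (sw-down n (s , norm-s , P-x n z≤n ≤-refl ps , proj₂ (ps n z≤n ≤-refl) , ms))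
      where
      fin : (∃ λ c → St (xs 1) (αs 0) (αs 1) c) → (∃ λ c → St (αs 0) (xs 0) (xs 1) c) → Sw 0 → ∀ y → Y y → y ≡ ε
      fin (α″ , sx) (x′ , sα) (σ , nσ , σx , σα , σm) = core record
          { a = αs 0 ; b = xs 1 ; ab = αx⁺ 0 ; Y = Y ; Ya = λ y Yy → proj₂ (Yy 0 z≤n (s≤s z≤n)) ; Yb = λ y Yy → proj₁ (Yy 1 z≤n (s≤s (s≤s z≤n))) ; atA = atA ; atB = atB }
        where
        σ₁ : σ ▹ αs 1 ≡ α″
        σ₁ = [ (λ e → ⊥-elim (σm (proj₁ e))) , proj₁ ]′ (swap? σ sx σx σα)
        σ₂ : σ ▹ α″ ≡ αs 1
        σ₂ = [ (λ e → ⊥-elim (σm (proj₁ e))) , proj₂ ]′ (swap? σ sx σx σα)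
        τ₀ : τ ▹ αs 0 ≡ α″ × τ ▹ α″ ≡ αs 0
        τ₀ = [ (λ e → ⊥-elim (τα₀ (proj₁ e))) , id ]′ (swap? τ (st-213 sx) τx τα₁)
        -- `γ` takes `αs 0` to `αs 1`, and `σ` followed by `τ` brings that back within the star of
        -- `xs 1`. The result is a normalising rotation about `αs 0`.
        ρ : G
        ρ = (τ ∙ σ) ∙ γ
        nρ : Nrm ρ
        nρ = norm-mul (τ ∙ σ) γ (norm-mul τ σ norm-τ nσ) norm-γ
        ρα : ρ ▹ αs 0 ≡ αs 0
        ρα = ∙▹≡ (τ ∙ σ) γ refl (∙▹≡ τ σ σ₁ (proj₂ τ₀))
        ρ₀ : ρ ▹ xs 0 ≡ xs 1
        ρ₀ = ∙▹≡ (τ ∙ σ) γ refl (fix-∙ τx σx)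
        ρ₁ : ρ ▹ xs 1 ≡ x′
        ρ₁ = proj₁ (rotates (Tα 0) sα ρα ρ₀)
        ρ′ : ρ ▹ x′ ≡ xs 0
        ρ′ = proj₂ (rotates (Tα 0) sα ρα ρ₀)
        nε : Nrm ε
        nε y Yy = subst Y (grp (y ∷ []) [] (var 0) (e0 ⁻ ⊕ var 0 ⊕ e0) refl) Yy
        atA : ∀ b′ → Adj (αs 0) b′ → ∃ λ h → h ▹ αs 0 ≡ αs 0 × h ▹ xs 1 ≡ b′ × Nrm h
        atA b′ ab = [ (λ { refl → ρ ∙ ρ , fix-∙ ρα ρα , ∙▹≡ ρ ρ ρ₁ ρ′ , norm-mul ρ ρ nρ nρ }) , [ (λ { refl → ε , ε▹ _ , ε▹ _ , nε }) , (λ { refl → ρ , ρα , ρ₁ , nρ }) ]′ ]′ (only sα b′ ab)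
        atB : ∀ a′ → Adj (xs 1) a′ → ∃ λ h → h ▹ xs 1 ≡ xs 1 × h ▹ αs 0 ≡ a′ × Nrm h
        atB a′ ba = [ (λ { refl → ε , ε▹ _ , ε▹ _ , nε }) , [ (λ { refl → σ ∙ τ , fix-∙ σx τx , ∙▹≡ σ τ (proj₁ τ₀) σ₂ , norm-mul σ τ nσ norm-τ }) , (λ { refl → τ , τx , proj₁ τ₀ , norm-τ }) ]′ ]′ (only sx a′ ba)

-- Generators of the stabilisers of path segments

module RigidGens (S : Setting) (t : Bool) (rigid₀ : ∀ g → Basics.S₀ S g → Basics.Q S (Setting.o S t) g)
    (turn₀ : ∀ {b c} → Basics.St S (Setting.o S (not t)) (Setting.o S t) b c →
       ∃ λ g → Setting._▹_ S g (Setting.o S (not t)) ≡ Setting.o S (not t) × Setting._▹_ S g (Setting.o S t) ≡ Setting.o S t × Setting._▹_ S g b ≡ c) where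
  open Rigid S t rigid₀ turn₀ public

  P-up′ : ∀ {a b g} → a < b → P a b g → g ▹ αs b ≡ αs b → P a (suc b) g
  P-up′ {b = suc b} (s≤s le) = P-up le

  -- Both elements exchange `αs b` with the third neighbour of `xs b`, so their product fixes it.
  two-up : ∀ {a b g h} → a < b → P a b g → P a b h → g ▹ αs b ≢ αs b → h ▹ αs b ≢ αs b → P a (suc b) (g ∙ h)
  two-up {a} {suc b} {g} {h} (s≤s le) pg ph ng nh with x-star b
  ... | c , s = P-up le (P-mul pg ph) (∙▹≡ g h (swp ph nh proj₁) (swp pg ng proj₂))
    where
    swp : ∀ {k} {A : Set} → P a (suc b) k → k ▹ αs (suc b) ≢ αs (suc b) → (k ▹ αs (suc b) ≡ c × k ▹ c ≡ αs (suc b) → A) → A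
    swp {k} pk nk f = [ (λ e → ⊥-elim (nk (proj₁ e))) , f ]′ (swap? k s (P-x b le ≤-refl pk) (proj₂ (pk b le ≤-refl)))

  two-down : ∀ {a b g h} → suc a < b → P (suc a) b g → P (suc a) b h → g ▹ αs a ≢ αs a → h ▹ αs a ≢ αs a → P a b (g ∙ h)
  two-down {a} {b} {g} {h} lt pg ph ng nh with x-star a
  ... | c , s = P-down lt (P-mul pg ph) (∙▹≡ g h (swp ph nh proj₁) (swp pg ng proj₂))
    where
    swp : ∀ {k} {A : Set} → P (suc a) b k → k ▹ αs a ≢ αs a → (k ▹ αs a ≡ c × k ▹ c ≡ αs a → A) → A
    swp {k} pk nk f = [ (λ e → ⊥-elim (nk (proj₁ e))) , f ]′ (swap? k (st-213 s) (proj₁ (pk (suc a) ≤-refl lt)) (proj₂ (pk (suc a) ≤-refl lt)))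

  pull-fix : ∀ h {y v} → y ▹ (h ▹ v) ≡ h ▹ v → (h ⁻¹ ∙ y ∙ h) ▹ v ≡ v
  pull-fix h {y} {v} e = ∙▹≡ (h ⁻¹ ∙ y) h refl (∙▹≡ (h ⁻¹) y e (⁻¹▹ h refl))

  norm-up : ∀ {a b h y} → a < b → P a b h → P a (suc b) y → P a (suc b) (h ⁻¹ ∙ y ∙ h)
  norm-up {a} {suc b} {h} {y} (s≤s le) ph py = P-up le (P-mul (P-mul (P-inv ph) (P-mono ≤-refl (n≤1+n _) py)) ph)
    (pull-fix h (fixₙ (P-xQ b le ≤-refl py) _ (subst (λ v → Adj v (h ▹ αs (suc b))) (P-x b le ≤-refl ph) (actA h (xα (suc b))))))

  norm-down : ∀ {a b h y} → suc a < b → P (suc a) b h → P a b y → P a b (h ⁻¹ ∙ y ∙ h)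
  norm-down {a} {b} {h} {y} lt ph py = P-down lt (P-mul (P-mul (P-inv ph) (P-mono (n≤1+n _) ≤-refl py)) ph)
    (pull-fix h (fixₙ (P-xQ a ≤-refl lt py) _ (subst (λ v → Adj v (h ▹ αs a)) (proj₁ (ph (suc a) ≤-refl lt)) (actA h (symA (αx⁺ a))))))

  -- P k (N + k + 1) is trivial and P k (N + k) = ⟨ H k ⟩.
  module Gens (N : ℕ) (1≤N : 1 ≤ N) (triv₀ : ∀ y → P 0 (suc N) y → y ≡ ε) (s₀ : G) (ps₀ : P 0 N s₀) (ms₀ : s₀ ▹ αs N ≢ αs N) where
    unconj : ∀ {y} → γ ⁻¹ ∙ y ∙ γ ≡ ε → y ≡ ε
    unconj {y} e = trans (grp (γ ∷ y ∷ []) [] (var 1) (var 0 ⊕ (var 0 ⁻ ⊕ var 1 ⊕ var 0) ⊕ var 0 ⁻) refl) (trans (cong (λ w → γ ∙ w ∙ γ ⁻¹) e) (grp (γ ∷ []) [] (var 0 ⊕ e0 ⊕ var 0 ⁻) e0 refl))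

    P-triv′ : ∀ k y → P k (k + suc N) y → y ≡ ε
    P-triv′ zero y p = triv₀ y p
    P-triv′ (suc k) y p = unconj (P-triv′ k _ (P-back p))

    P-triv : ∀ k {b y} → suc (k + N) ≤ b → P k b y → y ≡ ε
    P-triv k le p = P-triv′ k _ (P-mono ≤-refl (≤-trans (≤-reflexive (+-suc k N)) le) p)

    abstract
      H : ℕ → G
      H zero = s₀
      H (suc i) = γ ∙ H i ∙ γ ⁻¹

      H-suc : ∀ i → γ ∙ H i ∙ γ ⁻¹ ≡ H (suc i)
      H-suc _ = refl

      H-P : ∀ i → P i (i + N) (H i)
      H-P zero = ps₀
      H-P (suc i) = P-shift (H-P i)

      H-up : ∀ i → H i ▹ αs (i + N) ≢ αs (i + N)
      H-up zero = ms₀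
      H-up (suc i) e = H-up i (trans (cong (_▹ αs (i + N)) (grp (γ ∷ H i ∷ []) [] (var 1) (var 0 ⁻ ⊕ (var 0 ⊕ var 1 ⊕ var 0 ⁻) ⊕ var 0) refl)) (pull-fix γ e))

    H-shift : ∀ i j → (γ ∙ (H i ∙ H j) ∙ γ ⁻¹) ≡ H (suc i) ∙ H (suc j)
    H-shift i j = trans (grp (γ ∷ H i ∷ H j ∷ []) [] (var 0 ⊕ (var 1 ⊕ var 2) ⊕ var 0 ⁻) ((var 0 ⊕ var 1 ⊕ var 0 ⁻) ⊕ (var 0 ⊕ var 2 ⊕ var 0 ⁻)) refl) (cong₂ _∙_ (H-suc i) (H-suc j))

    γ-inj : ∀ {x y} → γ ∙ x ∙ γ ⁻¹ ≡ γ ∙ y ∙ γ ⁻¹ → x ≡ y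
    γ-inj e = cancelˡ γ (cancelʳ (γ ⁻¹) e)

    H≢ε : ∀ i → H i ≢ ε
    H≢ε i e = H-up i (trans (cong (_▹ αs (i + N)) e) (ε▹ _))

    H-in : ∀ i {a b} → i ≤ a → b ≤ i + N → P a b (H i)
    H-in i la lb = P-mono la lb (H-P i)

    k<k+N : ∀ k → k < k + N
    k<k+N k = ≤-trans (≤-reflexive (+-comm 1 k)) (+-mono-≤ (≤-refl {k}) 1≤N)

    H-down : ∀ i → H (suc i) ▹ αs i ≢ αs i
    H-down i e = H≢ε (suc i) (P-triv i ≤-refl (P-down (s≤s (k<k+N i)) (H-P (suc i)) e))

    H² : ∀ i → H i ∙ H i ≡ ε
    H² i = P-triv i ≤-refl (two-up (k<k+N i) (H-P i) (H-P i) (H-up i) (H-up i))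

    H-only : ∀ i {y} → P i (i + N) y → y ≡ ε ⊎ y ≡ H i
    H-only i {y} p with (y ▹ αs (i + N)) ≟ⱽ αs (i + N)
    ... | yes e = inj₁ (P-triv i ≤-refl (P-up′ (k<k+N i) p e))
    ... | no ne = inj₂ (cancelˡ (H i) (trans (P-triv i ≤-refl (two-up (k<k+N i) (H-P i) p (H-up i) ne)) (sym (H² i))))

    -- `H l` fixes the same segment and moves `αs (l + N)`, so one of `y` and `H l ∙ y` reaches one
    -- index further.
    peelˡ : ∀ l r {y} → r < l + N → l ≤ r → P r (l + N) y → P r (suc l + N) y ⊎ P r (suc l + N) (H l ∙ y)
    peelˡ l r {y} lt le p with (y ▹ αs (l + N)) ≟ⱽ αs (l + N)
    ... | yes e = inj₁ (P-up′ lt p e)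
    ... | no ne = inj₂ (two-up lt (H-in l le ≤-refl) p (H-up l) ne)

    peelʳ : ∀ l r {y} → suc r < l + N → l ≤ suc r → P (suc r) (l + N) y → P r (l + N) y ⊎ P r (l + N) (H (suc r) ∙ y)
    peelʳ l r {y} lt le p with (y ▹ αs r) ≟ⱽ αs r
    ... | yes e = inj₁ (P-down lt p e)
    ... | no ne = inj₂ (two-down lt (H-in (suc r) ≤-refl (+-mono-≤ le ≤-refl)) p (H-down r) ne)

    -- Thus P r (l + N) is generated by H l , … , H r.
    gen : ∀ k l r {z y} → l + k ≡ suc r → r < l + N → (∀ i → l ≤ i → i ≤ r → Comm z (H i)) → P r (l + N) y → Comm z y
    gen zero l r {z} {y} e lt c p = subst (Comm z) (sym (P-triv r (≤-reflexive (cong (_+ N) (trans (sym e) (+-identityʳ l)))) p)) (trans (idʳ z) (sym (idˡ z)))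
    gen (suc k) l r {z} {y} e lt c p = [ rec , (λ q → subst (Comm z) (grp (H l ∷ y ∷ []) [] (var 0 ⁻ ⊕ (var 0 ⊕ var 1)) (var 1) refl) (comm-∙ (comm-inv (c l ≤-refl l≤r)) (rec q))) ]′ (peelˡ l r lt l≤r p)
      where
      e′ : suc l + k ≡ suc r
      e′ = trans (sym (+-suc l k)) e
      l≤r : l ≤ r
      l≤r = ≤-pred (≤-trans (m≤m+n (suc l) k) (≤-reflexive e′))
      rec : ∀ {y} → P r (suc l + N) y → Comm z y
      rec = gen k (suc l) r e′ (m≤n⇒m≤1+n lt) (λ i li → c i (≤-trans (n≤1+n l) li))

    gen′ : ∀ l r {z y} → l ≤ suc r → r < l + N → (∀ i → l ≤ i → i ≤ r → Comm z (H i)) → P r (l + N) y → Comm z y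
    gen′ l r le = gen (suc r ∸ l) l r (m+[n∸m]≡n le)
      where open import Data.Nat.Properties using (m+[n∸m]≡n)

    module Dist (c : ℕ) (cH : ∀ d → d ≤ c → Comm (H 0) (H d)) where
      cH′ : ∀ i d → d ≤ c → Comm (H i) (H (i + d))
      cH′ zero d le = cH d le
      cH′ (suc i) d le = trans (sym (H-shift i (i + d))) (trans (cong (λ w → γ ∙ w ∙ γ ⁻¹) (cH′ i d le)) (H-shift (i + d) i))

      near : ∀ i j → i ≤ j + c → j ≤ i + c → Comm (H i) (H j)
      near i j p q with ≤-total i j
        where open import Data.Nat.Properties using (≤-total)
      ... | inj₁ le = subst (λ k → Comm (H i) (H k)) (m+[n∸m]≡n le) (cH′ i (j ∸ i) (≤-trans (∸-monoˡ-≤ i q) (≤-reflexive (m+n∸m≡n i c))))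
        where open import Data.Nat.Properties using (m+[n∸m]≡n; ∸-monoˡ-≤; m+n∸m≡n)
      ... | inj₂ le = sym (subst (λ k → Comm (H j) (H k)) (m+[n∸m]≡n le) (cH′ j (i ∸ j) (≤-trans (∸-monoˡ-≤ j p) (≤-reflexive (m+n∸m≡n j c)))))
        where open import Data.Nat.Properties using (m+[n∸m]≡n; ∸-monoˡ-≤; m+n∸m≡n)

      far′ : ¬ Comm (H 0) (H (suc c)) → ∀ i → ¬ Comm (H i) (H (i + suc c))
      far′ n zero e = n e
      far′ n (suc i) e = far′ n i (γ-inj (trans (H-shift i (i + suc c)) (trans e (sym (H-shift (i + suc c) i)))))

      comm-left : ∀ {h z x} → Comm h z → Comm h (x ∙ z) → Comm h x
      comm-left {h} {z} {x} p q = subst (Comm h) (grp (x ∷ z ∷ []) [] ((var 0 ⊕ var 1) ⊕ var 1 ⁻) (var 0) refl) (comm-∙ q (comm-inv p))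

      -- `P (suc r) N` extends `P r N` by the involution `H (suc r)`, which normalises it. A central
      -- involution of `P r N` is kept if it commutes with this one, and otherwise replaced by its
      -- product with the conjugate.
      chain-centre : ∀ r → r < N → ∃ λ m → m ≢ ε × m ∙ m ≡ ε × P r N m × (∀ y → P r N y → Comm m y)
      chain-centre zero lt = H 0 , H≢ε 0 , H² 0 , H-P 0 , λ y p → [ (λ { refl → trans (idʳ _) (sym (idˡ _)) }) , (λ { refl → refl }) ]′ (H-only 0 p)
      chain-centre (suc r) lt = go (chain-centre r (<⇒≤ lt))
        where
        h : G
        h = H (suc r)
        ph : P (suc r) N h
        ph = H-in (suc r) ≤-refl (m≤n+m N (suc r))
        h² : h ∙ h ≡ ε
        h² = H² (suc r)
        go : (∃ λ m → m ≢ ε × m ∙ m ≡ ε × P r N m × (∀ y → P r N y → Comm m y)) → ∃ λ m → m ≢ ε × m ∙ m ≡ ε × P (suc r) N m × (∀ y → P (suc r) N y → Comm m y)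
        go (m , m≢ , m² , pm , cm) = pick ((h ∙ m) ≟ᴳ (m ∙ h))
          where
          m′ : G
          m′ = h ⁻¹ ∙ m ∙ h
          pm′ : P r N m′
          pm′ = norm-down lt ph pm
          cm′ : ∀ y → P r N y → Comm m′ y
          cm′ y py = trans (grp (h ∷ m ∷ y ∷ []) [] ((var 0 ⁻ ⊕ var 1 ⊕ var 0) ⊕ var 2) (var 0 ⁻ ⊕ (var 1 ⊕ (var 0 ⊕ var 2 ⊕ var 0 ⁻)) ⊕ var 0) refl)
            (trans (cong (λ w → h ⁻¹ ∙ w ∙ h) (cm _ (subst (P r N) (grp (h ∷ y ∷ []) (ι 0 h² ∷ []) (var 0 ⁻ ⊕ var 1 ⊕ var 0) (var 0 ⊕ var 1 ⊕ var 0 ⁻) refl) (norm-down lt ph py))))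
              (grp (h ∷ m ∷ y ∷ []) [] (var 0 ⁻ ⊕ ((var 0 ⊕ var 2 ⊕ var 0 ⁻) ⊕ var 1) ⊕ var 0) (var 2 ⊕ (var 0 ⁻ ⊕ var 1 ⊕ var 0)) refl))
          whole : ∀ {w} → Comm w h → (∀ y → P r N y → Comm w y) → ∀ y → P (suc r) N y → Comm w y
          whole {w} wh wr y py = [ wr y , (λ q → subst (Comm w) (grp (h ∷ y ∷ []) [] (var 0 ⁻ ⊕ (var 0 ⊕ var 1)) (var 1) refl) (comm-∙ (comm-inv wh) (wr _ q))) ]′ (peelʳ 0 r lt z≤n py)
          pick : Dec (h ∙ m ≡ m ∙ h) → _
          pick (yes e) = m , m≢ , m² , P-mono (n≤1+n r) ≤-refl pm , whole (sym e) cm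
          pick (no ne) = m ∙ m′ , (λ e → ne (sym (trans (grp (h ∷ m ∷ []) [] (var 1 ⊕ var 0) (var 0 ⊕ (var 0 ⁻ ⊕ var 1 ⊕ var 0)) refl) (cong (h ∙_) (sym (cancelˡ m (trans m² (sym e))))))))
            , trans (grp (m ∷ m′ ∷ []) (κ 0 1 (cm m′ pm′) ∷ []) ((var 0 ⊕ var 1) ⊕ (var 0 ⊕ var 1)) ((var 0 ⊕ var 0) ⊕ (var 1 ⊕ var 1)) refl)
                (trans (cong₂ _∙_ m² (grp (h ∷ m ∷ []) (ι 1 m² ∷ []) ((var 0 ⁻ ⊕ var 1 ⊕ var 0) ⊕ (var 0 ⁻ ⊕ var 1 ⊕ var 0)) e0 refl)) (idˡ ε))
            , P-mono (n≤1+n r) ≤-refl (P-mul pm pm′)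
            , whole (trans (cong (_∙ h) (cm m′ pm′)) (grp (h ∷ m ∷ []) (ι 0 h² ∷ []) (((var 0 ⁻ ⊕ var 1 ⊕ var 0) ⊕ var 1) ⊕ var 0) (var 0 ⊕ (var 1 ⊕ (var 0 ⁻ ⊕ var 1 ⊕ var 0))) refl))
                    λ y py → sym (comm-∙ (sym (cm y py)) (sym (cm′ y py)))

      module _ (nc : ¬ Comm (H 0) (H (suc c))) where
        c+k : ∀ k → k + suc c ≡ suc (c + k)
        c+k k = trans (+-suc k c) (cong suc (+-comm k c))

        -- The group ⟨ H 0 , … , H (2 c + 1) ⟩ would have trivial centre.
        twice : ¬ (suc (suc (c + c)) ≤ N)
        twice lt = go (chain-centre (suc (c + c)) lt)
          where
          go : (∃ λ m → m ≢ ε × m ∙ m ≡ ε × P (suc (c + c)) N m × (∀ y → P (suc (c + c)) N y → Comm m y)) → ⊥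
          go (m , m≢ , _ , pm , cm) = m≢ (P-triv c ≤-refl (up (suc c) ≤-refl))
            where
            cmH : ∀ i → i ≤ suc (c + c) → Comm (H i) m
            cmH i le = sym (cm _ (H-in i le (m≤n+m N i)))
            down : ∀ k → k ≤ suc c → P (c + k) N m → P c N m
            down zero _ p = subst (λ x → P x N m) (+-identityʳ c) p
            down (suc k) (s≤s le) p = [ down k (m≤n⇒m≤1+n le) , (λ q → ⊥-elim (far′ nc k (subst (λ x → Comm (H k) (H x)) (sym (c+k k)) (comm-left (cmH k (≤-trans le (≤-trans (m≤m+n c c) (n≤1+n _))))
                (gen′ 0 (c + k) z≤n (<⇒≤ lt′) (λ i _ ik → near k i (≤-trans le (m≤n+m c i)) (≤-trans ik (≤-reflexive (+-comm c k)))) q))))) ]′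
                (peelʳ 0 (c + k) lt′ z≤n (subst (λ x → P x N m) (+-suc c k) p))
              where
              lt′ : suc (c + k) < N
              lt′ = ≤-trans (s≤s (s≤s (+-mono-≤ (≤-refl {c}) le))) lt
            p₀ : P c N m
            p₀ = down (suc c) ≤-refl (subst (λ x → P x N m) (sym (+-suc c c)) pm)
            up : ∀ l → l ≤ suc c → P c (l + N) m
            up zero _ = p₀
            up (suc l) (s≤s le) = [ id , (λ q → ⊥-elim (bad q)) ]′ (peelˡ l c lt″ le (up l (m≤n⇒m≤1+n le)))
              where
              lt″ : c < l + N
              lt″ = ≤-trans (≤-trans (s≤s (≤-trans (m≤m+n c c) (n≤1+n _))) lt) (m≤n+m N l)
              bad : P c (suc l + N) (H l ∙ m) → ⊥
              bad q = far′ nc l (sym (comm-left (cmH (l + suc c) (≤-trans (≤-reflexive (c+k l)) (s≤s (+-mono-≤ (≤-refl {c}) le))))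
                (gen′ (suc l) c (s≤s le) (m≤n⇒m≤1+n lt″) (λ i li ic → near (l + suc c) i (≤-trans (≤-reflexive (+-suc l c)) (+-mono-≤ li ≤-refl))
                  (≤-trans ic (≤-trans (m≤m+n c c) (+-mono-≤ (≤-trans (n≤1+n c) (m≤n+m (suc c) l)) ≤-refl)))) q)))

-- The centre of the flag stabiliser and inequalities for the commuting range

module RigidCount (S : Setting) (t : Bool) (rigid₀ : ∀ g → Basics.S₀ S g → Basics.Q S (Setting.o S t) g)
    (turn₀ : ∀ {b c} → Basics.St S (Setting.o S (not t)) (Setting.o S t) b c →
       ∃ λ g → Setting._▹_ S g (Setting.o S (not t)) ≡ Setting.o S (not t) × Setting._▹_ S g (Setting.o S t) ≡ Setting.o S t × Setting._▹_ S g b ≡ c) where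
  open RigidGens S t rigid₀ turn₀ public

  module Count (N : ℕ) (1≤N : 1 ≤ N) (triv₀ : ∀ y → P 0 (suc N) y → y ≡ ε) (s₀ : G) (ps₀ : P 0 N s₀) (ms₀ : s₀ ▹ αs N ≢ αs N)
      (c p : ℕ) (eN : N ≡ c + p) (1≤p : 1 ≤ p) (p≤ : p ≤ suc c) where
    open Gens N 1≤N triv₀ s₀ ps₀ ms₀ public

    module Steps (cH : ∀ d → d ≤ c → Comm (H 0) (H d)) (nc′ : 2 ≤ p → ¬ Comm (H 0) (H (suc c))) where
      open Dist c cH public

      N≤ : N ≤ c + p
      N≤ = ≤-reflexive eN
      ≤N : ∀ {m} → m ≤ c + p → m ≤ N
      ≤N le = ≤-trans le (≤-reflexive (sym eN))
      p≤N : p ≤ N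
      p≤N = ≤N (m≤n+m p c)

      Cent : G → Set
      Cent y = P N (suc N) y × (∀ s → P N (suc N) s → Comm y s)

      S-H : ∀ j → 1 ≤ j → j ≤ N → P N (suc N) (H j)
      S-H j l u = H-in j u (+-mono-≤ l ≤-refl)

      -- The centre of ⟨ H 1 , … , H N ⟩ is ⟨ H p , … , H (c + 1) ⟩.
      centre-in : ∀ {y} → Cent y → P (suc c) (p + N) y
      centre-in {y} (py , cy) = down p 1≤p ≤-refl (subst (λ x → P x (p + N) y) eN (up p 1≤p ≤-refl))
        where
        up : ∀ l → 1 ≤ l → l ≤ p → P N (l + N) y
        up (suc zero) _ _ = py
        up (suc (suc l)) _ le = [ id , (λ q → ⊥-elim (bad q)) ]′ (peelˡ (suc l) N (s≤s (m≤n+m N l)) (≤-trans (<⇒≤ le) p≤N) (up (suc l) (s≤s z≤n) (<⇒≤ le)))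
          where
          j : ℕ
          j = suc l + suc c
          j≤N : j ≤ N
          j≤N = ≤N (≤-trans (≤-reflexive (trans (+-suc (suc l) c) (+-comm (suc (suc l)) c))) (+-mono-≤ (≤-refl {c}) le))
          bad : P N (suc (suc l) + N) (H (suc l) ∙ y) → ⊥
          bad q = far′ (nc′ (≤-trans (s≤s (s≤s z≤n)) le)) (suc l) (sym (comm-left (sym (cy _ (S-H j (s≤s z≤n) j≤N)))
            (gen′ (suc (suc l)) N (s≤s (≤-trans (<⇒≤ le) p≤N)) (s≤s (m≤n⇒m≤1+n (m≤n+m N l)))
              (λ i li iN → near j i (≤-trans (≤-reflexive (+-suc (suc l) c)) (+-mono-≤ li ≤-refl)) (≤-trans iN (≤-trans N≤ (≤-trans (≤-reflexive (+-comm c p)) (+-mono-≤ (≤-trans p≤ (m≤n+m (suc c) (suc l))) ≤-refl))))) q)))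
        down : ∀ k → 1 ≤ k → k ≤ p → P (c + k) (p + N) y → P (suc c) (p + N) y
        down (suc zero) _ _ q = subst (λ x → P x (p + N) y) (+-comm c 1) q
        down (suc (suc k)) _ le q = [ down (suc k) (s≤s z≤n) (<⇒≤ le) , (λ r → ⊥-elim (bad r)) ]′ (peelʳ p (c + suc k) lt (≤-trans p≤ (s≤s (m≤m+n c (suc k)))) (subst (λ x → P x (p + N) y) (+-suc c (suc k)) q))
          where
          lt : suc (c + suc k) < p + N
          lt = ≤-trans (s≤s (≤N (≤-trans (≤-reflexive (sym (+-suc c (suc k)))) (+-mono-≤ (≤-refl {c}) le)))) (+-mono-≤ 1≤p ≤-refl)
          bad : P (c + suc k) (p + N) (H (suc (c + suc k)) ∙ y) → ⊥
          bad r = far′ (nc′ (≤-trans (s≤s (s≤s z≤n)) le)) (suc k) (subst (λ x → Comm (H (suc k)) (H x)) (sym (trans (+-suc (suc k) c) (cong suc (+-comm (suc k) c))))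
            (comm-left (sym (cy _ (S-H (suc k) (s≤s z≤n) (≤-trans (<⇒≤ le) p≤N))))
              (gen′ p (c + suc k) (≤-trans p≤ (s≤s (m≤m+n c (suc k)))) (<⇒≤ lt)
                (λ i pi ik → near (suc k) i (≤-trans (<⇒≤ le) (≤-trans pi (m≤m+n i c))) (≤-trans ik (≤-reflexive (+-comm c (suc k))))) r)))

      H-cent : ∀ i → p ≤ i → i ≤ suc c → Cent (H i)
      H-cent i pi ic = S-H i (≤-trans 1≤p pi) (≤N (≤-trans ic (≤-trans (≤-reflexive (+-comm 1 c)) (+-mono-≤ (≤-refl {c}) 1≤p))))
        , λ s → gen′ 1 N (s≤s z≤n) ≤-refl λ j j₁ jN → near i j (≤-trans ic (+-mono-≤ j₁ ≤-refl)) (≤-trans jN (≤-trans N≤ (≤-trans (≤-reflexive (+-comm c p)) (+-mono-≤ pi ≤-refl))))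

      cent-mul : ∀ {y z} → Cent y → Cent z → Cent (y ∙ z)
      cent-mul (p , f) (q , g) = P-mul p q , λ s ps → sym (comm-∙ (sym (f s ps)) (sym (g s ps)))

      S-mem : ∀ {y x} → Adj (αs N) x → y ▹ αs N ≡ αs N → y ▹ x ≡ x → P N (suc N) y
      S-mem ax yα yx i l u with ≤-antisym l (≤-pred u)
      ... | refl = fixₙ (rigid (Tα N) ax yα yx) _ (symA (xα N)) , yα

      S-conj : ∀ ρ {y} → ρ ▹ αs N ≡ αs N → P N (suc N) y → P N (suc N) (ρ ⁻¹ ∙ y ∙ ρ)
      S-conj ρ {y} ρα py = S-mem (symA (xα N)) (fix q) (fixₙ q _ (symA (xα N)))
        where
        q : Q (αs N) (ρ ⁻¹ ∙ y ∙ ρ)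
        q = Q-back ρα (P-Q N ≤-refl ≤-refl py)

      cent-conj : ∀ ρ {y} → ρ ▹ αs N ≡ αs N → Cent y → Cent (ρ ⁻¹ ∙ y ∙ ρ)
      cent-conj ρ {y} ρα (py , cy) = S-conj ρ ρα py , λ s ps → trans (grp (ρ ∷ y ∷ s ∷ []) [] ((var 0 ⁻ ⊕ var 1 ⊕ var 0) ⊕ var 2) (var 0 ⁻ ⊕ (var 1 ⊕ (var 0 ⊕ var 2 ⊕ var 0 ⁻)) ⊕ var 0) refl)
        (trans (cong (λ w → ρ ⁻¹ ∙ w ∙ ρ) (cy _ (subst (P N (suc N)) (grp (ρ ∷ s ∷ []) [] ((var 0 ⁻) ⁻ ⊕ var 1 ⊕ var 0 ⁻) (var 0 ⊕ var 1 ⊕ var 0 ⁻) refl) (S-conj (ρ ⁻¹) (⁻¹▹ ρ ρα) ps))))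
          (grp (ρ ∷ y ∷ s ∷ []) [] (var 0 ⁻ ⊕ ((var 0 ⊕ var 2 ⊕ var 0 ⁻) ⊕ var 1) ⊕ var 0) (var 2 ⊕ (var 0 ⁻ ⊕ var 1 ⊕ var 0)) refl))

      -- H p is the only generator of the centre that moves this vertex.
      C : G → Set
      C y = y ▹ αs (p + N) ≡ αs (p + N)

      C-dec : ∀ y → Dec (C y)
      C-dec y = (y ▹ αs (p + N)) ≟ⱽ αs (p + N)

      sc< : suc c < p + N
      sc< = ≤-trans (≤-trans (s≤s (≤-trans (≤-reflexive (+-comm 1 c)) (+-mono-≤ (≤-refl {c}) 1≤p))) (s≤s (≤-reflexive (sym eN)))) (+-mono-≤ 1≤p ≤-refl)

      C-odd : ∀ {y z} → Cent y → Cent z → ¬ C y → ¬ C z → C (y ∙ z)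
      C-odd cy cz ny nz = proj₂ (two-up sc< (centre-in cy) (centre-in cz) ny nz (p + N) (<⇒≤ sc<) ≤-refl)

      lead : ∀ i {y} → y ▹ αs (i + N) ≡ αs (i + N) → H i ∙ y ≢ ε
      lead i {y} f e = H-up i (trans (sym (∙▹≡ (H i) y f refl)) (trans (cong (_▹ αs (i + N)) e) (ε▹ _)))

      H-fix : ∀ i j → i < j → j ≤ i + N → H j ▹ αs (i + N) ≡ αs (i + N)
      H-fix i j ij jN = proj₂ (H-P j (i + N) jN (+-mono-≤ ij ≤-refl))

      -- The centre has rank c + 2 - p, here at least 4. The hyperplane `C` contains three
      -- independent generators, so it meets its two images under a rotation `ρ` of the star of
      -- `αs N` nontrivially. The intersection `K` is normalised by `ρ` and centralised by `H 1` and
      -- `H (suc N)`, which suffices to make it trivial.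
      narrow : ¬ (suc (suc p) ≤ c)
      narrow 2+p≤ = go (α-star N) (x-star N)
        where
        go : (∃ λ x′ → St (αs N) (xs N) (xs (suc N)) x′) → (∃ λ a → St (xs (suc N)) (αs N) (αs (suc N)) a) → ⊥
        go (x′ , sα) (a″ , sx) = rot (rotation (Tα N) sα)
          where
          rot : (∃ λ ρ → ρ ▹ αs N ≡ αs N × ρ ▹ xs N ≡ xs (suc N) × ρ ▹ xs (suc N) ≡ x′ × ρ ▹ x′ ≡ xs N) → ⊥
          rot (ρ , ρα , ρ₀ , ρ₁ , ρ′) = found-⊥
            where
            cj : G → G
            cj y = ρ ⁻¹ ∙ y ∙ ρ
            cj-mul : ∀ y z → cj (y ∙ z) ≡ cj y ∙ cj z
            cj-mul y z = grp (ρ ∷ y ∷ z ∷ []) [] (var 0 ⁻ ⊕ (var 1 ⊕ var 2) ⊕ var 0) ((var 0 ⁻ ⊕ var 1 ⊕ var 0) ⊕ (var 0 ⁻ ⊕ var 2 ⊕ var 0)) refl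
            cj-cent : ∀ {y} → Cent y → Cent (cj y)
            cj-cent = cent-conj ρ ρα
            K : G → Set
            K y = Cent y × C y × C (cj y) × C (cj (cj y))
            ρ³ : P N (suc N) (ρ ∙ ρ ∙ ρ)
            ρ³ = S-mem (symA (xα N)) (fix-∙ (fix-∙ ρα ρα) ρα) (∙▹≡ (ρ ∙ ρ) ρ ρ₀ (∙▹≡ ρ ρ ρ₁ ρ′))
            K-ρ : ∀ y → K y → K (cj y)
            K-ρ y (cy , p₀ , p₁ , p₂) = cj-cent cy , p₁ , p₂ , subst C (sym (trans (grp (ρ ∷ y ∷ []) [] (var 0 ⁻ ⊕ (var 0 ⁻ ⊕ (var 0 ⁻ ⊕ var 1 ⊕ var 0) ⊕ var 0) ⊕ var 0) ((var 0 ⊕ var 0 ⊕ var 0) ⁻ ⊕ var 1 ⊕ (var 0 ⊕ var 0 ⊕ var 0)) refl) (comm-conj (proj₂ cy _ ρ³)))) p₀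
            K-comm : ∀ {y h} → Comm y h → K y → K (h ⁻¹ ∙ y ∙ h)
            K-comm e k = subst K (sym (comm-conj e)) k
            σ τ : G
            σ = H 1
            τ = H (suc N)
            pσ : P N (suc N) σ
            pσ = S-H 1 ≤-refl 1≤N
            σx : σ ▹ xs (suc N) ≡ xs (suc N)
            σx = P-x N ≤-refl ≤-refl pσ
            σ₁ : σ ▹ αs (suc N) ≡ a″ × σ ▹ a″ ≡ αs (suc N)
            σ₁ = [ (λ e → ⊥-elim (H-up 1 (proj₁ e))) , id ]′ (swap? σ sx σx (proj₂ (pσ N ≤-refl ≤-refl)))
            pτ : P (suc N) (suc N + N) τ
            pτ = H-P (suc N)
            τx : τ ▹ xs (suc N) ≡ xs (suc N)
            τx = proj₁ (pτ (suc N) ≤-refl (k<k+N (suc N)))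
            τ₁ : τ ▹ αs N ≡ a″ × τ ▹ a″ ≡ αs N
            τ₁ = [ (λ e → ⊥-elim (H-down N (proj₁ e))) , id ]′ (swap? τ (st-213 sx) τx (proj₂ (pτ (suc N) ≤-refl (k<k+N (suc N)))))
            K-τ : ∀ {y} → K y → Comm y τ
            K-τ (cy , p₀ , _) = sym (gen′ (suc p) (suc c) (s≤s (m≤n⇒m≤1+n (≤-trans (m≤n⇒m≤1+n (n≤1+n p)) 2+p≤))) (m≤n⇒m≤1+n sc<)
              (λ i pi ic → near (suc N) i (≤-trans (s≤s (≤-trans N≤ (≤-reflexive (+-comm c p)))) (+-mono-≤ pi ≤-refl)) (≤-trans ic (s≤s (m≤n+m c N)))) (P-up′ sc< (centre-in cy) p₀))
            trivial : ∀ y → K y → y ≡ ε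
            trivial = core record { a = αs N ; b = xs (suc N) ; ab = αx⁺ N ; Y = K ; Ya = λ y k → proj₂ (proj₁ (proj₁ k) N ≤-refl ≤-refl) ; Yb = λ y k → P-x N ≤-refl ≤-refl (proj₁ (proj₁ k)) ; atA = atA ; atB = atB }
              where
              atA : ∀ b′ → Adj (αs N) b′ → ∃ λ h → h ▹ αs N ≡ αs N × h ▹ xs (suc N) ≡ b′ × (∀ y → K y → K (h ⁻¹ ∙ y ∙ h))
              atA b′ ab = [ (λ { refl → ρ ∙ ρ , fix-∙ ρα ρα , ∙▹≡ ρ ρ ρ₁ ρ′ , λ y k → subst K (grp (ρ ∷ y ∷ []) [] (var 0 ⁻ ⊕ (var 0 ⁻ ⊕ var 1 ⊕ var 0) ⊕ var 0) ((var 0 ⊕ var 0) ⁻ ⊕ var 1 ⊕ (var 0 ⊕ var 0)) refl) (K-ρ _ (K-ρ y k)) })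
                , [ (λ { refl → ε , ε▹ _ , ε▹ _ , λ y k → K-comm (trans (idʳ y) (sym (idˡ y))) k }) , (λ { refl → ρ , ρα , ρ₁ , K-ρ }) ]′ ]′ (only sα b′ ab)
              atB : ∀ a′ → Adj (xs (suc N)) a′ → ∃ λ h → h ▹ xs (suc N) ≡ xs (suc N) × h ▹ αs N ≡ a′ × (∀ y → K y → K (h ⁻¹ ∙ y ∙ h))
              atB a′ ba = [ (λ { refl → ε , ε▹ _ , ε▹ _ , λ y k → K-comm (trans (idʳ y) (sym (idˡ y))) k })
                , [ (λ { refl → σ ∙ τ , fix-∙ σx τx , ∙▹≡ σ τ (proj₁ τ₁) (proj₂ σ₁) , λ y k → K-comm (comm-∙ (proj₂ (proj₁ k) _ pσ) (K-τ k)) k }) , (λ { refl → τ , τx , proj₁ τ₁ , λ y k → K-comm (K-τ k) k }) ]′ ]′ (only sx a′ ba)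
            -- Among the products of three generators there is a common element of the two other hyperplanes.
            u v w : G
            u = H (suc p)
            v = H (suc (suc p))
            w = H (suc (suc (suc p)))
            cu : Cent u
            cu = H-cent (suc p) (n≤1+n p) (≤-trans (≤-trans (n≤1+n _) 2+p≤) (n≤1+n c))
            cv : Cent v
            cv = H-cent (suc (suc p)) (m≤n⇒m≤1+n (n≤1+n p)) (≤-trans 2+p≤ (n≤1+n c))
            cw : Cent w
            cw = H-cent (suc (suc (suc p))) (m≤n⇒m≤1+n (m≤n⇒m≤1+n (n≤1+n p))) (s≤s 2+p≤)
            2p≤ : suc (suc p) ≤ N
            2p≤ = ≤N (≤-trans 2+p≤ (m≤m+n c p))
            Cu : C u
            Cu = H-fix p (suc p) ≤-refl (≤-trans (≤-trans (n≤1+n _) 2p≤) (m≤n+m N p))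
            Cv : C v
            Cv = H-fix p (suc (suc p)) (n≤1+n _) (≤-trans 2p≤ (m≤n+m N p))
            Cw : C w
            Cw = H-fix p (suc (suc (suc p))) (m≤n⇒m≤1+n (n≤1+n _)) (≤-trans (s≤s 2p≤) (+-mono-≤ 1≤p ≤-refl))
            u≢ : u ≢ ε
            u≢ = H≢ε (suc p)
            v≢ : v ≢ ε
            v≢ = H≢ε (suc (suc p))
            w≢ : w ≢ ε
            w≢ = H≢ε (suc (suc (suc p)))
            uv : Comm u v
            uv = proj₂ cu v (proj₁ cv)
            vw : Comm v w
            vw = proj₂ cv w (proj₁ cw)
            v₁ : v ▹ αs (suc p + N) ≡ αs (suc p + N)
            v₁ = H-fix (suc p) (suc (suc p)) ≤-refl (s≤s (≤-trans (≤-trans (n≤1+n _) 2p≤) (m≤n+m N p)))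
            w₁ : w ▹ αs (suc p + N) ≡ αs (suc p + N)
            w₁ = H-fix (suc p) (suc (suc (suc p))) (n≤1+n _) (s≤s (≤-trans 2p≤ (m≤n+m N p)))
            w₂ : w ▹ αs (suc (suc p) + N) ≡ αs (suc (suc p) + N)
            w₂ = H-fix (suc (suc p)) (suc (suc (suc p))) ≤-refl (s≤s (s≤s (≤-trans (≤-trans (n≤1+n _) 2p≤) (m≤n+m N p))))
            record Pair (D : G → Set) : Set where
              field
                a b : G
                a≢ : a ≢ ε
                b≢ : b ≢ ε
                ab≢ : a ∙ b ≢ ε
                ca : Cent a
                cb : Cent b
                Ca : C a
                Cb : C b
                Da : D a
                Db : D b
            D₁ D₂ : G → Set
            D₁ y = C (cj y)
            D₂ y = C (cj (cj y))
            odd₁ : ∀ {y z} → Cent y → Cent z → ¬ D₁ y → ¬ D₁ z → D₁ (y ∙ z)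
            odd₁ cy cz ny nz = subst C (sym (cj-mul _ _)) (C-odd (cj-cent cy) (cj-cent cz) ny nz)
            odd₂ : ∀ {y z} → Cent y → Cent z → ¬ D₂ y → ¬ D₂ z → D₂ (y ∙ z)
            odd₂ {y} {z} cy cz ny nz = subst C (sym (trans (cong cj (cj-mul y z)) (cj-mul (cj y) (cj z)))) (C-odd (cj-cent (cj-cent cy)) (cj-cent (cj-cent cz)) ny nz)
            mul₁ : ∀ {y z} → D₁ y → D₁ z → D₁ (y ∙ z)
            mul₁ {y} {z} p q = subst C (sym (cj-mul y z)) (fix-∙ p q)
            pair : Pair D₁
            pair with C-dec (cj u) | C-dec (cj v) | C-dec (cj w)
            ... | yes du | yes dv | _ = record { a = u ; b = v ; a≢ = u≢ ; b≢ = v≢ ; ab≢ = lead (suc p) v₁ ; ca = cu ; cb = cv ; Ca = Cu ; Cb = Cv ; Da = du ; Db = dv }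
            ... | yes du | no _ | yes dw = record { a = u ; b = w ; a≢ = u≢ ; b≢ = w≢ ; ab≢ = lead (suc p) w₁ ; ca = cu ; cb = cw ; Ca = Cu ; Cb = Cw ; Da = du ; Db = dw }
            ... | yes du | no nv | no nw = record { a = u ; b = v ∙ w ; a≢ = u≢ ; b≢ = lead (suc (suc p)) w₂ ; ab≢ = lead (suc p) (fix-∙ v₁ w₁) ; ca = cu ; cb = cent-mul cv cw ; Ca = Cu ; Cb = fix-∙ Cv Cw ; Da = du ; Db = odd₁ cv cw nv nw }
            ... | no _ | yes dv | yes dw = record { a = v ; b = w ; a≢ = v≢ ; b≢ = w≢ ; ab≢ = lead (suc (suc p)) w₂ ; ca = cv ; cb = cw ; Ca = Cv ; Cb = Cw ; Da = dv ; Db = dw }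
            ... | no nu | yes dv | no nw = record { a = v ; b = u ∙ w ; a≢ = v≢ ; b≢ = lead (suc p) w₁ ; ab≢ = λ e → lead (suc p) (fix-∙ v₁ w₁) (trans (grp (u ∷ v ∷ w ∷ []) (κ 0 1 uv ∷ []) (var 0 ⊕ (var 1 ⊕ var 2)) (var 1 ⊕ (var 0 ⊕ var 2)) refl) e)
                                        ; ca = cv ; cb = cent-mul cu cw ; Ca = Cv ; Cb = fix-∙ Cu Cw ; Da = dv ; Db = odd₁ cu cw nu nw }
            ... | no nu | no nv | yes dw = record { a = u ∙ v ; b = w ; a≢ = lead (suc p) v₁ ; b≢ = w≢ ; ab≢ = λ e → lead (suc p) (fix-∙ v₁ w₁) (trans (sym (assoc u v w)) e) ; ca = cent-mul cu cv ; cb = cw ; Ca = fix-∙ Cu Cv ; Cb = Cw ; Da = odd₁ cu cv nu nv ; Db = dw }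
            ... | no nu | no nv | no nw = record { a = u ∙ v ; b = u ∙ w ; a≢ = lead (suc p) v₁ ; b≢ = lead (suc p) w₁ ; ab≢ = λ e → lead (suc (suc p)) w₂ (trans (grp (u ∷ v ∷ w ∷ []) (ι 0 (H² (suc p)) ∷ κ 0 1 uv ∷ []) (var 1 ⊕ var 2) ((var 0 ⊕ var 1) ⊕ (var 0 ⊕ var 2)) refl) e)
                                        ; ca = cent-mul cu cv ; cb = cent-mul cu cw ; Ca = fix-∙ Cu Cv ; Cb = fix-∙ Cu Cw ; Da = odd₁ cu cv nu nv ; Db = odd₁ cu cw nu nw }
            found : ∃ λ y → y ≢ ε × K y
            found with C-dec (cj (cj (Pair.a pair))) | C-dec (cj (cj (Pair.b pair)))
            ... | yes d | _ = Pair.a pair , Pair.a≢ pair , Pair.ca pair , Pair.Ca pair , Pair.Da pair , d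
            ... | no _ | yes d = Pair.b pair , Pair.b≢ pair , Pair.cb pair , Pair.Cb pair , Pair.Db pair , d
            ... | no na | no nb′ = Pair.a pair ∙ Pair.b pair , Pair.ab≢ pair , cent-mul (Pair.ca pair) (Pair.cb pair) , fix-∙ (Pair.Ca pair) (Pair.Cb pair) , mul₁ (Pair.Da pair) (Pair.Db pair) , odd₂ (Pair.ca pair) (Pair.cb pair) na nb′
            found-⊥ : ⊥
            found-⊥ = proj₁ (proj₂ found) (trivial _ (proj₂ (proj₂ found)))

      -- `S₂` has index 2 and `h` represents the other coset. The element `e` and its conjugate
      -- under `h` both centralise `S₂`, and `h` exchanges them.
      double-cent : ∀ {e h} (S₂ : G → Set) → h ∙ h ≡ ε → (∀ y → P N (suc N) y → S₂ y ⊎ S₂ (h ∙ y)) → (∀ y → S₂ y → S₂ (h ⁻¹ ∙ y ∙ h)) → P N (suc N) e → P N (suc N) h →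
                    S₂ e → (∀ y → S₂ y → Comm e y) → Cent (e ∙ (h ∙ e ∙ h ⁻¹))
      double-cent {e} {h} S₂ h² split₂ nrm₂ pe ph Se ce = P-mul pe (P-mul (P-mul ph pe) (P-inv ph)) , λ s ps → [ on-S₂ , (λ q → subst (Comm ω) (grp (h ∷ s ∷ []) [] (var 0 ⁻ ⊕ (var 0 ⊕ var 1)) (var 1) refl) (comm-∙ (comm-inv on-h) (on-S₂ q))) ]′ (split₂ s ps)
        where
        e″ ω : G
        e″ = h ∙ e ∙ h ⁻¹
        ω = e ∙ e″
        ce″ : ∀ {y} → S₂ y → Comm e″ y
        ce″ {y} q = trans (grp (h ∷ e ∷ y ∷ []) [] ((var 0 ⊕ var 1 ⊕ var 0 ⁻) ⊕ var 2) (var 0 ⊕ (var 1 ⊕ (var 0 ⁻ ⊕ var 2 ⊕ var 0)) ⊕ var 0 ⁻) refl)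
          (trans (cong (λ w → h ∙ w ∙ h ⁻¹) (ce _ (nrm₂ y q))) (grp (h ∷ e ∷ y ∷ []) [] (var 0 ⊕ ((var 0 ⁻ ⊕ var 2 ⊕ var 0) ⊕ var 1) ⊕ var 0 ⁻) (var 2 ⊕ (var 0 ⊕ var 1 ⊕ var 0 ⁻)) refl))
        on-S₂ : ∀ {y} → S₂ y → Comm ω y
        on-S₂ {y} q = sym (comm-∙ (sym (ce y q)) (sym (ce″ q)))
        on-h : Comm ω h
        on-h = trans (grp (h ∷ e ∷ []) (ι 0 h² ∷ []) ((var 1 ⊕ (var 0 ⊕ var 1 ⊕ var 0 ⁻)) ⊕ var 0) (var 0 ⊕ ((var 0 ⊕ var 1 ⊕ var 0 ⁻) ⊕ var 1)) refl) (cong (h ∙_) (ce″ Se))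

      sh : ℕ → G → G
      sh zero y = y
      sh (suc i) y = γ ∙ sh i y ∙ γ ⁻¹

      sh-P : ∀ i {a b y} → P a b y → P (i + a) (i + b) (sh i y)
      sh-P zero q = q
      sh-P (suc i) q = P-shift (sh-P i q)

      sh-H : ∀ i j → sh i (H j) ≡ H (i + j)
      sh-H zero j = refl
      sh-H (suc i) j = trans (cong (λ w → γ ∙ w ∙ γ ⁻¹) (sh-H i j)) (H-suc (i + j))

      sh-word : ∀ i x y → sh i (x ∙ (y ∙ x ∙ y ⁻¹)) ≡ sh i x ∙ (sh i y ∙ sh i x ∙ sh i y ⁻¹)
      sh-word zero x y = refl
      sh-word (suc i) x y = trans (cong (λ w → γ ∙ w ∙ γ ⁻¹) (sh-word i x y)) (grp (γ ∷ sh i x ∷ sh i y ∷ []) [] (var 0 ⊕ (var 1 ⊕ (var 2 ⊕ var 1 ⊕ var 2 ⁻)) ⊕ var 0 ⁻)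
        ((var 0 ⊕ var 1 ⊕ var 0 ⁻) ⊕ ((var 0 ⊕ var 2 ⊕ var 0 ⁻) ⊕ (var 0 ⊕ var 1 ⊕ var 0 ⁻) ⊕ (var 0 ⊕ var 2 ⊕ var 0 ⁻) ⁻)) refl)

      P-glue : ∀ {a b a′ b′ y} → P a b y → P a′ b′ y → a′ ≤ b → P a b′ y
      P-glue {a} {b} q r le i ai ib with suc i ≤? b
      ... | yes lt = q i ai lt
      ... | no nlt = r i (≤-trans le (≤-pred (≰⇒> nlt))) ib

      module Wide (k : ℕ) (ep : p ≡ suc (suc k)) where
        nc : ¬ Comm (H 0) (H (suc c))
        nc = nc′ (≤-trans (s≤s (s≤s z≤n)) (≤-reflexive (sym ep)))

        M : ℕ
        M = c + suc k
        eM : N ≡ suc M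
        eM = trans eN (trans (cong (λ i → c + i) ep) (+-suc c (suc k)))
        2c≤N : suc (suc c) ≤ N
        2c≤N = ≤-trans (s≤s (≤-trans (≤-reflexive (+-comm 1 c)) (+-mono-≤ (≤-refl {c}) (s≤s z≤n)))) (≤-reflexive (sym eM))
        1k≤c : suc k ≤ c
        1k≤c = ≤-pred (≤-trans (≤-reflexive (sym ep)) p≤)

        -- Commutators of generators at the first non-commuting distance c + 1, taken at the two
        -- ends of `H 1` to `H N`. They are central and, up to inversion, shifts of each other by
        -- `k`, so `w₂` lies both in the centre and in a shift of it.
        w₁ w₂ : G
        w₁ = H (suc (suc c)) ∙ (H 1 ∙ H (suc (suc c)) ∙ H 1 ⁻¹)
        w₂ = H (suc k) ∙ (H N ∙ H (suc k) ∙ H N ⁻¹)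

        cent₁ : Cent w₁
        cent₁ = double-cent (P N (2 + N)) (H² 1) (λ y → peelˡ 1 N ≤-refl 1≤N) (λ y → norm-up ≤-refl (S-H 1 ≤-refl 1≤N)) (S-H _ (s≤s z≤n) 2c≤N) (S-H 1 ≤-refl 1≤N)
          (H-in (suc (suc c)) 2c≤N (s≤s (s≤s (m≤n+m N c)))) λ y → gen′ 2 N (s≤s 1≤N) (n≤1+n _)
            λ i i₂ iN → near (suc (suc c)) i (≤-trans (≤-refl {2 + c}) (+-mono-≤ i₂ ≤-refl)) (≤-trans iN (≤-trans N≤ (≤-trans (≤-reflexive (+-comm c p)) (+-mono-≤ (≤-trans p≤ (n≤1+n _)) ≤-refl))))

        cent₂ : Cent w₂
        cent₂ = double-cent (P M (suc N)) (H² N) (λ y py → subst (λ x → P M (suc N) y ⊎ P M (suc N) (H x ∙ y)) (sym eM) (peelʳ 1 M (s≤s (≤-reflexive (sym eM))) (s≤s z≤n) (subst (λ x → P x (suc N) y) eM py)))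
            (λ y → norm-down (s≤s (≤-reflexive (sym eM))) (subst (λ x → P x (suc N) (H N)) eM (S-H N 1≤N ≤-refl))) (S-H _ (s≤s z≤n) k≤N) (S-H N 1≤N ≤-refl)
            (H-in (suc k) (m≤n+m (suc k) c) (s≤s (m≤n+m N k))) λ y → gen′ 1 M (s≤s z≤n) (m≤n⇒m≤1+n (≤-reflexive (sym eM)))
              λ i i₁ iM → near (suc k) i (≤-trans 1k≤c (m≤n+m c i)) (≤-trans iM (≤-reflexive (+-comm c (suc k))))
          where
          k≤N : suc k ≤ N
          k≤N = ≤-trans (m≤n⇒m≤1+n (m≤n+m (suc k) c)) (≤-reflexive (sym eM))

        shifted : sh k w₁ ⁻¹ ≡ w₂
        shifted = trans (cong _⁻¹ (trans (sh-word k _ _) (cong₂ (λ x y → x ∙ (y ∙ x ∙ y ⁻¹)) (trans (sh-H k (suc (suc c))) (cong H i₁)) (trans (sh-H k 1) (cong H (+-comm k 1))))))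
          (grp (H N ∷ H (suc k) ∷ []) (ι 0 (H² N) ∷ ι 1 (H² (suc k)) ∷ []) ((var 0 ⊕ (var 1 ⊕ var 0 ⊕ var 1 ⁻)) ⁻) (var 1 ⊕ (var 0 ⊕ var 1 ⊕ var 0 ⁻)) refl)
          where
          i₁ : k + suc (suc c) ≡ N
          i₁ = trans (+-comm k (suc (suc c))) (trans (cong suc (sym (+-suc c k))) (sym eM))

        inside : P (suc c) (k + (p + N)) w₂
        inside = P-glue (centre-in cent₂) (subst (P (k + suc c) (k + (p + N))) shifted (P-inv (sh-P k (centre-in cent₁))))
          (≤-trans (≤-reflexive (trans (+-suc k c) (+-comm (suc k) c))) (≤-trans (+-mono-≤ (≤-refl {c}) (≤-trans (n≤1+n _) (≤-reflexive (sym ep)))) (≤-trans (≤-reflexive (sym eN)) (m≤n+m N p))))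

        w₂≢ε : w₂ ≢ ε
        w₂≢ε x = far′ nc (suc k) (subst (λ x → Comm (H (suc k)) (H x)) (trans eM (cong suc (trans (+-suc c k) (+-comm (suc c) k))))
          (cancelʳ (H (suc k) ∙ H N ⁻¹) (trans (grp (H (suc k) ∷ H N ∷ []) [] ((var 0 ⊕ var 1) ⊕ (var 0 ⊕ var 1 ⁻)) (var 0 ⊕ (var 1 ⊕ var 0 ⊕ var 1 ⁻)) refl)
            (trans x (grp (H (suc k) ∷ H N ∷ []) (ι 0 (H² (suc k)) ∷ []) e0 ((var 1 ⊕ var 0) ⊕ (var 0 ⊕ var 1 ⁻)) refl)))))

        wide : ¬ (suc (suc c) ≤ k + p)
        wide le = w₂≢ε (P-triv (suc c) (≤-trans (+-mono-≤ le (≤-refl {N})) (≤-reflexive (+-assoc k p N))) inside)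

    -- The hypotheses say c ≤ p + 1 and 2 p ≤ c + 3. For p ≤ 3 this gives N ≤ 2 p + 1 ≤ 7; p = 4
    -- forces c = 5, and larger p is impossible.
    few : ¬ (suc (suc p) ≤ c) → (∀ k → p ≡ suc (suc k) → ¬ (suc (suc c) ≤ k + p)) → N ≤ 7 ⊎ (c ≡ 5 × p ≡ 4)
    few n₁ n₂ = go p refl
      where
      c≤ : c ≤ suc p
      c≤ = ≤-pred (≰⇒> n₁)
      bound : ∀ {q} → p ≡ q → N ≤ suc q + q
      bound refl = ≤-trans (≤-reflexive eN) (+-mono-≤ c≤ ≤-refl)
      go : ∀ q → p ≡ q → N ≤ 7 ⊎ (c ≡ 5 × p ≡ 4)
      go 0 e = inj₁ (≤-trans (bound e) (s≤s z≤n))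
      go 1 e = inj₁ (≤-trans (bound e) (m≤m+n 3 4))
      go 2 e = inj₁ (≤-trans (bound e) (m≤m+n 5 2))
      go 3 e = inj₁ (bound e)
      go 4 e = inj₂ (≤-antisym (≤-trans c≤ (≤-reflexive (cong suc e))) (≤-pred (≤-pred (≰⇒> λ x → n₂ 2 e (≤-trans (s≤s (≤-pred x)) (≤-reflexive (sym (cong (λ i → 2 + i) e)))))) ) , e)
      go (suc (suc (suc (suc (suc j))))) e = ⊥-elim (n₂ (suc (suc (suc j))) e (≤-trans (s≤s (s≤s (≤-trans c≤ (≤-reflexive (cong suc e))))) (≤-trans (m≤n+m _ j) (≤-trans (≤-reflexive refl) (big j e)))))
        where
        big : ∀ j → p ≡ suc (suc (suc (suc (suc j)))) → j + suc (suc (suc (suc (suc (suc (suc (suc j))))))) ≤ suc (suc (suc j)) + p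
        big j e = ≤-reflexive (trans (trans (+-suc j _) (cong suc (trans (+-suc j _) (cong suc (+-suc j _))))) (cong (λ x → suc (suc (suc (j + x)))) (sym e)))

-- The exceptional parameters N = 9 and c = 5

module RigidNine (S : Setting) (t : Bool) (rigid₀ : ∀ g → Basics.S₀ S g → Basics.Q S (Setting.o S t) g)
    (turn₀ : ∀ {b c} → Basics.St S (Setting.o S (not t)) (Setting.o S t) b c →
       ∃ λ g → Setting._▹_ S g (Setting.o S (not t)) ≡ Setting.o S (not t) × Setting._▹_ S g (Setting.o S t) ≡ Setting.o S t × Setting._▹_ S g b ≡ c) where
  open RigidCount S t rigid₀ turn₀ public

  le : ∀ a b {_ : True (a ≤? b)} → a ≤ b
  le a b {w} = toWitness w

  module Nine (triv₀ : ∀ y → P 0 10 y → y ≡ ε) (s₀ : G) (ps₀ : P 0 9 s₀) (ms₀ : s₀ ▹ αs 9 ≢ αs 9)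
      (cH : ∀ d → d ≤ 5 → Comm (Gens.H 9 (le 1 9) triv₀ s₀ ps₀ ms₀ 0) (Gens.H 9 (le 1 9) triv₀ s₀ ps₀ ms₀ d)) (nc₀ : ¬ Comm (Gens.H 9 (le 1 9) triv₀ s₀ ps₀ ms₀ 0) (Gens.H 9 (le 1 9) triv₀ s₀ ps₀ ms₀ 6)) where
    open Count 9 (le 1 9) triv₀ s₀ ps₀ ms₀ 5 4 refl (le 1 4) (le 4 6)
    open Steps cH (λ _ → nc₀)
    open Wide 2 refl using (w₂≢ε; inside)

    nr : ∀ i j {_ : True (i ≤? j + 5)} {_ : True (j ≤? i + 5)} → Comm (H i) (H j)
    nr i j {u} {v} = near i j (toWitness u) (toWitness v)

    nrG : ∀ i l r {y} {_ : True (l ≤? suc r)} {_ : True (suc r ≤? l + 9)} {_ : True (i ≤? l + 5)} {_ : True (r ≤? i + 5)} → P r (l + 9) y → Comm (H i) y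
    nrG i l r {_} {a} {b} {d} {e} = gen′ l r (toWitness a) (toWitness b) λ j lj jr → near i j (≤-trans (toWitness d) (+-mono-≤ lj ≤-refl)) (≤-trans jr (toWitness e))

    -- The commutator of `H k` and `H (6 + k)` is `H (3 + k)`. For k = 3 it is the nontrivial
    -- element `w₂`, confined to a group of order 2; shifting gives the other cases.
    Six : ℕ → Set
    Six k = H k ∙ H (6 + k) ≡ H (3 + k) ∙ (H (6 + k) ∙ H k)

    six-shift : ∀ k → γ ∙ (H (3 + k) ∙ (H (6 + k) ∙ H k)) ∙ γ ⁻¹ ≡ H (4 + k) ∙ (H (7 + k) ∙ H (suc k))
    six-shift k = trans (grp (γ ∷ H (3 + k) ∷ H (6 + k) ∙ H k ∷ []) [] (var 0 ⊕ (var 1 ⊕ var 2) ⊕ var 0 ⁻) ((var 0 ⊕ var 1 ⊕ var 0 ⁻) ⊕ (var 0 ⊕ var 2 ⊕ var 0 ⁻)) refl) (cong₂ _∙_ (H-suc (3 + k)) (H-shift (6 + k) k))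

    six-down : ∀ k → Six (suc k) → Six k
    six-down k e = γ-inj (trans (H-shift k (6 + k)) (trans e (sym (six-shift k))))

    six-up : ∀ k → Six k → Six (suc k)
    six-up k e = trans (sym (H-shift k (6 + k))) (trans (cong (λ w → γ ∙ w ∙ γ ⁻¹) e) (six-shift k))

    six : ∀ k → Six k
    six zero = six-down 0 (six-down 1 (six-down 2 six₃))
      where
      w≡ : H 3 ∙ (H 9 ∙ H 3 ∙ H 9 ⁻¹) ≡ H 6
      w≡ = [ (λ e → ⊥-elim (w₂≢ε e)) , id ]′ (H-only 6 inside)
      six₃ : Six 3
      six₃ = trans (grp (H 3 ∷ H 9 ∷ []) (ι 0 (H² 3) ∷ []) (var 0 ⊕ var 1) ((var 0 ⊕ (var 1 ⊕ var 0 ⊕ var 1 ⁻)) ⊕ (var 1 ⊕ var 0)) refl) (cong (_∙ (H 9 ∙ H 3)) w≡)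
    six (suc k) = six-up k (six k)

    -- Towards each end the commutator is a product of two elements moving the same vertex: a
    -- generator and a conjugate of it.
    com-in : ∀ i j {_ : True (suc i ≤? suc j)} {_ : True (suc (suc j) ≤? i + 9)} → P j (suc i + 9) (H i ∙ H (suc j) ∙ H i ∙ H (suc j))
    com-in i j {a} {b} = P-glue lower upper (<⇒≤ (toWitness b))
      where
      A B : G
      A = H i
      B = H (suc j)
      pA : P (suc j) (i + 9) A
      pA = H-in i (<⇒≤ (toWitness a)) ≤-refl
      pB : P (suc j) (i + 9) B
      pB = H-in (suc j) ≤-refl (+-mono-≤ (<⇒≤ (toWitness a)) ≤-refl)
      upper : P (suc j) (suc i + 9) (A ∙ B ∙ A ∙ B)
      upper = subst (P (suc j) (suc i + 9)) (grp (A ∷ B ∷ []) (ι 1 (H² (suc j)) ∷ []) (var 0 ⊕ (var 1 ⊕ var 0 ⊕ var 1 ⁻)) (var 0 ⊕ var 1 ⊕ var 0 ⊕ var 1) refl)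
        (two-up (toWitness b) pA (P-mul (P-mul pB pA) (P-inv pB)) (H-up i) λ e → H-up i (▹-inj B (trans (trans (cong (λ v → B ▹ (A ▹ v)) (sym fB⁻)) (trans (sym (trans (∙▹ (B ∙ A) (B ⁻¹) _) (∙▹ B A _))) e)) (sym fB))))
        where
        fB : B ▹ αs (i + 9) ≡ αs (i + 9)
        fB = H-fix i (suc j) (toWitness a) (<⇒≤ (toWitness b))
        fB⁻ : B ⁻¹ ▹ αs (i + 9) ≡ αs (i + 9)
        fB⁻ = ⁻¹▹ B fB
      lower : P j (i + 9) (A ∙ B ∙ A ∙ B)
      lower = subst (P j (i + 9)) (grp (A ∷ B ∷ []) (ι 0 (H² i) ∷ []) ((var 0 ⊕ var 1 ⊕ var 0 ⁻) ⊕ var 1) (var 0 ⊕ var 1 ⊕ var 0 ⊕ var 1) refl)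
        (two-down (toWitness b) (P-mul (P-mul pA pB) (P-inv pA)) pB (λ e → H-down j (▹-inj A (trans (trans (cong (λ v → A ▹ (B ▹ v)) (sym (⁻¹▹ A fA))) (trans (sym (trans (∙▹ (A ∙ B) (A ⁻¹) _) (∙▹ A B _))) e)) (sym fA)))) (H-down j))
        where
        fA : A ▹ αs j ≡ αs j
        fA = proj₂ (H-P i j (≤-pred (toWitness a)) (<⇒≤ (toWitness b)))

    six-conj : ∀ k → H k ∙ H (6 + k) ∙ H k ⁻¹ ≡ H (3 + k) ∙ H (6 + k)
    six-conj k = trans (cong (_∙ H k ⁻¹) (six k)) (grp (H k ∷ H (6 + k) ∷ H (3 + k) ∷ []) [] ((var 2 ⊕ (var 1 ⊕ var 0)) ⊕ var 0 ⁻) (var 2 ⊕ var 1) refl)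

    six-conj′ : ∀ k → H (6 + k) ∙ H k ∙ H (6 + k) ⁻¹ ≡ H (3 + k) ∙ H k
    six-conj′ k = trans (cong (_∙ H (6 + k) ⁻¹) (trans (grp (H k ∷ H (6 + k) ∷ H (3 + k) ∷ []) (ι 2 (H² (3 + k)) ∷ []) (var 1 ⊕ var 0) (var 2 ⊕ (var 2 ⊕ (var 1 ⊕ var 0))) refl) (cong (H (3 + k) ∙_) (sym (six k)))))
      (grp (H k ∷ H (6 + k) ∷ H (3 + k) ∷ []) [] ((var 2 ⊕ (var 0 ⊕ var 1)) ⊕ var 1 ⁻) (var 2 ⊕ var 0) refl)

    -- Commutators of generators at distance 7, shifts of one another. The aim is `y-in`, which
    -- confines `y` between the indices 6 and 14.
    y y₁ y₃ : G
    y = H 2 ∙ H 9 ∙ H 2 ∙ H 9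
    y₁ = H 1 ∙ H 8 ∙ H 1 ∙ H 8
    y₃ = H 3 ∙ H 10 ∙ H 3 ∙ H 10

    γ-word : ∀ i j → γ ∙ (H i ∙ H j ∙ H i ∙ H j) ∙ γ ⁻¹ ≡ H (suc i) ∙ H (suc j) ∙ H (suc i) ∙ H (suc j)
    γ-word i j = trans (grp (γ ∷ H i ∷ H j ∷ []) [] (var 0 ⊕ (var 1 ⊕ var 2 ⊕ var 1 ⊕ var 2) ⊕ var 0 ⁻) ((var 0 ⊕ var 1 ⊕ var 0 ⁻) ⊕ (var 0 ⊕ var 2 ⊕ var 0 ⁻) ⊕ (var 0 ⊕ var 1 ⊕ var 0 ⁻) ⊕ (var 0 ⊕ var 2 ⊕ var 0 ⁻)) refl)
      (cong₂ (λ a b → a ∙ b ∙ a ∙ b) (H-suc i) (H-suc j))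

    γy₁ : γ ∙ y₁ ∙ γ ⁻¹ ≡ y
    γy₁ = γ-word 1 8

    γy : γ ∙ y ∙ γ ⁻¹ ≡ y₃
    γy = γ-word 2 9

    py : P 8 12 y
    py = com-in 2 8

    data Pow (i : ℕ) (g : G) : Set where
      none : g ≡ ε → Pow i g
      one  : g ≡ H i → Pow i g

    pow-comm : ∀ {i g h} → Pow i g → Comm h (H i) → Comm h g
    pow-comm (none refl) _ = trans (idʳ _) (sym (idˡ _))
    pow-comm (one refl) c = c

    pow² : ∀ {i g} → Pow i g → g ∙ g ≡ ε
    pow² (none refl) = idˡ ε
    pow² {i} (one refl) = H² i

    pow-P : ∀ {i g a b} → Pow i g → P a b (H i) → P a b g
    pow-P (none refl) _ = λ j _ _ → ε▹ _ , ε▹ _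
    pow-P (one refl) p = p

    pow-γ : ∀ {i g} → Pow i g → Pow (suc i) (γ ∙ g ∙ γ ⁻¹)
    pow-γ (none refl) = none (grp (γ ∷ []) [] (var 0 ⊕ e0 ⊕ var 0 ⁻) e0 refl)
    pow-γ {i} (one refl) = one (H-suc i)

    pow-γ⁻ : ∀ {i g} → Pow (suc i) (γ ∙ g ∙ γ ⁻¹) → Pow i g
    pow-γ⁻ {i} {g} (none e) = none (cancelˡ γ (cancelʳ (γ ⁻¹) (trans e (grp (γ ∷ []) [] e0 (var 0 ⊕ e0 ⊕ var 0 ⁻) refl))))
    pow-γ⁻ {i} {g} (one e) = one (γ-inj (trans e (sym (H-suc i))))

    pow-clash : ∀ {i g} → Pow (suc i) g → g ≡ H i → ⊥
    pow-clash {i} (none e) q = H≢ε i (trans (sym q) e)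
    pow-clash {i} (one e) q = H-up i (trans (cong (_▹ αs (i + 9)) (trans (sym q) e)) (H-fix i (suc i) ≤-refl (≤-trans (≤-reflexive (+-comm 1 i)) (+-mono-≤ (≤-refl {i}) (le 1 9)))))

    pow-clash′ : ∀ {i g} → Pow i g → g ≡ H (suc i) → ⊥
    pow-clash′ {i} (none e) q = H≢ε (suc i) (trans (sym q) e)
    pow-clash′ {i} {g} (one e) q = pow-clash {i} {g} (one q) e

    pow-pair : ∀ {w ζ g} → Pow 5 w → Pow 6 ζ → g ≡ ζ ∙ w → P 6 14 g
    pow-pair k z refl = P-mul (pow-P z (H-in 6 (le 6 6) (le 14 15))) (pow-P k (H-in 5 (le 5 6) (le 14 14)))

    -- Conjugation by `H 1` multiplies `y` by a power of `H 5`. After peeling off `H 8` if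
    -- necessary, an element of `P 7 12` is left, which `H 1` changes only by a power of `H 4`. The
    -- comparison either confines `y` directly or expresses `y₁` by `H 5` and `H 4`.
    module Upper where
      v : G
      v = H 9 ∙ H 1 ∙ H 9 ∙ H 1
      pv : P 8 11 v
      pv = P-mono ≤-refl (le 11 11) (subst (P 8 11) (grp (H 1 ∷ H 9 ∷ []) (ι 0 (H² 1) ∷ ι 1 (H² 9) ∷ []) ((var 0 ⊕ var 1 ⊕ var 0 ⊕ var 1) ⁻) (var 1 ⊕ var 0 ⊕ var 1 ⊕ var 0) refl) (P-inv (com-in 1 8)))
      ζ-of : ∃ λ ζ → Pow 5 ζ × H 2 ∙ v ≡ ζ ∙ (v ∙ H 2)
      ζ-of = [ (λ q → ε , none refl , trans (nrG 2 2 7 q) (sym (idˡ _))) , (λ q → H 5 , one refl , eight q) ]′ (peelʳ 2 7 (le 9 11) (le 2 8) pv)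
        where
        eight : P 7 11 (H 8 ∙ v) → H 2 ∙ v ≡ H 5 ∙ (v ∙ H 2)
        eight q = trans (grp (H 2 ∷ H 8 ∷ v ∷ []) (ι 1 (H² 8) ∷ []) (var 0 ⊕ var 2) ((var 0 ⊕ var 1) ⊕ (var 1 ⊕ var 2)) refl) (trans (cong (_∙ (H 8 ∙ v)) (six 2))
          (trans (grp (H 2 ∷ H 8 ∷ H 8 ∙ v ∷ H 5 ∷ []) (κ 0 2 (nrG 2 2 7 q) ∷ []) ((var 3 ⊕ (var 1 ⊕ var 0)) ⊕ var 2) (var 3 ⊕ (var 1 ⊕ var 2 ⊕ var 0)) refl)
          (grp (H 2 ∷ H 8 ∷ v ∷ H 5 ∷ []) (ι 1 (H² 8) ∷ []) (var 3 ⊕ (var 1 ⊕ (var 1 ⊕ var 2) ⊕ var 0)) (var 3 ⊕ (var 2 ⊕ var 0)) refl)))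
      ζ : G
      ζ = proj₁ ζ-of
      pζ : Pow 5 ζ
      pζ = proj₁ (proj₂ ζ-of)
      conj₁ : H 1 ∙ y ∙ H 1 ⁻¹ ≡ ζ ∙ y
      conj₁ = cancelʳ (H 9 ∙ v ∙ H 2) (trans (grp (H 1 ∷ H 9 ∷ H 2 ∷ []) (ι 0 (H² 1) ∷ ι 1 (H² 9) ∷ ι 2 (H² 2) ∷ κ 0 2 (nr 1 2) ∷ [])
          ((var 0 ⊕ (var 2 ⊕ var 1 ⊕ var 2 ⊕ var 1) ⊕ var 0 ⁻) ⊕ (var 1 ⊕ (var 1 ⊕ var 0 ⊕ var 1 ⊕ var 0) ⊕ var 2)) (var 2 ⊕ var 1 ⊕ (var 1 ⊕ var 0 ⊕ var 1 ⊕ var 0)) refl)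
        (trans (grp (H 9 ∷ H 2 ∷ v ∷ []) (ι 0 (H² 9) ∷ ι 1 (H² 2) ∷ []) (var 1 ⊕ var 0 ⊕ var 2) ((var 1 ⊕ var 0 ⊕ var 1 ⊕ var 0) ⊕ var 0 ⊕ (var 1 ⊕ var 2)) refl)
        (trans (cong (y ∙ H 9 ∙_) (proj₂ (proj₂ ζ-of))) (grp (y ∷ H 9 ∷ v ∷ H 2 ∷ ζ ∷ []) (κ 0 4 (pow-comm pζ (sym (nrG 5 3 8 py))) ∷ κ 1 4 (pow-comm pζ (nr 9 5)) ∷ [])
          ((var 0 ⊕ var 1) ⊕ (var 4 ⊕ (var 2 ⊕ var 3))) ((var 4 ⊕ var 0) ⊕ (var 1 ⊕ var 2 ⊕ var 3)) refl))))
      Fixes : G → Set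
      Fixes u = ∃ λ w → Pow 4 w × H 1 ∙ u ∙ H 1 ⁻¹ ≡ w ∙ u × (w ≡ ε → P 6 12 u)
      κ-of : ∀ {u} → P 7 12 u → Fixes u
      κ-of {u} pu = [ still , (λ q → H 4 , one refl , seven q , λ e → ⊥-elim (H≢ε 4 e)) ]′ (peelʳ 3 6 (le 8 12) (le 3 7) pu)
        where
        still : P 6 12 u → Fixes u
        still q = ε , none refl , trans (cong (_∙ H 1 ⁻¹) (nrG 1 3 6 q)) (grp (u ∷ H 1 ∷ []) [] ((var 0 ⊕ var 1) ⊕ var 1 ⁻) (e0 ⊕ var 0) refl) , λ _ → q
        seven : P 6 12 (H 7 ∙ u) → H 1 ∙ u ∙ H 1 ⁻¹ ≡ H 4 ∙ u
        seven q = trans (grp (H 1 ∷ H 7 ∷ u ∷ []) (ι 1 (H² 7) ∷ []) (var 0 ⊕ var 2 ⊕ var 0 ⁻) ((var 0 ⊕ var 1 ⊕ var 0 ⁻) ⊕ (var 0 ⊕ (var 1 ⊕ var 2) ⊕ var 0 ⁻)) refl)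
          (trans (cong₂ _∙_ (six-conj 1) (trans (cong (_∙ H 1 ⁻¹) (nrG 1 3 6 q)) (grp (H 7 ∙ u ∷ H 1 ∷ []) [] ((var 0 ⊕ var 1) ⊕ var 1 ⁻) (var 0) refl)))
          (grp (H 4 ∷ H 7 ∷ u ∷ []) (ι 1 (H² 7) ∷ []) ((var 0 ⊕ var 1) ⊕ (var 1 ⊕ var 2)) (var 0 ⊕ var 2) refl))
      upper : P 6 14 y ⊎ P 6 12 y
      upper = [ without , with-8 ]′ (peelʳ 3 7 (le 9 12) (le 3 8) py)
        where
        without : P 7 12 y → P 6 14 y ⊎ P 6 12 y
        without q = fin (κ-of q)
          where
          fin : Fixes y → P 6 14 y ⊎ P 6 12 y
          fin (_ , none e , _ , k) = inj₂ (k e)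
          fin (_ , one e , c , _) = ⊥-elim (pow-clash pζ (trans (cancelʳ y (trans (sym conj₁) c)) e))
        with-8 : P 7 12 (H 8 ∙ y) → P 6 14 y ⊎ P 6 12 y
        with-8 q = inj₁ (fin (κ-of q))
          where
          fin : Fixes (H 8 ∙ y) → P 6 14 y
          fin (k₄ , pk , c , _) = pow-pair (pow-γ pk) (pow-γ pζ) (trans (sym γy₁) (trans (cong (λ w → γ ∙ w ∙ γ ⁻¹) y₁≡) (grp (γ ∷ ζ ∷ k₄ ∷ []) [] (var 0 ⊕ (var 1 ⊕ var 2) ⊕ var 0 ⁻) ((var 0 ⊕ var 1 ⊕ var 0 ⁻) ⊕ (var 0 ⊕ var 2 ⊕ var 0 ⁻)) refl)))
            where
            y₁≡ : y₁ ≡ ζ ∙ k₄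
            y₁≡ = cancelʳ (H 8 ∙ (k₄ ∙ (H 8 ∙ y))) (trans (cong (λ w → y₁ ∙ (H 8 ∙ w)) (sym c)) (trans (grp (H 1 ∷ H 8 ∷ y ∷ []) (ι 0 (H² 1) ∷ ι 1 (H² 8) ∷ []) ((var 0 ⊕ var 1 ⊕ var 0 ⊕ var 1) ⊕ (var 1 ⊕ (var 0 ⊕ (var 1 ⊕ var 2) ⊕ var 0 ⁻))) (var 0 ⊕ var 2 ⊕ var 0 ⁻) refl)
              (trans conj₁ (grp (ζ ∷ k₄ ∷ H 8 ∷ y ∷ []) (ι 1 (pow² pk) ∷ ι 2 (H² 8) ∷ κ 1 2 (sym (pow-comm pk (nr 8 4))) ∷ []) (var 0 ⊕ var 3) ((var 0 ⊕ var 1) ⊕ (var 2 ⊕ (var 1 ⊕ (var 2 ⊕ var 3)))) refl))))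

    -- The mirror image of `Upper`: conjugation by `H 10`, peeling off `H 3`, and `y₃` in the place
    -- of `y₁`.
    module Lower where
      v : G
      v = H 2 ∙ H 10 ∙ H 2 ∙ H 10
      pv : P 9 12 v
      pv = com-in 2 9
      ζ-of : ∃ λ ζ → Pow 6 ζ × H 9 ∙ v ≡ ζ ∙ (v ∙ H 9)
      ζ-of = [ (λ q → ε , none refl , trans (nrG 9 4 9 q) (sym (idˡ _))) , (λ q → H 6 , one refl , three q) ]′ (peelˡ 3 9 (le 10 12) (le 3 9) pv)
        where
        three : P 9 13 (H 3 ∙ v) → H 9 ∙ v ≡ H 6 ∙ (v ∙ H 9)
        three q = trans (grp (H 9 ∷ H 3 ∷ v ∷ []) (ι 1 (H² 3) ∷ []) (var 0 ⊕ var 2) ((var 0 ⊕ var 1 ⊕ var 0 ⁻) ⊕ (var 0 ⊕ (var 1 ⊕ var 2))) refl) (trans (cong₂ _∙_ (six-conj′ 3) (nrG 9 4 9 q))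
          (grp (H 9 ∷ H 3 ∷ v ∷ H 6 ∷ []) (ι 1 (H² 3) ∷ []) ((var 3 ⊕ var 1) ⊕ ((var 1 ⊕ var 2) ⊕ var 0)) (var 3 ⊕ (var 2 ⊕ var 0)) refl))
      ζ : G
      ζ = proj₁ ζ-of
      pζ : Pow 6 ζ
      pζ = proj₁ (proj₂ ζ-of)
      conj₁₀ : H 10 ∙ y ∙ H 10 ⁻¹ ≡ ζ ∙ y
      conj₁₀ = cancelʳ (H 9 ∙ (H 2 ∙ v)) (trans (grp (H 10 ∷ H 9 ∷ H 2 ∷ []) (ι 0 (H² 10) ∷ ι 1 (H² 9) ∷ ι 2 (H² 2) ∷ κ 0 1 (nr 10 9) ∷ [])
          ((var 0 ⊕ (var 2 ⊕ var 1 ⊕ var 2 ⊕ var 1) ⊕ var 0 ⁻) ⊕ (var 1 ⊕ (var 2 ⊕ (var 2 ⊕ var 0 ⊕ var 2 ⊕ var 0)))) (var 2 ⊕ ((var 2 ⊕ var 0 ⊕ var 2 ⊕ var 0) ⊕ var 1)) refl)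
        (trans (grp (H 2 ∷ ζ ∷ v ∷ H 9 ∷ []) (ι 1 (pow² pζ) ∷ κ 0 1 (pow-comm pζ (nr 2 6)) ∷ []) (var 0 ⊕ (var 2 ⊕ var 3)) (var 1 ⊕ (var 0 ⊕ (var 1 ⊕ (var 2 ⊕ var 3)))) refl)
        (trans (cong (λ w → ζ ∙ (H 2 ∙ w)) (sym (proj₂ (proj₂ ζ-of)))) (grp (H 2 ∷ H 9 ∷ v ∷ ζ ∷ []) (ι 0 (H² 2) ∷ ι 1 (H² 9) ∷ []) (var 3 ⊕ (var 0 ⊕ (var 1 ⊕ var 2))) ((var 3 ⊕ (var 0 ⊕ var 1 ⊕ var 0 ⊕ var 1)) ⊕ (var 1 ⊕ (var 0 ⊕ var 2))) refl))))
      Fixes : G → Set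
      Fixes u = ∃ λ w → Pow 7 w × H 10 ∙ u ∙ H 10 ⁻¹ ≡ w ∙ u × (w ≡ ε → P 8 14 u)
      κ-of : ∀ {u} → P 8 13 u → Fixes u
      κ-of {u} pu = [ still , (λ q → H 7 , one refl , four q , λ e → ⊥-elim (H≢ε 7 e)) ]′ (peelˡ 4 8 (le 9 13) (le 4 8) pu)
        where
        still : P 8 14 u → Fixes u
        still q = ε , none refl , trans (cong (_∙ H 10 ⁻¹) (nrG 10 5 8 q)) (grp (u ∷ H 10 ∷ []) [] ((var 0 ⊕ var 1) ⊕ var 1 ⁻) (e0 ⊕ var 0) refl) , λ _ → q
        four : P 8 14 (H 4 ∙ u) → H 10 ∙ u ∙ H 10 ⁻¹ ≡ H 7 ∙ u
        four q = trans (grp (H 10 ∷ H 4 ∷ u ∷ []) (ι 1 (H² 4) ∷ []) (var 0 ⊕ var 2 ⊕ var 0 ⁻) ((var 0 ⊕ var 1 ⊕ var 0 ⁻) ⊕ (var 0 ⊕ (var 1 ⊕ var 2) ⊕ var 0 ⁻)) refl)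
          (trans (cong₂ _∙_ (six-conj′ 4) (trans (cong (_∙ H 10 ⁻¹) (nrG 10 5 8 q)) (grp (H 4 ∙ u ∷ H 10 ∷ []) [] ((var 0 ⊕ var 1) ⊕ var 1 ⁻) (var 0) refl)))
          (grp (H 7 ∷ H 4 ∷ u ∷ []) (ι 1 (H² 4) ∷ []) ((var 0 ⊕ var 1) ⊕ (var 1 ⊕ var 2)) (var 0 ⊕ var 2) refl))
      lower : P 6 14 y ⊎ P 8 14 y
      lower = [ without , with-3 ]′ (peelˡ 3 8 (le 9 12) (le 3 8) py)
        where
        without : P 8 13 y → P 6 14 y ⊎ P 8 14 y
        without q = fin (κ-of q)
          where
          fin : Fixes y → P 6 14 y ⊎ P 8 14 y
          fin (_ , none e , _ , k) = inj₂ (k e)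
          fin (_ , one e , c , _) = ⊥-elim (pow-clash′ pζ (trans (cancelʳ y (trans (sym conj₁₀) c)) e))
        with-3 : P 8 13 (H 3 ∙ y) → P 6 14 y ⊎ P 8 14 y
        with-3 q = inj₁ (fin (κ-of q))
          where
          fin : Fixes (H 3 ∙ y) → P 6 14 y
          fin (k₇ , pk , c , _) = final
            where
            y₃≡ : y₃ ≡ ζ ∙ k₇
            y₃≡ = cancelʳ (k₇ ∙ (H 3 ∙ y)) (cancelˡ (H 3) (trans (cong (λ w → H 3 ∙ (y₃ ∙ w)) (sym c))
              (trans (grp (H 10 ∷ H 3 ∷ y ∷ []) (ι 0 (H² 10) ∷ ι 1 (H² 3) ∷ []) (var 1 ⊕ ((var 1 ⊕ var 0 ⊕ var 1 ⊕ var 0) ⊕ (var 0 ⊕ (var 1 ⊕ var 2) ⊕ var 0 ⁻))) (var 0 ⊕ var 2 ⊕ var 0 ⁻) refl)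
              (trans conj₁₀ (grp (ζ ∷ k₇ ∷ H 3 ∷ y ∷ []) (ι 1 (pow² pk) ∷ ι 2 (H² 3) ∷ κ 2 0 (pow-comm pζ (nr 3 6)) ∷ []) (var 0 ⊕ var 3) (var 2 ⊕ ((var 0 ⊕ var 1) ⊕ (var 1 ⊕ (var 2 ⊕ var 3)))) refl)))))
            back : G → G
            back g = γ ⁻¹ ∙ g ∙ γ
            γback : ∀ g → γ ∙ back g ∙ γ ⁻¹ ≡ g
            γback g = grp (γ ∷ g ∷ []) [] (var 0 ⊕ (var 0 ⁻ ⊕ var 1 ⊕ var 0) ⊕ var 0 ⁻) (var 1) refl
            final : P 6 14 y
            final = pow-pair (pow-γ⁻ (subst (Pow 6) (sym (γback ζ)) pζ)) (pow-γ⁻ (subst (Pow 7) (sym (γback k₇)) pk))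
              (trans (cancelˡ γ (cancelʳ (γ ⁻¹) (trans γy (trans y₃≡ (grp (γ ∷ ζ ∷ k₇ ∷ []) [] (var 1 ⊕ var 2) (var 0 ⊕ ((var 0 ⁻ ⊕ var 1 ⊕ var 0) ⊕ (var 0 ⁻ ⊕ var 2 ⊕ var 0)) ⊕ var 0 ⁻) refl)))))
                (pow-comm (pow-γ⁻ {6} (subst (Pow 7) (sym (γback k₇)) pk)) (sym (pow-comm (pow-γ⁻ {5} (subst (Pow 6) (sym (γback ζ)) pζ)) (nr 6 5)))))

    y-in : P 6 14 y
    y-in = [ id , (λ p → [ id , (λ q → P-glue p q (le 8 12)) ]′ Lower.lower) ]′ Upper.upper

    τ τ′ d d′ : G
    τ = H 10 ∙ H 1
    τ′ = H 0 ∙ H 9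
    d = τ ∙ γ
    d′ = τ′ ∙ γ ⁻¹

    -- `d` and `d′` rotate the star of `αs 9` in opposite directions, so `d′` is `d ∙ d` times an
    -- element `s` of the flag stabiliser. Conjugating `H 3` by both expresses `F₂` through `F₁` and
    -- `H 5`. But by `y-in`, `F₁` and `H 5` fix `αs 11` while `F₂` moves it.
    contradiction : ⊥
    contradiction = go (α-star 9) (x-star 9) (x-star 8)
      where
      go : (∃ λ x′ → St (αs 9) (xs 9) (xs 10) x′) → (∃ λ a → St (xs 10) (αs 9) (αs 10) a) → (∃ λ b → St (xs 9) (αs 8) (αs 9) b) → ⊥
      go (x′ , sα) (a , sx) (b , sy) = [ F₂≢ , F₂≢′ ]′ F₂-value
        where
        p₁ : P 9 10 (H 1)
        p₁ = H-in 1 (le 1 9) (le 10 10)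
        p₁₀ : P 10 19 (H 10)
        p₁₀ = H-P 10
        p₉ : P 9 18 (H 9)
        p₉ = H-P 9
        p₀ : P 0 9 (H 0)
        p₀ = H-P 0
        x₁₀ : H 1 ▹ xs 10 ≡ xs 10
        x₁₀ = P-x 9 ≤-refl ≤-refl p₁
        sw₁ : H 1 ▹ αs 10 ≡ a
        sw₁ = [ (λ e → ⊥-elim (H-up 1 (proj₁ e))) , proj₁ ]′ (swap? (H 1) sx x₁₀ (proj₂ (p₁ 9 ≤-refl ≤-refl)))
        f₁₀ : H 10 ▹ xs 10 ≡ xs 10 × H 10 ▹ αs 10 ≡ αs 10
        f₁₀ = p₁₀ 10 ≤-refl (le 11 19)
        sw₁₀ : H 10 ▹ a ≡ αs 9
        sw₁₀ = [ (λ e → ⊥-elim (H-down 9 (proj₁ e))) , proj₂ ]′ (swap? (H 10) (st-213 sx) (proj₁ f₁₀) (proj₂ f₁₀))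
        dα : d ▹ αs 9 ≡ αs 9
        dα = ∙▹≡ τ γ refl (∙▹≡ (H 10) (H 1) sw₁ sw₁₀)
        d₀ : d ▹ xs 9 ≡ xs 10
        d₀ = ∙▹≡ τ γ refl (fix-∙ (proj₁ f₁₀) x₁₀)
        x₉ : H 0 ▹ xs 9 ≡ xs 9
        x₉ = P-x 8 (le 0 8) ≤-refl p₀
        f₉ : H 9 ▹ xs 9 ≡ xs 9 × H 9 ▹ αs 9 ≡ αs 9
        f₉ = p₉ 9 ≤-refl (le 10 18)
        sw₉ : H 9 ▹ αs 8 ≡ b
        sw₉ = [ (λ e → ⊥-elim (H-down 8 (proj₁ e))) , proj₁ ]′ (swap? (H 9) (st-213 sy) (proj₁ f₉) (proj₂ f₉))
        sw₀ : H 0 ▹ b ≡ αs 9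
        sw₀ = [ (λ e → ⊥-elim (H-up 0 (proj₁ e))) , proj₂ ]′ (swap? (H 0) sy x₉ (proj₂ (p₀ 8 (le 0 8) ≤-refl)))
        d′α : d′ ▹ αs 9 ≡ αs 9
        d′α = ∙▹≡ τ′ (γ ⁻¹) (⁻¹▹ γ refl) (∙▹≡ (H 0) (H 9) sw₉ sw₀)
        d′₁ : d′ ▹ xs 10 ≡ xs 9
        d′₁ = ∙▹≡ τ′ (γ ⁻¹) (⁻¹▹ γ refl) (fix-∙ x₉ (proj₁ f₉))
        rot = rotates (Tα 9) sα dα d₀
        s : G
        s = (d ∙ d) ⁻¹ ∙ d′
        ps : P 9 10 s
        ps = S-mem (₂ sα) (∙▹≡ ((d ∙ d) ⁻¹) d′ d′α (⁻¹▹ (d ∙ d) (fix-∙ dα dα))) (∙▹≡ ((d ∙ d) ⁻¹) d′ d′₁ (⁻¹▹ (d ∙ d) (∙▹≡ d d (proj₁ rot) (proj₂ rot))))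
        conj-d : ∀ i {g} → τ ∙ H (suc i) ∙ τ ⁻¹ ≡ g → d ∙ H i ∙ d ⁻¹ ≡ g
        conj-d i e = trans (grp (τ ∷ γ ∷ H i ∷ []) [] ((var 0 ⊕ var 1) ⊕ var 2 ⊕ (var 0 ⊕ var 1) ⁻) (var 0 ⊕ (var 1 ⊕ var 2 ⊕ var 1 ⁻) ⊕ var 0 ⁻) refl) (trans (cong (λ w → τ ∙ w ∙ τ ⁻¹) (H-suc i)) e)
        F₁ F₂ : G
        F₁ = τ ∙ H 8 ∙ τ ⁻¹
        F₂ = τ′ ∙ H 2 ∙ τ′ ⁻¹
        d₃ : d ∙ H 3 ∙ d ⁻¹ ≡ H 7 ∙ H 4
        d₃ = conj-d 3 (trans (grp (H 10 ∷ H 1 ∷ H 4 ∷ []) (κ 1 2 (nr 1 4) ∷ []) ((var 0 ⊕ var 1) ⊕ var 2 ⊕ (var 0 ⊕ var 1) ⁻) (var 0 ⊕ var 2 ⊕ var 0 ⁻) refl) (six-conj′ 4))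
        d₄ : d ∙ H 4 ∙ d ⁻¹ ≡ H 5
        d₄ = conj-d 4 (grp (H 10 ∷ H 1 ∷ H 5 ∷ []) (κ 1 2 (nr 1 5) ∷ κ 0 2 (nr 10 5) ∷ []) ((var 0 ⊕ var 1) ⊕ var 2 ⊕ (var 0 ⊕ var 1) ⁻) (var 2) refl)
        d₆ : d ∙ H 6 ∙ d ⁻¹ ≡ H 4
        d₆ = conj-d 6 (trans (grp (H 10 ∷ H 1 ∷ H 7 ∷ []) [] ((var 0 ⊕ var 1) ⊕ var 2 ⊕ (var 0 ⊕ var 1) ⁻) (var 0 ⊕ (var 1 ⊕ var 2 ⊕ var 1 ⁻) ⊕ var 0 ⁻) refl) (trans (cong (λ w → H 10 ∙ w ∙ H 10 ⁻¹) (six-conj 1))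
          (trans (grp (H 10 ∷ H 4 ∷ H 7 ∷ []) (κ 0 2 (nr 10 7) ∷ []) (var 0 ⊕ (var 1 ⊕ var 2) ⊕ var 0 ⁻) ((var 0 ⊕ var 1 ⊕ var 0 ⁻) ⊕ var 2) refl)
          (trans (cong (_∙ H 7) (six-conj′ 4)) (grp (H 7 ∷ H 4 ∷ []) (ι 0 (H² 7) ∷ κ 0 1 (nr 7 4) ∷ []) ((var 0 ⊕ var 1) ⊕ var 0) (var 1) refl)))))
        dd₃ : (d ∙ d) ∙ H 3 ∙ (d ∙ d) ⁻¹ ≡ F₁ ∙ H 5
        dd₃ = trans (grp (d ∷ H 3 ∷ []) [] ((var 0 ⊕ var 0) ⊕ var 1 ⊕ (var 0 ⊕ var 0) ⁻) (var 0 ⊕ (var 0 ⊕ var 1 ⊕ var 0 ⁻) ⊕ var 0 ⁻) refl) (trans (cong (λ w → d ∙ w ∙ d ⁻¹) d₃)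
          (trans (grp (d ∷ H 7 ∷ H 4 ∷ []) [] (var 0 ⊕ (var 1 ⊕ var 2) ⊕ var 0 ⁻) ((var 0 ⊕ var 1 ⊕ var 0 ⁻) ⊕ (var 0 ⊕ var 2 ⊕ var 0 ⁻)) refl) (cong₂ _∙_ (conj-d 7 refl) d₄)))
        dd₆ : (d ∙ d) ∙ H 6 ∙ (d ∙ d) ⁻¹ ≡ H 5
        dd₆ = trans (grp (d ∷ H 6 ∷ []) [] ((var 0 ⊕ var 0) ⊕ var 1 ⊕ (var 0 ⊕ var 0) ⁻) (var 0 ⊕ (var 0 ⊕ var 1 ⊕ var 0 ⁻) ⊕ var 0 ⁻) refl) (trans (cong (λ w → d ∙ w ∙ d ⁻¹) d₆) d₄)
        s₃ : s ∙ H 3 ∙ s ⁻¹ ≡ H 3 ⊎ s ∙ H 3 ∙ s ⁻¹ ≡ H 6 ∙ H 3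
        s₃ = [ (λ q → inj₁ (fixed (nrG 3 1 8 q))) , (λ q → inj₂ (moved q)) ]′ (peelʳ 1 8 (le 10 10) (le 1 9) ps)
          where
          fixed : ∀ {s} → Comm (H 3) s → s ∙ H 3 ∙ s ⁻¹ ≡ H 3
          fixed {s} c = grp (s ∷ H 3 ∷ []) (κ 1 0 c ∷ []) (var 0 ⊕ var 1 ⊕ var 0 ⁻) (var 1) refl
          moved : P 8 10 (H 9 ∙ s) → s ∙ H 3 ∙ s ⁻¹ ≡ H 6 ∙ H 3
          moved q = trans (grp (s ∷ H 3 ∷ H 9 ∷ []) (ι 2 (H² 9) ∷ []) (var 0 ⊕ var 1 ⊕ var 0 ⁻) (var 2 ⊕ ((var 2 ⊕ var 0) ⊕ var 1 ⊕ (var 2 ⊕ var 0) ⁻) ⊕ var 2 ⁻) refl)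
            (trans (cong (λ w → H 9 ∙ w ∙ H 9 ⁻¹) (fixed (nrG 3 1 8 q))) (six-conj′ 3))
        F₂≡ : F₂ ≡ (d ∙ d) ∙ (s ∙ H 3 ∙ s ⁻¹) ∙ (d ∙ d) ⁻¹
        F₂≡ = trans (grp (d ∷ τ′ ∷ γ ∷ H 2 ∷ []) [] (var 1 ⊕ var 3 ⊕ var 1 ⁻)
          ((var 0 ⊕ var 0) ⊕ (((var 0 ⊕ var 0) ⁻ ⊕ (var 1 ⊕ var 2 ⁻)) ⊕ (var 2 ⊕ var 3 ⊕ var 2 ⁻) ⊕ ((var 0 ⊕ var 0) ⁻ ⊕ (var 1 ⊕ var 2 ⁻)) ⁻) ⊕ (var 0 ⊕ var 0) ⁻) refl)
          (cong (λ w → (d ∙ d) ∙ (s ∙ w ∙ s ⁻¹) ∙ (d ∙ d) ⁻¹) (H-suc 2))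
        F₂-value : F₂ ≡ F₁ ∙ H 5 ⊎ F₂ ≡ H 5 ∙ (F₁ ∙ H 5)
        F₂-value = [ (λ e → inj₁ (trans F₂≡ (trans (cong (λ w → (d ∙ d) ∙ w ∙ (d ∙ d) ⁻¹) e) dd₃)))
          , (λ e → inj₂ (trans F₂≡ (trans (cong (λ w → (d ∙ d) ∙ w ∙ (d ∙ d) ⁻¹) e) (trans (grp (d ∷ H 6 ∷ H 3 ∷ []) [] ((var 0 ⊕ var 0) ⊕ (var 1 ⊕ var 2) ⊕ (var 0 ⊕ var 0) ⁻)
              (((var 0 ⊕ var 0) ⊕ var 1 ⊕ (var 0 ⊕ var 0) ⁻) ⊕ ((var 0 ⊕ var 0) ⊕ var 2 ⊕ (var 0 ⊕ var 0) ⁻)) refl) (cong₂ _∙_ dd₆ dd₃))))) ]′ s₃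
        fix₅ : H 5 ▹ αs 11 ≡ αs 11
        fix₅ = proj₂ (H-P 5 11 (le 5 11) (le 12 14))
        y₁-in : P 5 13 y₁
        y₁-in = subst (P 5 13) (trans (cong (λ w → γ ⁻¹ ∙ w ∙ γ) (sym γy₁)) (grp (γ ∷ y₁ ∷ []) [] (var 0 ⁻ ⊕ (var 0 ⊕ var 1 ⊕ var 0 ⁻) ⊕ var 0) (var 1) refl)) (P-back y-in)
        fix-y₁ : (H 10 ∙ y₁ ∙ H 10 ⁻¹) ▹ αs 11 ≡ αs 11
        fix-y₁ = [ (λ q → subst (λ w → w ▹ αs 11 ≡ αs 11) (sym (grp (y₁ ∷ H 10 ∷ []) (κ 1 0 (nrG 10 5 5 q) ∷ []) (var 1 ⊕ var 0 ⊕ var 1 ⁻) (var 0) refl)) (proj₂ (q 11 (le 5 11) (le 12 14))))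
            , (λ q → subst (λ w → w ▹ αs 11 ≡ αs 11) (sym (trans (grp (y₁ ∷ H 10 ∷ H 4 ∷ []) (ι 2 (H² 4) ∷ []) (var 1 ⊕ var 0 ⊕ var 1 ⁻) ((var 1 ⊕ var 2 ⊕ var 1 ⁻) ⊕ (var 1 ⊕ (var 2 ⊕ var 0) ⊕ var 1 ⁻)) refl)
                 (cong₂ _∙_ (six-conj′ 4) (grp (H 4 ∙ y₁ ∷ H 10 ∷ []) (κ 1 0 (nrG 10 5 5 q) ∷ []) (var 1 ⊕ var 0 ⊕ var 1 ⁻) (var 0) refl))))
                 (fix-∙ (fix-∙ (proj₂ (H-P 7 11 (le 7 11) (le 12 16))) (proj₂ (H-P 4 11 (le 4 11) (le 12 13)))) (proj₂ (q 11 (le 5 11) (le 12 14))))) ]′ (peelˡ 4 5 (le 6 13) (le 4 5) y₁-in)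
        fix-F₁ : F₁ ▹ αs 11 ≡ αs 11
        fix-F₁ = subst (λ w → w ▹ αs 11 ≡ αs 11) (grp (H 10 ∷ H 1 ∷ H 8 ∷ []) (ι 1 (H² 1) ∷ ι 2 (H² 8) ∷ κ 0 2 (nr 10 8) ∷ []) ((var 0 ⊕ (var 1 ⊕ var 2 ⊕ var 1 ⊕ var 2) ⊕ var 0 ⁻) ⊕ var 2) ((var 0 ⊕ var 1) ⊕ var 2 ⊕ (var 0 ⊕ var 1) ⁻) refl)
          (fix-∙ fix-y₁ (proj₂ (H-P 8 11 (le 8 11) (le 12 17))))
        fix-y : (H 0 ∙ y ∙ H 0 ⁻¹) ▹ αs 11 ≡ αs 11
        fix-y = [ (λ q → subst (λ w → w ▹ αs 11 ≡ αs 11) (sym (grp (y ∷ H 0 ∷ []) (κ 1 0 (nrG 0 5 5 q) ∷ []) (var 1 ⊕ var 0 ⊕ var 1 ⁻) (var 0) refl)) (proj₂ (q 11 (le 5 11) (le 12 14))))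
            , (λ q → subst (λ w → w ▹ αs 11 ≡ αs 11) (sym (trans (grp (y ∷ H 0 ∷ H 6 ∷ []) (ι 2 (H² 6) ∷ []) (var 1 ⊕ var 0 ⊕ var 1 ⁻) ((var 1 ⊕ var 2 ⊕ var 1 ⁻) ⊕ (var 1 ⊕ (var 2 ⊕ var 0) ⊕ var 1 ⁻)) refl)
                 (cong₂ _∙_ (six-conj 0) (grp (H 6 ∙ y ∷ H 0 ∷ []) (κ 1 0 (nrG 0 5 5 q) ∷ []) (var 1 ⊕ var 0 ⊕ var 1 ⁻) (var 0) refl))))
                 (fix-∙ (fix-∙ (proj₂ (H-P 3 11 (le 3 11) (le 12 12))) (proj₂ (H-P 6 11 (le 6 11) (le 12 15)))) (proj₂ (q 11 (le 5 11) (le 12 14))))) ]′ (peelʳ 5 5 (le 7 14) (le 5 6) y-in)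
        move-F₂ : F₂ ▹ αs 11 ≢ αs 11
        move-F₂ e = H-up 2 (trans (cong (H 2 ▹_) (sym fix-y)) (trans (sym (∙▹ (H 2) (H 0 ∙ y ∙ H 0 ⁻¹) (αs 11))) (trans (cong (_▹ αs 11) eq) e)))
          where
          eq : H 2 ∙ (H 0 ∙ y ∙ H 0 ⁻¹) ≡ F₂
          eq = grp (H 0 ∷ H 9 ∷ H 2 ∷ []) (ι 1 (H² 9) ∷ ι 2 (H² 2) ∷ κ 0 2 (nr 0 2) ∷ []) (var 2 ⊕ (var 0 ⊕ (var 2 ⊕ var 1 ⊕ var 2 ⊕ var 1) ⊕ var 0 ⁻)) ((var 0 ⊕ var 1) ⊕ var 2 ⊕ (var 0 ⊕ var 1) ⁻) refl
        F₂≢ : F₂ ≡ F₁ ∙ H 5 → ⊥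
        F₂≢ e = move-F₂ (trans (cong (_▹ αs 11) e) (fix-∙ fix-F₁ fix₅))
        F₂≢′ : F₂ ≡ H 5 ∙ (F₁ ∙ H 5) → ⊥
        F₂≢′ e = move-F₂ (trans (cong (_▹ αs 11) e) (fix-∙ fix₅ (fix-∙ fix-F₁ fix₅)))

-- The bound in the rigid case

module RigidBound (S : Setting) (t : Bool) (rigid₀ : ∀ g → Basics.S₀ S g → Basics.Q S (Setting.o S t) g)
    (turn₀ : ∀ {b c} → Basics.St S (Setting.o S (not t)) (Setting.o S t) b c →
       ∃ λ g → Setting._▹_ S g (Setting.o S (not t)) ≡ Setting.o S (not t) × Setting._▹_ S g (Setting.o S t) ≡ Setting.o S t × Setting._▹_ S g b ≡ c) where
  open RigidNine S t rigid₀ turn₀ public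

  pw : ℕ → ℕ
  pw zero = 1
  pw (suc k) = pw k + pw k

  pw-mono : ∀ {k l} → k ≤ l → pw k ≤ pw l
  pw-mono {zero} {zero} z≤n = ≤-refl
  pw-mono {zero} {suc l} z≤n = ≤-trans (pw-mono {zero} {l} z≤n) (m≤m+n _ _)
  pw-mono (s≤s le) = +-mono-≤ (pw-mono le) (pw-mono le)

  chain-bound : ∀ {N} → (∀ y → P 0 (suc N) y → y ≡ ε) → ∀ k m → m + k ≡ suc N → 1 ≤ m → Bnd (P 0 m) (pw k)
  chain-bound triv₀ zero m e _ = bnd-1 λ y p → triv₀ y (subst (λ b → P 0 b y) (trans (sym (+-identityʳ m)) e) p)
  chain-bound triv₀ (suc k) m e l = index2 {K = P 0 (suc m)} dec ix (chain-bound triv₀ k (suc m) (trans (sym (+-suc m k)) e) (s≤s z≤n))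
    where
    dec : ∀ g → P 0 m g → Dec (P 0 (suc m) g)
    dec g p with (g ▹ αs m) ≟ⱽ αs m
    ... | yes q = yes (P-up′ l p q)
    ... | no nq = no λ r → nq (proj₂ (r m z≤n ≤-refl))
    ix : ∀ g h → P 0 m g → P 0 m h → ¬ P 0 (suc m) g → ¬ P 0 (suc m) h → P 0 (suc m) (g ⁻¹ ∙ h)
    ix g h pg ph ng nh = two-up l (P-inv pg) ph (λ q → ng (P-up′ l pg (trans (cong (g ▹_) (sym q)) (trans (sym (∙▹ g (g ⁻¹) (αs m))) (trans (cong (_▹ αs m) (invʳ g)) (ε▹ _)))))) (λ q → nh (P-up′ l ph q))

  length-bound : ∀ n → (∀ y → P 0 (suc (suc n)) y → y ≡ ε) → ∀ s → P 0 (suc n) s → s ▹ αs (suc n) ≢ αs (suc n) → ¬ ¬ (suc n ≤ 7)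
  length-bound n triv₀ s ps ms k = least Break n (inj₁ refl) λ { (c , br , mn) → go c br mn }
    where
    open Gens (suc n) (s≤s z≤n) triv₀ s ps ms
    -- The end of the list counts as a failure to commute, so that a least `c` exists also when all
    -- generators commute; then p is 1.
    Break : ℕ → Set
    Break d = d ≡ n ⊎ ¬ Comm (H 0) (H (suc d))
    go : ∀ c → Break c → (∀ m → m < c → ¬ Break m) → ⊥
    go c br mn = count (2 ≤? p)
      where
      c≤n : c ≤ n
      c≤n = [ ≤-reflexive , (λ _ → decidable-stable (c ≤? n) λ nle → mn n (≰⇒> nle) (inj₁ refl)) ]′ br
      p : ℕ
      p = suc (n ∸ c)
      eN : suc n ≡ c + p
      eN = sym (trans (+-suc c (n ∸ c)) (cong suc (m+[n∸m]≡n c≤n)))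
        where open import Data.Nat.Properties using (m+[n∸m]≡n)
      cH : ∀ d → d ≤ c → Comm (H 0) (H d)
      cH zero _ = refl
      cH (suc d) le = decidable-stable ((H 0 ∙ H (suc d)) ≟ᴳ (H (suc d) ∙ H 0)) λ nc → mn d le (inj₂ nc)
      nc′ : 2 ≤ p → ¬ Comm (H 0) (H (suc c))
      nc′ le = [ (λ e → ⊥-elim (<-irrefl refl (≤-trans (≤-pred le) (≤-reflexive (trans (cong (n ∸_) e) (n∸n≡0 n)))))) , id ]′ br
        where open import Data.Nat.Properties using (n∸n≡0)
      with-p : p ≤ suc c → ⊥
      with-p p≤ = [ k , nine ]′ (few (narrow′) wide′)
        where
        open Count (suc n) (s≤s z≤n) triv₀ s ps ms c p eN (s≤s z≤n) p≤ hiding (H)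
        narrow′ : ¬ (suc (suc p) ≤ c)
        narrow′ = Steps.narrow cH nc′
        wide′ : ∀ k → p ≡ suc (suc k) → ¬ (suc (suc c) ≤ k + p)
        wide′ k e = Steps.Wide.wide cH nc′ k e
        nine : c ≡ 5 × p ≡ 4 → ⊥
        nine (e₅ , e₄) = at-nine n (trans eN (cong₂ _+_ e₅ e₄)) triv₀ s ps ms (λ d le → cH d (≤-trans le (≤-reflexive (sym e₅)))) (subst (λ c → ¬ Comm (H 0) (H (suc c))) e₅ (nc′ (≤-trans (s≤s (s≤s z≤n)) (≤-reflexive (sym e₄)))))
          where
          at-nine : ∀ n → suc n ≡ 9 → (tr : ∀ y → P 0 (suc (suc n)) y → y ≡ ε) (s : G) (ps : P 0 (suc n) s) (ms : s ▹ αs (suc n) ≢ αs (suc n)) →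
                    (∀ d → d ≤ 5 → Comm (Gens.H (suc n) (s≤s z≤n) tr s ps ms 0) (Gens.H (suc n) (s≤s z≤n) tr s ps ms d)) → ¬ Comm (Gens.H (suc n) (s≤s z≤n) tr s ps ms 0) (Gens.H (suc n) (s≤s z≤n) tr s ps ms 6) → ⊥
          at-nine n refl tr s ps ms c₅ n₆ = Nine.contradiction tr s ps ms c₅ n₆
      count : Dec (2 ≤ p) → ⊥
      count (no n2) = with-p (≤-trans (≤-pred (≰⇒> n2)) (s≤s z≤n))
      count (yes le2) = with-p (decidable-stable (p ≤? suc c) λ np → Dist.twice c cH (nc′ le2)
        (≤-trans (≤-reflexive (trans (cong suc (sym (+-suc c c))) (sym (+-suc c (suc c))))) (≤-trans (+-mono-≤ (≤-refl {c}) (≰⇒> np)) (≤-reflexive (sym eN)))))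

  -- At the least stopping index `suc n`, some element of `P 0 (suc n)` moves `αs (suc n)`, because
  -- `Stop n` fails, and then `P 0 (suc (suc n))` is trivial. So N is `suc n`.
  rigid-bound : ¬ ¬ Bnd S₀ 128
  rigid-bound k = least Stop (proj₁ stops) (proj₂ stops) λ { (zero , st , _) → not-stop-0 st ; (suc n , st , mn) → go n st (mn n ≤-refl) }
    where
    go : ∀ n → Stop (suc n) → ¬ Stop n → ⊥
    go n st nst = em⊥ (∃ λ s → P 0 (suc n) s × s ▹ αs (suc n) ≢ αs (suc n)) found
        λ none → nst λ y p → P-up z≤n p (decidable-stable (_ ≟ⱽ _) λ ne → none (y , p , ne))
      where
      found : (∃ λ s → P 0 (suc n) s × s ▹ αs (suc n) ≢ αs (suc n)) → ⊥
      found (s , ps , ms) = length-bound n triv₀ s ps ms λ le7 → k (flag-bnd {t} (To t) (Ao t)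
          (bnd-⊆ (λ g → λ { (gα , gx) zero _ _ → gx , gα ; _ (suc i) _ (s≤s ()) }) (bnd-mono (pw-mono le7) (chain-bound triv₀ (suc n) 1 refl ≤-refl))))
        where
        triv₀ : ∀ y → P 0 (suc (suc n)) y → y ≡ ε
        triv₀ = Stopped.P-trivial n st s ps ms

-- All local actions together

module FlagBound (S : Setting) where
  open Basics S

  private
    Turn : Bool → Set
    Turn t = ∀ {b c} → St (o t) (o (not t)) b c → ∃ λ g → g ▹ o t ≡ o t × g ▹ o (not t) ≡ o (not t) × g ▹ b ≡ c

    Fixed : Bool → Set
    Fixed t = ∀ g → S₀ g → Q (o t) g

    at-o : ∀ t {g} → S₀ g → g ▹ o t ≡ o t
    at-o true = proj₁
    at-o false = proj₂

    decide : ∀ t → ¬ ¬ (Turn t ⊎ Fixed t)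
    decide t k = em⊥ (∃ λ g → S₀ g × ¬ Q (o t) g) (λ { (g , s , nq) → k (inj₁ λ st → g , at-o t s , at-o (not t) s , proj₁ (notQ st (at-o t s) (at-o (not t) s) nq)) })
      λ none → k (inj₂ λ g s → Q-stable λ nq → none (g , s , nq))

    both-fixed : Fixed true → Fixed false → Bnd S₀ 1
    both-fixed ft ff = bnd-1 (core record { a = o true ; b = o false ; ab = Ao true ; Y = S₀ ; Ya = λ y → proj₁ ; Yb = λ y → proj₂
      ; atA = λ b ab → let h , ha , hb = spin (To true) (Ao true) b ab in h , ha , hb , λ y s → let q = Q-back ha (ft y s) in fix q , fixₙ q _ (Ao true)
      ; atB = λ a ba → let h , hb , ha = spin (To false) (Ao false) a ba in h , hb , ha , λ y s → let q = Q-back hb (ff y s) in fixₙ q _ (Ao false) , fix q })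
      where
      spin : ∀ {s x} → T s x → ∀ {a} → Adj x a → ∀ b → Adj x b → ∃ λ h → h ▹ x ≡ x × h ▹ a ≡ b
      spin {s} {x} tx {a} xa b xb = move s x b ∙ move s x a ⁻¹ , ∙▹≡ (move s x b) (move s x a ⁻¹) (⁻¹▹ (move s x a) (move₁ tx xa)) (move₁ tx xb)
        , ∙▹≡ (move s x b) (move s x a ⁻¹) (⁻¹▹ (move s x a) (move₂ tx xa)) (move₂ tx xb)

    -- If every vertex had both types, rigidity would hold at both ends of the flag, against the
    -- turn at the second end; hence the alternative with 128 is allowed.
    mixed : ∀ t → Fixed t → Turn (not t) → ¬ ¬ Outcome S
    mixed t f tn k = RigidBound.rigid-bound S t f turn₀ λ b → k (inj₂ (b , no-swap))
      where
      turn₀ : ∀ {b c} → St (o (not t)) (o t) b c → ∃ λ g → g ▹ o (not t) ≡ o (not t) × g ▹ o t ≡ o t × g ▹ b ≡ c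
      turn₀ = subst (λ s → ∀ {b c} → St (o (not t)) (o s) b c → ∃ λ g → g ▹ o (not t) ≡ o (not t) × g ▹ o s ≡ o s × g ▹ b ≡ c) (not-not t) tn
      ot : Adj (o (not t)) (o t)
      ot = symA (Ao t)
      no-swap : ¬ (∀ s v → T s v)
      no-swap T∀ = go (star ot)
        where
        go : ∃₂ (λ b c → St (o (not t)) (o t) b c) → ⊥
        go (b , c , s) with turn₀ s
        ... | g , g₁ , g₂ , e = b≢c s (trans (sym (fixₙ (Rigid.rigid S t f turn₀ (T∀ t _) ot g₁ g₂) b (₂ s))) e)

  outcome : ¬ ¬ Outcome S
  outcome k = decide true λ
    { (inj₁ t₁) → decide false λ { (inj₁ t₀) → S3Bound.s3-outcome S (λ { true → t₁ ; false → t₀ }) k ; (inj₂ f₀) → mixed false f₀ t₁ k }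
    ; (inj₂ f₁) → decide false λ { (inj₁ t₀) → mixed true f₁ t₀ k ; (inj₂ f₀) → k (inj₁ (bnd-mono (s≤s z≤n) (both-fixed f₁ f₀))) } }

-- Finite sums

∑-mono : ∀ {n} {f g : Fin n → ℕ} → (∀ i → f i ≤ g i) → ∑ f ≤ ∑ g
∑-mono {zero} h = z≤n
∑-mono {suc n} h = +-mono-≤ (h fzero) (∑-mono (h ∘ fsuc))

term≤∑ : ∀ {n} (f : Fin n → ℕ) i → f i ≤ ∑ f
term≤∑ f fzero = m≤m+n _ _
term≤∑ f (fsuc i) = ≤-trans (term≤∑ (f ∘ fsuc) i) (m≤n+m _ _)

∑-const : ∀ {n c} {f : Fin n → ℕ} → (∀ i → f i ≡ c) → ∑ f ≡ n ℕ.* c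
∑-const {zero} h = refl
∑-const {suc n} h = cong₂ _+_ (h fzero) (∑-const (h ∘ fsuc))

∑-scale : ∀ {n} c (f : Fin n → ℕ) → ∑ (λ i → c ℕ.* f i) ≡ c ℕ.* ∑ f
∑-scale {zero} c f = sym (*-zeroʳ c)
∑-scale {suc n} c f = trans (cong (λ x → c ℕ.* f fzero + x) (∑-scale c (f ∘ fsuc))) (sym (*-distribˡ-+ c _ _))

sum-tabulate : ∀ {A : Set} {n} (f : A → ℕ) (g : Fin n → A) → sum (map f (tabulateᴸ g)) ≡ ∑ (f ∘ g)
sum-tabulate {n = zero} f g = refl
sum-tabulate {n = suc n} f g = cong (λ x → f (g fzero) + x) (sum-tabulate f (g ∘ fsuc))

sum-count : ∀ {A : Set} (p : A → Bool) xs → sum (map (λ x → if p x then 1 else 0) xs) ≡ length (filter (λ x → p x ≟ᴮ true) xs)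
sum-count p [] = refl
sum-count p (x ∷ xs) with p x
... | true = cong suc (sum-count p xs)
... | false = sum-count p xs

-- The automorphism group of a finite graph

module Automorphisms {n : ℕ} (Γ : SimpleGraph n) where
  V : Set
  V = Fin n

  Adj : V → V → Set
  Adj u v = adj Γ u v ≡ true

  -- Automorphisms as tables, so that pointwise equal automorphisms are equal.
  record A : Set where
    constructor tables
    field
      to from : Vec V n
      to-from : tabulate (λ v → lookup to (lookup from v)) ≡ tabulate id
      from-to : tabulate (λ v → lookup from (lookup to v)) ≡ tabulate id
      preserves : tabulate (λ u → tabulate λ v → adj Γ (lookup to u) (lookup to v)) ≡ tabulate (λ u → tabulate (adj Γ u))
  open A

  infixr 6 _▹_ _◃_
  _▹_ _◃_ : A → V → V
  g ▹ v = lookup (to g) v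
  g ◃ v = lookup (from g) v

  pointwise : ∀ {X : Set} {m} {f g : Fin m → X} → tabulate f ≡ tabulate g → ∀ i → f i ≡ g i
  pointwise {f = f} {g} e i = trans (sym (lookup∘tabulate f i)) (trans (cong (λ x → lookup x i) e) (lookup∘tabulate g i))

  ▹◃ : ∀ g v → g ▹ (g ◃ v) ≡ v
  ▹◃ g = pointwise (to-from g)

  ◃▹ : ∀ g v → g ◃ (g ▹ v) ≡ v
  ◃▹ g = pointwise (from-to g)

  adj▹ : ∀ g u v → adj Γ (g ▹ u) (g ▹ v) ≡ adj Γ u v
  adj▹ g u = pointwise (pointwise (preserves g) u)

  from-tables : ∀ {X : Set} {m} {x y : Vec X m} → (∀ i → lookup x i ≡ lookup y i) → x ≡ y
  from-tables {x = x} {y} e = trans (sym (tabulate∘lookup x)) (trans (tabulate-cong e) (tabulate∘lookup y))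

  -- The inverse table is determined by the first one, and proofs of equality between tables are
  -- unique.
  A-ext : ∀ {g h} → (∀ v → g ▹ v ≡ h ▹ v) → g ≡ h
  A-ext {g} {h} e = go {g} {h} (from-tables e) (from-tables λ v → trans (sym (◃▹ h (g ◃ v))) (cong (h ◃_) (trans (sym (e (g ◃ v))) (▹◃ g v))))
    where
    uip : ∀ {X : Set} {x y : X} (p q : x ≡ y) → p ≡ q
    uip refl refl = refl
    go : ∀ {g h} → to g ≡ to h → from g ≡ from h → g ≡ h
    go {tables t f p q r} {tables .t .f p′ q′ r′} refl refl with uip p p′ | uip q q′ | uip r r′
    ... | refl | refl | refl = refl

  _≟ᴬ_ : (g h : A) → Dec (g ≡ h)
  g ≟ᴬ h with ≡-decⱽ _≟ꟳ_ (to g) (to h)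
  ... | yes e = yes (A-ext λ v → cong (λ t → lookup t v) e)
  ... | no ne = no λ e → ne (cong to e)

  mkA : (f h : V → V) → (∀ v → f (h v) ≡ v) → (∀ v → h (f v) ≡ v) → (∀ u v → adj Γ (f u) (f v) ≡ adj Γ u v) → A
  mkA f h fh hf p = record
    { to = tabulate f ; from = tabulate h
    ; to-from = tabulate-cong λ v → trans (lookup∘tabulate f _) (trans (cong f (lookup∘tabulate h v)) (fh v))
    ; from-to = tabulate-cong λ v → trans (lookup∘tabulate h _) (trans (cong h (lookup∘tabulate f v)) (hf v))
    ; preserves = tabulate-cong λ u → tabulate-cong λ v → trans (cong₂ (adj Γ) (lookup∘tabulate f u) (lookup∘tabulate f v)) (p u v) }

  infixl 7 _∙_
  infix 8 _⁻¹
  ε : A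
  ε = mkA id id (λ _ → refl) (λ _ → refl) (λ _ _ → refl)

  _∙_ : A → A → A
  g ∙ h = mkA (λ v → g ▹ (h ▹ v)) (λ v → h ◃ (g ◃ v)) (λ v → trans (cong (g ▹_) (▹◃ h _)) (▹◃ g v)) (λ v → trans (cong (h ◃_) (◃▹ g _)) (◃▹ h v))
    λ u v → trans (adj▹ g _ _) (adj▹ h u v)

  _⁻¹ : A → A
  g ⁻¹ = mkA (g ◃_) (g ▹_) (◃▹ g) (▹◃ g) λ u v → trans (sym (adj▹ g _ _)) (cong₂ (adj Γ) (▹◃ g u) (▹◃ g v))

  ε▹ : ∀ v → ε ▹ v ≡ v
  ε▹ = lookup∘tabulate id

  ∙▹ : ∀ g h v → (g ∙ h) ▹ v ≡ g ▹ (h ▹ v)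
  ∙▹ g h = lookup∘tabulate _

  ⁻¹▹ : ∀ g v → g ⁻¹ ▹ v ≡ g ◃ v
  ⁻¹▹ g = lookup∘tabulate _

  isGroup : IsGroup _∙_ ε _⁻¹
  isGroup = record
    { assoc = λ x y z → A-ext λ v → trans (∙▹ (x ∙ y) z v) (trans (∙▹ x y (z ▹ v)) (sym (trans (∙▹ x (y ∙ z) v) (cong (x ▹_) (∙▹ y z v)))))
    ; idˡ = λ x → A-ext λ v → trans (∙▹ ε x v) (ε▹ (x ▹ v))
    ; idʳ = λ x → A-ext λ v → trans (∙▹ x ε v) (cong (x ▹_) (ε▹ v))
    ; invˡ = λ x → A-ext λ v → trans (∙▹ (x ⁻¹) x v) (trans (⁻¹▹ x (x ▹ v)) (trans (◃▹ x v) (sym (ε▹ v))))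
    ; invʳ = λ x → A-ext λ v → trans (∙▹ x (x ⁻¹) v) (trans (cong (x ▹_) (⁻¹▹ x v)) (trans (▹◃ x v) (sym (ε▹ v)))) }

  open IsGroup isGroup

  faithful : ∀ g → (∀ v → g ▹ v ≡ v) → g ≡ ε
  faithful g e = A-ext λ v → trans (e v) (sym (ε▹ v))

  symA : ∀ {u v} → Adj u v → Adj v u
  symA {u} {v} a = trans (Defs.sym Γ v u) a

  actA : ∀ g {u v} → Adj u v → Adj (g ▹ u) (g ▹ v)
  actA g a = trans (adj▹ g _ _) a

  adj-≢ : ∀ {u v} → Adj u v → u ≢ v
  adj-≢ {u} a refl = case trans (sym (irref Γ u)) a of λ ()

  pow : A → ℕ → A
  pow g zero = ε
  pow g (suc k) = g ∙ pow g k

  -- By the pigeonhole principle, applied to the maps that are powers of g, the inverse of g is a power of g.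
  torsion : ∀ (P : A → Set) g → P g → (∀ h → P h → P (g ∙ h)) → P (g ⁻¹)
  torsion P g Pg Pcl = go (pigeonhole (n<1+n (n ^ n)) λ i → funToFin (λ v → pow g (toℕ i) ▹ v))
    where
    P-pow : ∀ k → P (pow g (suc k))
    P-pow zero = subst P (sym (idʳ g)) Pg
    P-pow (suc k) = Pcl _ (P-pow k)

    back : ∀ i j → i < j → pow g i ≡ pow g j → ∃ λ d → ε ≡ pow g (suc d)
    back zero (suc j) lt e = j , e
    back (suc i) (suc j) (s≤s lt) e = back i j lt (GroupSolver.cancelˡ isGroup g e)

    P-inv : (∃ λ d → ε ≡ pow g (suc d)) → P (g ⁻¹)
    P-inv (zero , e) = subst P (trans (sym e) (GroupSolver.cancelˡ isGroup g (trans (sym e) (sym (invʳ g))))) (P-pow 0)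
    P-inv (suc d , e) = subst P (GroupSolver.cancelˡ isGroup g (trans (sym e) (sym (invʳ g)))) (P-pow d)

    go : (∃₂ λ i j → toℕ i < toℕ j × funToFin (λ v → pow g (toℕ i) ▹ v) ≡ funToFin (λ v → pow g (toℕ j) ▹ v)) → P (g ⁻¹)
    go (i , j , lt , e) = P-inv (back (toℕ i) (toℕ j) lt (A-ext λ v → trans (sym (finToFun-funToFin (λ v → pow g (toℕ i) ▹ v) v)) (trans (cong (λ t → finToFun t v) e) (finToFun-funToFin (λ v → pow g (toℕ j) ▹ v) v))))

  fromAut : Aut Γ → A
  fromAut σ = mkA (proj₁ σ ⟨$⟩ʳ_) (proj₁ σ ⟨$⟩ˡ_) (λ v → inverseʳ (proj₁ σ)) (λ v → inverseˡ (proj₁ σ)) (proj₂ σ)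

  fromAut▹ : ∀ σ v → fromAut σ ▹ v ≡ apply Γ σ v
  fromAut▹ σ = lookup∘tabulate _

  neighbours : V → List V
  neighbours v = filter (λ w → adj Γ v w ≟ᴮ true) (allFin n)

  length-neighbours : Cubic Γ → ∀ v → length (neighbours v) ≡ 3
  length-neighbours cubic v = trans (sym (sum-count (adj Γ v) (allFin n))) (cubic v)

  ∈-neighbours : ∀ {v w} → w ∈ neighbours v → Adj v w
  ∈-neighbours {v} w∈ = proj₂ (∈-filter⁻ (λ w → adj Γ v w ≟ᴮ true) {xs = allFin n} w∈)

  neighbour : Cubic Γ → ∀ v → ∃ λ w → Adj v w
  neighbour cubic v = go (neighbours v) (length-neighbours cubic v) λ _ → ∈-neighbours
    where
    go : ∀ ws → length ws ≡ 3 → (∀ w → w ∈ ws → Adj v w) → ∃ λ w → Adj v w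
    go (w ∷ _) _ nb = w , nb w (here refl)

  star : Cubic Γ → ∀ {v a} → Adj v a → ∃₂ λ b c → Star Adj v a b c
  star cubic {v} {a} va = pick (neighbours v) (length-neighbours cubic v) (filter⁺ᵁ (λ w → adj Γ v w ≟ᴮ true) (allFin⁺ n))
      (λ w vw → ∈-filter⁺ (λ w → adj Γ v w ≟ᴮ true) (∈-allFin w) vw) (λ _ → ∈-neighbours)
    where
    pick : ∀ ws → length ws ≡ 3 → Unique ws → (∀ w → Adj v w → w ∈ ws) → (∀ w → w ∈ ws → Adj v w) → ∃₂ λ b c → Star Adj v a b c
    pick (x ∷ y ∷ z ∷ []) refl ((x≢y ∷ x≢z ∷ []) ∷ (y≢z ∷ []) ∷ [] ∷ []) all∈ nb = go (all∈ a va)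
      where
      vx : Adj v x
      vx = nb x (here refl)
      vy : Adj v y
      vy = nb y (there (here refl))
      vz : Adj v z
      vz = nb z (there (there (here refl)))
      go : a ∈ x ∷ y ∷ z ∷ [] → ∃₂ λ b c → Star Adj v a b c
      go (here refl) = y , z , mkStar vx vy vz x≢y x≢z y≢z λ w vw → case all∈ w vw of λ
        { (here e) → inj₁ e ; (there (here e)) → inj₂ (inj₁ e) ; (there (there (here e))) → inj₂ (inj₂ e) }
      go (there (here refl)) = x , z , mkStar vy vx vz (≢-sym x≢y) y≢z x≢z λ w vw → case all∈ w vw of λ
        { (here e) → inj₂ (inj₁ e) ; (there (here e)) → inj₁ e ; (there (there (here e))) → inj₂ (inj₂ e) }
      go (there (there (here refl))) = x , y , mkStar vz vx vy (≢-sym x≢z) (≢-sym y≢z) x≢y λ w vw → case all∈ w vw of λ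
        { (here e) → inj₂ (inj₁ e) ; (there (here e)) → inj₂ (inj₂ e) ; (there (there (here e))) → inj₁ e }

  walk′ : ∀ {u v} → Defs.Walk Γ u v → ∃ λ k → Walk′ Adj k u v
  walk′ here = 0 , stay
  walk′ (step a p) = let k , q = walk′ p in suc k , (a ▸ q)

-- Counting edges and arcs

ind : ∀ {P : Set} → Dec P → ℕ
ind (yes _) = 1
ind (no _) = 0

ind-cong : ∀ {P Q : Set} (p : Dec P) (q : Dec Q) → (P → Q) → (Q → P) → ind p ≡ ind q
ind-cong (yes _) (yes _) f g = refl
ind-cong (yes p) (no q) f g = ⊥-elim (q (f p))
ind-cong (no p) (yes q) f g = ⊥-elim (p (g q))
ind-cong (no _) (no _) f g = refl

ind-sum : ∀ {P Q : Set} (p : Dec P) (q : Dec Q) x → ¬ (P × Q) → (x ≡ true → P ⊎ Q) → (P ⊎ Q → x ≡ true) → ind p + ind q ≡ (if x then 1 else 0)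
ind-sum (yes p) (yes q) x e f g = ⊥-elim (e (p , q))
ind-sum (yes p) (no _) true e f g = refl
ind-sum (yes p) (no _) false e f g = case g (inj₁ p) of λ ()
ind-sum (no _) (yes q) true e f g = refl
ind-sum (no _) (yes q) false e f g = case g (inj₂ q) of λ ()
ind-sum (no p) (no q) true e f g = ⊥-elim ([ p , q ]′ (f refl))
ind-sum (no _) (no _) false e f g = refl

<ᵇ-sum : ∀ i j → i ≢ j → (if i <ᵇ j then 1 else 0) + (if j <ᵇ i then 1 else 0) ≡ 1
<ᵇ-sum zero zero ne = ⊥-elim (ne refl)
<ᵇ-sum zero (suc j) ne = refl
<ᵇ-sum (suc i) zero ne = refl
<ᵇ-sum (suc i) (suc j) ne = <ᵇ-sum i j (ne ∘ cong suc)

module CubicGraph {n : ℕ} (Γ : SimpleGraph n) (cubic : Cubic Γ) where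
  open Automorphisms Γ

  edge : V → V → ℕ
  edge u v = if adj Γ u v ∧ (toℕ u <ᵇ toℕ v) then 1 else 0

  degree-∑ : ∀ u → ∑ (λ v → if adj Γ u v then 1 else 0) ≡ 3
  degree-∑ u = trans (sym (sum-tabulate (λ v → if adj Γ u v then 1 else 0) id)) (cubic u)

  -- Any weight that sums to 1 over the two directions of an edge has half the degree sum as its
  -- total. It serves for the order of the vertices and for an orbit of arcs.
  double-count : (f : V → V → ℕ) → (∀ u v → f u v + f v u ≡ (if adj Γ u v then 1 else 0)) → ∑ (λ u → ∑ (f u)) + ∑ (λ u → ∑ (f u)) ≡ n ℕ.* 3
  double-count f e = trans (cong (λ x → ∑ (λ u → ∑ (f u)) + x) (∑-comm f)) (trans (sym (∑-distrib-+ (λ u → ∑ (f u)) (λ u → ∑ λ v → f v u)))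
    (∑-const λ u → trans (sym (∑-distrib-+ (f u) (λ v → f v u))) (trans (sum-cong-≗ (e u)) (degree-∑ u))))

  edge-sum : ∀ u v → edge u v + edge v u ≡ (if adj Γ u v then 1 else 0)
  edge-sum u v = trans (cong (λ x → edge u v + (if x ∧ (toℕ v <ᵇ toℕ u) then 1 else 0)) (Defs.sym Γ v u)) (go (adj Γ u v) refl)
    where
    go : ∀ x → adj Γ u v ≡ x → (if x ∧ (toℕ u <ᵇ toℕ v) then 1 else 0) + (if x ∧ (toℕ v <ᵇ toℕ u) then 1 else 0) ≡ (if x then 1 else 0)
    go true uv = <ᵇ-sum (toℕ u) (toℕ v) (adj-≢ uv ∘ toℕ-injective)
    go false _ = refl

  edgeCount-∑ : edgeCount Γ ≡ ∑ λ u → ∑ (edge u)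
  edgeCount-∑ = trans (sum-tabulate (λ u → sum (map (edge u) (allFin n))) id) (sum-cong-≗ λ u → sum-tabulate (edge u) id)

  handshake : edgeCount Γ + edgeCount Γ ≡ n ℕ.* 3
  handshake = trans (cong₂ _+_ edgeCount-∑ edgeCount-∑) (double-count edge edge-sum)

-- From flag stabilisers to edge stabilisers and the whole group

module EdgeStabiliser {n : ℕ} (Γ : SimpleGraph n) (cubic : Cubic Γ) (walks : ∀ u v → Defs.Walk Γ u v) (et : EdgeTransitive Γ)
    {a b : Fin n} (ab : adj Γ a b ≡ true) where
  open Automorphisms Γ
  open IsGroup isGroup
  open CubicGraph Γ cubic

  ∙▹≡ : ∀ g h {u v w} → h ▹ u ≡ v → g ▹ v ≡ w → (g ∙ h) ▹ u ≡ w
  ∙▹≡ g h refl refl = ∙▹ g h _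

  inv▹ : ∀ g {u v} → g ▹ u ≡ v → g ⁻¹ ▹ v ≡ u
  inv▹ g refl = trans (⁻¹▹ g _) (◃▹ g _)

  carry : ∀ {p q u v} → Adj p q → Adj u v → ∃ λ g → (g ▹ p ≡ u × g ▹ q ≡ v) ⊎ (g ▹ p ≡ v × g ▹ q ≡ u)
  carry pq uv with et _ _ _ _ pq uv
  ... | σ , inj₁ (e , f) = fromAut σ , inj₁ (trans (fromAut▹ σ _) e , trans (fromAut▹ σ _) f)
  ... | σ , inj₂ (e , f) = fromAut σ , inj₂ (trans (fromAut▹ σ _) e , trans (fromAut▹ σ _) f)

  o : Bool → V
  o true = a
  o false = b

  Ao : ∀ t → Adj (o t) (o (not t))
  Ao true = ab
  Ao false = symA ab

  len : V → V → ℕ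
  len u v = proj₁ (walk′ (walks u v))

  -- `flag` chooses its element before `T t u` is known, which lets `move` be a function of the
  -- vertices.
  setting : (T : Bool → V → Set) → (∀ {t u v} → Adj u v → T t u → T (not t) v) → (∀ {t} g {v} → T t v → T t (g ▹ v)) → (∀ t → T t (o t)) →
            (∀ t {u v} → Adj u v → ∃ λ g → T t u → g ▹ o t ≡ u × g ▹ o (not t) ≡ v) → Setting
  setting T T-adj T-act To flag = record
    { V = V ; G = A ; _≟ⱽ_ = _≟ꟳ_ ; _≟ᴳ_ = _≟ᴬ_ ; ε = ε ; _∙_ = _∙_ ; _⁻¹ = _⁻¹ ; isGroup = isGroup
    ; _▹_ = _▹_ ; ε▹ = ε▹ ; ∙▹ = ∙▹ ; faithful = faithful ; Adj = Adj ; symA = symA ; actA = actA ; star = star cubic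
    ; T = T ; T-adj = T-adj ; T-act = T-act ; o = o ; To = To ; Ao = Ao
    ; move = λ t u v → move t (adj Γ u v ≟ᴮ true)
    ; move₁ = λ {t} {u} {v} tu uv → proj₁ (moves t tu uv (adj Γ u v ≟ᴮ true)) ; move₂ = λ {t} {u} {v} tu uv → proj₂ (moves t tu uv (adj Γ u v ≟ᴮ true))
    -- A crude bound: the sum of the lengths of all chosen walks.
    ; diam = ∑ λ u → ∑ (len u)
    ; conn = λ u v → len u v , ≤-trans (term≤∑ (len u) v) (term≤∑ (λ u → ∑ (len u)) u) , proj₂ (walk′ (walks u v))
    ; vertices = allFin n ; complete = ∈-allFin ; torsion = torsion }
    where
    move : Bool → ∀ {u v} → Dec (Adj u v) → A
    move t (yes uv) = proj₁ (flag t uv)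
    move t (no _) = ε
    moves : ∀ t {u v} → T t u → Adj u v → (d : Dec (Adj u v)) → move t d ▹ o t ≡ u × move t d ▹ o (not t) ≡ v
    moves t tu uv (yes uv′) = proj₂ (flag t uv′) tu
    moves t tu uv (no ¬uv) = ⊥-elim (¬uv uv)

  Ends : V → V → A → Set
  Ends u v g = (g ▹ a ≡ u × g ▹ b ≡ v) ⊎ (g ▹ a ≡ v × g ▹ b ≡ u)

  Bound : (A → Set) → Set
  Bound H = ∀ xs → Unique xs → All H xs → length xs ≤ 128

  Reversed : Set
  Reversed = ∃ λ g → g ▹ a ≡ b × g ▹ b ≡ a

  -- Both classes are the whole vertex set, which rules out the weaker alternative of `Outcome`. The
  -- flag stabiliser has index at most 2 in the edge stabiliser, and twice 64 is 128.
  reversed-bound : Reversed → ¬ ¬ Bound (Ends a b)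
  reversed-bound (s , sa , sb) k = FlagBound.outcome S λ { (inj₁ bnd) → k (index2 fixes? (λ g h eg eh ng nh → both g h (flips g eg ng) (flips h eh nh)) bnd) ; (inj₂ (_ , mixed)) → mixed λ _ _ → tt }
    where
    s▹ : ∀ t → s ▹ o (not t) ≡ o t
    s▹ true = sb
    s▹ false = sa
    s▹′ : ∀ t → s ▹ o t ≡ o (not t)
    s▹′ true = sa
    s▹′ false = sb
    flag : ∀ t {u v} → Adj u v → ∃ λ g → ⊤ → g ▹ o t ≡ u × g ▹ o (not t) ≡ v
    flag t uv with carry (Ao t) uv
    ... | g , inj₁ r = g , λ _ → r
    ... | g , inj₂ (e , f) = g ∙ s , λ _ → ∙▹≡ g s (s▹′ t) f , ∙▹≡ g s (s▹ t) e
    S : Setting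
    S = setting (λ _ _ → ⊤) (λ _ _ → tt) (λ _ _ → tt) (λ _ → tt) flag
    open Basics S using (index2; S₀)
    fixes? : ∀ g → Ends a b g → Dec (S₀ g)
    fixes? g (inj₁ r) = yes r
    fixes? g (inj₂ (e , _)) = no λ r → adj-≢ ab (trans (sym (proj₁ r)) e)
    flips : ∀ g → Ends a b g → ¬ S₀ g → g ▹ a ≡ b × g ▹ b ≡ a
    flips g (inj₁ r) n = ⊥-elim (n r)
    flips g (inj₂ r) n = r
    both : ∀ g h → g ▹ a ≡ b × g ▹ b ≡ a → h ▹ a ≡ b × h ▹ b ≡ a → S₀ (g ⁻¹ ∙ h)
    both g h (e , f) (e′ , f′) = ∙▹≡ (g ⁻¹) h e′ (inv▹ g e) , ∙▹≡ (g ⁻¹) h f′ (inv▹ g f)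

  -- The orbits of `a` and `b` are disjoint and serve as the two classes; an element preserving the
  -- edge fixes both of its ends.
  separate-bound : ¬ (∃ λ g → g ▹ a ≡ b) → ¬ ¬ Bound (Ends a b)
  separate-bound sep k = FlagBound.outcome S λ { (inj₁ bnd) → k (restrict (bnd-mono (m≤m+n 64 64) bnd)) ; (inj₂ (bnd , _)) → k (restrict bnd) }
    where
    T : Bool → V → Set
    T t u = ∃ λ g → g ▹ o t ≡ u
    apart : ∀ t g → g ▹ o t ≢ o (not t)
    apart true g e = sep (g , e)
    apart false g e = sep (g ⁻¹ , inv▹ g e)
    meet : ∀ t {u} → T t u → T (not t) u → ⊥
    meet t (g , e) (h , f) = apart t (h ⁻¹ ∙ g) (∙▹≡ (h ⁻¹) g e (inv▹ h f))
    T-adj : ∀ {t u v} → Adj u v → T t u → T (not t) v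
    T-adj {t} uv tu with carry (Ao t) uv
    ... | g , inj₁ (_ , f) = g , f
    ... | g , inj₂ (_ , f) = ⊥-elim (meet t tu (g , f))
    flag : ∀ t {u v} → Adj u v → ∃ λ g → T t u → g ▹ o t ≡ u × g ▹ o (not t) ≡ v
    flag t uv with carry (Ao t) uv
    ... | g , inj₁ r = g , λ _ → r
    ... | g , inj₂ (_ , f) = g , λ tu → ⊥-elim (meet t tu (g , f))
    S : Setting
    S = setting T T-adj (λ { g (h , e) → g ∙ h , ∙▹≡ g h e refl }) (λ t → ε , ε▹ _) flag
    open Basics S using (Bnd; S₀; bnd-mono; bnd-⊆)
    restrict : Bnd S₀ 128 → Bound (Ends a b)
    restrict = bnd-⊆ {K = S₀} λ { g (inj₁ r) → r ; g (inj₂ (e , _)) → ⊥-elim (sep (g , e)) }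

  Arc : V → V → Set
  Arc u v = ∃ λ g → g ▹ a ≡ u × g ▹ b ≡ v

  -- Otherwise the arcs in the orbit of (a , b) orient all edges; out-degrees are constant and equal to half the degree, which is odd.
  not-half-arc-transitive : (∃ λ g → g ▹ a ≡ b) → ¬ Reversed → ⊥
  not-half-arc-transitive (s , sa) ¬rev = odd (out a) (*-cancelˡ-≡ 3 (out a + out a) n {{Fin-nonZero a}} (sym (trans (*-distribˡ-+ n (out a) (out a)) (trans (cong₂ _+_ (sym total) (sym total)) (double-count d d-sum)))))
    where
    Fin-nonZero : ∀ {m} → Fin m → ℕ.NonZero m
    Fin-nonZero fzero = _
    Fin-nonZero (fsuc _) = _
    odd : ∀ c → 3 ≡ c + c → ⊥
    odd (suc zero) ()
    odd (suc (suc zero)) ()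
    odd (suc (suc (suc c))) e = case trans e (cong (λ x → suc (suc (suc x))) (+-comm c (3 + c))) of λ ()
    turn : ∀ {u v} → Arc u v → Arc v u → Reversed
    turn (g , e , f) (h , e′ , f′) = h ⁻¹ ∙ g , ∙▹≡ (h ⁻¹) g e (inv▹ h f′) , ∙▹≡ (h ⁻¹) g f (inv▹ h e′)
    arc-adj : ∀ {u v} → Arc u v → Adj u v
    arc-adj (g , refl , refl) = actA g ab
    arcs : ∀ {u v} → Adj u v → Arc u v ⊎ Arc v u
    arcs uv with carry ab uv
    ... | g , inj₁ r = inj₁ (g , r)
    ... | g , inj₂ r = inj₂ (g , r)
    arc? : ∀ u v → Dec (Arc u v)
    arc? u v with adj Γ u v ≟ᴮ true
    ... | no ¬uv = no λ r → ¬uv (arc-adj r)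
    ... | yes uv = [ yes , (λ r → no λ r′ → ¬rev (turn r r′)) ]′ (arcs uv)
    d : V → V → ℕ
    d u v = ind (arc? u v)
    out : V → ℕ
    out u = ∑ (d u)
    d-sum : ∀ u v → d u v + d v u ≡ (if adj Γ u v then 1 else 0)
    d-sum u v = ind-sum (arc? u v) (arc? v u) (adj Γ u v) (λ { (r , r′) → ¬rev (turn r r′) }) arcs [ arc-adj , (λ r → symA (arc-adj r)) ]′
    arc-act : ∀ g {u v} → Arc u v → Arc (g ▹ u) (g ▹ v)
    arc-act g (h , e , f) = g ∙ h , ∙▹≡ g h e refl , ∙▹≡ g h f refl
    arc-act⁻ : ∀ g {u v} → Arc (g ▹ u) (g ▹ v) → Arc u v
    arc-act⁻ g (h , e , f) = g ⁻¹ ∙ h , ∙▹≡ (g ⁻¹) h e (inv▹ g refl) , ∙▹≡ (g ⁻¹) h f (inv▹ g refl)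
    orbit : ∀ u → ∃ λ g → g ▹ a ≡ u
    orbit u = case u ≟ꟳ a of λ { (yes e) → ε , trans (ε▹ a) (sym e) ; (no ne) → via ne (walks u a) }
      where
      via : u ≢ a → Defs.Walk Γ u a → ∃ λ g → g ▹ a ≡ u
      via ne here = ⊥-elim (ne refl)
      via ne (step uv _) with arcs uv
      ... | inj₁ (g , e , _) = g , e
      ... | inj₂ (g , _ , f) = g ∙ s , ∙▹≡ g s sa f
    out-const : ∀ u → out u ≡ out a
    out-const u with orbit u
    ... | g , refl = trans (sum-permute (d (g ▹ a)) (permutation (g ▹_) (g ◃_) (▹◃ g) (◃▹ g)))
      (sum-cong-≗ λ v → ind-cong (arc? (g ▹ a) (g ▹ v)) (arc? a v) (arc-act⁻ g) (arc-act g))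
    total : ∑ out ≡ n ℕ.* out a
    total = ∑-const out-const

  edge-bound : ¬ ¬ Bound (Ends a b)
  edge-bound k = em⊥ Reversed (λ r → reversed-bound r k) λ ¬rev → em⊥ (∃ λ g → g ▹ a ≡ b) (λ g → not-half-arc-transitive g ¬rev) λ sep → separate-bound sep k

  abstract
    ends? : ∀ u v g → Dec (Ends u v g)
    ends? u v g = ((g ▹ a) ≟ꟳ u ×-dec (g ▹ b) ≟ꟳ v) ⊎-dec ((g ▹ a) ≟ꟳ v ×-dec (g ▹ b) ≟ꟳ u)

  -- These elements lie in one coset of the edge stabiliser, and the inverse of the first of them
  -- translates them into it.
  coset-bound : Bound (Ends a b) → ∀ u v → Bound (Ends u v)
  coset-bound bnd u v [] _ _ = z≤n
  coset-bound bnd u v (g ∷ gs) un al@(eg ∷ _) = ≤-trans (≤-reflexive (sym (length-map (g ⁻¹ ∙_) (g ∷ gs))))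
      (bnd (map (g ⁻¹ ∙_) (g ∷ gs)) (map⁺ (GroupSolver.cancelˡ isGroup (g ⁻¹)) un) (All-map⁺ (All.map (λ {h} → quotient {h}  eg) al)))
    where
    quotient : ∀ {h} → Ends u v g → Ends u v h → Ends a b (g ⁻¹ ∙ h)
    quotient {h} (inj₁ (e , f)) (inj₁ (e′ , f′)) = inj₁ (∙▹≡ (g ⁻¹) h e′ (inv▹ g e) , ∙▹≡ (g ⁻¹) h f′ (inv▹ g f))
    quotient {h} (inj₁ (e , f)) (inj₂ (e′ , f′)) = inj₂ (∙▹≡ (g ⁻¹) h e′ (inv▹ g f) , ∙▹≡ (g ⁻¹) h f′ (inv▹ g e))
    quotient {h} (inj₂ (e , f)) (inj₁ (e′ , f′)) = inj₂ (∙▹≡ (g ⁻¹) h e′ (inv▹ g f) , ∙▹≡ (g ⁻¹) h f′ (inv▹ g e))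
    quotient {h} (inj₂ (e , f)) (inj₂ (e′ , f′)) = inj₁ (∙▹≡ (g ⁻¹) h e′ (inv▹ g e) , ∙▹≡ (g ⁻¹) h f′ (inv▹ g f))

  -- Sorts a list by the image of the edge `a b`; the condition on the order matches the way
  -- `edgeCount` counts.
  fibre : List A → V → V → ℕ
  fibre gs u v = if toℕ u <ᵇ toℕ v then length (filter (ends? u v) gs) else 0

  fibre-∷ : ∀ g gs u v → fibre (g ∷ gs) u v ≡ fibre (g ∷ []) u v + fibre gs u v
  fibre-∷ g gs u v with toℕ u <ᵇ toℕ v | ends? u v g
  ... | false | _ = refl
  ... | true | yes _ = refl
  ... | true | no _ = refl

  fibre-at : ∀ {g u v} → toℕ u < toℕ v → Ends u v g → 1 ≤ fibre (g ∷ []) u v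
  fibre-at {g} {u} {v} lt e with toℕ u <ᵇ toℕ v | <⇒<ᵇ lt | ends? u v g
  ... | false | () | _
  ... | true | _ | yes _ = s≤s z≤n
  ... | true | _ | no ¬e = ⊥-elim (¬e e)

  fibre-hit : ∀ g → 1 ≤ ∑ λ u → ∑ (fibre (g ∷ []) u)
  fibre-hit g with <-cmp (toℕ (g ▹ a)) (toℕ (g ▹ b))
  ... | tri< lt _ _ = ≤-trans (fibre-at lt (inj₁ (refl , refl))) (≤-trans (term≤∑ _ (g ▹ b)) (term≤∑ _ (g ▹ a)))
  ... | tri≈ _ e _ = ⊥-elim (adj-≢ (actA g ab) (toℕ-injective e))
  ... | tri> _ _ gt = ≤-trans (fibre-at gt (inj₂ (refl , refl))) (≤-trans (term≤∑ _ (g ▹ a)) (term≤∑ _ (g ▹ b)))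

  length≤fibres : ∀ gs → length gs ≤ ∑ λ u → ∑ (fibre gs u)
  length≤fibres [] = z≤n
  length≤fibres (g ∷ gs) = ≤-trans (+-mono-≤ (fibre-hit g) (length≤fibres gs)) (≤-reflexive (trans (sym (∑-distrib-+ (λ u → ∑ (fibre (g ∷ []) u)) (λ u → ∑ (fibre gs u))))
    (sum-cong-≗ λ u → trans (sym (∑-distrib-+ (fibre (g ∷ []) u) (fibre gs u))) (sum-cong-≗ λ v → sym (fibre-∷ g gs u v)))))

  fibre≤ : Bound (Ends a b) → ∀ gs → Unique gs → ∀ u v → fibre gs u v ≤ 128 ℕ.* edge u v
  fibre≤ bnd gs un u v = go (adj Γ u v) refl (toℕ u <ᵇ toℕ v)
    where
    ends-adj : ∀ g → Ends u v g → Adj u v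
    ends-adj g (inj₁ (refl , refl)) = actA g ab
    ends-adj g (inj₂ (refl , refl)) = symA (actA g ab)
    none : ∀ hs → All (Ends u v) hs → adj Γ u v ≡ false → length hs ≤ 0
    none [] _ _ = z≤n
    none (h ∷ _) (e ∷ _) ¬uv = case trans (sym (ends-adj h e)) ¬uv of λ ()
    go : ∀ x → adj Γ u v ≡ x → ∀ y → (if y then length (filter (ends? u v) gs) else 0) ≤ 128 ℕ.* (if x ∧ y then 1 else 0)
    go true _ true = coset-bound bnd u v _ (filter⁺ᵁ (ends? u v) un) (all-filter (ends? u v) gs)
    go false ¬uv true = none _ (all-filter (ends? u v) gs) ¬uv
    go _ _ false = z≤n

  automorphism-bound : ¬ ¬ (∀ gs → Unique gs → length gs ≤ 128 ℕ.* edgeCount Γ)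
  automorphism-bound k = edge-bound λ bnd → k λ gs un → ≤-trans (length≤fibres gs) (≤-trans (∑-mono λ u → ∑-mono λ v → fibre≤ bnd gs un u v)
    (≤-reflexive (trans (sum-cong-≗ λ u → ∑-scale 128 (edge u)) (trans (∑-scale 128 (λ u → ∑ (edge u))) (cong (λ x → 128 ℕ.* x) (sym edgeCount-∑))))))

private
  open +-*-Solver
  -- 384 m is 128 times 3 m, that is 256 e, and 384 e - 256 e is 128 e.
  ℤ-identity : ∀ e m → e ℤ.+ e ≡ m * + 3 → (+ 384) * (((e - m) ℤ.+ + 1) - + 1) ≡ + 128 * e
  ℤ-identity e m h = trans (solve 2 (λ x y → con (+ 384) :* (((x :- y) :+ con (+ 1)) :- con (+ 1)) := con (+ 384) :* x :- con (+ 128) :* (y :* con (+ 3))) refl e m)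
    (trans (cong (λ z → + 384 * e - + 128 * z) (sym h)) (solve 1 (λ x → con (+ 384) :* x :- con (+ 128) :* (x :+ x) := con (+ 128) :* x) refl e))

distinct-bound : ∀ {n} (Γ : SimpleGraph n) → (∀ gs → Unique gs → length gs ≤ 128 ℕ.* edgeCount Γ) → ∀ k (f : Fin k → Aut Γ) →
  (∀ i j → (∀ v → apply Γ (f i) v ≡ apply Γ (f j) v) → i ≡ j) → k ≤ 128 ℕ.* edgeCount Γ
distinct-bound Γ bnd k f inj = ≤-trans (≤-reflexive (sym (trans (length-map (fromAut ∘ f) (allFin k)) (length-tabulate id))))
    (bnd (map (fromAut ∘ f) (allFin k)) (map⁺ (λ {i} {j} e → inj i j λ v → trans (sym (fromAut▹ (f i) v)) (trans (cong (_▹ v) e) (fromAut▹ (f j) v))) (allFin⁺ k)))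
  where
  open Automorphisms Γ

theorem3p3 : ∀ (n : ℕ) (G : SimpleGraph n) → Connected G → Cubic G → EdgeTransitive G →
    AutCardLe G ((+ 384) * (genus G - + 1))
theorem3p3 (suc n) G (_ , walks) cubic et k f inj = ℤ.≤-trans (ℤ.+≤+ bound) (ℤ.≤-reflexive (trans (ℤ.pos-* 128 (edgeCount G)) (sym (ℤ-identity (+ edgeCount G) (+ suc n) eq))))
  where
  base : ∃ λ w → adj G fzero w ≡ true
  base = Automorphisms.neighbour G cubic fzero
  bound : k ≤ 128 ℕ.* edgeCount G
  bound = decidable-stable (k ≤? 128 ℕ.* edgeCount G) λ ¬b → EdgeStabiliser.automorphism-bound G cubic walks et (proj₂ base) λ bnd → ¬b (distinct-bound G bnd k f inj)
  eq : + edgeCount G ℤ.+ + edgeCount G ≡ + suc n * + 3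
  eq = trans (cong +_ (CubicGraph.handshake G cubic)) (ℤ.pos-* (suc n) 3)
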